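{- Let $(f_n(x_1,\dots,x_{u(n)}))_{n\ge 0}$ be a family of multivariate polynomials with integer coefficients that can be evaluated in $\mathsf{CH}/\mathsf{poly}$ at integer points. If $\mathsf{VP}^0=\mathsf{VNP}^0$, then $(f_n)\in\mathsf{VP}^0_{\mathsf{nb}}$.
   Context: Arithmetic circuits have inputs that are indeterminates or constants and gates $+,-,\times$; the size is the number of gates. A constant-free circuit uses only the constant $1$. The formal degree of a circuit is defined inductively: inputs have formal degree $1$, a $+$ or $-$ gate has the maximum of the formal degrees of its inputs, a $\times$ gate has the sum; the formal degree of the circuit is that of its output gate. $\mathsf{VP}^0_{\mathsf{nb}}$ is the class of families $(f_n)$ of polynomials (with a polynomially bounded number of variables) computed by constant-free circuits of size polynomial in $n$, with no bound on the degree. $\mathsf{VP}^0$ is the class of families computed by constant-free circuits whose size and formal degree are both bounded by a polynomial in $n$. $\mathsf{VNP}^0$ is the class of families $(f_n(\bar x))$ for which there exist $(g_n(\bar x,\bar y))\in\mathsf{VP}^0$ and a polynomial $p$ with $|\bar y|=p(n)$ and $f_n(\bar x)=\sum_{\bar\epsilon\in\{0,1\}^{p(n)}}g_n(\bar x,\bar\epsilon)$. The counting hierarchy $\mathsf{CH}$ is $\bigcup_i \mathsf{C}_i\mathsf{P}$ where $\mathsf{C}_0\mathsf{P}=\mathsf{P}$ and $\mathsf{C}_{i+1}\mathsf{P}$ is the set of languages $A$ for which there are $B\in\mathsf{C}_i\mathsf{P}$ and a polynomial $p$ with $x\in A\iff \#\{y\in\{0,1\}^{p(|x|)}:(x,y)\in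 B\}\ge 2^{p(|x|)-1}$. $\mathsf{CH}/\mathsf{poly}$ is the set of languages $A$ for which there are $B\in\mathsf{CH}$, a polynomial $p$ and words $(a_n)$ with $|a_n|\le p(n)$ such that $x\in A\iff (x,a_{|x|})\in B$. Integers are encoded in binary with the sign recoverable from the encoding. A family $(f_n(x_1,\dots,x_{u(n)}))$ of polynomials with integer coefficients can be evaluated in $\mathsf{CH}/\mathsf{poly}$ at integer points if: (1) $u(n)$ is polynomially bounded; (2) the degree of $f_n$ and the bitsize of its coefficients are bounded by $2^{p(n)}$ for some polynomial $p$; (3) the language $\{(1^n,i_1,\dots,i_{u(n)},j,b)\mid \text{the } j\text{ -th bit of } f_n(i_1,\dots,i_{u(n)}) \text{ is } b\}$ (with $n$ in unary and the integers in binary) is in $\mathsf{CH}/\mathsf{poly}$. -}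

module Defs where

open import Data.Nat using (ℕ; zero; suc; _+_; _*_; _∸_; _^_; _≤_; _<_; _≡ᵇ_)
open import Data.Nat.DivMod using (_/_; _%_)
import Data.Nat.Properties as ℕP
import Data.Vec.Properties as VP
open import Data.Nat.ListAction using (sum)
open import Data.Nat using (_⊔_)
open import Data.Integer as ℤ using (ℤ; +_; -[1+_])
open import Data.Bool using (Bool; true; false; if_then_else_)
open import Data.List as L using (List; []; _∷_; _++_; length; concatMap; foldr)
open import Data.Vec as V using (Vec)
open import Data.Fin using (Fin; zero; suc)
open import Data.Product using (Σ; _×_; _,_; ∃)
open import Relation.Binary.PropositionalEquality using (_≡_; _≢_)
open import Relation.Nullary using (yes; no)
open import Function.Bundles using (_⇔_)

NatPoly : Set
NatPoly = List ℕ

⟦_⟧ : NatPoly → ℕ → ℕ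
⟦ cs ⟧ n = foldr (λ c acc → c + n * acc) 0 cs

-- fuel-driven binary expansion, least significant bit first, no leading zeros
bitsAux : ℕ → ℕ → List Bool
bitsAux zero    _       = []
bitsAux (suc f) zero    = []
bitsAux (suc f) (suc k) = (suc k % 2 ≡ᵇ 1) ∷ bitsAux f (suc k / 2)

-- binary encoding of a natural number (fuel n suffices)
bitsℕ : ℕ → List Bool
bitsℕ n = bitsAux n n

encℤ : ℤ → List Bool
encℤ (+ n)      = false ∷ bitsℕ n
encℤ -[1+ n ]   = true ∷ bitsℕ (suc n)

bitsize : ℤ → ℕ
bitsize z = length (encℤ z)

bitAt : ℕ → List Bool → Bool
bitAt _       []       = false
bitAt zero    (b ∷ _)  = b
bitAt (suc j) (_ ∷ bs) = bitAt j bs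

-- self-delimiting encoding of a list of words: each bit doubled, then 01
encWord : List Bool → List Bool
encWord w = concatMap (λ c → c ∷ c ∷ []) w ++ (false ∷ true ∷ [])

encTupleList : List (List Bool) → List Bool
encTupleList = concatMap encWord

pair : List Bool → List Bool → List Bool
pair x y = encTupleList (x ∷ y ∷ [])

-- Turing machines and P (deterministic, single bi-infinite tape)
-- tape symbols: Fin (3 + extra); 0 = blank, 1 = bit 0, 2 = bit 1

data Move : Set where
  left right stay : Move

data Action (Q S : ℕ) : Set where
  halt : Bool → Action Q S
  step : Fin Q → Fin S → Move → Action Q S

record TM : Set where
  field
    states : ℕ
    extra  : ℕ
    start  : Fin states
    δ      : Fin states → Fin (3 + extra) → Action states (3 + extra)

module _ (M : TM) where
  open TM M

  Sym : Set
  Sym = Fin (3 + extra)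

  blank : Sym
  blank = zero

  data State : Set where
    running : Fin states → State
    done    : Bool → State

  record Cfg : Set where
    constructor cfg
    field
      st    : State
      lft   : List Sym   -- cells left of the head, nearest first
      here  : Sym
      rgt   : List Sym   -- cells right of the head, nearest first

  headOf : List Sym → Sym × List Sym
  headOf []       = blank , []
  headOf (s ∷ ss) = s , ss

  stepCfg : Cfg → Cfg
  stepCfg (cfg (done b) l h r) = cfg (done b) l h r
  stepCfg (cfg (running q) l h r) with δ q h
  ... | halt b = cfg (done b) l h r
  ... | step q' s left  with headOf l
  ...   | h' , l' = cfg (running q') l' h' (s ∷ r)
  stepCfg (cfg (running q) l h r) | step q' s right with headOf r
  ...   | h' , r' = cfg (running q') (s ∷ l) h' r'
  stepCfg (cfg (running q) l h r) | step q' s stay = cfg (running q') l s r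

  run : ℕ → Cfg → Cfg
  run zero    c = c
  run (suc t) c = run t (stepCfg c)

  inSym : Bool → Sym
  inSym false = suc zero
  inSym true  = suc (suc zero)

  initCfg : List Bool → Cfg
  initCfg []       = cfg (running start) [] blank []
  initCfg (b ∷ bs) = cfg (running start) [] (inSym b) (L.map inSym bs)

Lang : Set
Lang = List Bool → Bool

InP : Lang → Set
InP A = Σ TM λ M → Σ NatPoly λ q → ∀ w →
  Σ ℕ λ t → t ≤ ⟦ q ⟧ (length w) × Cfg.st (run M t (initCfg M w)) ≡ done (A w)

allWords : ℕ → List (List Bool)
allWords zero    = [] ∷ []
allWords (suc k) = L.map (false ∷_) (allWords k) ++ L.map (true ∷_) (allWords k)

count : Lang → List Bool → ℕ → ℕ
count B x k = sum (L.map (λ y → if B (pair x y) then 1 else 0) (allWords k))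

CP : ℕ → Lang → Set
CP zero    A = InP A
CP (suc i) A = Σ Lang λ B → CP i B × Σ NatPoly λ p → ∀ x →
  (A x ≡ true) ⇔ (2 ^ (⟦ p ⟧ (length x) ∸ 1) ≤ count B x (⟦ p ⟧ (length x)))

InCH : Lang → Set
InCH A = Σ ℕ λ i → CP i A

InCHpoly : (List Bool → Set) → Set
InCHpoly A = Σ Lang λ B → InCH B × Σ NatPoly λ p → Σ (ℕ → List Bool) λ a →
  (∀ n → length (a n) ≤ ⟦ p ⟧ n) × (∀ x → A x ⇔ (B (pair x (a (length x))) ≡ true))

-- Multivariate integer polynomials in u variables, as formal sums of terms
-- c · x^e (a term is a coefficient and an exponent vector)

Mono : ℕ → Set
Mono u = Vec ℕ u

Poly : ℕ → Set
Poly u = List (ℤ × Mono u)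

coeff : ∀ {u} → Poly u → Mono u → ℤ
coeff []            e = ℤ.0ℤ
coeff ((c , e') ∷ p) e with VP.≡-dec ℕP._≟_ e' e
... | yes _ = c ℤ.+ coeff p e
... | no  _ = coeff p e

_≈P_ : ∀ {u} → Poly u → Poly u → Set
p ≈P q = ∀ e → coeff p e ≡ coeff q e

totalDeg : ∀ {u} → Mono u → ℕ
totalDeg e = V.sum e

addP : ∀ {u} → Poly u → Poly u → Poly u
addP p q = p ++ q

negP : ∀ {u} → Poly u → Poly u
negP = L.map (λ { (c , e) → (ℤ.- c , e) })

subP : ∀ {u} → Poly u → Poly u → Poly u
subP p q = addP p (negP q)

mulP : ∀ {u} → Poly u → Poly u → Poly u
mulP p q = concatMap (λ { (c , e) → L.map (λ { (d , f) → (c ℤ.* d , V.zipWith _+_ e f) }) q }) p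

oneP : ∀ {u} → Poly u
oneP {u} = (ℤ.1ℤ , V.replicate u 0) ∷ []

unitVec : ∀ {u} → Fin u → Mono u
unitVec zero    = 1 V.∷ V.replicate _ 0
unitVec (suc i) = 0 V.∷ unitVec i

varP : ∀ {u} → Fin u → Poly u
varP i = (ℤ.1ℤ , unitVec i) ∷ []

evalMono : ∀ {u} → Mono u → Vec ℤ u → ℤ
evalMono e x = V.foldr _ ℤ._*_ ℤ.1ℤ (V.zipWith (λ xi k → xi ℤ.^ k) x e)

evalP : ∀ {u} → Poly u → Vec ℤ u → ℤ
evalP p x = L.foldr ℤ._+_ ℤ.0ℤ (L.map (λ { (c , e) → c ℤ.* evalMono e x }) p)

boolℤ : Bool → ℤ
boolℤ false = ℤ.0ℤ
boolℤ true  = ℤ.1ℤ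

substLast : ∀ {u} k → Vec Bool k → Poly (u + k) → Poly u
substLast {u} k ε g =
  L.map (λ { (c , e) → (c ℤ.* evalMono (V.drop u e) (V.map boolℤ ε) , V.take u e) }) g

allBoolVecs : (k : ℕ) → List (Vec Bool k)
allBoolVecs zero    = V.[] ∷ []
allBoolVecs (suc k) = L.map (false V.∷_) (allBoolVecs k) ++ L.map (true V.∷_) (allBoolVecs k)

sumBool : ∀ {u} k → Poly (u + k) → Poly u
sumBool k g = concatMap (λ ε → substLast k ε g) (allBoolVecs k)

-- Constant-free arithmetic circuits (straight-line programs)
-- A circuit in m variables with s gates has s + suc m nodes, indexed by
-- Fin (s + suc m): index i < s is the gate added (s ∸ 1 ∸ i)-th
-- (most recent gate first), then the constant 1, then x₁ … x_m.
-- Each gate may use any earlier node. The size is the number s of gates.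

data Op : Set where
  plus minus times : Op

data SLP (m : ℕ) : ℕ → Set where
  []  : SLP m 0
  _▷_ : ∀ {s} → SLP m s → Op × Fin (s + suc m) × Fin (s + suc m) → SLP m (suc s)

applyOp : ∀ {u} → Op → Poly u → Poly u → Poly u
applyOp plus  = addP
applyOp minus = subP
applyOp times = mulP

values : ∀ {m s} → SLP m s → Vec (Poly m) (s + suc m)
values {m} []                  = oneP V.∷ V.tabulate varP
values (C ▷ (o , i , j)) = applyOp o (V.lookup vs i) (V.lookup vs j) V.∷ vs
  where vs = values C

fdegs : ∀ {m s} → SLP m s → Vec ℕ (s + suc m)
fdegs {m} []             = V.replicate (suc m) 1
fdegs (C ▷ (o , i , j)) = combine o (V.lookup ds i) (V.lookup ds j) V.∷ ds
  where
    ds = fdegs C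
    combine : Op → ℕ → ℕ → ℕ
    combine times a b = a + b
    combine _     a b = a ⊔ b

record Circuit (m s : ℕ) : Set where
  constructor circuit
  field
    gates  : SLP m s
    output : Fin (s + suc m)

computed : ∀ {m s} → Circuit m s → Poly m
computed (circuit C o) = V.lookup (values C) o

formalDegree : ∀ {m s} → Circuit m s → ℕ
formalDegree (circuit C o) = V.lookup (fdegs C) o

record Family : Set where
  constructor family
  field
    nvars : ℕ → ℕ
    poly  : (n : ℕ) → Poly (nvars n)

PolyBounded : (ℕ → ℕ) → Set
PolyBounded g = Σ NatPoly λ q → ∀ n → g n ≤ ⟦ q ⟧ n

VP0nb : Family → Set
VP0nb (family u f) = PolyBounded u × Σ NatPoly λ q → ∀ n →
  Σ ℕ λ s → Σ (Circuit (u n) s) λ C → s ≤ ⟦ q ⟧ n × computed C ≈P f n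

VP0 : Family → Set
VP0 (family u f) = PolyBounded u × Σ NatPoly λ q → ∀ n →
  Σ ℕ λ s → Σ (Circuit (u n) s) λ C →
    s ≤ ⟦ q ⟧ n × formalDegree C ≤ ⟦ q ⟧ n × computed C ≈P f n

VNP0 : Family → Set
VNP0 (family u f) = PolyBounded u × Σ NatPoly λ p →
  Σ ((n : ℕ) → Poly (u n + ⟦ p ⟧ n)) λ g →
    VP0 (family (λ n → u n + ⟦ p ⟧ n) g) × (∀ n → f n ≈P sumBool (⟦ p ⟧ n) (g n))

unary : ℕ → List Bool
unary n = L.replicate n true

encTuple : ∀ {u} → ℕ → Vec ℤ u → ℕ → Bool → List Bool
encTuple n is j b =
  encTupleList (unary n ∷ (V.toList (V.map encℤ is) ++ (bitsℕ j ∷ (b ∷ []) ∷ [])))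

BitLang : Family → List Bool → Set
BitLang (family u f) w = Σ ℕ λ n → Σ (Vec ℤ (u n)) λ is → Σ ℕ λ j → Σ Bool λ b →
  (w ≡ encTuple n is j b) × (bitAt j (encℤ (evalP (f n) is)) ≡ b)

EvalCHpoly : Family → Set
EvalCHpoly F@(family u f) =
  PolyBounded u ×
  (Σ NatPoly λ p → ∀ n → ∀ e →
      ((coeff (f n) e ≢ ℤ.0ℤ → totalDeg e ≤ 2 ^ ⟦ p ⟧ n) ×
       bitsize (coeff (f n) e) ≤ 2 ^ ⟦ p ⟧ n)) ×
  InCHpoly (BitLang F)

{-# OPTIONS --safe #-}
module Submission where

-- Call a function of natural numbers easy if, on arguments with polynomially many bits, constant-free circuits of
-- polynomial size and formal degree compute it from the bits of the arguments. If VP0 = VNP0, then easy functions are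
-- closed under sums over exponentially many terms. A polynomial-time computation is such a sum, over guessed and checked
-- histories, so all of CH/poly is easy, and so are the bits of f_n at integer points. Let q exceed the degrees of f_n.
-- A Fourier sum over F_q^u gives the coefficients of f_n modulo q. The residues modulo enough primes q are turned into
-- binary by Chinese remaindering, whose big products become sums of discrete logarithms modulo each prime, and whose
-- rounded fractions are sums of small numbers. Hence an easy ψ satisfies f_n = Σ_E Σ_k ψ(k, E) 2^k x^E. With variables
-- for the powers 2^(2^i) and x_j^(2^r) this is a sum over a Boolean cube, thus in VP0, and repeated squaring, which costs
-- high degree but few gates, supplies those powers.

open import Algebra.Bundles using (CommutativeMonoid)
open import Data.Bool using (Bool; true; false; if_then_else_; not; _∧_; _∨_; _xor_)
open import Data.Empty using (⊥; ⊥-elim)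
open import Data.Fin as F using (Fin; zero; suc; toℕ; fromℕ<; _↑ˡ_; _↑ʳ_)
import Data.Fin.Properties as FP
open import Data.Integer as ℤ using (ℤ; +_; -[1+_]; ∣_∣)
import Data.Integer.Properties as ℤP
open import Data.Integer.Tactic.RingSolver using () renaming (solve-∀ to ℤ-solve)
open import Data.List as L using (List; []; _∷_; length; concatMap)
import Data.List.Properties as LP
open import Data.Nat as ℕ using (ℕ; zero; suc; _+_; _*_; _∸_; _^_; _≤_; _<_; z≤n; s≤s; _⊔_; _≤?_; _<?_; _≟_)
open import Data.Nat.Coprimality using (Coprime; coprime-Bézout)
open import Data.Nat.Divisibility
open import Data.Nat.DivMod using (_/_; _%_; m≡m%n+[m/n]*n; m%n<n; m%n≡m∸m/n*n; m/n*n≤m; m/n≤m; m/n<m; m/n/o≡m/[n*o]; m<n⇒m%n≡m; m<n⇒m/n≡0; [m+kn]%n≡m%n; m*n/n≡m; n/1≡n; m<n*o⇒m/o<n; m*n%n≡0; +-distrib-/)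
open import Data.Nat.GCD using (gcd; module Bézout)
open import Data.Nat.LCM using (lcm; m∣lcm[m,n]; n∣lcm[m,n]; lcm-least; gcd*lcm)
open import Data.Nat.ListAction using (sum)
open import Data.Nat.ListAction.Properties using (sum-++)
open import Data.Nat.Primality
import Data.Nat.Properties as ℕP
open import Data.Nat.Tactic.RingSolver using () renaming (solve-∀ to ℕ-solve)
open import Data.Product using (Σ; _×_; _,_; ∃; proj₁; proj₂)
open import Data.Sum using (_⊎_; inj₁; inj₂; [_,_]′)
open import Data.Unit using (⊤; tt)
open import Data.Vec as V using (Vec; []; _∷_; lookup)
import Data.Vec.Properties as VP
open import Function.Base using (_∘_; case_of_)
open import Function.Bundles using (_⇔_; Equivalence)
open import Level using (0ℓ)
open import Relation.Binary.Definitions using (Tri; tri<; tri≈; tri>)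
open import Relation.Binary.PropositionalEquality hiding (setoid; isEquivalence; J)
open import Relation.Nullary using (¬_; Dec; yes; no)

open import Defs

-- The collapse is an arithmetic hypothesis, and each circuit that it yields must again have
-- polynomial formal degree. Hence neither composition nor iteration is free: a circuit for a value
-- does not give the bits of that value. The remedy is to guess. `f (g x)` is a Boolean sum over y
-- of `f y` times the test y = `g x`, and tests reduce to the sign of an integer, which is found by
-- simulating a circuit on two's complement words while all gate values are guessed. The
-- coefficients of f_n have exponentially many bits, as has each product of primes; only their
-- residues and rounded fractions are handled. Chinese remaindering needs a multiplier close to Q /
-- 2^s, Q being the product of the primes. The residues of the integer part of Q / 2^s cannot be
-- read off from those of Q, whereas the multiplier chosen here is a product whose factors have
-- known residues. Finally, ψ need not take the values 0 and 1: carries between binary places are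
-- never propagated, since only the total Σ_k ψ(k, E) 2^k matters.

-- Finite sums and products over initial segments of the natural numbers

module Big (M : CommutativeMonoid 0ℓ 0ℓ) where
  open CommutativeMonoid M
    renaming (Carrier to C; refl to ≈-refl; sym to ≈-sym; trans to ≈-trans; reflexive to ≈-reflexive)
  open import Relation.Binary.Reasoning.Setoid setoid

  big : ℕ → (ℕ → C) → C
  big zero    f = ε
  big (suc n) f = big n f ∙ f n

  big-cong : ∀ n {f g} → (∀ i → i < n → f i ≈ g i) → big n f ≈ big n g
  big-cong zero    h = ≈-refl
  big-cong (suc n) h = ∙-cong (big-cong n (λ i i<n → h i (ℕP.m<n⇒m<1+n i<n))) (h n ℕP.≤-refl)

  interchange : ∀ a b c d → (a ∙ b) ∙ (c ∙ d) ≈ (a ∙ c) ∙ (b ∙ d)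
  interchange a b c d = begin
    (a ∙ b) ∙ (c ∙ d)  ≈⟨ assoc a b (c ∙ d) ⟩
    a ∙ (b ∙ (c ∙ d))  ≈⟨ ∙-congˡ (assoc b c d) ⟨
    a ∙ ((b ∙ c) ∙ d)  ≈⟨ ∙-congˡ (∙-congʳ (comm b c)) ⟩
    a ∙ ((c ∙ b) ∙ d)  ≈⟨ ∙-congˡ (assoc c b d) ⟩
    a ∙ (c ∙ (b ∙ d))  ≈⟨ assoc a c (b ∙ d) ⟨
    (a ∙ c) ∙ (b ∙ d)  ∎

  big-∙ : ∀ n f g → big n (λ i → f i ∙ g i) ≈ big n f ∙ big n g
  big-∙ zero    f g = ≈-sym (identityˡ ε)
  big-∙ (suc n) f g = ≈-trans (∙-congʳ (big-∙ n f g)) (interchange _ _ _ _)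

  big-ε : ∀ n {f} → (∀ i → i < n → f i ≈ ε) → big n f ≈ ε
  big-ε zero    h = ≈-refl
  big-ε (suc n) h = ≈-trans
    (∙-cong (big-ε n (λ i i<n → h i (ℕP.m<n⇒m<1+n i<n))) (h n ℕP.≤-refl)) (identityˡ ε)

  big-+ : ∀ m n f → big (m + n) f ≈ big m f ∙ big n (λ i → f (m + i))
  big-+ m zero    f rewrite ℕP.+-identityʳ m = ≈-sym (identityʳ _)
  big-+ m (suc n) f rewrite ℕP.+-suc m n = ≈-trans (∙-congʳ (big-+ m n f)) (assoc _ _ _)

  big-suc : ∀ n f → big (suc n) f ≈ f 0 ∙ big n (λ i → f (suc i))
  big-suc n f = ≈-trans (big-+ 1 n f) (∙-congʳ (identityˡ _))

  big-swap : ∀ m n (f : ℕ → ℕ → C) →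
    big m (λ i → big n (f i)) ≈ big n (λ j → big m (λ i → f i j))
  big-swap zero    n f = ≈-sym (big-ε n (λ _ _ → ≈-refl))
  big-swap (suc m) n f = ≈-trans (∙-congʳ (big-swap m n f)) (≈-sym (big-∙ n _ _))

  big-* : ∀ m n f → big (m * n) f ≈ big m (λ i → big n (λ j → f (i * n + j)))
  big-* zero    n f = ≈-refl
  big-* (suc m) n f rewrite ℕP.+-comm n (m * n) =
    ≈-trans (big-+ (m * n) n f) (∙-congʳ (big-* m n f))

  big-single : ∀ n {f i} → i < n → (∀ j → j < n → j ≢ i → f j ≈ ε) → big n f ≈ f i
  big-single (suc n) {f} {i} i<1+n h with i ≟ n
  ... | yes refl = ≈-trans
    (∙-congʳ (big-ε n (λ j j<n → h j (ℕP.m<n⇒m<1+n j<n) (ℕP.<⇒≢ j<n)))) (identityˡ _)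
  ... | no i≢n = ≈-trans
    (∙-cong (big-single n (ℕP.≤∧≢⇒< (ℕP.≤-pred i<1+n) i≢n) (λ j j<n → h j (ℕP.m<n⇒m<1+n j<n)))
            (h n ℕP.≤-refl (i≢n ∘ sym)))
    (identityʳ _)

  big-truncate : ∀ {m n} {f} → m ≤ n → (∀ i → m ≤ i → i < n → f i ≈ ε) → big n f ≈ big m f
  big-truncate {m} {n} {f} m≤n h with ℕP.m≤n⇒∃[o]m+o≡n m≤n
  ... | o , refl = ≈-trans (big-+ m o f)
    (≈-trans (∙-congˡ (big-ε o (λ i i<o → h (m + i) (ℕP.m≤m+n m i) (ℕP.+-monoʳ-< m i<o)))) (identityʳ _))

open Big ℕP.+-0-commutativeMonoid public using () renaming
  ( big to ΣN; big-cong to ΣN-cong; big-∙ to ΣN-+; big-ε to ΣN-0; big-+ to ΣN-split; big-suc to ΣN-suc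
  ; big-swap to ΣN-swap; big-* to ΣN-*; big-single to ΣN-single; big-truncate to ΣN-truncate )
open Big ℤP.+-0-commutativeMonoid public using () renaming
  ( big to ΣZ; big-cong to ΣZ-cong; big-∙ to ΣZ-+; big-ε to ΣZ-0; big-+ to ΣZ-split; big-suc to ΣZ-suc
  ; big-swap to ΣZ-swap; big-* to ΣZ-*; big-single to ΣZ-single; big-truncate to ΣZ-truncate )
open Big ℕP.*-1-commutativeMonoid public using () renaming
  ( big to ΠN; big-cong to ΠN-cong; big-∙ to ΠN-*; big-ε to ΠN-1; big-+ to ΠN-split; big-suc to ΠN-suc
  ; big-truncate to ΠN-truncate )
open Big ℤP.*-1-commutativeMonoid public using () renaming
  ( big to ΠZ; big-cong to ΠZ-cong; big-∙ to ΠZ-*; big-ε to ΠZ-1; big-+ to ΠZ-split; big-suc to ΠZ-suc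
  ; big-truncate to ΠZ-truncate )

ΣN-*ˡ : ∀ n c f → ΣN n (λ i → c * f i) ≡ c * ΣN n f
ΣN-*ˡ zero    c f = sym (ℕP.*-zeroʳ c)
ΣN-*ˡ (suc n) c f = trans (cong (_+ c * f n) (ΣN-*ˡ n c f)) (sym (ℕP.*-distribˡ-+ c _ _))

ΣZ-*ˡ : ∀ n c f → ΣZ n (λ i → c ℤ.* f i) ≡ c ℤ.* ΣZ n f
ΣZ-*ˡ zero    c f = sym (ℤP.*-zeroʳ c)
ΣZ-*ˡ (suc n) c f = trans (cong (ℤ._+ c ℤ.* f n) (ΣZ-*ˡ n c f)) (sym (ℤP.*-distribˡ-+ c _ _))

ΣN-*ʳ : ∀ n c f → ΣN n (λ i → f i * c) ≡ ΣN n f * c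
ΣN-*ʳ n c f = trans (ΣN-cong n (λ i _ → ℕP.*-comm (f i) c)) (trans (ΣN-*ˡ n c f) (ℕP.*-comm c _))

ΣZ-*ʳ : ∀ n c f → ΣZ n (λ i → f i ℤ.* c) ≡ ΣZ n f ℤ.* c
ΣZ-*ʳ n c f = trans (ΣZ-cong n (λ i _ → ℤP.*-comm (f i) c)) (trans (ΣZ-*ˡ n c f) (ℤP.*-comm c _))

ΣZ-neg : ∀ n f → ΣZ n (λ i → ℤ.- f i) ≡ ℤ.- ΣZ n f
ΣZ-neg zero    f = refl
ΣZ-neg (suc n) f = trans (cong (ℤ._+ ℤ.- f n) (ΣZ-neg n f)) (sym (ℤP.neg-distrib-+ (ΣZ n f) (f n)))

pos-ΣN : ∀ n f → + ΣN n f ≡ ΣZ n (λ i → + f i)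
pos-ΣN zero    f = refl
pos-ΣN (suc n) f = trans (ℤP.pos-+ (ΣN n f) (f n)) (cong (ℤ._+ + f n) (pos-ΣN n f))

pos-ΠN : ∀ n f → + ΠN n f ≡ ΠZ n (λ i → + f i)
pos-ΠN zero    f = refl
pos-ΠN (suc n) f = trans (ℤP.pos-* (ΠN n f) (f n)) (cong (ℤ._* + f n) (pos-ΠN n f))

ΣN-mono : ∀ n {f g} → (∀ i → i < n → f i ≤ g i) → ΣN n f ≤ ΣN n g
ΣN-mono zero    h = z≤n
ΣN-mono (suc n) h = ℕP.+-mono-≤ (ΣN-mono n (λ i i<n → h i (ℕP.m<n⇒m<1+n i<n))) (h n ℕP.≤-refl)

ΣN-const : ∀ n c → ΣN n (λ _ → c) ≡ n * c
ΣN-const zero    c = refl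
ΣN-const (suc n) c = trans (cong (_+ c) (ΣN-const n c)) (ℕP.+-comm (n * c) c)

ΣN-≤ : ∀ n {f} {b} → (∀ i → i < n → f i ≤ b) → ΣN n f ≤ n * b
ΣN-≤ n {b = b} h = ℕP.≤-trans (ΣN-mono n h) (ℕP.≤-reflexive (ΣN-const n b))

ΣN-member : ∀ n {f i} → i < n → f i ≤ ΣN n f
ΣN-member (suc n) {f} {i} i<1+n with i ≟ n
... | yes refl = ℕP.m≤n+m (f i) _
... | no i≢n = ℕP.≤-trans (ΣN-member n (ℕP.≤∧≢⇒< (ℕP.≤-pred i<1+n) i≢n)) (ℕP.m≤m+n _ _)

ΠN-const : ∀ n c → ΠN n (λ _ → c) ≡ c ^ n
ΠN-const zero    c = refl
ΠN-const (suc n) c = trans (cong (_* c) (ΠN-const n c)) (ℕP.*-comm (c ^ n) c)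

-- Polynomials as functions on integer points

eval : ∀ {u} → Poly u → Vec ℤ u → ℤ
eval []            x = ℤ.0ℤ
eval ((c , e) ∷ p) x = c ℤ.* evalMono e x ℤ.+ eval p x

evalP≡eval : ∀ {u} (p : Poly u) x → evalP p x ≡ eval p x
evalP≡eval []            x = refl
evalP≡eval ((c , e) ∷ p) x = cong (ℤ._+_ (c ℤ.* evalMono e x)) (evalP≡eval p x)

evalMono-+ : ∀ {u} (e f : Mono u) x → evalMono (V.zipWith _+_ e f) x ≡ evalMono e x ℤ.* evalMono f x
evalMono-+ []      []      []      = refl
evalMono-+ (a ∷ e) (b ∷ f) (t ∷ x) rewrite evalMono-+ e f x | ℤP.^-distribˡ-+-* t a b =
  shuffle (t ℤ.^ a) (t ℤ.^ b) (evalMono e x) (evalMono f x)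
  where
    shuffle : ∀ p q r s → (p ℤ.* q) ℤ.* (r ℤ.* s) ≡ (p ℤ.* r) ℤ.* (q ℤ.* s)
    shuffle = ℤ-solve

evalMono-0 : ∀ {u} (x : Vec ℤ u) → evalMono (V.replicate u 0) x ≡ ℤ.1ℤ
evalMono-0 []      = refl
evalMono-0 (t ∷ x) rewrite evalMono-0 x = refl

evalMono-unit : ∀ {u} (i : Fin u) x → evalMono (unitVec i) x ≡ lookup x i
evalMono-unit zero    (t ∷ x) rewrite evalMono-0 x = trans (ℤP.*-identityʳ _) (ℤP.*-identityʳ t)
evalMono-unit (suc i) (t ∷ x) rewrite evalMono-unit i x = ℤP.*-identityˡ _

eval-add : ∀ {u} (p q : Poly u) x → eval (addP p q) x ≡ eval p x ℤ.+ eval q x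
eval-add []            q x = sym (ℤP.+-identityˡ _)
eval-add ((c , e) ∷ p) q x rewrite eval-add p q x = sym (ℤP.+-assoc (c ℤ.* evalMono e x) (eval p x) (eval q x))

eval-neg : ∀ {u} (p : Poly u) x → eval (negP p) x ≡ ℤ.- eval p x
eval-neg []            x = refl
eval-neg ((c , e) ∷ p) x rewrite eval-neg p x = distrib c (evalMono e x) (eval p x)
  where
    distrib : ∀ c m r → (ℤ.- c) ℤ.* m ℤ.+ (ℤ.- r) ≡ ℤ.- (c ℤ.* m ℤ.+ r)
    distrib = ℤ-solve

scaleP : ∀ {u} → ℤ → Mono u → Poly u → Poly u
scaleP c e []            = []
scaleP c e ((d , f) ∷ q) = (c ℤ.* d , V.zipWith _+_ e f) ∷ scaleP c e q

eval-scale : ∀ {u} c (e : Mono u) (q : Poly u) x →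
  eval (scaleP c e q) x ≡ (c ℤ.* evalMono e x) ℤ.* eval q x
eval-scale c e []            x = sym (ℤP.*-zeroʳ (c ℤ.* evalMono e x))
eval-scale c e ((d , f) ∷ q) x rewrite eval-scale c e q x | evalMono-+ e f x =
  distrib c d (evalMono e x) (evalMono f x) (eval q x)
  where
    distrib : ∀ c d m k r → (c ℤ.* d) ℤ.* (m ℤ.* k) ℤ.+ (c ℤ.* m) ℤ.* r ≡ (c ℤ.* m) ℤ.* (d ℤ.* k ℤ.+ r)
    distrib = ℤ-solve

mulP-∷ : ∀ {u} c (e : Mono u) (p q : Poly u) → mulP ((c , e) ∷ p) q ≡ scaleP c e q L.++ mulP p q
mulP-∷ {u} c e p q = cong (L._++ mulP p q) (scale q)
  where
    scale : ∀ q → L.map (λ (d , f) → (c ℤ.* d , V.zipWith _+_ e f)) q ≡ scaleP c e q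
    scale []      = refl
    scale (_ ∷ q) = cong (_ ∷_) (scale q)

eval-mul : ∀ {u} (p q : Poly u) x → eval (mulP p q) x ≡ eval p x ℤ.* eval q x
eval-mul []            q x = sym (ℤP.*-zeroˡ (eval q x))
eval-mul ((c , e) ∷ p) q x = begin
  eval (mulP ((c , e) ∷ p) q) x
    ≡⟨ cong (λ l → eval l x) (mulP-∷ c e p q) ⟩
  eval (addP (scaleP c e q) (mulP p q)) x
    ≡⟨ eval-add (scaleP c e q) (mulP p q) x ⟩
  eval (scaleP c e q) x ℤ.+ eval (mulP p q) x
    ≡⟨ cong₂ ℤ._+_ (eval-scale c e q x) (eval-mul p q x) ⟩
  (c ℤ.* evalMono e x) ℤ.* eval q x ℤ.+ eval p x ℤ.* eval q x
    ≡⟨ ℤP.*-distribʳ-+ (eval q x) (c ℤ.* evalMono e x) (eval p x) ⟨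
  eval ((c , e) ∷ p) x ℤ.* eval q x ∎
  where open ≡-Reasoning

eval-one : ∀ {u} (x : Vec ℤ u) → eval oneP x ≡ ℤ.1ℤ
eval-one x rewrite evalMono-0 x = refl

eval-var : ∀ {u} (i : Fin u) x → eval (varP i) x ≡ lookup x i
eval-var i x rewrite evalMono-unit i x = trans (ℤP.+-identityʳ _) (ℤP.*-identityˡ _)

-- Terms with exponent e are collected and removed, so that the remaining list is strictly shorter.
drop-exponent : ∀ {u} → Mono u → Poly u → Poly u
drop-exponent e []             = []
drop-exponent e ((c , e') ∷ p) with VP.≡-dec _≟_ e' e
... | yes _ = drop-exponent e p
... | no  _ = (c , e') ∷ drop-exponent e p

drop-exponent-length : ∀ {u} (e : Mono u) p → length (drop-exponent e p) ≤ length p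
drop-exponent-length e []             = z≤n
drop-exponent-length e ((c , e') ∷ p) with VP.≡-dec _≟_ e' e
... | yes _ = ℕP.m≤n⇒m≤1+n (drop-exponent-length e p)
... | no  _ = s≤s (drop-exponent-length e p)

eval-drop-exponent : ∀ {u} (e : Mono u) p x →
  eval p x ≡ coeff p e ℤ.* evalMono e x ℤ.+ eval (drop-exponent e p) x
eval-drop-exponent e []             x = sym (trans (ℤP.+-identityʳ _) (ℤP.*-zeroˡ (evalMono e x)))
eval-drop-exponent e ((c , e') ∷ p) x with VP.≡-dec _≟_ e' e
... | yes refl rewrite eval-drop-exponent e p x = distrib c (evalMono e x) (coeff p e) _
  where
    distrib : ∀ c m k r → c ℤ.* m ℤ.+ (k ℤ.* m ℤ.+ r) ≡ (c ℤ.+ k) ℤ.* m ℤ.+ r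
    distrib = ℤ-solve
... | no _ rewrite eval-drop-exponent e p x = exchange (c ℤ.* evalMono e' x) (coeff p e ℤ.* evalMono e x) _
  where
    exchange : ∀ a b r → a ℤ.+ (b ℤ.+ r) ≡ b ℤ.+ (a ℤ.+ r)
    exchange = ℤ-solve

coeff-drop-exponent-same : ∀ {u} (e : Mono u) p → coeff (drop-exponent e p) e ≡ ℤ.0ℤ
coeff-drop-exponent-same e []             = refl
coeff-drop-exponent-same e ((c , e') ∷ p) with VP.≡-dec _≟_ e' e
... | yes _ = coeff-drop-exponent-same e p
... | no e'≢e with VP.≡-dec _≟_ e' e
...   | yes e'≡e = ⊥-elim (e'≢e e'≡e)
...   | no _ = coeff-drop-exponent-same e p

coeff-drop-exponent-other : ∀ {u} (e : Mono u) p g → e ≢ g → coeff (drop-exponent e p) g ≡ coeff p g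
coeff-drop-exponent-other e []             g e≢g = refl
coeff-drop-exponent-other e ((c , e') ∷ p) g e≢g with VP.≡-dec _≟_ e' e
... | yes refl with VP.≡-dec _≟_ e g
...   | yes e≡g = ⊥-elim (e≢g e≡g)
...   | no _ = coeff-drop-exponent-other e p g e≢g
coeff-drop-exponent-other e ((c , e') ∷ p) g e≢g | no _ with VP.≡-dec _≟_ e' g
...   | yes _ = cong (ℤ._+_ (c)) (coeff-drop-exponent-other e p g e≢g)
...   | no _ = coeff-drop-exponent-other e p g e≢g

-- Terms may cancel across the list, so the hypothesis does not pass to the tail. It does pass to
-- the list from which a whole exponent class has been removed; hence the induction on the length.
eval-zero : ∀ {u} (p : Poly u) → (∀ e → coeff p e ≡ ℤ.0ℤ) → ∀ x → eval p x ≡ ℤ.0ℤ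
eval-zero p h x = go (length p) p ℕP.≤-refl h
  where
    go : ∀ k p → length p ≤ k → (∀ e → coeff p e ≡ ℤ.0ℤ) → eval p x ≡ ℤ.0ℤ
    go k       []            _        h = refl
    go (suc k) p@((c , e) ∷ r) (s≤s l) h = begin
      eval p x
        ≡⟨ eval-drop-exponent e p x ⟩
      coeff p e ℤ.* evalMono e x ℤ.+ eval (drop-exponent e p) x
        ≡⟨ cong₂ (λ a b → a ℤ.* evalMono e x ℤ.+ b) (h e) (go k (drop-exponent e p) shorter rest) ⟩
      ℤ.0ℤ ℤ.* evalMono e x ℤ.+ ℤ.0ℤ
        ≡⟨ trans (ℤP.+-identityʳ _) (ℤP.*-zeroˡ (evalMono e x)) ⟩
      ℤ.0ℤ ∎
      where
        open ≡-Reasoning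
        shorter : length (drop-exponent e p) ≤ k
        shorter with VP.≡-dec _≟_ e e
        ... | yes _ = ℕP.≤-trans (drop-exponent-length e r) l
        ... | no e≢e = ⊥-elim (e≢e refl)
        rest : ∀ g → coeff (drop-exponent e p) g ≡ ℤ.0ℤ
        rest g with VP.≡-dec _≟_ e g
        ... | yes refl = coeff-drop-exponent-same e p
        ... | no e≢g = trans (coeff-drop-exponent-other e p g e≢g) (h g)

coeff-add : ∀ {u} (p q : Poly u) e → coeff (addP p q) e ≡ coeff p e ℤ.+ coeff q e
coeff-add []             q e = sym (ℤP.+-identityˡ _)
coeff-add ((c , e') ∷ p) q e with VP.≡-dec _≟_ e' e
... | yes _ rewrite coeff-add p q e = sym (ℤP.+-assoc c (coeff p e) (coeff q e))
... | no  _ = coeff-add p q e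

coeff-neg : ∀ {u} (p : Poly u) e → coeff (negP p) e ≡ ℤ.- coeff p e
coeff-neg []             e = refl
coeff-neg ((c , e') ∷ p) e with VP.≡-dec _≟_ e' e
... | yes _ rewrite coeff-neg p e = sym (ℤP.neg-distrib-+ c (coeff p e))
... | no  _ = coeff-neg p e

coeff-sub : ∀ {u} (p q : Poly u) e → coeff (subP p q) e ≡ coeff p e ℤ.- coeff q e
coeff-sub p q e = trans (coeff-add p (negP q) e) (cong (ℤ._+_ (coeff p e)) (coeff-neg q e))

eval-sub : ∀ {u} (p q : Poly u) x → eval (subP p q) x ≡ eval p x ℤ.- eval q x
eval-sub p q x = trans (eval-add p (negP q) x) (cong (λ r → eval p x ℤ.+ r) (eval-neg q x))

eval-cong : ∀ {u} (p q : Poly u) → p ≈P q → ∀ x → eval p x ≡ eval q x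
eval-cong p q p≈q x = ℤP.i-j≡0⇒i≡j _ _ (trans (sym (eval-sub p q x)) (eval-zero (subP p q)
  (λ e → trans (coeff-sub p q e) (ℤP.i≡j⇒i-j≡0 (p≈q e))) x))

-- The constant coefficient is divisible by every t ≥ 1, hence zero; then t can be cancelled.
univariate-zero : ∀ n (a : ℕ → ℤ) → (∀ t → ΣZ n (λ k → a k ℤ.* (+ suc t) ℤ.^ k) ≡ ℤ.0ℤ) →
  ∀ k → k < n → a k ≡ ℤ.0ℤ
univariate-zero (suc n) a vanish = result
  where
    open ≡-Reasoning
    rest : ℕ → ℤ
    rest t = ΣZ n (λ k → a (suc k) ℤ.* (+ suc t) ℤ.^ k)
    split : ∀ t → a 0 ℤ.+ (+ suc t) ℤ.* rest t ≡ ℤ.0ℤ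
    split t = begin
      a 0 ℤ.+ (+ suc t) ℤ.* rest t
        ≡⟨ cong₂ ℤ._+_ (sym (ℤP.*-identityʳ (a 0))) (sym (ΣZ-*ˡ n (+ suc t) _)) ⟩
      a 0 ℤ.* ℤ.1ℤ ℤ.+ ΣZ n (λ k → (+ suc t) ℤ.* (a (suc k) ℤ.* (+ suc t) ℤ.^ k))
        ≡⟨ cong (ℤ._+_ (a 0 ℤ.* ℤ.1ℤ)) (ΣZ-cong n (λ k _ → exchange (+ suc t) (a (suc k)) _)) ⟩
      a 0 ℤ.* ℤ.1ℤ ℤ.+ ΣZ n (λ k → a (suc k) ℤ.* (+ suc t) ℤ.^ (suc k))
        ≡⟨ ΣZ-suc n _ ⟨
      ΣZ (suc n) (λ k → a k ℤ.* (+ suc t) ℤ.^ k)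
        ≡⟨ vanish t ⟩
      ℤ.0ℤ ∎
      where
        exchange : ∀ t a r → t ℤ.* (a ℤ.* r) ≡ a ℤ.* (t ℤ.* r)
        exchange = ℤ-solve
    -- One evaluation point suffices: z is a multiple of ∣z∣ + 1, which forces z = 0.
    a0-small : ∀ z r → z ℤ.+ (+ suc ∣ z ∣) ℤ.* r ≡ ℤ.0ℤ → z ≡ ℤ.0ℤ
    a0-small z r eq = ℤP.∣i∣≡0⇒i≡0 (abs-zero ∣ r ∣ (trans (cong ∣_∣ z≡) (trans (ℤP.∣-i∣≡∣i∣ ((+ suc ∣ z ∣) ℤ.* r)) (ℤP.abs-* (+ suc ∣ z ∣) r))))
      where
        z≡ : z ≡ ℤ.- ((+ suc ∣ z ∣) ℤ.* r)
        z≡ = ℤP.i-j≡0⇒i≡j _ _ (trans (cong (ℤ._+_ (z)) (ℤP.neg-involutive _)) eq)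
        abs-zero : ∀ k {m} → m ≡ suc m * k → m ≡ 0
        abs-zero zero {m} m≡ = trans m≡ (ℕP.*-zeroʳ (suc m))
        abs-zero (suc k) {m} m≡ = ⊥-elim (ℕP.<-irrefl m≡ (ℕP.<-≤-trans (ℕP.n<1+n m) (ℕP.m≤m*n (suc m) (suc k))))
    a0 : a 0 ≡ ℤ.0ℤ
    a0 = a0-small (a 0) (rest ∣ a 0 ∣) (split ∣ a 0 ∣)
    rest-zero : ∀ t → rest t ≡ ℤ.0ℤ
    rest-zero t with ℤP.i*j≡0⇒i≡0∨j≡0 (+ suc t)
      (trans (sym (ℤP.+-identityˡ _)) (trans (cong (ℤ._+ (+ suc t) ℤ.* rest t) (sym a0)) (split t)))
    ... | inj₂ r = r
    result : ∀ k → k < suc n → a k ≡ ℤ.0ℤ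
    result zero    _         = a0
    result (suc k) (s≤s k<n) = univariate-zero n (a ∘ suc) rest-zero k k<n

slice : ∀ {u} → ℕ → Poly (suc u) → Poly u
slice k []                  = []
slice k ((c , (a ∷ e)) ∷ p) with a ≟ k
... | yes _ = (c , e) ∷ slice k p
... | no  _ = slice k p

-- Only some strict bound on the first exponents is wanted; a sum serves as well as a maximum.
maxFirst : ∀ {u} → Poly (suc u) → ℕ
maxFirst []                  = 0
maxFirst ((c , (a ∷ e)) ∷ p) = suc a + maxFirst p

coeff-slice : ∀ {u} (p : Poly (suc u)) k e → coeff p (k ∷ e) ≡ coeff (slice k p) e
coeff-slice []                  k e = refl
coeff-slice ((c , (a ∷ f)) ∷ p) k e with VP.≡-dec _≟_ (a ∷ f) (k ∷ e) | a ≟ k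
... | yes refl | yes _ with VP.≡-dec _≟_ f f
...   | yes _ = cong (ℤ._+_ (c)) (coeff-slice p k e)
...   | no f≢f = ⊥-elim (f≢f refl)
coeff-slice ((c , (a ∷ f)) ∷ p) k e | yes refl | no k≢k = ⊥-elim (k≢k refl)
coeff-slice ((c , (a ∷ f)) ∷ p) k e | no ne | yes refl with VP.≡-dec _≟_ f e
...   | yes refl = ⊥-elim (ne refl)
...   | no _ = coeff-slice p k e
coeff-slice ((c , (a ∷ f)) ∷ p) k e | no _ | no _ = coeff-slice p k e

coeff-large : ∀ {u} (p : Poly (suc u)) k e → maxFirst p ≤ k → coeff p (k ∷ e) ≡ ℤ.0ℤ
coeff-large []                  k e _ = refl
coeff-large ((c , (a ∷ f)) ∷ p) k e h with VP.≡-dec _≟_ (a ∷ f) (k ∷ e)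
... | yes refl = ⊥-elim (ℕP.<-irrefl refl (ℕP.≤-trans (ℕP.m≤m+n (suc a) (maxFirst p)) h))
... | no _ = coeff-large p k e (ℕP.≤-trans (ℕP.m≤n+m (maxFirst p) (suc a)) h)

eval-slices : ∀ {u} (p : Poly (suc u)) K t x → maxFirst p ≤ K →
  eval p (t ∷ x) ≡ ΣZ K (λ k → eval (slice k p) x ℤ.* t ℤ.^ k)
eval-slices []                  K t x h = sym (ΣZ-0 K (λ k _ → refl))
eval-slices ((c , (a ∷ e)) ∷ p) K t x h = begin
  c ℤ.* (t ℤ.^ a ℤ.* evalMono e x) ℤ.+ eval p (t ∷ x)
    ≡⟨ cong₂ ℤ._+_ head≡ (eval-slices p K t x (ℕP.≤-trans (ℕP.m≤n+m _ (suc a)) h)) ⟩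
  ΣZ K new ℤ.+ ΣZ K (λ k → eval (slice k p) x ℤ.* t ℤ.^ k)
    ≡⟨ ΣZ-+ K _ _ ⟨
  ΣZ K (λ k → new k ℤ.+ eval (slice k p) x ℤ.* t ℤ.^ k)
    ≡⟨ ΣZ-cong K (λ k _ → step≡ k) ⟩
  ΣZ K (λ k → eval (slice k ((c , (a ∷ e)) ∷ p)) x ℤ.* t ℤ.^ k) ∎
  where
    open ≡-Reasoning
    new : ℕ → ℤ
    new k with a ≟ k
    ... | yes _ = (c ℤ.* evalMono e x) ℤ.* t ℤ.^ k
    ... | no  _ = ℤ.0ℤ
    new-a : new a ≡ c ℤ.* (t ℤ.^ a ℤ.* evalMono e x)
    new-a with a ≟ a
    ... | yes _ = exchange c (evalMono e x) (t ℤ.^ a)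
      where
        exchange : ∀ c m r → (c ℤ.* m) ℤ.* r ≡ c ℤ.* (r ℤ.* m)
        exchange = ℤ-solve
    ... | no a≢a = ⊥-elim (a≢a refl)
    new-other : ∀ j → j ≢ a → new j ≡ ℤ.0ℤ
    new-other j j≢a with a ≟ j
    ... | yes refl = ⊥-elim (j≢a refl)
    ... | no _ = refl
    head≡ : c ℤ.* (t ℤ.^ a ℤ.* evalMono e x) ≡ ΣZ K new
    head≡ = sym (trans (ΣZ-single K (ℕP.≤-trans (ℕP.m≤m+n (suc a) _) h) (λ j _ → new-other j)) new-a)
    step≡ : ∀ k → new k ℤ.+ eval (slice k p) x ℤ.* t ℤ.^ k
                ≡ eval (slice k ((c , (a ∷ e)) ∷ p)) x ℤ.* t ℤ.^ k
    step≡ k with a ≟ k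
    ... | yes _ = sym (ℤP.*-distribʳ-+ (t ℤ.^ k) (c ℤ.* evalMono e x) (eval (slice k p) x))
    ... | no  _ = ℤP.+-identityˡ _

-- Induction on the number of variables: once the other variables are fixed, p is univariate in the
-- first one, and its coefficients are the values of the slices.
vanishing⇒zero : ∀ {u} (p : Poly u) → (∀ x → eval p x ≡ ℤ.0ℤ) → ∀ e → coeff p e ≡ ℤ.0ℤ
vanishing⇒zero {zero} p h [] = trans (constant p) (h [])
  where
    constant : ∀ p → coeff p [] ≡ eval p []
    constant []             = refl
    constant ((c , []) ∷ p) = cong₂ ℤ._+_ (sym (ℤP.*-identityʳ c)) (constant p)
vanishing⇒zero {suc u} p h (k ∷ e) with k <? maxFirst p
... | no k≮ = coeff-large p k e (ℕP.≮⇒≥ k≮)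
... | yes k< = trans (coeff-slice p k e) (vanishing⇒zero (slice k p)
  (λ x → univariate-zero (maxFirst p) (λ k → eval (slice k p) x)
    (λ t → trans (sym (eval-slices p (maxFirst p) (+ suc t) x ℕP.≤-refl)) (h (+ suc t ∷ x))) k k<) e)

-- Reduces the formal relation `≈P` to values at integer points, so that circuits can be verified
-- semantically throughout.
eval-injective : ∀ {u} (p q : Poly u) → (∀ x → eval p x ≡ eval q x) → p ≈P q
eval-injective p q h e = ℤP.i-j≡0⇒i≡j _ _ (trans (sym (coeff-sub p q e)) (vanishing⇒zero (subP p q)
  (λ x → trans (eval-sub p q x) (ℤP.i≡j⇒i-j≡0 (h x))) e))

-- Sums over a Boolean cube

evalMono-++ : ∀ {u k} (e : Mono u) (f : Mono k) x y →
  evalMono (e V.++ f) (x V.++ y) ≡ evalMono e x ℤ.* evalMono f y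
evalMono-++ []      f []      y = sym (ℤP.*-identityˡ _)
evalMono-++ (a ∷ e) f (t ∷ x) y rewrite evalMono-++ e f x y = sym (ℤP.*-assoc (t ℤ.^ a) (evalMono e x) (evalMono f y))

eval-substLast : ∀ {u} k (ε : Vec Bool k) (g : Poly (u + k)) x →
  eval (substLast k ε g) x ≡ eval g (x V.++ V.map boolℤ ε)
eval-substLast k ε [] x = refl
eval-substLast {u} k ε ((c , e) ∷ g) x = cong₂ ℤ._+_ term (eval-substLast k ε g x)
  where
    term : (c ℤ.* evalMono (V.drop u e) (V.map boolℤ ε)) ℤ.* evalMono (V.take u e) x
         ≡ c ℤ.* evalMono e (x V.++ V.map boolℤ ε)
    term = begin
      (c ℤ.* evalMono (V.drop u e) (V.map boolℤ ε)) ℤ.* evalMono (V.take u e) x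
        ≡⟨ exchange c _ _ ⟩
      c ℤ.* (evalMono (V.take u e) x ℤ.* evalMono (V.drop u e) (V.map boolℤ ε))
        ≡⟨ cong (c ℤ.*_) (evalMono-++ (V.take u e) (V.drop u e) x (V.map boolℤ ε)) ⟨
      c ℤ.* evalMono (V.take u e V.++ V.drop u e) (x V.++ V.map boolℤ ε)
        ≡⟨ cong (λ z → c ℤ.* evalMono z (x V.++ V.map boolℤ ε)) (VP.take++drop≡id u e) ⟩
      c ℤ.* evalMono e (x V.++ V.map boolℤ ε) ∎
      where
        open ≡-Reasoning
        exchange : ∀ c m r → (c ℤ.* m) ℤ.* r ≡ c ℤ.* (r ℤ.* m)
        exchange = ℤ-solve

val : ∀ {P} → Vec Bool P → ℕ
val []           = 0
val (false ∷ bs) = 2 * val bs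
val (true ∷ bs)  = suc (2 * val bs)

ΣB : ∀ k → (Vec Bool k → ℤ) → ℤ
ΣB zero    F = F []
ΣB (suc k) F = ΣB k (λ ε → F (false ∷ ε)) ℤ.+ ΣB k (λ ε → F (true ∷ ε))

eval-sumBool : ∀ {u} k (g : Poly (u + k)) x →
  eval (sumBool k g) x ≡ ΣB k (λ ε → eval g (x V.++ V.map boolℤ ε))
eval-sumBool {u} k g x = trans (over-list (allBoolVecs k))
  (trans (cube k _) (ΣB-cong k (λ ε → eval-substLast k ε g x)))
  where
    sumL : ∀ {A : Set} → (A → ℤ) → List A → ℤ
    sumL F []       = ℤ.0ℤ
    sumL F (a ∷ as) = F a ℤ.+ sumL F as
    sumL-++ : ∀ {A : Set} (F : A → ℤ) as bs → sumL F (as L.++ bs) ≡ sumL F as ℤ.+ sumL F bs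
    sumL-++ F []       bs = sym (ℤP.+-identityˡ _)
    sumL-++ F (a ∷ as) bs = trans (cong (ℤ._+_ (F a)) (sumL-++ F as bs)) (sym (ℤP.+-assoc (F a) _ _))
    sumL-map : ∀ {A B : Set} (F : B → ℤ) (h : A → B) as → sumL F (L.map h as) ≡ sumL (F ∘ h) as
    sumL-map F h []       = refl
    sumL-map F h (a ∷ as) = cong (ℤ._+_ (F (h a))) (sumL-map F h as)
    over-list : ∀ εs → eval (concatMap (λ ε → substLast k ε g) εs) x ≡ sumL (λ ε → eval (substLast k ε g) x) εs
    over-list []       = refl
    over-list (ε ∷ εs) = trans (eval-add (substLast k ε g) _ x) (cong (λ r → eval (substLast k ε g) x ℤ.+ r) (over-list εs))
    cube : ∀ k F → sumL F (allBoolVecs k) ≡ ΣB k F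
    cube zero    F = ℤP.+-identityʳ _
    cube (suc k) F = trans (sumL-++ F (L.map (false ∷_) (allBoolVecs k)) _) (cong₂ ℤ._+_
      (trans (sumL-map F (false ∷_) (allBoolVecs k)) (cube k _))
      (trans (sumL-map F (true ∷_) (allBoolVecs k)) (cube k _)))
    ΣB-cong : ∀ k {F G : Vec Bool k → ℤ} → (∀ ε → F ε ≡ G ε) → ΣB k F ≡ ΣB k G
    ΣB-cong zero    h = h []
    ΣB-cong (suc k) h = cong₂ ℤ._+_ (ΣB-cong k (λ ε → h (false ∷ ε))) (ΣB-cong k (λ ε → h (true ∷ ε)))

-- Circuits as straight-line programs

opZ : Op → ℤ → ℤ → ℤ
opZ plus  = ℤ._+_
opZ minus = ℤ._-_
opZ times = ℤ._*_

degOp : Op → ℕ → ℕ → ℕ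
degOp times a b = a + b
degOp _     a b = a ⊔ b

evalS : ∀ {m s} → SLP m s → Vec ℤ m → Vec ℤ (s + suc m)
evalS []                x = ℤ.1ℤ ∷ x
evalS (C ▷ (o , i , j)) x = opZ o (lookup (evalS C x) i) (lookup (evalS C x) j) ∷ evalS C x

evalC : ∀ {m s} → Circuit m s → Vec ℤ m → ℤ
evalC (circuit C o) x = lookup (evalS C x) o

eval-applyOp : ∀ {u} o (p q : Poly u) x → eval (applyOp o p q) x ≡ opZ o (eval p x) (eval q x)
eval-applyOp plus  = eval-add
eval-applyOp minus = eval-sub
eval-applyOp times = eval-mul

evalS-correct : ∀ {m s} (C : SLP m s) x i → lookup (evalS C x) i ≡ eval (lookup (values C) i) x
evalS-correct []                x zero    = sym (eval-one x)
evalS-correct []                x (suc i) =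
  sym (trans (cong (λ p → eval p x) (VP.lookup∘tabulate varP i)) (eval-var i x))
evalS-correct (C ▷ (o , i , j)) x zero    =
  trans (cong₂ (opZ o) (evalS-correct C x i) (evalS-correct C x j))
        (sym (eval-applyOp o (lookup (values C) i) (lookup (values C) j) x))
evalS-correct (C ▷ _)           x (suc k) = evalS-correct C x k

evalC-correct : ∀ {m s} (C : Circuit m s) x → evalC C x ≡ eval (computed C) x
evalC-correct (circuit C o) x = evalS-correct C x o

data _⊑_ {m} {s} (C : SLP m s) : ∀ {s'} → SLP m s' → Set where
  here : C ⊑ C
  next : ∀ {s'} {C' : SLP m s'} {g} → C ⊑ C' → C ⊑ (C' ▷ g)

⊑-trans : ∀ {m s s' s''} {C : SLP m s} {C' : SLP m s'} {C'' : SLP m s''} → C ⊑ C' → C' ⊑ C'' → C ⊑ C''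
⊑-trans p here     = p
⊑-trans p (next q) = next (⊑-trans p q)

-- Circuits are studied on a set X of points embedded by ι: a wire is identified with the function
-- X → ℤ it computes, so that wires need no re-indexing when gates are added.
module Wires {X : Set} {m : ℕ} (ι : X → Vec ℤ m) where

  record Has {s} (C : SLP m s) (f : X → ℤ) (d : ℕ) : Set where
    constructor has
    field
      index  : Fin (s + suc m)
      sem    : ∀ x → lookup (evalS C (ι x)) index ≡ f x
      degree : lookup (fdegs C) index ≤ d

  has-⊑ : ∀ {s s'} {C : SLP m s} {C' : SLP m s'} {f d} → C ⊑ C' → Has C f d → Has C' f d
  has-⊑ here     h = h
  has-⊑ (next p) h with has-⊑ p h
  ... | has i e d = has (suc i) e d

  has-cong : ∀ {s} {C : SLP m s} {f g d} → (∀ x → f x ≡ g x) → Has C f d → Has C g d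
  has-cong eq (has i e d) = has i (λ x → trans (e x) (eq x)) d

  has-≤ : ∀ {s} {C : SLP m s} {f d d'} → d ≤ d' → Has C f d → Has C f d'
  has-≤ le (has i e d) = has i e (ℕP.≤-trans d le)

  has-one : ∀ {s} (C : SLP m s) → Has C (λ _ → ℤ.1ℤ) 1
  has-one []      = has zero (λ _ → refl) ℕP.≤-refl
  has-one (C ▷ g) = has-⊑ (next here) (has-one C)

  has-input : ∀ {s} (C : SLP m s) i → Has C (λ x → lookup (ι x) i) 1
  has-input []      i = has (suc i) (λ _ → refl) (ℕP.≤-reflexive (VP.lookup-replicate i 1))
  has-input (C ▷ g) i = has-⊑ (next here) (has-input C i)

  has-op : ∀ o {s} {C : SLP m s} {f g d e} (hf : Has C f d) (hg : Has C g e) →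
    Has (C ▷ (o , Has.index hf , Has.index hg)) (λ x → opZ o (f x) (g x)) (degOp o d e)
  has-op o {C = C} {d = d} {e} (has i ei di) (has j ej dj) =
    has zero (λ x → cong₂ (opZ o) (ei x) (ej x)) (bound o)
    where
      bound : ∀ o → lookup (fdegs (C ▷ (o , i , j))) zero ≤ degOp o d e
      bound plus  = ℕP.⊔-mono-≤ di dj
      bound minus = ℕP.⊔-mono-≤ di dj
      bound times = ℕP.+-mono-≤ di dj

  record Extension {s} (C : SLP m s) (c : ℕ) (P : ∀ {s'} → SLP m s' → Set) : Set where
    constructor extension
    field
      {size}  : ℕ
      circ    : SLP m size
      extends : C ⊑ circ
      cost    : size ≤ s + c
      result  : P circ

  -- A postponed construction: f can be added to any later circuit. Generators over the same C can
  -- therefore be run one after the other without invalidating each other's wires.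
  Gen : ∀ {s} → SLP m s → (X → ℤ) → ℕ → ℕ → Set
  Gen C f d c = ∀ {s'} {C' : SLP m s'} → C ⊑ C' → Extension C' c (λ C'' → Has C'' f d)

  gen-⊑ : ∀ {s s'} {C : SLP m s} {C' : SLP m s'} {f d c} → C ⊑ C' → Gen C f d c → Gen C' f d c
  gen-⊑ p G q = G (⊑-trans p q)

  gen-has : ∀ {s} {C : SLP m s} {f d} → Has C f d → Gen C f d 0
  gen-has h p = extension _ here (ℕP.≤-reflexive (sym (ℕP.+-identityʳ _))) (has-⊑ p h)

  gen-let : ∀ {s} {C : SLP m s} {f d c g e c'} → Gen C f d c →
    (∀ {s'} {C' : SLP m s'} → C ⊑ C' → Has C' f d → Gen C' g e c') → Gen C g e (c + c')
  gen-let {c = c} {c' = c'} F k {s'} p with F p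
  ... | extension C₁ p₁ c₁ h with k (⊑-trans p p₁) h here
  ...   | extension C₂ p₂ c₂ h₂ = extension C₂ (⊑-trans p₁ p₂)
          (ℕP.≤-trans c₂ (ℕP.≤-trans (ℕP.+-monoˡ-≤ c' c₁) (ℕP.≤-reflexive (ℕP.+-assoc s' c c')))) h₂

  gen-cong : ∀ {s} {C : SLP m s} {f g d c} → (∀ x → f x ≡ g x) → Gen C f d c → Gen C g d c
  gen-cong eq G p with G p
  ... | extension C₁ p₁ c₁ h = extension C₁ p₁ c₁ (has-cong eq h)

  gen-≤ : ∀ {s} {C : SLP m s} {f d c d' c'} → d ≤ d' → c ≤ c' → Gen C f d c → Gen C f d' c'
  gen-≤ d≤ c≤ G {s'} p with G p
  ... | extension C₁ p₁ c₁ h = extension C₁ p₁ (ℕP.≤-trans c₁ (ℕP.+-monoʳ-≤ s' c≤)) (has-≤ d≤ h)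

  gen-op : ∀ o {s} {C : SLP m s} {f g d e c c'} → Gen C f d c → Gen C g e c' →
    Gen C (λ x → opZ o (f x) (g x)) (degOp o d e) (c + (c' + 1))
  gen-op o F G = gen-let F (λ p hf → gen-let (gen-⊑ p G) (λ p' hg q →
    extension _ (next here) (ℕP.≤-reflexive (ℕP.+-comm 1 _)) (has-op o (has-⊑ (⊑-trans p' q) hf) (has-⊑ q hg))))

  gen-one : ∀ {s} {C : SLP m s} → Gen C (λ _ → ℤ.1ℤ) 1 0
  gen-one {C = C} = gen-has (has-one C)

  gen-zero : ∀ {s} {C : SLP m s} → Gen C (λ _ → ℤ.0ℤ) 1 1
  gen-zero = gen-op minus gen-one gen-one

  gen-product : ∀ {s} {C : SLP m s} n (f : ℕ → X → ℤ) {d c} → (∀ i → i < n → Gen C (f i) d c) →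
    Gen C (λ x → ΠZ n (λ i → f i x)) (n * d + 1) (n * (c + 1))
  gen-product zero    f G = gen-one
  gen-product (suc n) f {d} {c} G = gen-≤ (ℕP.≤-reflexive (arith₁ n d)) (ℕP.≤-reflexive (arith₂ n c))
    (gen-op times (gen-product n f (λ i i<n → G i (ℕP.m<n⇒m<1+n i<n))) (G n ℕP.≤-refl))
    where
      arith₁ : ∀ n d → (n * d + 1) + d ≡ (d + n * d) + 1
      arith₁ = ℕ-solve
      arith₂ : ∀ n c → n * (c + 1) + (c + 1) ≡ (c + 1) + n * (c + 1)
      arith₂ = ℕ-solve

  -- Feeding wires of degree at most δ into D multiplies its formal degrees by δ. For the constant
  -- 1, whose formal degree is 1 and not 0, this uses 1 ≤ δ.
  embed : ∀ {m' k s} (D : SLP m' k) (C : SLP m s) (F : X → Vec ℤ m') δ → 1 ≤ δ →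
    (∀ i → Has C (λ x → lookup (F x) i) δ) →
    Extension C k (λ C' → ∀ j → Has C' (λ x → lookup (evalS D (F x)) j) (lookup (fdegs D) j * δ))
  embed []                C F δ 1≤δ wires = extension C here (ℕP.≤-reflexive (sym (ℕP.+-identityʳ _))) λ
    { zero    → has-≤ (ℕP.≤-trans 1≤δ (ℕP.≤-reflexive (sym (ℕP.*-identityˡ δ)))) (has-one C)
    ; (suc i) → has-≤ (ℕP.≤-reflexive (sym (trans (cong (_* δ) (VP.lookup-replicate i 1)) (ℕP.*-identityˡ δ)))) (wires i) }
  embed {s = s} (_▷_ {k} D (o , i , j)) C F δ 1≤δ wires with embed D C F δ 1≤δ wires
  ... | extension C' p c h = extension _ (next p) (ℕP.≤-trans (s≤s c) (ℕP.≤-reflexive (sym (ℕP.+-suc s k)))) λ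
    { zero    → has-≤ (bound o) (has-op o (h i) (h j))
    ; (suc l) → has-⊑ (next here) (h l) }
    where
      bound : ∀ o → degOp o (lookup (fdegs D) i * δ) (lookup (fdegs D) j * δ) ≤ lookup (fdegs (D ▷ (o , i , j))) zero * δ
      bound plus  = ℕP.≤-reflexive (sym (ℕP.*-distribʳ-⊔ δ (lookup (fdegs D) i) (lookup (fdegs D) j)))
      bound minus = ℕP.≤-reflexive (sym (ℕP.*-distribʳ-⊔ δ (lookup (fdegs D) i) (lookup (fdegs D) j)))
      bound times = ℕP.≤-reflexive (sym (ℕP.*-distribʳ-+ δ (lookup (fdegs D) i) (lookup (fdegs D) j)))

  gen-embed : ∀ {m' k s} (D : Circuit m' k) {C : SLP m s} (F : X → Vec ℤ m') δ → 1 ≤ δ →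
    (∀ i → Has C (λ x → lookup (F x) i) δ) → Gen C (λ x → evalC D (F x)) (formalDegree D * δ) k
  gen-embed (circuit D o) F δ 1≤δ wires p with embed D _ F δ 1≤δ (λ i → has-⊑ p (wires i))
  ... | extension C' q c h = extension C' q c (h o)

open Wires public using (has; extension)

record Realised {X : Set} {m} (ι : X → Vec ℤ m) (f : X → ℤ) (b : ℕ) : Set where
  constructor realised
  field
    {size}  : ℕ
    circ    : Circuit m size
    size≤   : size ≤ b
    degree≤ : formalDegree circ ≤ b
    sem     : ∀ x → evalC circ (ι x) ≡ f x

realise : ∀ {X : Set} {m} (ι : X → Vec ℤ m) {f d c b} → Wires.Gen ι [] f d c → d ≤ b → c ≤ b → Realised ι f b
realise ι G d≤ c≤ with G here
... | extension C _ cost (has i e d) = realised (circuit C i) (ℕP.≤-trans cost c≤) (ℕP.≤-trans d d≤) e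

realised-≤ : ∀ {X : Set} {m} {ι : X → Vec ℤ m} {f b b'} → b ≤ b' → Realised ι f b → Realised ι f b'
realised-≤ le (realised C s d e) = realised C (ℕP.≤-trans s le) (ℕP.≤-trans d le) e

gen-realised : ∀ {X : Set} {m} (ι : X → Vec ℤ m) {Y : Set} {n} {κ : Y → Vec ℤ n} {f b} (R : Realised κ f b)
  (h : X → Y) {s} {C : SLP m s} → (∀ i → Wires.Has ι C (λ x → lookup (κ (h x)) i) 1) →
  Wires.Gen ι C (λ x → f (h x)) b b
gen-realised ι {κ = κ} (realised D s d e) h wires = gen-cong (λ x → e (h x))
  (gen-≤ (ℕP.≤-trans (ℕP.≤-reflexive (ℕP.*-identityʳ _)) d) s
    (gen-embed D (κ ∘ h) 1 ℕP.≤-refl wires))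
  where open Wires ι

boolℤ-bound : ∀ b → ∣ boolℤ b ∣ ≤ 1
boolℤ-bound false = z≤n
boolℤ-bound true  = ℕP.≤-refl

-- At Boolean points the number of bits is at most size times formal degree, hence polynomial;
-- without a degree bound, repeated squaring would exceed it. The second component pays for the
-- doubling at an additive gate: one more gate raises the exponent by the degree, which is at least
-- 1.
evalS-bound : ∀ {m s} (C : SLP m s) (x : Vec Bool m) i →
  ∣ lookup (evalS C (V.map boolℤ x)) i ∣ ≤ 2 ^ (s * lookup (fdegs C) i) × 1 ≤ lookup (fdegs C) i
evalS-bound []                x zero    = ℕP.≤-refl , ℕP.≤-refl
evalS-bound []                x (suc i) =
  ℕP.≤-trans (ℕP.≤-reflexive (cong ∣_∣ (VP.lookup-map i boolℤ x))) (boolℤ-bound (lookup x i)) ,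
  ℕP.≤-reflexive (sym (VP.lookup-replicate i 1))
evalS-bound {s = suc s} (C ▷ (o , i , j)) x zero    = op o
  where
    v = lookup (evalS C (V.map boolℤ x))
    d = lookup (fdegs C)
    two : ∀ a b {A B : ℕ} → A ≤ 2 ^ (s * a) → B ≤ 2 ^ (s * b) → 1 ≤ a → A + B ≤ 2 ^ (suc s * (a ⊔ b))
    two a b {A} {B} hA hB 1≤a = begin
      A + B                                   ≤⟨ ℕP.+-mono-≤ (ℕP.≤-trans hA (up (ℕP.m≤m⊔n a b))) (ℕP.≤-trans hB (up (ℕP.m≤n⊔m a b))) ⟩
      2 ^ (s * (a ⊔ b)) + 2 ^ (s * (a ⊔ b))   ≡⟨ cong (λ z → 2 ^ (s * (a ⊔ b)) + z) (sym (ℕP.+-identityʳ _)) ⟩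
      2 ^ suc (s * (a ⊔ b))                   ≤⟨ ℕP.^-monoʳ-≤ 2 (ℕP.+-monoˡ-≤ (s * (a ⊔ b)) (ℕP.≤-trans 1≤a (ℕP.m≤m⊔n a b))) ⟩
      2 ^ (suc s * (a ⊔ b))                   ∎
      where
        open ℕP.≤-Reasoning
        up : ∀ {c} → c ≤ a ⊔ b → 2 ^ (s * c) ≤ 2 ^ (s * (a ⊔ b))
        up le = ℕP.^-monoʳ-≤ 2 (ℕP.*-monoʳ-≤ s le)
    hi = evalS-bound C x i
    hj = evalS-bound C x j
    op : ∀ o → ∣ opZ o (v i) (v j) ∣ ≤ 2 ^ (suc s * lookup (fdegs (C ▷ (o , i , j))) zero)
             × 1 ≤ lookup (fdegs (C ▷ (o , i , j))) zero
    op plus  = ℕP.≤-trans (ℤP.∣i+j∣≤∣i∣+∣j∣ (v i) (v j)) (two (d i) (d j) (proj₁ hi) (proj₁ hj) (proj₂ hi)) ,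
               ℕP.≤-trans (proj₂ hi) (ℕP.m≤m⊔n (d i) (d j))
    op minus = ℕP.≤-trans (ℤP.∣i-j∣≤∣i∣+∣j∣ (v i) (v j)) (two (d i) (d j) (proj₁ hi) (proj₁ hj) (proj₂ hi)) ,
               ℕP.≤-trans (proj₂ hi) (ℕP.m≤m⊔n (d i) (d j))
    op times = (begin
      ∣ v i ℤ.* v j ∣                ≡⟨ ℤP.abs-* (v i) (v j) ⟩
      ∣ v i ∣ * ∣ v j ∣              ≤⟨ ℕP.*-mono-≤ (proj₁ hi) (proj₁ hj) ⟩
      2 ^ (s * d i) * 2 ^ (s * d j)  ≡⟨ ℕP.^-distribˡ-+-* 2 (s * d i) (s * d j) ⟨
      2 ^ (s * d i + s * d j)        ≡⟨ cong (2 ^_) (ℕP.*-distribˡ-+ s (d i) (d j)) ⟨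
      2 ^ (s * (d i + d j))          ≤⟨ ℕP.^-monoʳ-≤ 2 (ℕP.*-monoˡ-≤ (d i + d j) (ℕP.n≤1+n s)) ⟩
      2 ^ (suc s * (d i + d j))      ∎) , ℕP.≤-trans (proj₂ hi) (ℕP.m≤m+n (d i) (d j))
      where open ℕP.≤-Reasoning
evalS-bound {s = suc s} (C ▷ g) x (suc k) =
  ℕP.≤-trans (proj₁ (evalS-bound C x k)) (ℕP.^-monoʳ-≤ 2 (ℕP.*-monoˡ-≤ _ (ℕP.n≤1+n s))) , proj₂ (evalS-bound C x k)

-- Polynomial bounds

addN : NatPoly → NatPoly → NatPoly
addN []      q       = q
addN (c ∷ p) []      = c ∷ p
addN (c ∷ p) (d ∷ q) = (c + d) ∷ addN p q

scaleN : ℕ → NatPoly → NatPoly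
scaleN c = L.map (c *_)

mulN : NatPoly → NatPoly → NatPoly
mulN []      q = []
mulN (c ∷ p) q = addN (scaleN c q) (0 ∷ mulN p q)

compN : NatPoly → NatPoly → NatPoly
compN []      q = []
compN (c ∷ p) q = addN (c ∷ []) (mulN q (compN p q))

⟦addN⟧ : ∀ p q n → ⟦ addN p q ⟧ n ≡ ⟦ p ⟧ n + ⟦ q ⟧ n
⟦addN⟧ []      q       n = refl
⟦addN⟧ (c ∷ p) []      n = sym (ℕP.+-identityʳ _)
⟦addN⟧ (c ∷ p) (d ∷ q) n rewrite ⟦addN⟧ p q n = rearrange c d n (⟦ p ⟧ n) (⟦ q ⟧ n)
  where
    rearrange : ∀ c d n a b → c + d + n * (a + b) ≡ c + n * a + (d + n * b)
    rearrange = ℕ-solve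

⟦scaleN⟧ : ∀ c q n → ⟦ scaleN c q ⟧ n ≡ c * ⟦ q ⟧ n
⟦scaleN⟧ c []      n = sym (ℕP.*-zeroʳ c)
⟦scaleN⟧ c (d ∷ q) n rewrite ⟦scaleN⟧ c q n = rearrange c d n (⟦ q ⟧ n)
  where
    rearrange : ∀ c d n a → c * d + n * (c * a) ≡ c * (d + n * a)
    rearrange = ℕ-solve

⟦mulN⟧ : ∀ p q n → ⟦ mulN p q ⟧ n ≡ ⟦ p ⟧ n * ⟦ q ⟧ n
⟦mulN⟧ []      q n = refl
⟦mulN⟧ (c ∷ p) q n rewrite ⟦addN⟧ (scaleN c q) (0 ∷ mulN p q) n | ⟦scaleN⟧ c q n | ⟦mulN⟧ p q n =
  rearrange c n (⟦ p ⟧ n) (⟦ q ⟧ n)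
  where
    rearrange : ∀ c n a b → c * b + (n * (a * b)) ≡ (c + n * a) * b
    rearrange = ℕ-solve

⟦compN⟧ : ∀ p q n → ⟦ compN p q ⟧ n ≡ ⟦ p ⟧ (⟦ q ⟧ n)
⟦compN⟧ []      q n = refl
⟦compN⟧ (c ∷ p) q n rewrite ⟦addN⟧ (c ∷ []) (mulN q (compN p q)) n | ⟦mulN⟧ q (compN p q) n | ⟦compN⟧ p q n
  | ℕP.*-zeroʳ n | ℕP.+-identityʳ c = refl

⟦⟧-mono : ∀ q {a b} → a ≤ b → ⟦ q ⟧ a ≤ ⟦ q ⟧ b
⟦⟧-mono []      a≤b = z≤n
⟦⟧-mono (c ∷ q) a≤b = ℕP.+-monoʳ-≤ c (ℕP.*-mono-≤ a≤b (⟦⟧-mono q a≤b))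

pb-poly : ∀ q → PolyBounded ⟦ q ⟧
pb-poly q = q , λ _ → ℕP.≤-refl

pb-const : ∀ c → PolyBounded (λ _ → c)
pb-const c = c ∷ [] , λ n → ℕP.m≤m+n c _

pb-+ : ∀ {f g} → PolyBounded f → PolyBounded g → PolyBounded (λ n → f n + g n)
pb-+ (p , hp) (q , hq) = addN p q , λ n →
  ℕP.≤-trans (ℕP.+-mono-≤ (hp n) (hq n)) (ℕP.≤-reflexive (sym (⟦addN⟧ p q n)))

pb-* : ∀ {f g} → PolyBounded f → PolyBounded g → PolyBounded (λ n → f n * g n)
pb-* (p , hp) (q , hq) = mulN p q , λ n →
  ℕP.≤-trans (ℕP.*-mono-≤ (hp n) (hq n)) (ℕP.≤-reflexive (sym (⟦mulN⟧ p q n)))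

-- Boolean programs

-- Three inputs, so that the sum and the carry of a full adder are single gates.
Gate : Set
Gate = Bool → Bool → Bool → Bool

data BP (m : ℕ) : ℕ → Set where
  []  : BP m 0
  _▷_ : ∀ {k} → BP m k → Gate × Fin (k + suc m) × Fin (k + suc m) × Fin (k + suc m) → BP m (suc k)

run-BP : ∀ {m k} → BP m k → Vec Bool m → Vec Bool (k + suc m)
run-BP []                    x = true ∷ x
run-BP (B ▷ (g , i , j , l)) x = let v = run-BP B x in g (lookup v i) (lookup v j) (lookup v l) ∷ v

_≡𝔹_ : Bool → Bool → Bool
a ≡𝔹 b = not (a xor b)

check : ∀ {m k} → BP m k → Vec Bool (k + suc m) → ℤ
check []                    ν       = ℤ.1ℤ
check (B ▷ (g , i , j , l)) (b ∷ ν) = check B ν ℤ.* boolℤ (b ≡𝔹 g (lookup ν i) (lookup ν j) (lookup ν l))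

ΣB-cong : ∀ k {F G : Vec Bool k → ℤ} → (∀ ε → F ε ≡ G ε) → ΣB k F ≡ ΣB k G
ΣB-cong zero    h = h []
ΣB-cong (suc k) h = cong₂ ℤ._+_ (ΣB-cong k (λ ε → h (false ∷ ε))) (ΣB-cong k (λ ε → h (true ∷ ε)))

ΣB-+ : ∀ k (F G : Vec Bool k → ℤ) → ΣB k F ℤ.+ ΣB k G ≡ ΣB k (λ ε → F ε ℤ.+ G ε)
ΣB-+ zero    F G = refl
ΣB-+ (suc k) F G = trans (exchange (ΣB k _) _ (ΣB k _) _) (cong₂ ℤ._+_ (ΣB-+ k _ _) (ΣB-+ k _ _))
  where
    exchange : ∀ a b c d → (a ℤ.+ b) ℤ.+ (c ℤ.+ d) ≡ (a ℤ.+ c) ℤ.+ (b ℤ.+ d)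
    exchange = ℤ-solve

-- Of all guesses for the gate values only the actual run passes the check. The proof sums out the
-- most recent gate: its value is determined by the others, so one of the two terms vanishes.
ΣB-check : ∀ {m k} (B : BP m k) x (F : Vec Bool (k + suc m) → ℤ) →
  ΣB k (λ z → check B (z V.++ (true ∷ x)) ℤ.* F (z V.++ (true ∷ x))) ≡ F (run-BP B x)
ΣB-check []                                x F = ℤP.*-identityˡ (F (true ∷ x))
ΣB-check (_▷_ {k} B (g , i , j , l)) x F = begin
  ΣB k (λ z → body false (z V.++ (true ∷ x))) ℤ.+ ΣB k (λ z → body true (z V.++ (true ∷ x)))
    ≡⟨ ΣB-+ k (λ z → body false (z V.++ (true ∷ x))) (λ z → body true (z V.++ (true ∷ x))) ⟩
  ΣB k (λ z → body false (z V.++ (true ∷ x)) ℤ.+ body true (z V.++ (true ∷ x)))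
    ≡⟨ ΣB-cong k (λ z → pick (z V.++ (true ∷ x))) ⟩
  ΣB k (λ z → check B (z V.++ (true ∷ x)) ℤ.* F (out (z V.++ (true ∷ x)) ∷ (z V.++ (true ∷ x))))
    ≡⟨ ΣB-check B x (λ ν → F (out ν ∷ ν)) ⟩
  F (run-BP (B ▷ (g , i , j , l)) x) ∎
  where
    open ≡-Reasoning
    out : Vec Bool _ → Bool
    out ν = g (lookup ν i) (lookup ν j) (lookup ν l)
    body : Bool → Vec Bool _ → ℤ
    body b ν = (check B ν ℤ.* boolℤ (b ≡𝔹 out ν)) ℤ.* F (b ∷ ν)
    pick : ∀ ν → body false ν ℤ.+ body true ν ≡ check B ν ℤ.* F (out ν ∷ ν)
    pick ν with out ν
    ... | false = keepˡ (check B ν) (F (false ∷ ν)) (F (true ∷ ν))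
      where
        keepˡ : ∀ c a b → (c ℤ.* ℤ.1ℤ) ℤ.* a ℤ.+ (c ℤ.* ℤ.0ℤ) ℤ.* b ≡ c ℤ.* a
        keepˡ = ℤ-solve
    ... | true  = keepʳ (check B ν) (F (false ∷ ν)) (F (true ∷ ν))
      where
        keepʳ : ∀ c a b → (c ℤ.* ℤ.0ℤ) ℤ.* a ℤ.+ (c ℤ.* ℤ.1ℤ) ℤ.* b ≡ c ℤ.* b
        keepʳ = ℤ-solve

muxCost : ℕ → ℕ
muxCost zero    = 1
muxCost (suc n) = muxCost n + muxCost n + 5

module GenBool {X : Set} {m : ℕ} (ι : X → Vec ℤ m) where
  open Wires ι

  -- Case distinction on the first bit, as b g₁ + (1 - b) g₀. The cost is exponential in n, which is
  -- harmless for the four wires of a gate test.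
  gen-boolfun : ∀ n (g : Vec Bool n → Bool) (w : X → Vec Bool n) {s} {C : SLP m s} →
    (∀ i → Has C (λ x → boolℤ (lookup (w x) i)) 1) → Gen C (λ x → boolℤ (g (w x))) (suc n) (muxCost n)
  gen-boolfun zero g w {C = C} H = gen-cong (λ x → cong (boolℤ ∘ g) (nil (w x))) (const (g []))
    where
      nil : (v : Vec Bool 0) → [] ≡ v
      nil [] = refl
      const : ∀ b → Gen C (λ _ → boolℤ b) 1 1
      const false = gen-zero
      const true  = gen-≤ ℕP.≤-refl z≤n gen-one
  gen-boolfun (suc n) g w {C = C} H = gen-cong (λ x → select (w x))
    (gen-≤ (ℕP.⊔-lub ℕP.≤-refl ℕP.≤-refl) (cost≤ (muxCost n))
      (gen-op plus (gen-op times (gen-has (H zero)) (branch true))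
                   (gen-op times (gen-op minus gen-one (gen-has (H zero))) (branch false))))
    where
      H-tail : ∀ i → Has C (λ x → boolℤ (lookup (V.tail (w x)) i)) 1
      H-tail i = has-cong (λ x → cong boolℤ (tail≡ (w x))) (H (suc i))
        where
          tail≡ : ∀ (v : Vec Bool (suc n)) → lookup v (suc i) ≡ lookup (V.tail v) i
          tail≡ (_ ∷ _) = refl
      branch : ∀ b → Gen C (λ x → boolℤ (g (b ∷ V.tail (w x)))) (suc n) (muxCost n)
      branch b = gen-boolfun n (λ v → g (b ∷ v)) (λ x → V.tail (w x)) H-tail
      cost≤ : ∀ c → (0 + (c + 1)) + (((0 + (0 + 1)) + (c + 1)) + 1) ≤ c + c + 5
      cost≤ c = ℕP.≤-trans (ℕP.≤-reflexive (arith c)) (ℕP.+-monoʳ-≤ (c + c) (ℕP.n≤1+n 4))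
        where
          arith : ∀ c → (0 + (c + 1)) + (((0 + (0 + 1)) + (c + 1)) + 1) ≡ c + c + 4
          arith = ℕ-solve
      select : ∀ v → boolℤ (lookup v zero) ℤ.* boolℤ (g (true ∷ V.tail v))
        ℤ.+ (ℤ.1ℤ ℤ.- boolℤ (lookup v zero)) ℤ.* boolℤ (g (false ∷ V.tail v)) ≡ boolℤ (g v)
      select (true  ∷ v) = trans (ℤP.+-identityʳ _) (ℤP.*-identityˡ (boolℤ (g (true ∷ v))))
      select (false ∷ v) = trans (ℤP.+-identityˡ _) (ℤP.*-identityˡ (boolℤ (g (false ∷ v))))

  -- Since the gate values are inputs here, every gate contributes one factor of constant degree,
  -- and the total degree is linear in the number of gates. Evaluating the program by composition
  -- would let degrees multiply along its depth.
  gen-check : ∀ {m' k} (B : BP m' k) (ν : X → Vec Bool (k + suc m')) {s} {C : SLP m s} →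
    (∀ i → Has C (λ x → boolℤ (lookup (ν x) i)) 1) →
    Gen C (λ x → check B (ν x)) (k * 5 + 1) (k * (muxCost 4 + 1))
  gen-check []                                ν H = gen-one
  gen-check (_▷_ {k} B (g , i , j , l)) ν {C = C} H = gen-cong (λ x → split (ν x))
    (gen-≤ (ℕP.≤-reflexive (arith₁ k)) (ℕP.≤-reflexive (ℕP.+-comm (k * (muxCost 4 + 1)) _))
    (gen-op times (gen-check B (λ x → V.tail (ν x)) (λ i → tail-wire i))
      (gen-boolfun 4 test (λ x → lookup (ν x) zero ∷ lookup (V.tail (ν x)) i ∷ lookup (V.tail (ν x)) j ∷ lookup (V.tail (ν x)) l ∷ [])
        (λ { zero → H zero ; (suc zero) → tail-wire i ; (suc (suc zero)) → tail-wire j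
           ; (suc (suc (suc zero))) → tail-wire l }))))
    where
      test : Vec Bool 4 → Bool
      test (b ∷ p ∷ q ∷ r ∷ []) = b ≡𝔹 g p q r
      arith₁ : ∀ k → (k * 5 + 1) + 5 ≡ (5 + k * 5) + 1
      arith₁ = ℕ-solve
      tail-wire : ∀ i → Has C (λ x → boolℤ (lookup (V.tail (ν x)) i)) 1
      tail-wire i = has-cong (λ x → cong boolℤ (tail≡ (ν x))) (H (suc i))
        where
          tail≡ : ∀ {n} (v : Vec Bool (suc n)) {i} → lookup v (suc i) ≡ lookup (V.tail v) i
          tail≡ (_ ∷ _) = refl
      split : ∀ (v : Vec Bool (suc k + suc _)) → check B (V.tail v) ℤ.* boolℤ (lookup v zero ≡𝔹
        g (lookup (V.tail v) i) (lookup (V.tail v) j) (lookup (V.tail v) l)) ≡ check (B ▷ (g , i , j , l)) v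
      split (b ∷ v) = refl

-- Construction of Boolean programs

data _⊑𝔹_ {m} {k} (B : BP m k) : ∀ {k'} → BP m k' → Set where
  here : B ⊑𝔹 B
  next : ∀ {k'} {B' : BP m k'} {g} → B ⊑𝔹 B' → B ⊑𝔹 (B' ▷ g)

⊑𝔹-trans : ∀ {m k k' k''} {B : BP m k} {B' : BP m k'} {B'' : BP m k''} → B ⊑𝔹 B' → B' ⊑𝔹 B'' → B ⊑𝔹 B''
⊑𝔹-trans p here     = p
⊑𝔹-trans p (next q) = next (⊑𝔹-trans p q)

record HasB {m k} (B : BP m k) (f : Vec Bool m → Bool) : Set where
  constructor hasB
  field
    index : Fin (k + suc m)
    sem   : ∀ x → lookup (run-BP B x) index ≡ f x

record HasV {m k} (B : BP m k) {n} (w : Vec Bool m → Vec Bool n) : Set where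
  constructor hasV
  field
    wire : ∀ i → HasB B (λ x → lookup (w x) i)
open HasV public using (wire)

hasB-⊑ : ∀ {m k k'} {B : BP m k} {B' : BP m k'} {f} → B ⊑𝔹 B' → HasB B f → HasB B' f
hasB-⊑ here     h = h
hasB-⊑ (next p) h with hasB-⊑ p h
... | hasB i e = hasB (suc i) e

hasV-⊑ : ∀ {m k k'} {B : BP m k} {B' : BP m k'} {n} {w : Vec Bool m → Vec Bool n} →
  B ⊑𝔹 B' → HasV B w → HasV B' w
hasV-⊑ p h = hasV (λ i → hasB-⊑ p (wire h i))

hasB-true : ∀ {m k} (B : BP m k) → HasB B (λ _ → true)
hasB-true []      = hasB zero (λ _ → refl)
hasB-true (B ▷ g) = hasB-⊑ (next here) (hasB-true B)

hasB-input : ∀ {m k} (B : BP m k) i → HasB B (λ x → lookup x i)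
hasB-input []      i = hasB (suc i) (λ _ → refl)
hasB-input (B ▷ g) i = hasB-⊑ (next here) (hasB-input B i)

hasB-cong : ∀ {m k} {B : BP m k} {f g} → (∀ x → f x ≡ g x) → HasB B f → HasB B g
hasB-cong eq (hasB i e) = hasB i (λ x → trans (e x) (eq x))

record ExtensionB {m k} (B : BP m k) (c : ℕ) (P : ∀ {k'} → BP m k' → Set) : Set where
  constructor extensionB
  field
    {size}  : ℕ
    prog    : BP m size
    extends : B ⊑𝔹 prog
    cost    : size ≤ k + c
    result  : P prog

infixl 1 _>>=B_
_>>=B_ : ∀ {m k} {B : BP m k} {c c'} {P Q : ∀ {k'} → BP m k' → Set} →
  ExtensionB B c P → (∀ {k'} (B' : BP m k') → B ⊑𝔹 B' → P B' → ExtensionB B' c' Q) → ExtensionB B (c + c') Q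
_>>=B_ {k = k} {c = c} {c'} (extensionB B₁ p₁ c₁ r₁) f with f B₁ p₁ r₁
... | extensionB B₂ p₂ c₂ r₂ = extensionB B₂ (⊑𝔹-trans p₁ p₂)
  (ℕP.≤-trans c₂ (ℕP.≤-trans (ℕP.+-monoˡ-≤ c' c₁) (ℕP.≤-reflexive (ℕP.+-assoc k c c')))) r₂

returnB : ∀ {m k} {B : BP m k} {P : ∀ {k'} → BP m k' → Set} → P B → ExtensionB B 0 P
returnB {k = k} r = extensionB _ here (ℕP.≤-reflexive (sym (ℕP.+-identityʳ k))) r

mapB : ∀ {m k} {B : BP m k} {c} {P Q : ∀ {k'} → BP m k' → Set} →
  (∀ {k'} {B' : BP m k'} → B ⊑𝔹 B' → P B' → Q B') → ExtensionB B c P → ExtensionB B c Q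
mapB f (extensionB B' p c r) = extensionB B' p c (f p r)

weakenB : ∀ {m k} {B : BP m k} {c c'} {P : ∀ {k'} → BP m k' → Set} → c ≤ c' → ExtensionB B c P → ExtensionB B c' P
weakenB {k = k} le (extensionB B' p c r) = extensionB B' p (ℕP.≤-trans c (ℕP.+-monoʳ-≤ k le)) r

gateB : ∀ {m k} {B : BP m k} (g : Gate) {p q r} → HasB B p → HasB B q → HasB B r →
  ExtensionB B 1 (λ B' → HasB B' (λ x → g (p x) (q x) (r x)))
gateB {k = k} {B} g (hasB i ei) (hasB j ej) (hasB l el) = extensionB (B ▷ (g , i , j , l)) (next here)
  (ℕP.≤-reflexive (ℕP.+-comm 1 k))
  (hasB zero (λ x → trans (cong₂ (λ a b → g a b _) (ei x) (ej x)) (cong (g _ _) (el x))))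

mapGateB : ∀ {m k} {B : BP m k} (g : Bool → Bool → Bool) {c n} {w : Vec Bool m → Vec Bool n} →
  HasB B c → HasV B w → ExtensionB B n (λ B' → HasV B' (λ x → V.map (g (c x)) (w x)))
mapGateB g {n = zero} hc hw = returnB (hasV λ ())
mapGateB {B = B} g {c} {n = suc n} {w} hc hw =
  gateB (λ a b _ → g a b) hc (wire hw zero) (wire hw zero) >>=B λ B₁ p₁ h₁ →
  mapB (λ p₂ h₂ → hasV λ
    { zero    → hasB-cong (λ x → head≡ (w x) (c x)) (hasB-⊑ p₂ h₁)
    ; (suc i) → hasB-cong (λ x → tail≡ (w x) (c x) i) (wire h₂ i) })
  (mapGateB g {w = λ x → V.tail (w x)} (hasB-⊑ p₁ hc)
    (hasV λ i → hasB-⊑ p₁ (hasB-cong (λ x → lookup-tail (w x) i) (wire hw (suc i)))))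
  where
    lookup-tail : ∀ (v : Vec Bool (suc n)) i → lookup v (suc i) ≡ lookup (V.tail v) i
    lookup-tail (_ ∷ _) i = refl
    head≡ : ∀ (v : Vec Bool (suc n)) c → g c (lookup v zero) ≡ lookup (V.map (g c) v) zero
    head≡ (_ ∷ _) c = refl
    tail≡ : ∀ (v : Vec Bool (suc n)) c i → lookup (V.map (g c) (V.tail v)) i ≡ lookup (V.map (g c) v) (suc i)
    tail≡ (_ ∷ _) c i = refl

-- Addition and multiplication by Boolean programs

sum3 maj3 : Gate
sum3 a b c = a xor (b xor c)
maj3 a b c = (a ∧ b) ∨ ((a ∧ c) ∨ (b ∧ c))

addBits : ∀ {n} → Bool → Vec Bool n → Vec Bool n → Vec Bool n
addBits c []       []       = []
addBits c (a ∷ as) (b ∷ bs) = sum3 a b c ∷ addBits (maj3 a b c) as bs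

shiftIn : ∀ {n} → Bool → Vec Bool n → Vec Bool n
shiftIn c []       = []
shiftIn c (a ∷ as) = c ∷ shiftIn a as

mulBits : ∀ {k n} → Vec Bool k → Vec Bool n → Vec Bool n
mulBits []       bs = V.replicate _ false
mulBits (a ∷ as) bs = addBits false (V.map (a ∧_) bs) (shiftIn false (mulBits as bs))

addBitsB : ∀ {m k} {B : BP m k} {n} {c} {as bs : Vec Bool m → Vec Bool n} → HasB B c → HasV B as → HasV B bs →
  ExtensionB B (n * 2) (λ B' → HasV B' (λ x → addBits (c x) (as x) (bs x)))
addBitsB {n = zero} hc ha hb = returnB (hasV λ ())
addBitsB {n = suc n} {c} {as} {bs} hc ha hb =
  gateB sum3 (wire ha zero) (wire hb zero) hc >>=B λ B₁ p₁ h₁ →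
  gateB maj3 (hasB-⊑ p₁ (wire ha zero)) (hasB-⊑ p₁ (wire hb zero)) (hasB-⊑ p₁ hc) >>=B λ B₂ p₂ h₂ →
  mapB (λ p₃ h₃ → hasV λ
    { zero    → hasB-cong (λ x → head≡ (as x) (bs x) (c x)) (hasB-⊑ (⊑𝔹-trans p₂ p₃) h₁)
    ; (suc i) → hasB-cong (λ x → tail≡ (as x) (bs x) (c x) i) (wire h₃ i) })
  (addBitsB {as = λ x → V.tail (as x)} {bs = λ x → V.tail (bs x)} h₂
    (hasV λ i → hasB-⊑ (⊑𝔹-trans p₁ p₂) (hasB-cong (λ x → lookup-tail (as x) i) (wire ha (suc i))))
    (hasV λ i → hasB-⊑ (⊑𝔹-trans p₁ p₂) (hasB-cong (λ x → lookup-tail (bs x) i) (wire hb (suc i)))))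
  where
    lookup-tail : ∀ (v : Vec Bool (suc n)) i → lookup v (suc i) ≡ lookup (V.tail v) i
    lookup-tail (_ ∷ _) i = refl
    head≡ : ∀ (v w : Vec Bool (suc n)) c → sum3 (lookup v zero) (lookup w zero) c ≡ lookup (addBits c v w) zero
    head≡ (_ ∷ _) (_ ∷ _) c = refl
    tail≡ : ∀ (v w : Vec Bool (suc n)) c i →
      lookup (addBits (maj3 (lookup v zero) (lookup w zero) c) (V.tail v) (V.tail w)) i ≡ lookup (addBits c v w) (suc i)
    tail≡ (_ ∷ _) (_ ∷ _) c i = refl

shiftIn-wire : ∀ {m k} {B : BP m k} {n} {c} {w : Vec Bool m → Vec Bool n} → HasB B c → HasV B w →
  ∀ i → HasB B (λ x → lookup (shiftIn (c x) (w x)) i)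
shiftIn-wire {n = suc n} {c} {w} hc hw zero    = hasB-cong (λ x → head≡ (w x) (c x)) hc
  where
    head≡ : ∀ (v : Vec Bool (suc n)) c → c ≡ lookup (shiftIn c v) zero
    head≡ (_ ∷ _) c = refl
shiftIn-wire {n = suc n} {c} {w} hc hw (suc i) = hasB-cong (λ x → tail≡ (w x) (c x))
  (shiftIn-wire {w = λ x → V.tail (w x)} (wire hw zero) (hasV λ i → hasB-cong (λ x → lookup-tail (w x) i) (wire hw (suc i))) i)
  where
    lookup-tail : ∀ (v : Vec Bool (suc n)) i → lookup v (suc i) ≡ lookup (V.tail v) i
    lookup-tail (_ ∷ _) i = refl
    tail≡ : ∀ (v : Vec Bool (suc n)) c → lookup (shiftIn (lookup v zero) (V.tail v)) i ≡ lookup (shiftIn c v) (suc i)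
    tail≡ (_ ∷ _) c = refl

mulBitsB : ∀ {m k} {B : BP m k} {l n} {as : Vec Bool m → Vec Bool l} {bs : Vec Bool m → Vec Bool n} →
  HasB B (λ _ → false) → HasV B as → HasV B bs →
  ExtensionB B (l * (n + n * 2)) (λ B' → HasV B' (λ x → mulBits (as x) (bs x)))
mulBitsB {l = zero} {n} {as} {bs} hf ha hb =
  returnB (hasV λ i → hasB-cong (λ x → zero≡ (as x) (bs x) i) hf)
  where
    zero≡ : ∀ (v : Vec Bool 0) (w : Vec Bool n) i → false ≡ lookup (mulBits v w) i
    zero≡ [] w i = sym (VP.lookup-replicate i false)
mulBitsB {l = suc l} {n} {as} {bs} hf ha hb = weakenB (ℕP.≤-reflexive (arith l n))
  (mulBitsB {as = λ x → V.tail (as x)} hf (hasV λ i → hasB-cong (λ x → lookup-tail (as x) i) (wire ha (suc i))) hb >>=B λ B₁ p₁ h₁ →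
   mapGateB _∧_ (hasB-⊑ p₁ (wire ha zero)) (hasV-⊑ {w = bs} p₁ hb) >>=B λ B₂ p₂ h₂ →
   mapB (λ _ h₃ → hasV λ i → hasB-cong (λ x → mul≡ (as x) (bs x) i) (wire h₃ i))
     (addBitsB {as = λ x → V.map (lookup (as x) zero ∧_) (bs x)}
               {bs = λ x → shiftIn false (mulBits (V.tail (as x)) (bs x))} (hasB-⊑ (⊑𝔹-trans p₁ p₂) hf) h₂
       (hasV (shiftIn-wire {w = λ x → mulBits (V.tail (as x)) (bs x)} (hasB-⊑ (⊑𝔹-trans p₁ p₂) hf)
         (hasV-⊑ {w = λ x → mulBits (V.tail (as x)) (bs x)} p₂ h₁)))))
  where
    arith : ∀ l n → l * (n + n * 2) + (n + n * 2) ≡ (n + n * 2) + l * (n + n * 2)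
    arith = ℕ-solve
    lookup-tail : ∀ (v : Vec Bool (suc l)) i → lookup v (suc i) ≡ lookup (V.tail v) i
    lookup-tail (_ ∷ _) i = refl
    mul≡ : ∀ (v : Vec Bool (suc l)) (w : Vec Bool n) i →
      lookup (addBits false (V.map (lookup v zero ∧_) w) (shiftIn false (mulBits (V.tail v) w))) i ≡ lookup (mulBits v w) i
    mul≡ (_ ∷ _) w i = refl

-- Values of binary words modulo 2^n

bit : Bool → ℕ
bit false = 0
bit true  = 1

pos-bit : ∀ b → boolℤ b ≡ + bit b
pos-bit false = refl
pos-bit true  = refl

val-∷ : ∀ {n} b (bs : Vec Bool n) → val (b ∷ bs) ≡ bit b + 2 * val bs
val-∷ false bs = refl
val-∷ true  bs = refl

val<2^ : ∀ {n} (bs : Vec Bool n) → val bs < 2 ^ n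
val<2^ []           = ℕP.≤-refl
val<2^ (false ∷ bs) = ℕP.*-monoʳ-< 2 (val<2^ bs)
val<2^ {suc n} (true ∷ bs)  = begin
  suc (suc (2 * val bs))  ≡⟨ ℕP.*-distribˡ-+ 2 1 (val bs) ⟨
  2 * suc (val bs)        ≤⟨ ℕP.*-monoʳ-≤ 2 (val<2^ bs) ⟩
  2 * 2 ^ n               ∎
  where open ℕP.≤-Reasoning

full-adder : ∀ a b c → bit (sum3 a b c) + 2 * bit (maj3 a b c) ≡ bit a + bit b + bit c
full-adder false false false = refl
full-adder false false true  = refl
full-adder false true  false = refl
full-adder false true  true  = refl
full-adder true  false false = refl
full-adder true  false true  = refl
full-adder true  true  false = refl
full-adder true  true  true  = refl

val-addBits : ∀ {n} c (as bs : Vec Bool n) →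
  ∃ λ t → val (addBits c as bs) + t * 2 ^ n ≡ val as + val bs + bit c
val-addBits c []       []       = bit c , ℕP.*-identityʳ (bit c)
val-addBits {suc n} c (a ∷ as) (b ∷ bs) with val-addBits (maj3 a b c) as bs
... | t , eq = t , (begin
  val (sum3 a b c ∷ rest) + t * (2 * 2 ^ n)
    ≡⟨ cong (_+ t * (2 * 2 ^ n)) (val-∷ (sum3 a b c) rest) ⟩
  bit (sum3 a b c) + 2 * val rest + t * (2 * 2 ^ n)
    ≡⟨ regroup (bit (sum3 a b c)) (val rest) t (2 ^ n) ⟩
  bit (sum3 a b c) + 2 * (val rest + t * 2 ^ n)
    ≡⟨ cong (λ z → bit (sum3 a b c) + 2 * z) eq ⟩
  bit (sum3 a b c) + 2 * (val as + val bs + bit (maj3 a b c))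
    ≡⟨ spread (bit (sum3 a b c)) (val as) (val bs) (bit (maj3 a b c)) ⟩
  (bit (sum3 a b c) + 2 * bit (maj3 a b c)) + 2 * val as + 2 * val bs
    ≡⟨ cong (λ z → z + 2 * val as + 2 * val bs) (full-adder a b c) ⟩
  (bit a + bit b + bit c) + 2 * val as + 2 * val bs
    ≡⟨ shuffle (bit a) (bit b) (bit c) (val as) (val bs) ⟩
  (bit a + 2 * val as) + (bit b + 2 * val bs) + bit c
    ≡⟨ cong₂ (λ p q → p + q + bit c) (val-∷ a as) (val-∷ b bs) ⟨
  val (a ∷ as) + val (b ∷ bs) + bit c ∎)
  where
    open ≡-Reasoning
    rest = addBits (maj3 a b c) as bs
    regroup : ∀ s r t w → s + 2 * r + t * (2 * w) ≡ s + 2 * (r + t * w)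
    regroup = ℕ-solve
    spread : ∀ s p q m → s + 2 * (p + q + m) ≡ (s + 2 * m) + 2 * p + 2 * q
    spread = ℕ-solve
    shuffle : ∀ a b c p q → (a + b + c) + 2 * p + 2 * q ≡ (a + 2 * p) + (b + 2 * q) + c
    shuffle = ℕ-solve

val-shiftIn : ∀ {n} c (as : Vec Bool n) → ∃ λ t → val (shiftIn c as) + t * 2 ^ n ≡ bit c + 2 * val as
val-shiftIn c []       = bit c , trans (ℕP.*-identityʳ (bit c)) (sym (ℕP.+-identityʳ (bit c)))
val-shiftIn {suc n} c (a ∷ as) with val-shiftIn a as
... | t , eq = t , (begin
  val (c ∷ shiftIn a as) + t * (2 * 2 ^ n)         ≡⟨ cong (_+ t * (2 * 2 ^ n)) (val-∷ c (shiftIn a as)) ⟩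
  bit c + 2 * val (shiftIn a as) + t * (2 * 2 ^ n) ≡⟨ regroup (bit c) (val (shiftIn a as)) t (2 ^ n) ⟩
  bit c + 2 * (val (shiftIn a as) + t * 2 ^ n)     ≡⟨ cong (λ z → bit c + 2 * z) (trans eq (sym (val-∷ a as))) ⟩
  bit c + 2 * val (a ∷ as)                         ∎)
  where
    open ≡-Reasoning
    regroup : ∀ s r t w → s + 2 * r + t * (2 * w) ≡ s + 2 * (r + t * w)
    regroup = ℕ-solve

val-zeros : ∀ n → val (V.replicate n false) ≡ 0
val-zeros zero    = refl
val-zeros (suc n) = cong (2 *_) (val-zeros n)

val-and : ∀ {n} a (bs : Vec Bool n) → val (V.map (a ∧_) bs) ≡ bit a * val bs
val-and a     []       = sym (ℕP.*-zeroʳ (bit a))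
val-and false (b ∷ bs) = cong (2 *_) (val-and false bs)
val-and true  (false ∷ bs) = cong (2 *_) (trans (val-and true bs) (ℕP.+-identityʳ _))
  ⟨≡⟩ sym (ℕP.+-identityʳ _)
  where
    _⟨≡⟩_ : ∀ {a b c : ℕ} → a ≡ b → b ≡ c → a ≡ c
    _⟨≡⟩_ = trans
val-and true  (true ∷ bs)  = trans (cong (λ z → suc (2 * z)) (trans (val-and true bs) (ℕP.+-identityʳ _)))
  (sym (ℕP.+-identityʳ _))

val-not : ∀ {n} (bs : Vec Bool n) → val (V.map not bs) + val bs + 1 ≡ 2 ^ n
val-not []       = refl
val-not {suc n} (b ∷ bs) = begin
  val (not b ∷ V.map not bs) + val (b ∷ bs) + 1
    ≡⟨ cong₂ (λ p q → p + q + 1) (val-∷ (not b) (V.map not bs)) (val-∷ b bs) ⟩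
  (bit (not b) + 2 * val (V.map not bs)) + (bit b + 2 * val bs) + 1
    ≡⟨ regroup (bit (not b)) (bit b) (val (V.map not bs)) (val bs) ⟩
  (bit (not b) + bit b) + 1 + 2 * (val (V.map not bs) + val bs)
    ≡⟨ cong (λ z → z + 1 + 2 * (val (V.map not bs) + val bs)) (complement b) ⟩
  2 + 2 * (val (V.map not bs) + val bs)
    ≡⟨ factor (val (V.map not bs) + val bs) ⟩
  2 * (val (V.map not bs) + val bs + 1)
    ≡⟨ cong (2 *_) (val-not bs) ⟩
  2 * 2 ^ n ∎
  where
    open ≡-Reasoning
    complement : ∀ b → bit (not b) + bit b ≡ 1
    complement false = refl
    complement true  = refl
    regroup : ∀ p q r s → (p + 2 * r) + (q + 2 * s) + 1 ≡ (p + q) + 1 + 2 * (r + s)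
    regroup = ℕ-solve
    factor : ∀ r → 2 + 2 * r ≡ 2 * (r + 1)
    factor = ℕ-solve

val-mulBits : ∀ {k n} (as : Vec Bool k) (bs : Vec Bool n) →
  ∃ λ t → val (mulBits as bs) + t * 2 ^ n ≡ val as * val bs
val-mulBits {n = n} []       bs = 0 , trans (ℕP.+-identityʳ _) (val-zeros n)
val-mulBits {n = n} (a ∷ as) bs with val-mulBits as bs
... | t₁ , eq₁ with val-shiftIn false (mulBits as bs)
... | t₂ , eq₂ with val-addBits false (V.map (a ∧_) bs) (shiftIn false (mulBits as bs))
... | t₃ , eq₃ = t₃ + t₂ + 2 * t₁ , (begin
  val (mulBits (a ∷ as) bs) + (t₃ + t₂ + 2 * t₁) * w
    ≡⟨ regroup (val (mulBits (a ∷ as) bs)) t₁ t₂ t₃ w ⟩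
  (val (mulBits (a ∷ as) bs) + t₃ * w) + (t₂ + 2 * t₁) * w
    ≡⟨ cong (_+ (t₂ + 2 * t₁) * w) eq₃ ⟩
  (val (V.map (a ∧_) bs) + sh + 0) + (t₂ + 2 * t₁) * w
    ≡⟨ shuffle (val (V.map (a ∧_) bs)) sh t₁ t₂ w ⟩
  val (V.map (a ∧_) bs) + (sh + t₂ * w) + 2 * (t₁ * w)
    ≡⟨ cong₂ (λ p q → p + q + 2 * (t₁ * w)) (val-and a bs) eq₂ ⟩
  bit a * val bs + 2 * val (mulBits as bs) + 2 * (t₁ * w)
    ≡⟨ factor (bit a * val bs) (val (mulBits as bs)) (t₁ * w) ⟩
  bit a * val bs + 2 * (val (mulBits as bs) + t₁ * w)
    ≡⟨ cong (λ z → bit a * val bs + 2 * z) eq₁ ⟩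
  bit a * val bs + 2 * (val as * val bs)
    ≡⟨ distrib (bit a) (val as) (val bs) ⟩
  (bit a + 2 * val as) * val bs
    ≡⟨ cong (_* val bs) (val-∷ a as) ⟨
  val (a ∷ as) * val bs ∎)
  where
    open ≡-Reasoning
    w  = 2 ^ n
    sh = val (shiftIn false (mulBits as bs))
    regroup : ∀ v t₁ t₂ t₃ w → v + (t₃ + t₂ + 2 * t₁) * w ≡ (v + t₃ * w) + (t₂ + 2 * t₁) * w
    regroup = ℕ-solve
    shuffle : ∀ p s t₁ t₂ w → (p + s + 0) + (t₂ + 2 * t₁) * w ≡ p + (s + t₂ * w) + 2 * (t₁ * w)
    shuffle = ℕ-solve
    factor : ∀ p m r → p + 2 * m + 2 * r ≡ p + 2 * (m + r)
    factor = ℕ-solve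
    distrib : ∀ b a v → b * v + 2 * (a * v) ≡ (b + 2 * a) * v
    distrib = ℕ-solve

-- Two's complement, up to wrap-around.
record Rep {n} (v : Vec Bool n) (z : ℤ) : Set where
  constructor rep
  field
    wraps : ℤ
    value : z ≡ + val v ℤ.+ wraps ℤ.* + (2 ^ n)

pos-eq : ∀ a t w {r} → a + t * w ≡ r → + a ≡ + r ℤ.- + t ℤ.* + w
pos-eq a t w refl = trans (ring (+ a) (+ t ℤ.* + w)) (cong (ℤ._- + t ℤ.* + w)
  (trans (cong (ℤ._+_ (+ a)) (sym (ℤP.pos-* t w))) (sym (ℤP.pos-+ a (t * w)))))
  where
    ring : ∀ a b → a ≡ (a ℤ.+ b) ℤ.- b
    ring = ℤ-solve

rep-add : ∀ {n} {v w : Vec Bool n} {x y} → Rep v x → Rep w y → Rep (addBits false v w) (x ℤ.+ y)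
rep-add {n} {v} {w} {x} {y} (rep k ex) (rep l ey) with val-addBits false v w
... | t , eq = rep (k ℤ.+ l ℤ.+ + t) (begin
  x ℤ.+ y
    ≡⟨ cong₂ ℤ._+_ ex ey ⟩
  (+ val v ℤ.+ k ℤ.* W) ℤ.+ (+ val w ℤ.+ l ℤ.* W)
    ≡⟨ ring (+ val v) (+ val w) k l (+ t) W ⟩
  ((+ val v ℤ.+ + val w) ℤ.- + t ℤ.* W) ℤ.+ (k ℤ.+ l ℤ.+ + t) ℤ.* W
    ≡⟨ cong (λ z → (z ℤ.- + t ℤ.* W) ℤ.+ (k ℤ.+ l ℤ.+ + t) ℤ.* W) (trans (sym (ℤP.pos-+ (val v) (val w))) (cong +_ (sym (ℕP.+-identityʳ _)))) ⟩
  (+ (val v + val w + 0) ℤ.- + t ℤ.* W) ℤ.+ (k ℤ.+ l ℤ.+ + t) ℤ.* W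
    ≡⟨ cong (ℤ._+ (k ℤ.+ l ℤ.+ + t) ℤ.* W) (pos-eq (val (addBits false v w)) t (2 ^ n) eq) ⟨
  + val (addBits false v w) ℤ.+ (k ℤ.+ l ℤ.+ + t) ℤ.* W ∎)
  where
    open ≡-Reasoning
    W = + (2 ^ n)
    ring : ∀ a b k l t W → (a ℤ.+ k ℤ.* W) ℤ.+ (b ℤ.+ l ℤ.* W) ≡ ((a ℤ.+ b) ℤ.- t ℤ.* W) ℤ.+ (k ℤ.+ l ℤ.+ t) ℤ.* W
    ring = ℤ-solve

rep-sub : ∀ {n} {v w : Vec Bool n} {x y} → Rep v x → Rep w y → Rep (addBits true v (V.map not w)) (x ℤ.- y)
rep-sub {n} {v} {w} {x} {y} (rep k ex) (rep l ey) with val-addBits true v (V.map not w)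
-- Complementing w brings in one extra 2^n, by `val-not`; the final -1 takes it out again.
... | t , eq = rep (k ℤ.- l ℤ.+ + t ℤ.- ℤ.1ℤ) (begin
  x ℤ.- y
    ≡⟨ cong₂ ℤ._-_ ex ey ⟩
  (+ val v ℤ.+ k ℤ.* W) ℤ.- (+ val w ℤ.+ l ℤ.* W)
    ≡⟨ ring (+ val v) (+ val w) (+ val (V.map not w)) k l (+ t) W ⟩
  ((+ val v ℤ.+ + val (V.map not w) ℤ.+ ℤ.1ℤ) ℤ.- + t ℤ.* W) ℤ.+ (k ℤ.- l ℤ.+ + t) ℤ.* W
    ℤ.- (+ val (V.map not w) ℤ.+ + val w ℤ.+ ℤ.1ℤ)
    ≡⟨ cong₂ (λ p q → (p ℤ.- + t ℤ.* W) ℤ.+ (k ℤ.- l ℤ.+ + t) ℤ.* W ℤ.- q) (posʳ (val v) _) (trans (posʳ (val (V.map not w)) _) (cong +_ (val-not w))) ⟩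
  (+ (val v + val (V.map not w) + 1) ℤ.- + t ℤ.* W) ℤ.+ (k ℤ.- l ℤ.+ + t) ℤ.* W ℤ.- W
    ≡⟨ cong (λ z → z ℤ.+ (k ℤ.- l ℤ.+ + t) ℤ.* W ℤ.- W) (pos-eq (val (addBits true v (V.map not w))) t (2 ^ n) eq) ⟨
  + val (addBits true v (V.map not w)) ℤ.+ (k ℤ.- l ℤ.+ + t) ℤ.* W ℤ.- W
    ≡⟨ collect (+ val (addBits true v (V.map not w))) k l (+ t) W ⟩
  + val (addBits true v (V.map not w)) ℤ.+ (k ℤ.- l ℤ.+ + t ℤ.- ℤ.1ℤ) ℤ.* W ∎)
  where
    open ≡-Reasoning
    W = + (2 ^ n)
    posʳ : ∀ a b → + a ℤ.+ + b ℤ.+ ℤ.1ℤ ≡ + (a + b + 1)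
    posʳ a b = trans (cong (ℤ._+ ℤ.1ℤ) (sym (ℤP.pos-+ a b))) (sym (ℤP.pos-+ (a + b) 1))
    ring : ∀ a b c k l t W → (a ℤ.+ k ℤ.* W) ℤ.- (b ℤ.+ l ℤ.* W) ≡
      ((a ℤ.+ c ℤ.+ ℤ.1ℤ) ℤ.- t ℤ.* W) ℤ.+ (k ℤ.- l ℤ.+ t) ℤ.* W ℤ.- (c ℤ.+ b ℤ.+ ℤ.1ℤ)
    ring = ℤ-solve
    collect : ∀ a k l t W → a ℤ.+ (k ℤ.- l ℤ.+ t) ℤ.* W ℤ.- W ≡ a ℤ.+ (k ℤ.- l ℤ.+ t ℤ.- ℤ.1ℤ) ℤ.* W
    collect = ℤ-solve

rep-mul : ∀ {n} {v w : Vec Bool n} {x y} → Rep v x → Rep w y → Rep (mulBits v w) (x ℤ.* y)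
rep-mul {n} {v} {w} {x} {y} (rep k ex) (rep l ey) with val-mulBits v w
... | t , eq = rep K (begin
  x ℤ.* y
    ≡⟨ cong₂ ℤ._*_ ex ey ⟩
  (+ val v ℤ.+ k ℤ.* W) ℤ.* (+ val w ℤ.+ l ℤ.* W)
    ≡⟨ ring (+ val v) (+ val w) k l (+ t) W ⟩
  (+ val v ℤ.* + val w ℤ.- + t ℤ.* W) ℤ.+ K ℤ.* W
    ≡⟨ cong (λ z → (z ℤ.- + t ℤ.* W) ℤ.+ K ℤ.* W) (ℤP.pos-* (val v) (val w)) ⟨
  (+ (val v * val w) ℤ.- + t ℤ.* W) ℤ.+ K ℤ.* W
    ≡⟨ cong (ℤ._+ K ℤ.* W) (pos-eq (val (mulBits v w)) t (2 ^ n) eq) ⟨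
  + val (mulBits v w) ℤ.+ K ℤ.* W ∎)
  where
    open ≡-Reasoning
    W = + (2 ^ n)
    K = + val v ℤ.* l ℤ.+ k ℤ.* + val w ℤ.+ k ℤ.* l ℤ.* W ℤ.+ + t
    ring : ∀ a b k l t W → (a ℤ.+ k ℤ.* W) ℤ.* (b ℤ.+ l ℤ.* W) ≡
      (a ℤ.* b ℤ.- t ℤ.* W) ℤ.+ (a ℤ.* l ℤ.+ k ℤ.* b ℤ.+ k ℤ.* l ℤ.* W ℤ.+ t) ℤ.* W
    ring = ℤ-solve

topBit : ∀ {n} → Vec Bool (suc n) → Bool
topBit (b ∷ [])       = b
topBit (_ ∷ b ∷ bs) = topBit (b ∷ bs)

val-topBit : ∀ {n} (v : Vec Bool (suc n)) → ∃ λ l → l < 2 ^ n × val v ≡ l + bit (topBit v) * 2 ^ n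
val-topBit (false ∷ []) = 0 , ℕP.≤-refl , refl
val-topBit (true ∷ [])  = 0 , ℕP.≤-refl , refl
val-topBit {suc n} (a ∷ b ∷ bs) with val-topBit (b ∷ bs)
... | l , l< , eq = bit a + 2 * l , bound a , (begin
  val (a ∷ b ∷ bs)                                  ≡⟨ val-∷ a (b ∷ bs) ⟩
  bit a + 2 * val (b ∷ bs)                          ≡⟨ cong (λ z → bit a + 2 * z) eq ⟩
  bit a + 2 * (l + bit (topBit (b ∷ bs)) * 2 ^ n)   ≡⟨ regroup (bit a) l (bit (topBit (b ∷ bs))) (2 ^ n) ⟩
  bit a + 2 * l + bit (topBit (b ∷ bs)) * (2 * 2 ^ n) ∎)
  where
    open ≡-Reasoning
    regroup : ∀ a l t w → a + 2 * (l + t * w) ≡ a + 2 * l + t * (2 * w)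
    regroup = ℕ-solve
    bound : ∀ a → bit a + 2 * l < 2 * 2 ^ n
    bound false = ℕP.*-monoʳ-< 2 l<
    bound true  = ℕP.≤-trans (ℕP.≤-reflexive (sym (ℕP.*-distribˡ-+ 2 1 l))) (ℕP.*-monoʳ-≤ 2 l<)

nonneg : ℤ → Bool
nonneg (+ _)    = true
nonneg -[1+ _ ] = false

-- The word has one bit more than ∣z∣ needs, so its value is z or z + 2^(n+1), and the top bit tells
-- the two cases apart.
rep-sign : ∀ {n} (v : Vec Bool (suc n)) z → Rep v z → ∣ z ∣ < 2 ^ n → not (topBit v) ≡ nonneg z
rep-sign {n} v z (rep k eq) small with val-topBit v
... | l , l< , veq with topBit v
rep-sign {n} v (+ z) (rep (+ zero) eq) small | l , l< , veq | false = refl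
rep-sign {n} v (+ z) (rep (+ suc k) eq) small | l , l< , veq | b = ⊥-elim (ℕP.<-irrefl refl (begin-strict
  2 ^ n                      ≤⟨ ℕP.≤-trans (ℕP.m≤n*m (2 ^ n) 2) (ℕP.m≤m+n _ (k * 2 ^ suc n)) ⟩
  suc k * 2 ^ suc n          ≤⟨ ℕP.m≤n+m _ (val v) ⟩
  val v + suc k * 2 ^ suc n  ≡⟨ ℤP.+-injective (trans eq (trans (cong (ℤ._+_ (+ val v)) (sym (ℤP.pos-* (suc k) (2 ^ suc n)))) (sym (ℤP.pos-+ (val v) _)))) ⟨
  z                          <⟨ small ⟩
  2 ^ n                      ∎))
  where open ℕP.≤-Reasoning
rep-sign {n} v -[1+ z ] (rep (+ k) eq) small | l , l< , veq | b
  with trans eq (trans (cong (ℤ._+_ (+ val v)) (sym (ℤP.pos-* k (2 ^ suc n)))) (sym (ℤP.pos-+ (val v) _)))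
... | ()
rep-sign {n} v (+ z) (rep (+ zero) eq) small | l , l< , veq | true = ⊥-elim (ℕP.<-irrefl refl (begin-strict
  2 ^ n          ≡⟨ ℕP.+-identityʳ _ ⟨
  1 * 2 ^ n      ≤⟨ ℕP.m≤n+m _ l ⟩
  l + 1 * 2 ^ n  ≡⟨ veq ⟨
  val v          ≡⟨ ℤP.+-injective (trans eq (ℤP.+-identityʳ _)) ⟨
  z              <⟨ small ⟩
  2 ^ n          ∎))
  where open ℕP.≤-Reasoning
rep-sign {n} v z (rep -[1+ k ] eq) small | l , l< , veq | b = below z small eq b veq
  where
    nat-eq : ∀ z → z ≡ + val v ℤ.+ -[1+ k ] ℤ.* + (2 ^ suc n) → z ℤ.+ + (suc k * 2 ^ suc n) ≡ + val v
    nat-eq z eq = trans (cong₂ ℤ._+_ eq (ℤP.pos-* (suc k) (2 ^ suc n))) (ring (+ val v) (+ suc k) (+ (2 ^ suc n)))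
      where
        ring : ∀ a k w → a ℤ.+ (ℤ.- k) ℤ.* w ℤ.+ k ℤ.* w ≡ a
        ring = ℤ-solve
    big : 2 ^ suc n ≤ suc k * 2 ^ suc n
    big = ℕP.m≤m+n _ _
    below : ∀ z → ∣ z ∣ < 2 ^ n → z ≡ + val v ℤ.+ -[1+ k ] ℤ.* + (2 ^ suc n) → ∀ b → val v ≡ l + bit b * 2 ^ n →
      not b ≡ nonneg z
    below (+ z) small eq b veq = ⊥-elim (ℕP.<-irrefl refl (ℕP.<-≤-trans (val<2^ v) (ℕP.≤-trans big
      (ℕP.≤-trans (ℕP.m≤n+m _ z) (ℕP.≤-reflexive (ℤP.+-injective (nat-eq (+ z) eq)))))))
    below -[1+ z ] small eq true  veq = refl
    below -[1+ z ] small eq false veq = ⊥-elim (ℕP.<-irrefl refl (begin-strict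
      2 ^ suc n                   ≤⟨ big ⟩
      suc k * 2 ^ suc n           ≡⟨ ℤP.+-injective back ⟩
      val v + suc z               ≡⟨ cong (_+ suc z) (trans veq (ℕP.+-identityʳ l)) ⟩
      l + suc z                   <⟨ ℕP.+-mono-< l< small ⟩
      2 ^ n + 2 ^ n               ≡⟨ cong (λ t → 2 ^ n + t) (ℕP.+-identityʳ _) ⟨
      2 ^ suc n                   ∎))
      where
        open ℕP.≤-Reasoning
        back : + (suc k * 2 ^ suc n) ≡ + (val v + suc z)
        back = trans (ring (+ (suc k * 2 ^ suc n)) (+ suc z)) (cong (ℤ._+ + suc z) (nat-eq -[1+ z ] eq))
          where
            ring : ∀ a s → a ≡ (ℤ.- s) ℤ.+ a ℤ.+ s
            ring = ℤ-solve

-- Boolean simulation of a circuit and the sign of its value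

opCost : ℕ → ℕ
opCost n = (n + n * 2) + n * (n + n * 2)

NodeWires : ∀ {m s} → SLP m s → (n : ℕ) → ∀ {k} → BP m k → Set
NodeWires {m} C n B = ∀ i → Σ (Vec Bool m → Vec Bool n) λ w →
  HasV B w × (∀ x → Rep (w x) (lookup (evalS C (V.map boolℤ x)) i))

rep-bit : ∀ {n} b → Rep {suc n} (b ∷ V.replicate n false) (boolℤ b)
rep-bit {n} b = rep ℤ.0ℤ (sym (trans (ℤP.+-identityʳ _) (trans (cong +_ (trans (val-∷ b _)
  (trans (cong (λ z → bit b + 2 * z) (val-zeros n)) (ℕP.+-identityʳ _)))) (sym (pos-bit b)))))

-- Inner nodes may overflow: they are only represented modulo a power of two, which sums,
-- differences and products respect. A size bound is required of the output alone, when its sign is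
-- read.
simulate : ∀ {m s} (C : SLP m s) n {k} (B : BP m k) → HasB B (λ _ → false) →
  ExtensionB B (s * opCost (suc n)) (NodeWires C (suc n))
simulate {m} [] n B hf = returnB nodes
  where
    pad : ∀ {f} → HasB B f → HasV B (λ x → f x ∷ V.replicate n false)
    pad h = hasV λ
      { zero    → h
      ; (suc i) → hasB-cong (λ _ → sym (VP.lookup-replicate i false)) hf }
    nodes : NodeWires [] (suc n) B
    nodes zero    = _ , pad (hasB-true B) , λ x → rep-bit true
    nodes (suc i) = _ , pad (hasB-input B i) , λ x →
      subst (Rep _) (sym (VP.lookup-map i boolℤ x)) (rep-bit (lookup x i))
simulate {m} {suc s} (C ▷ (o , i , j)) n {k} B hf = weakenB (ℕP.≤-reflexive (ℕP.+-comm (s * opCost (suc n)) _))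
  (simulate C n B hf >>=B λ B₁ p₁ nodes → gate o p₁ (nodes i) (nodes j) nodes)
  where
    N = suc n
    Node : ∀ {k'} → BP m k' → (Vec Bool m → ℤ) → Set
    Node B z = Σ (Vec Bool m → Vec Bool N) λ w → HasV B w × (∀ x → Rep (w x) (z x))
    v : Fin _ → Vec Bool m → ℤ
    v i x = lookup (evalS C (V.map boolℤ x)) i
    node-⊑ : ∀ {k k'} {B : BP m k} {B' : BP m k'} {z} → B ⊑𝔹 B' → Node B z → Node B' z
    node-⊑ p (w , h , r) = w , hasV-⊑ p h , r
    extend : ∀ o {k} {B : BP m k} → NodeWires C N B → Node B (λ x → opZ o (v i x) (v j x)) →
      NodeWires (C ▷ (o , i , j)) N B
    extend o nodes new zero    = new
    extend o nodes new (suc l) = nodes l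
    gate : ∀ o {k'} {B₁ : BP m k'} → B ⊑𝔹 B₁ → Node B₁ (v i) → Node B₁ (v j) → NodeWires C N B₁ →
      ExtensionB B₁ (opCost N) (NodeWires (C ▷ (o , i , j)) N)
    gate plus {B₁ = B₁} p (a , ha , ra) (b , hb , rb) nodes = weakenB (ℕP.≤-trans (ℕP.m≤n+m (N * 2) N) (ℕP.m≤m+n _ _))
      (mapB (λ q h → extend plus (λ l → node-⊑ q (nodes l)) (_ , h , λ x → rep-add (ra x) (rb x)))
        (addBitsB (hasB-⊑ p hf) ha hb))
    gate minus {B₁ = B₁} p (a , ha , ra) (b , hb , rb) nodes = weakenB (ℕP.m≤m+n _ _)
      (mapGateB (λ _ → not) (hasB-true B₁) hb >>=B λ B₂ p₂ h₂ →
       mapB (λ q h → extend minus (λ l → node-⊑ (⊑𝔹-trans p₂ q) (nodes l)) (_ , h , λ x → rep-sub (ra x) (rb x)))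
        (addBitsB (hasB-true B₂) (hasV-⊑ p₂ ha) h₂))
    gate times {B₁ = B₁} p (a , ha , ra) (b , hb , rb) nodes = weakenB (ℕP.m≤n+m (N * (N + N * 2)) (N + N * 2))
      (mapB (λ q h → extend times (λ l → node-⊑ q (nodes l)) (_ , h , λ x → rep-mul (ra x) (rb x)))
        (mulBitsB (hasB-⊑ p hf) ha hb))

topBit-wire : ∀ {m k} {B : BP m k} {n} {w : Vec Bool m → Vec Bool (suc n)} → HasV B w → HasB B (λ x → topBit (w x))
topBit-wire {n = n} {w} h = hasB-cong (λ x → sym (last≡ (w x))) (wire h (F.fromℕ n))
  where
    last≡ : ∀ {n} (v : Vec Bool (suc n)) → topBit v ≡ lookup v (F.fromℕ n)
    last≡ (b ∷ [])     = refl
    last≡ (_ ∷ b ∷ bs) = last≡ (b ∷ bs)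

signCost : ℕ → ℕ → ℕ
signCost s n = suc (s * opCost (suc n) + 1)

sign-BP : ∀ {m s} (D : Circuit m s) n → (∀ x → ∣ evalC D (V.map boolℤ x) ∣ < 2 ^ n) →
  Σ ℕ λ k → Σ (BP m k) λ B → k ≤ signCost s n × HasB B (λ x → nonneg (evalC D (V.map boolℤ x)))
sign-BP {m} {s} (circuit C o) n small
  with (gateB {B = []} (λ _ _ _ → false) (hasB-true []) (hasB-true []) (hasB-true []) >>=B λ B₁ _ hf →
       simulate C n B₁ hf >>=B λ B₂ _ nodes →
       gateB (λ b _ _ → not b) (topBit-wire (proj₁ (proj₂ (nodes o)))) (hasB-true B₂) (hasB-true B₂) >>=B λ B₃ _ h →
       returnB (hasB-cong (λ x → rep-sign _ _ (proj₂ (proj₂ (nodes o)) x) (small x)) h))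
... | extensionB B _ cost h = _ , B , ℕP.≤-trans cost (ℕP.≤-reflexive (arith (s * opCost (suc n)))) , h
  where
    arith : ∀ c → 1 + (c + (1 + 0)) ≡ suc (c + 1)
    arith = ℕ-solve

-- Comparison, division, digits and iteration as sums

abstract
  le : ℕ → ℕ → ℕ
  le a b with a ≤? b
  ... | yes _ = 1
  ... | no  _ = 0

  le-yes : ∀ {a b} → a ≤ b → le a b ≡ 1
  le-yes {a} {b} h with a ≤? b
  ... | yes _ = refl
  ... | no ¬h = ⊥-elim (¬h h)

  le-no : ∀ {a b} → b < a → le a b ≡ 0
  le-no {a} {b} h with a ≤? b
  ... | yes h' = ⊥-elim (ℕP.<⇒≱ h h')
  ... | no  _  = refl

  -- Comparison becomes the sign of a difference, the one test that is realised on circuits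
  -- directly.
  le-sign : ∀ a b → boolℤ (nonneg (+ b ℤ.- + a)) ≡ + le a b
  le-sign a b with a ≤? b
  ... | yes h = cong (boolℤ ∘ nonneg) (trans (ℤP.m-n≡m⊖n b a) (ℤP.⊖-≥ h))
  ... | no ¬h = cong (boolℤ ∘ nonneg) (trans (ℤP.m-n≡m⊖n b a) (trans (ℤP.⊖-< (ℕP.≰⇒> ¬h)) (neg (ℕP.m<n⇒0<n∸m (ℕP.≰⇒> ¬h)))))
    where
      neg : ∀ {d} → 0 < d → ℤ.- + d ≡ -[1+ ℕ.pred d ]
      neg {suc d} _ = refl

  eqn : ℕ → ℕ → ℕ
  eqn a b = le a b * le b a

  eqn-def : ∀ a b → eqn a b ≡ le a b * le b a
  eqn-def a b = refl

  eqn-refl : ∀ a → eqn a a ≡ 1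
  eqn-refl a = cong₂ _*_ (le-yes (ℕP.≤-refl {a})) (le-yes (ℕP.≤-refl {a}))

  eqn-yes : ∀ {a b} → a ≡ b → eqn a b ≡ 1
  eqn-yes {a} refl = eqn-refl a

  eqn-no : ∀ {a b} → a ≢ b → eqn a b ≡ 0
  eqn-no {a} {b} a≢b with ℕP.<-cmp a b
  ... | tri< a<b _ _ = trans (cong (le a b *_) (le-no a<b)) (ℕP.*-zeroʳ (le a b))
  ... | tri≈ _ a≡b _ = ⊥-elim (a≢b a≡b)
  ... | tri> _ _ b<a = cong (_* le b a) (le-no b<a)

  ite : ℕ → ℕ → ℕ → ℕ
  ite c x y = c * x + (1 ∸ c) * y

  ite-def : ∀ c x y → ite c x y ≡ c * x + (1 ∸ c) * y
  ite-def c x y = refl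

  ite-yes : ∀ {c} x y → c ≡ 1 → ite c x y ≡ x
  ite-yes x y refl = trans (ℕP.+-identityʳ _) (ℕP.*-identityˡ x)

  ite-no : ∀ {c} x y → c ≡ 0 → ite c x y ≡ y
  ite-no x y refl = ℕP.*-identityˡ y

  -- Total quotient and remainder, with quo a 0 = 0 and rem a 0 = a.
  quo : ℕ → ℕ → ℕ
  quo a zero    = 0
  quo a (suc b) = a / suc b

  rem : ℕ → ℕ → ℕ
  rem a b = a ∸ quo a b * b

  -- Division by counting the multiples of b up to a. The sum is exponentially long in the number of
  -- bits of a, which the collapse permits. The factor `le 1 b` yields the chosen value 0 at b = 0,
  -- where every comparison would succeed.
  quo-formula : ∀ a b → quo a b ≡ le 1 b * ΣN a (λ k → le (suc k * b) a)
  quo-formula a zero    = cong (_* ΣN a (λ k → le (suc k * 0) a)) (sym (le-no {1} {0} ℕP.≤-refl))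
  quo-formula a (suc b) = sym (begin
    le 1 (suc b) * ΣN a f  ≡⟨ cong (_* ΣN a f) (le-yes {1} {suc b} (s≤s z≤n)) ⟩
    1 * ΣN a f             ≡⟨ ℕP.*-identityˡ _ ⟩
    ΣN a f                 ≡⟨ ΣN-truncate (m/n≤m a (suc b)) (λ k h _ → le-no (over k h)) ⟩
    ΣN (a / suc b) f       ≡⟨ ΣN-cong (a / suc b) (λ k h → le-yes (ℕP.≤-trans (ℕP.*-monoˡ-≤ (suc b) h) (m/n*n≤m a (suc b)))) ⟩
    ΣN (a / suc b) (λ _ → 1) ≡⟨ trans (ΣN-const (a / suc b) 1) (ℕP.*-identityʳ _) ⟩
    a / suc b              ∎)
    where
      open ≡-Reasoning
      f : ℕ → ℕ
      f k = le (suc k * suc b) a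
      over : ∀ k → a / suc b ≤ k → a < suc k * suc b
      over k h = ℕP.<-≤-trans (ℕP.≤-<-trans (ℕP.≤-reflexive (m≡m%n+[m/n]*n a (suc b)))
        (ℕP.+-monoˡ-< (a / suc b * suc b) (m%n<n a (suc b)))) (ℕP.*-monoˡ-≤ (suc b) (s≤s h))

  rem-def : ∀ a b → rem a b ≡ a ∸ quo a b * b
  rem-def a b = refl

  rem-% : ∀ a b → rem a (suc b) ≡ a % suc b
  rem-% a b = sym (m%n≡m∸m/n*n a (suc b))

  quo-rem : ∀ a b → a ≡ rem a b + quo a b * b
  quo-rem a zero    = sym (trans (ℕP.+-identityʳ _) refl)
  quo-rem a (suc b) = trans (m≡m%n+[m/n]*n a (suc b)) (cong (_+ a / suc b * suc b) (sym (rem-% a b)))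

  rem< : ∀ a {b} → 0 < b → rem a b < b
  rem< a {suc b} _ = subst (_< suc b) (sym (rem-% a b)) (m%n<n a (suc b))

  rem-small : ∀ {a b} → a < b → rem a b ≡ a
  rem-small {a} {suc b} a<b = trans (rem-% a b) (m<n⇒m%n≡m a<b)

  quo-small : ∀ {a b} → a < b → quo a b ≡ 0
  quo-small {a} {suc b} a<b = m<n⇒m/n≡0 a<b

  quo-rem-unique : ∀ {r k b} → r < b → quo (r + k * b) b ≡ k × rem (r + k * b) b ≡ r
  quo-rem-unique {r} {k} {suc b} r<b = q , trans (rem-% (r + k * suc b) b) (trans ([m+kn]%n≡m%n r k (suc b)) (m<n⇒m%n≡m r<b))
    where
      q : (r + k * suc b) / suc b ≡ k
      q = trans (+-distrib-/ r (k * suc b) (subst (_< suc b) (sym (cong₂ _+_ (m<n⇒m%n≡m r<b) (m*n%n≡0 k (suc b)))) (ℕP.≤-trans (s≤s (ℕP.≤-reflexive (ℕP.+-identityʳ r))) r<b)))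
        (cong₂ _+_ (m<n⇒m/n≡0 r<b) (m*n/n≡m k (suc b)))

  quo-quo : ∀ a b c → quo (quo a b) c ≡ quo a (b * c)
  quo-quo a zero    zero    = refl
  quo-quo a zero    (suc c) = refl
  quo-quo a (suc b) zero    = cong (quo a) (sym (ℕP.*-zeroʳ b))
  quo-quo a (suc b) (suc c) = m/n/o≡m/[n*o] a (suc b) (suc c)

  quo-1 : ∀ a → quo a 1 ≡ a
  quo-1 a = n/1≡n a

  quo< : ∀ {a b c} → a < c * b → quo a b < c
  quo< {a} {zero}  {c} h = ⊥-elim (ℕP.n≮0 (subst (a <_) (ℕP.*-zeroʳ c) h))
  quo< {a} {suc b} {c} h = m<n*o⇒m/o<n h

  digit : ℕ → ℕ → ℕ → ℕ
  digit W h i = rem (quo h (W ^ i)) W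

  digit-def : ∀ W h i → digit W h i ≡ rem (quo h (W ^ i)) W
  digit-def W h i = refl

  digit-0 : ∀ W h → digit W h 0 ≡ rem h W
  digit-0 W h = cong (λ z → rem z W) (quo-1 h)

  digit-suc : ∀ W h i → digit W h (suc i) ≡ digit W (quo h W) i
  digit-suc W h i = cong (λ z → rem z W) (sym (quo-quo h W (W ^ i)))

  digit< : ∀ {W} h i → 0 < W → digit W h i < W
  digit< {W} h i pos = rem< (quo h (W ^ i)) pos

lt : ℕ → ℕ → ℕ
lt a b = le (suc a) b

fromDigits : ℕ → ℕ → (ℕ → ℕ) → ℕ
fromDigits W zero    a = 0
fromDigits W (suc T) a = a 0 + fromDigits W T (λ i → a (suc i)) * W

fromDigits-cong : ∀ W T {a b : ℕ → ℕ} → (∀ i → i < T → a i ≡ b i) → fromDigits W T a ≡ fromDigits W T b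
fromDigits-cong W zero    h = refl
fromDigits-cong W (suc T) h = cong₂ (λ x y → x + y * W) (h 0 (s≤s z≤n)) (fromDigits-cong W T (λ i i<T → h (suc i) (s≤s i<T)))

fromDigits< : ∀ W T (a : ℕ → ℕ) → (∀ i → i < T → a i < W) → fromDigits W T a < W ^ T
fromDigits< W zero    a h = ℕP.≤-refl
fromDigits< W (suc T) a h = begin-strict
  a 0 + fromDigits W T _ * W    <⟨ ℕP.+-monoˡ-< _ (h 0 (s≤s z≤n)) ⟩
  W + fromDigits W T _ * W      ≤⟨ ℕP.*-monoˡ-≤ W (fromDigits< W T _ (λ i i<T → h (suc i) (s≤s i<T))) ⟩
  W ^ T * W                     ≡⟨ ℕP.*-comm (W ^ T) W ⟩
  W * W ^ T                     ∎
  where open ℕP.≤-Reasoning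

digit-fromDigits : ∀ W T (a : ℕ → ℕ) → (∀ i → i < T → a i < W) → ∀ i → i < T → digit W (fromDigits W T a) i ≡ a i
digit-fromDigits W (suc T) a h zero    _         =
  trans (digit-0 W (fromDigits W (suc T) a)) (proj₂ (quo-rem-unique {k = fromDigits W T (λ i → a (suc i))} (h 0 (s≤s z≤n))))
digit-fromDigits W (suc T) a h (suc i) (s≤s i<T) = trans (digit-suc W _ i)
  (trans (cong (λ z → digit W z i) (proj₁ (quo-rem-unique {k = fromDigits W T (λ i → a (suc i))} (h 0 (s≤s z≤n)))))
    (digit-fromDigits W T _ (λ i i<T → h (suc i) (s≤s i<T)) i i<T))

fromDigits-digit : ∀ W T h → h < W ^ T → fromDigits W T (digit W h) ≡ h
fromDigits-digit W zero    zero    _ = refl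
fromDigits-digit W zero    (suc h) (s≤s ())
fromDigits-digit W (suc T) h h< = begin
  digit W h 0 + fromDigits W T (λ i → digit W h (suc i)) * W
    ≡⟨ cong₂ (λ x y → x + y * W) (digit-0 W h) (fromDigits-cong W T (λ i _ → digit-suc W h i)) ⟩
  rem h W + fromDigits W T (digit W (quo h W)) * W
    ≡⟨ cong (λ z → rem h W + z * W) (fromDigits-digit W T (quo h W) (quo< (subst (h <_) (ℕP.*-comm W (W ^ T)) h<))) ⟩
  rem h W + quo h W * W
    ≡⟨ quo-rem h W ⟨
  h ∎
  where open ≡-Reasoning

iter : ℕ → (ℕ → ℕ → ℕ) → ℕ → ℕ
iter zero    F x = x
iter (suc t) F x = F t (iter t F x)

ΠN-0 : ∀ n {f i} → i < n → f i ≡ 0 → ΠN n f ≡ 0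
ΠN-0 (suc n) {f} {i} i<1+n h with i ≟ n
... | yes refl = trans (cong (ΠN n f *_) h) (ℕP.*-zeroʳ (ΠN n f))
... | no i≢n = cong (_* f n) (ΠN-0 n (ℕP.≤∧≢⇒< (ℕP.≤-pred i<1+n) i≢n) h)

-- The iteration is read off the unique number h whose base-W digits form a computation history.
iter-as-sum : ∀ W T F x → (∀ i → i ≤ T → iter i F x < W) →
  ΣN (W ^ suc T) (λ h → eqn (digit W h 0) x * ΠN T (λ i → eqn (digit W h (suc i)) (F i (digit W h i))) * digit W h T)
  ≡ iter T F x
iter-as-sum W T F x bounded = trans (ΣN-single (W ^ suc T) (fromDigits< W (suc T) a below) others) value
  where
    a : ℕ → ℕ
    a i = iter i F x
    below : ∀ i → i < suc T → a i < W
    below i (s≤s i≤T) = bounded i i≤T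
    dig : ∀ i → i ≤ T → digit W (fromDigits W (suc T) a) i ≡ a i
    dig i i≤T = digit-fromDigits W (suc T) a below i (s≤s i≤T)
    value : eqn (digit W _ 0) x * ΠN T (λ i → eqn (digit W _ (suc i)) (F i (digit W _ i))) * digit W _ T ≡ iter T F x
    value = trans (cong₂ _*_ (cong₂ _*_ (eqn-yes (dig 0 z≤n))
      (ΠN-1 T (λ i i<T → eqn-yes (trans (dig (suc i) i<T) (cong (F i) (sym (dig i (ℕP.<⇒≤ i<T))))))))
      (dig T ℕP.≤-refl)) (ℕP.+-identityʳ _)
    others : ∀ h → h < W ^ suc T → h ≢ fromDigits W (suc T) a →
      eqn (digit W h 0) x * ΠN T (λ i → eqn (digit W h (suc i)) (F i (digit W h i))) * digit W h T ≡ 0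
    others h h< h≢ with digit W h 0 ≟ x
    ... | no ne = cong (λ z → z * ΠN T _ * digit W h T) (eqn-no ne)
    -- A candidate with the right start either violates some step, and then a factor vanishes, or
    -- has the digits of the true history and is equal to it.
    ... | yes start with all-steps T
      where
        all-steps : ∀ t → (∀ i → i < t → digit W h (suc i) ≡ F i (digit W h i)) ⊎
          ∃ λ i → i < t × digit W h (suc i) ≢ F i (digit W h i)
        all-steps zero    = inj₁ λ _ ()
        all-steps (suc t) with all-steps t | digit W h (suc t) ≟ F t (digit W h t)
        ... | inj₂ (i , i<t , ne) | _ = inj₂ (i , ℕP.m<n⇒m<1+n i<t , ne)
        ... | inj₁ ok | no ne = inj₂ (t , ℕP.≤-refl , ne)
        ... | inj₁ ok | yes eq = inj₁ λ i i<1+t → case i ≟ t of λ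
          { (yes refl) → eq ; (no i≢t) → ok i (ℕP.≤∧≢⇒< (ℕP.≤-pred i<1+t) i≢t) }
    ...   | inj₂ (i , i<T , ne) = cong (_* digit W h T)
            (trans (cong (eqn (digit W h 0) x *_) (ΠN-0 T i<T (eqn-no ne))) (ℕP.*-zeroʳ (eqn (digit W h 0) x)))
    ...   | inj₁ ok = ⊥-elim (h≢ (trans (sym (fromDigits-digit W (suc T) h h<))
            (fromDigits-cong W (suc T) (λ i i<1+T → history i (ℕP.≤-pred i<1+T)))))
      where
        history : ∀ i → i ≤ T → digit W h i ≡ a i
        history zero    _   = start
        history (suc i) i<T = trans (ok i i<T) (cong (F i) (history i (ℕP.<⇒≤ i<T)))

-- Turing machines on word codes

-- Words are coded by positive numbers: least significant bit first, with a leading 1 marking the end.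
code : List Bool → ℕ
code []      = 1
code (b ∷ w) = bit b + 2 * code w

parity : ∀ c → ∃ λ b → ∃ λ d → c ≡ bit b + 2 * d
parity zero    = false , 0 , refl
parity (suc c) with parity c
... | false , d , refl = true , d , refl
... | true  , d , refl = false , suc d , sym (ℕP.*-distribˡ-+ 2 1 d)

decodeFuel : ℕ → ℕ → List Bool
decodeFuel zero    N = []
decodeFuel (suc f) N with parity N
... | b , zero    , _ = []
... | b , (suc d) , _ = b ∷ decodeFuel f (suc d)

decode : ℕ → List Bool
decode N = decodeFuel N N

code-decode : ∀ N → 1 ≤ N → code (decode N) ≡ N
code-decode N 1≤N = go N N 1≤N ℕP.≤-refl
  where
    go : ∀ f N → 1 ≤ N → N ≤ f → code (decodeFuel f N) ≡ N
    go zero    N 1≤N N≤f = ⊥-elim (ℕP.<⇒≱ 1≤N N≤f)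
    go (suc f) N 1≤N N≤f with parity N
    go (suc f) N 1≤N N≤f | false , zero , refl = ⊥-elim (ℕP.n≮0 1≤N)
    go (suc f) N 1≤N N≤f | true , zero , refl = refl
    go (suc f) N 1≤N N≤f | b , suc d , refl = cong (λ z → bit b + 2 * z) (go f (suc d) (s≤s z≤n)
      (ℕP.≤-pred (ℕP.≤-trans (ℕP.≤-trans (s≤s (s≤s (ℕP.≤-trans (ℕP.m≤m+n d (d + 0)) (ℕP.≤-trans (ℕP.≤-reflexive refl) (ℕP.≤-refl)))))
        (ℕP.≤-reflexive (sym (cong suc (ℕP.+-suc d (d + 0)))))) (ℕP.≤-trans (ℕP.m≤n+m (2 * suc d) (bit b)) N≤f))))

code-pos : ∀ w → 1 ≤ code w
code-pos []      = ℕP.≤-refl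
code-pos (b ∷ w) = ℕP.≤-trans (ℕP.≤-trans (code-pos w) (ℕP.m≤m+n (code w) _)) (ℕP.m≤n+m (2 * code w) (bit b))

bit-parity : ∀ {b b' x y} → bit b + 2 * x ≡ bit b' + 2 * y → b ≡ b' × x ≡ y
bit-parity {false} {false} eq = refl , ℕP.*-cancelˡ-≡ _ _ 2 eq
bit-parity {true}  {true}  eq = refl , ℕP.*-cancelˡ-≡ _ _ 2 (ℕP.suc-injective eq)
bit-parity {false} {true} {x} {y} eq = ⊥-elim (even≢odd x y eq)
  where
    even≢odd : ∀ x y → 2 * x ≢ suc (2 * y)
    even≢odd (suc x) zero eq = case trans (sym (ℕP.+-suc (suc x) (x + 0))) eq of λ ()
    even≢odd (suc x) (suc y) eq = even≢odd x y (ℕP.suc-injective (ℕP.suc-injective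
      (trans (sym (cong suc (ℕP.+-suc x (x + 0)))) (trans eq (cong (λ z → suc (suc z)) (ℕP.+-suc y (y + 0)))))))
bit-parity {true} {false} {x} {y} eq with bit-parity {false} {true} {y} {x} (sym eq)
... | ()

code-injective : ∀ v w → code v ≡ code w → v ≡ w
code-injective []      []      eq = refl
code-injective []      (b ∷ w) eq = ⊥-elim (ℕP.<-irrefl eq (ℕP.<-≤-trans (ℕP.*-monoʳ-≤ 2 (code-pos w)) (ℕP.m≤n+m _ (bit b))))
code-injective (b ∷ w) []      eq = ⊥-elim (ℕP.<-irrefl (sym eq) (ℕP.<-≤-trans (ℕP.*-monoʳ-≤ 2 (code-pos w)) (ℕP.m≤n+m _ (bit b))))
code-injective (a ∷ v) (b ∷ w) eq with bit-parity {a} {b} eq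
... | refl , eq' = cong (a ∷_) (code-injective v w eq')

decode-code : ∀ w → decode (code w) ≡ w
decode-code w = code-injective _ w (code-decode (code w) (code-pos w))

code≥2^ : ∀ w → 2 ^ length w ≤ code w
code≥2^ []      = ℕP.≤-refl
code≥2^ (b ∷ w) = ℕP.≤-trans (ℕP.*-monoʳ-≤ 2 (code≥2^ w)) (ℕP.m≤n+m _ (bit b))

double-bound : ∀ b {x y} → x < y → bit b + 2 * x < 2 * y
double-bound false x<y = ℕP.*-monoʳ-< 2 x<y
double-bound true {x} {y} x<y = ℕP.≤-trans (ℕP.≤-reflexive (sym (ℕP.*-distribˡ-+ 2 1 x))) (ℕP.*-monoʳ-≤ 2 x<y)

code<2^ : ∀ w → code w < 2 ^ suc (length w)
code<2^ []      = ℕP.≤-refl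
code<2^ (b ∷ w) = double-bound b (code<2^ w)

n<2^n : ∀ n → n < 2 ^ n
n<2^n zero    = ℕP.≤-refl
n<2^n (suc n) = ℕP.≤-trans (ℕP.+-mono-≤ (ℕP.m^n>0 2 n) (n<2^n n)) (ℕP.+-monoʳ-≤ (2 ^ n) (ℕP.m≤m+n _ 0))

-- Length, encoding, pairing and counting on word codes

blen : ℕ → ℕ
blen x = ΣN x (λ j → le (2 ^ j) x)

-- Allows the defining sum, with x terms, to stop after polynomially many, where the powers 2^j
-- still have polynomially many bits.
blen-cut : ∀ x P → x < 2 ^ P → ΣN P (λ j → le (2 ^ j) x) ≡ blen x
blen-cut x P x< with ℕP.≤-total P x
... | inj₁ P≤x = sym (ΣN-truncate P≤x (λ j P≤j _ → le-no (ℕP.<-≤-trans x< (ℕP.^-monoʳ-≤ 2 P≤j))))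
... | inj₂ x≤P = ΣN-truncate x≤P (λ j x≤j _ → le-no (ℕP.<-≤-trans (n<2^n x) (ℕP.^-monoʳ-≤ 2 x≤j)))

blen≤ : ∀ x P → x < 2 ^ P → blen x ≤ P
blen≤ x P x< = ℕP.≤-trans (ℕP.≤-reflexive (sym (blen-cut x P x<)))
  (ℕP.≤-trans (ΣN-≤ P (λ j _ → le≤1 (2 ^ j))) (ℕP.≤-reflexive (ℕP.*-identityʳ P)))
  where
    le≤1 : ∀ a → le a x ≤ 1
    le≤1 a with a ≤? x
    ... | yes h = ℕP.≤-reflexive (le-yes h)
    ... | no ¬h = ℕP.≤-trans (ℕP.≤-reflexive (le-no (ℕP.≰⇒> ¬h))) z≤n

blen-unique : ∀ x l → 2 ^ l ≤ x → x < 2 ^ suc l → blen x ≡ suc l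
blen-unique x l lo hi = trans (sym (blen-cut x (suc l) hi))
  (trans (ΣN-cong (suc l) (λ j j≤l → le-yes (ℕP.≤-trans (ℕP.^-monoʳ-≤ 2 (ℕP.≤-pred j≤l)) lo)))
    (trans (ΣN-const (suc l) 1) (ℕP.*-identityʳ _)))

lenN : ℕ → ℕ
lenN N = blen N ∸ 1

lenN-code : ∀ w → lenN (code w) ≡ length w
lenN-code w = cong (_∸ 1) (blen-unique (code w) (length w) (code≥2^ w) (code<2^ w))

lenN≤ : ∀ N P → N < 2 ^ P → lenN N ≤ P
lenN≤ N P N< = ℕP.≤-trans (ℕP.m∸n≤m (blen N) 1) (blen≤ N P N<)

length≤ : ∀ w P → code w < 2 ^ P → length w ≤ P
length≤ w P h = ℕP.≤-trans (ℕP.≤-reflexive (sym (lenN-code w))) (lenN≤ (code w) P h)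

quo-bit : ∀ b x → quo (bit b + 2 * x) 2 ≡ x
quo-bit b x = trans (cong (λ z → quo (bit b + z) 2) (ℕP.*-comm 2 x)) (proj₁ (quo-rem-unique {bit b} {x} {2} (bit<2 b)))
  where
    bit<2 : ∀ b → bit b < 2
    bit<2 false = s≤s z≤n
    bit<2 true  = ℕP.≤-refl

rem-bit : ∀ b x → rem (bit b + 2 * x) 2 ≡ bit b
rem-bit b x = trans (cong (λ z → rem (bit b + z) 2) (ℕP.*-comm 2 x)) (proj₂ (quo-rem-unique {bit b} {x} {2} (bit<2 b)))
  where
    bit<2 : ∀ b → bit b < 2
    bit<2 false = s≤s z≤n
    bit<2 true  = ℕP.≤-refl

-- Σ_j g (w_j) c^j, which is how letter-by-letter recodings of w are evaluated.
horner : ℕ → (ℕ → ℕ) → List Bool → ℕ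
horner c g []      = 0
horner c g (b ∷ w) = g (bit b) + c * horner c g w

hornerN : ℕ → (ℕ → ℕ) → ℕ → ℕ
hornerN c g N = ΣN (lenN N) (λ j → g (digit 2 N j) * c ^ j)

hornerN-code : ∀ c g w → hornerN c g (code w) ≡ horner c g w
hornerN-code c g w = trans (cong (λ l → ΣN l (λ j → g (digit 2 (code w) j) * c ^ j)) (lenN-code w)) (go w)
  where
    open ≡-Reasoning
    shuffle : ∀ c x y → x * (c * y) ≡ c * (x * y)
    shuffle = ℕ-solve
    go : ∀ w → ΣN (length w) (λ j → g (digit 2 (code w) j) * c ^ j) ≡ horner c g w
    go []      = refl
    go (b ∷ w) = begin
      ΣN (suc (length w)) (λ j → g (digit 2 (code (b ∷ w)) j) * c ^ j)
        ≡⟨ ΣN-suc (length w) _ ⟩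
      g (digit 2 (code (b ∷ w)) 0) * 1 + ΣN (length w) (λ j → g (digit 2 (code (b ∷ w)) (suc j)) * (c * c ^ j))
        ≡⟨ cong₂ _+_ (trans (ℕP.*-identityʳ _) (cong g (trans (digit-0 2 (code (b ∷ w))) (rem-bit b (code w)))))
             (ΣN-cong (length w) (λ j _ → trans (cong (λ z → g z * (c * c ^ j))
               (trans (digit-suc 2 (code (b ∷ w)) j) (cong (λ z → digit 2 z j) (quo-bit b (code w))))) (shuffle c (g (digit 2 (code w) j)) (c ^ j)))) ⟩
      g (bit b) + ΣN (length w) (λ j → c * (g (digit 2 (code w) j) * c ^ j))
        ≡⟨ cong (λ z → g (bit b) + z) (trans (ΣN-*ˡ (length w) c _) (cong (c *_) (go w))) ⟩
      g (bit b) + c * horner c g w ∎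

-- A doubled bit b is the base-4 digit 3 b. The number 6 is the code of the terminator 01 together
-- with the end mark.
encN : ℕ → ℕ
encN N = hornerN 4 (3 *_) N + 4 ^ lenN N * 6

encN-code : ∀ w → encN (code w) ≡ code (encWord w)
encN-code w = trans (cong₂ (λ x l → x + 4 ^ l * 6) (hornerN-code 4 (3 *_) w) (lenN-code w)) (go w)
  where
    arith : ∀ b h l → 3 * b + 4 * h + 4 * l * 6 ≡ b + 2 * (b + 2 * (h + l * 6))
    arith = ℕ-solve
    go : ∀ w → horner 4 (3 *_) w + 4 ^ length w * 6 ≡ code (encWord w)
    go []      = refl
    go (b ∷ w) = trans (arith (bit b) (horner 4 (3 *_) w) (4 ^ length w)) (cong (λ z → bit b + 2 * (bit b + 2 * z)) (go w))

-- The subtraction strips the end mark of the first word; the second word is shifted past the first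
-- and keeps its own.
catN : ℕ → ℕ → ℕ
catN N M = (N ∸ 2 ^ lenN N) + 2 ^ lenN N * M

catN-code : ∀ v w → catN (code v) (code w) ≡ code (v L.++ w)
catN-code v w = trans (cong (λ l → (code v ∸ 2 ^ l) + 2 ^ l * code w) (lenN-code v)) (go v)
  where
    arith : ∀ b x p m → b + 2 * x + 2 * p * m ≡ b + 2 * (x + p * m)
    arith = ℕ-solve
    go : ∀ v → (code v ∸ 2 ^ length v) + 2 ^ length v * code w ≡ code (v L.++ w)
    go []      = ℕP.*-identityˡ (code w)
    go (b ∷ v) = trans (cong (_+ 2 * 2 ^ length v * code w)
        (trans (ℕP.+-∸-assoc (bit b) (ℕP.*-monoʳ-≤ 2 (code≥2^ v))) (cong (λ z → bit b + z) (sym (ℕP.*-distribˡ-∸ 2 (code v) (2 ^ length v))))))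
      (trans (arith (bit b) (code v ∸ 2 ^ length v) (2 ^ length v) (code w)) (cong (λ z → bit b + 2 * z) (go v)))

pairN : ℕ → ℕ → ℕ
pairN N M = catN (encN N) (encN M)

pairN-code : ∀ v w → pairN (code v) (code w) ≡ code (pair v w)
pairN-code v w = trans (cong₂ catN (encN-code v) (encN-code w)) (trans (catN-code (encWord v) (encWord w))
  (cong (λ z → code (encWord v L.++ z)) (sym (LP.++-identityʳ (encWord w)))))

-- Because of the end mark, the words of length k have exactly the codes from 2^k to 2^(k+1) - 1.
sum-allWords : ∀ k F → sum (L.map (λ y → F (code y)) (allWords k)) ≡ ΣN (2 ^ k) (λ y → F (2 ^ k + y))

sum-allWords zero    F = ℕP.+-identityʳ _
sum-allWords (suc k) F = begin
  sum (L.map (λ y → F (code y)) (L.map (false ∷_) (allWords k) L.++ L.map (true ∷_) (allWords k)))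
    ≡⟨ trans (cong sum (LP.map-++ _ (L.map (false ∷_) (allWords k)) _)) (sum-++ (L.map (λ y → F (code y)) (L.map (false ∷_) (allWords k))) _) ⟩
  sum (L.map (λ y → F (code y)) (L.map (false ∷_) (allWords k))) + sum (L.map (λ y → F (code y)) (L.map (true ∷_) (allWords k)))
    ≡⟨ cong₂ _+_ (trans (cong sum (sym (LP.map-∘ (allWords k)))) (sum-allWords k (λ c → F (2 * c))))
                 (trans (cong sum (sym (LP.map-∘ (allWords k)))) (sum-allWords k (λ c → F (suc (2 * c))))) ⟩
  ΣN w (λ y → F (2 * (w + y))) + ΣN w (λ y → F (suc (2 * (w + y))))
    ≡⟨ ΣN-+ w _ _ ⟨
  ΣN w (λ y → F (2 * (w + y)) + F (suc (2 * (w + y))))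
    ≡⟨ ΣN-cong w (λ y _ → cong₂ _+_ (cong F (arith₀ w y)) (cong F (arith₁ w y))) ⟩
  ΣN w (λ y → ΣN 2 (λ j → F (2 * w + (y * 2 + j))))
    ≡⟨ ΣN-* w 2 _ ⟨
  ΣN (w * 2) (λ y → F (2 * w + y))
    ≡⟨ cong (λ z → ΣN z (λ y → F (2 * w + y))) (ℕP.*-comm w 2) ⟩
  ΣN (2 * w) (λ y → F (2 * w + y)) ∎
  where
    open ≡-Reasoning
    w = 2 ^ k
    arith₀ : ∀ w y → 2 * (w + y) ≡ 2 * w + (y * 2 + 0)
    arith₀ = ℕ-solve
    arith₁ : ∀ w y → suc (2 * (w + y)) ≡ 2 * w + (y * 2 + 1)
    arith₁ = ℕ-solve

count-code : ∀ B x k → Defs.count B x k ≡ ΣN (2 ^ k) (λ y → bit (B (decode (pairN (code x) (2 ^ k + y)))))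
count-code B x k = trans (cong sum (LP.map-cong (λ y → trans (if-bit (B (pair x y)))
    (cong (λ z → bit (B z)) (sym (trans (cong decode (pairN-code x y)) (decode-code (pair x y)))))) (allWords k)))
  (sum-allWords k (λ c → bit (B (decode (pairN (code x) c)))))
  where
    if-bit : ∀ b → (if b then 1 else 0) ≡ bit b
    if-bit false = refl
    if-bit true  = refl

iterate : ∀ {A : Set} → ℕ → (A → A) → A → A
iterate zero    g a = a
iterate (suc t) g a = g (iterate t g a)

iter-simulates : ∀ {A : Set} (F : ℕ → ℕ) (pack : A → ℕ) (nxt : A → A) (P : ℕ → A → Set) T →
  (∀ j a → j < T → P j a → F (pack a) ≡ pack (nxt a) × P (suc j) (nxt a)) →
  ∀ a → P 0 a → ∀ t → t ≤ T → iter t (λ _ → F) (pack a) ≡ pack (iterate t nxt a) × P t (iterate t nxt a)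
iter-simulates F pack nxt P T sim a P0 zero    _   = refl , P0
iter-simulates F pack nxt P T sim a P0 (suc t) t<T =
  let eq , Pt = iter-simulates F pack nxt P T sim a P0 t (ℕP.<⇒≤ t<T)
      eq' , Pt' = sim t _ t<T Pt
  in trans (cong F eq) eq' , Pt'

-- Turing machine configurations packed into numbers

module Simulation (M : TM) where
  open TM M

  -- K is a common radix for the state codes, which include two halted states, and for the symbols;
  -- a sum is above both ranges.
  S K : ℕ
  S = 3 + extra
  K = states + 2 + S

  -- Base S with the cell nearest to the head lowest. The blank is the digit 0, so a blank cell
  -- beyond the end of the list and an absent one have the same code, in agreement with `headOf`.
  tape : List (Fin S) → ℕ
  tape []      = 0
  tape (s ∷ l) = toℕ s + tape l * S

  stateN : State M → ℕ
  stateN (running q)  = toℕ q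
  stateN (done false) = states
  stateN (done true)  = suc states

  nextState nextMove nextSym : ℕ → ℕ → ℕ
  nextState q h with q <? states | h <? S
  ... | yes q< | yes h< with δ (fromℕ< q<) (fromℕ< h<)
  ...   | halt b      = states + bit b
  ...   | step q' _ _ = toℕ q'
  nextState q h | _ | _ = q
  nextMove q h with q <? states | h <? S
  ... | yes q< | yes h< with δ (fromℕ< q<) (fromℕ< h<)
  ...   | step _ _ left  = 0
  ...   | step _ _ right = 1
  ...   | _              = 2
  nextMove q h | _ | _ = 2
  nextSym q h with q <? states | h <? S
  ... | yes q< | yes h< with δ (fromℕ< q<) (fromℕ< h<)
  ...   | halt b     = h
  ...   | step _ s _ = toℕ s
  nextSym q h | _ | _ = h

  packN : ℕ → ℕ → ℕ → ℕ → ℕ → ℕ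
  packN W q h l r = q + (h + (l + r * W) * K) * K

  stepParts : ℕ → ℕ → ℕ → ℕ → ℕ → ℕ → ℕ → ℕ → ℕ
  stepParts W q' m s q h l r = packN W q'
    (ite (eqn m 0) (rem l S) (ite (eqn m 1) (rem r S) s))
    (ite (eqn m 0) (quo l S) (ite (eqn m 1) (s + l * S) l))
    (ite (eqn m 0) (s + r * S) (ite (eqn m 1) (quo r S) r))

  partQ partH partL partR : ℕ → ℕ → ℕ
  partQ W c = rem c K
  partH W c = rem (quo c K) K
  partL W c = rem (quo (quo c K) K) W
  partR W c = quo (quo (quo c K) K) W

  stepN : ℕ → ℕ → ℕ
  stepN W c = stepParts W (nextState q h) (nextMove q h) (nextSym q h) q h (partL W c) (partR W c)
    where
      q = partQ W c
      h = partH W c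

  unpack : ∀ {W q h l r} → q < K → h < K → l < W → let c = packN W q h l r in
    partQ W c ≡ q × partH W c ≡ h × partL W c ≡ l × partR W c ≡ r
  unpack {W} {q} {h} {l} {r} q< h< l< = proj₂ u₁ ,
    trans (cong (λ z → rem z K) (proj₁ u₁)) (proj₂ u₂) ,
    trans (cong (λ z → rem (quo z K) W) (proj₁ u₁)) (trans (cong (λ z → rem z W) (proj₁ u₂)) (proj₂ u₃)) ,
    trans (cong (λ z → quo (quo z K) W) (proj₁ u₁)) (trans (cong (λ z → quo z W) (proj₁ u₂)) (proj₁ u₃))
    where
      u₁ = quo-rem-unique {q} {h + (l + r * W) * K} {K} q<
      u₂ = quo-rem-unique {h} {l + r * W} {K} h<
      u₃ = quo-rem-unique {l} {r} {W} l<

  packC : ℕ → Cfg M → ℕ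
  packC W (cfg st l h r) = packN W (stateN st) (toℕ h) (tape l) (tape r)

  -- The space invariant: a step extends either side by at most one cell, so i grows by one per
  -- step. It keeps the left tape below the radix W, without which unpacking would fail.
  Fits : ℕ → Cfg M → Set
  Fits i (cfg st l h r) = tape l < S ^ i × tape r < S ^ i

  stateN<K : ∀ st → stateN st < K
  stateN<K (running q)  = ℕP.<-≤-trans (FP.toℕ<n q) (ℕP.≤-trans (ℕP.m≤m+n states 2) (ℕP.m≤m+n _ S))
  stateN<K (done false) = ℕP.≤-trans (ℕP.≤-trans (ℕP.≤-reflexive (ℕP.+-comm 1 states)) (ℕP.+-monoʳ-≤ states (s≤s z≤n))) (ℕP.m≤m+n _ S)
  stateN<K (done true)  = ℕP.≤-trans (ℕP.≤-reflexive (ℕP.+-comm 2 states)) (ℕP.m≤m+n _ S)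

  sym<K : ∀ (h : Fin S) → toℕ h < K
  sym<K h = ℕP.<-≤-trans (FP.toℕ<n h) (ℕP.m≤n+m S (states + 2))

  grow : ∀ {i} s {t} → t < S ^ i → toℕ {S} s + t * S < S ^ suc i
  grow {i} s {t} t< = ℕP.<-≤-trans (ℕP.+-monoˡ-< (t * S) (FP.toℕ<n s))
    (ℕP.≤-trans (ℕP.*-monoˡ-≤ S t<) (ℕP.≤-reflexive (ℕP.*-comm (S ^ i) S)))

  up : ∀ {i t} → t < S ^ i → t < S ^ suc i
  up {i} t< = ℕP.<-≤-trans t< (ℕP.m≤n*m (S ^ i) S)

  head-tape : ∀ l → toℕ (proj₁ (headOf M l)) ≡ rem (tape l) S × tape (proj₂ (headOf M l)) ≡ quo (tape l) S
  head-tape []      = sym (rem-small {0} {S} (s≤s z≤n)) , sym (quo-small {0} {S} (s≤s z≤n))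
  head-tape (s ∷ l) = sym (proj₂ u) , sym (proj₁ u)
    where u = quo-rem-unique {toℕ s} {tape l} {S} (FP.toℕ<n s)

  head-fits : ∀ {i} l → tape l < S ^ i → tape (proj₂ (headOf M l)) < S ^ i
  head-fits {i} []      t< = t<
  head-fits {i} (s ∷ l) t< = ℕP.≤-<-trans (ℕP.≤-trans (ℕP.m≤m*n (tape l) S) (ℕP.m≤n+m _ (toℕ s))) t<

  look-running : ∀ (q : Fin states) (h : Fin S) →
    nextState (toℕ q) (toℕ h) ≡ (case δ q h of λ { (halt b) → states + bit b ; (step q' _ _) → toℕ q' }) ×
    nextMove (toℕ q) (toℕ h) ≡ (case δ q h of λ { (step _ _ left) → 0 ; (step _ _ right) → 1 ; _ → 2 }) ×
    nextSym (toℕ q) (toℕ h) ≡ (case δ q h of λ { (halt _) → toℕ h ; (step _ s _) → toℕ s })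
  look-running q h with toℕ q <? states | toℕ h <? S
  ... | no q≮ | _ = ⊥-elim (q≮ (FP.toℕ<n q))
  ... | yes _ | no h≮ = ⊥-elim (h≮ (FP.toℕ<n h))
  ... | yes q< | yes h< rewrite FP.fromℕ<-toℕ q q< | FP.fromℕ<-toℕ h h< with δ q h
  ...   | halt b         = refl , refl , refl
  ...   | step _ _ left  = refl , refl , refl
  ...   | step _ _ right = refl , refl , refl
  ...   | step _ _ stay  = refl , refl , refl

  look-done : ∀ q (h : Fin S) → states ≤ q →
    nextState q (toℕ h) ≡ q × nextMove q (toℕ h) ≡ 2 × nextSym q (toℕ h) ≡ toℕ h
  look-done q h h≤ with q <? states | toℕ h <? S
  ... | yes q< | _ = ⊥-elim (ℕP.<⇒≱ q< h≤)
  ... | no _ | yes _ = refl , refl , refl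
  ... | no _ | no _  = refl , refl , refl

  stepParts-left : ∀ W q' s q h l r → stepParts W q' 0 s q h l r ≡ packN W q' (rem l S) (quo l S) (s + r * S)
  stepParts-left W q' s q h l r rewrite ite-yes {eqn 0 0} (rem l S) (ite (eqn 0 1) (rem r S) s) (eqn-refl 0)
    | ite-yes {eqn 0 0} (quo l S) (ite (eqn 0 1) (s + l * S) l) (eqn-refl 0)
    | ite-yes {eqn 0 0} (s + r * S) (ite (eqn 0 1) (quo r S) r) (eqn-refl 0) = refl

  stepParts-right : ∀ W q' s q h l r → stepParts W q' 1 s q h l r ≡ packN W q' (rem r S) (s + l * S) (quo r S)
  stepParts-right W q' s q h l r
    rewrite ite-no {eqn 1 0} (rem l S) (ite (eqn 1 1) (rem r S) s) (eqn-no {1} {0} λ ()) | ite-yes {eqn 1 1} (rem r S) s (eqn-refl 1)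
    | ite-no {eqn 1 0} (quo l S) (ite (eqn 1 1) (s + l * S) l) (eqn-no {1} {0} λ ()) | ite-yes {eqn 1 1} (s + l * S) l (eqn-refl 1)
    | ite-no {eqn 1 0} (s + r * S) (ite (eqn 1 1) (quo r S) r) (eqn-no {1} {0} λ ()) | ite-yes {eqn 1 1} (quo r S) r (eqn-refl 1) = refl

  stepParts-stay : ∀ W q' s q h l r → stepParts W q' 2 s q h l r ≡ packN W q' s l r
  stepParts-stay W q' s q h l r
    rewrite ite-no {eqn 2 0} (rem l S) (ite (eqn 2 1) (rem r S) s) (eqn-no {2} {0} λ ()) | ite-no {eqn 2 1} (rem r S) s (eqn-no {2} {1} λ ())
    | ite-no {eqn 2 0} (quo l S) (ite (eqn 2 1) (s + l * S) l) (eqn-no {2} {0} λ ()) | ite-no {eqn 2 1} (s + l * S) l (eqn-no {2} {1} λ ())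
    | ite-no {eqn 2 0} (s + r * S) (ite (eqn 2 1) (quo r S) r) (eqn-no {2} {0} λ ()) | ite-no {eqn 2 1} (quo r S) r (eqn-no {2} {1} λ ()) = refl

  stepN-parts : ∀ {W q h l r q' m s} → q < K → h < K → l < W →
    nextState q h ≡ q' → nextMove q h ≡ m → nextSym q h ≡ s → stepN W (packN W q h l r) ≡ stepParts W q' m s q h l r
  stepN-parts {W} {q} {h} {l} {r} q< h< l< refl refl refl with unpack {W} {q} {h} {l} {r} q< h< l<
  ... | eq , eh , el , er rewrite eq | eh | el | er = refl

  stepN-correct : ∀ W i c → Fits i c → S ^ i ≤ W → stepN W (packC W c) ≡ packC W (stepCfg M c) × Fits (suc i) (stepCfg M c)
  stepN-correct W i (cfg (done b) l h r) (fl , fr) W≥ = trans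
    (stepN-parts {W} {stateN (done b)} {toℕ h} {tape l} {tape r} (stateN<K (done b)) (sym<K h) (ℕP.<-≤-trans fl W≥)
      (proj₁ lk) (proj₁ (proj₂ lk)) (proj₂ (proj₂ lk)))
    (stepParts-stay W (stateN (done b)) (toℕ h) (stateN (done b)) (toℕ h) (tape l) (tape r)) , up {i} fl , up {i} fr
    where
      done≥ : ∀ b → states ≤ stateN (done b)
      done≥ false = ℕP.≤-refl
      done≥ true  = ℕP.n≤1+n states
      lk = look-done (stateN (done b)) h (done≥ b)
  stepN-correct W i (cfg (running q) l h r) (fl , fr) W≥ with δ q h | look-running q h
  ... | halt b | lk = trans
    (stepN-parts {W} {toℕ q} {toℕ h} {tape l} {tape r} (stateN<K (running q)) (sym<K h) (ℕP.<-≤-trans fl W≥)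
      (proj₁ lk) (proj₁ (proj₂ lk)) (proj₂ (proj₂ lk)))
    (trans (stepParts-stay W (states + bit b) (toℕ h) (toℕ q) (toℕ h) (tape l) (tape r))
      (cong (λ z → packN W z (toℕ h) (tape l) (tape r)) (done-code b))) , up {i} fl , up {i} fr
    where
      done-code : ∀ b → states + bit b ≡ stateN (done b)
      done-code false = ℕP.+-identityʳ states
      done-code true  = ℕP.+-comm states 1
  ... | step q' s left | lk = trans
    (stepN-parts {W} {toℕ q} {toℕ h} {tape l} {tape r} (stateN<K (running q)) (sym<K h) (ℕP.<-≤-trans fl W≥)
      (proj₁ lk) (proj₁ (proj₂ lk)) (proj₂ (proj₂ lk)))
    (trans (stepParts-left W (toℕ q') (toℕ s) (toℕ q) (toℕ h) (tape l) (tape r))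
      (cong₂ (λ x y → packN W (toℕ q') x y (toℕ s + tape r * S)) (sym (proj₁ (head-tape l))) (sym (proj₂ (head-tape l))))) ,
    up {i} (head-fits {i} l fl) , grow {i} s fr
  ... | step q' s right | lk = trans
    (stepN-parts {W} {toℕ q} {toℕ h} {tape l} {tape r} (stateN<K (running q)) (sym<K h) (ℕP.<-≤-trans fl W≥)
      (proj₁ lk) (proj₁ (proj₂ lk)) (proj₂ (proj₂ lk)))
    (trans (stepParts-right W (toℕ q') (toℕ s) (toℕ q) (toℕ h) (tape l) (tape r))
      (cong₂ (λ x y → packN W (toℕ q') x (toℕ s + tape l * S) y) (sym (proj₁ (head-tape r))) (sym (proj₂ (head-tape r))))) ,
    grow {i} s fl , up {i} (head-fits {i} r fr)
  ... | step q' s stay | lk = trans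
    (stepN-parts {W} {toℕ q} {toℕ h} {tape l} {tape r} (stateN<K (running q)) (sym<K h) (ℕP.<-≤-trans fl W≥)
      (proj₁ lk) (proj₁ (proj₂ lk)) (proj₂ (proj₂ lk)))
    (stepParts-stay W (toℕ q') (toℕ s) (toℕ q) (toℕ h) (tape l) (tape r)) , up {i} fl , up {i} fr

  run-suc : ∀ t c → run M (suc t) c ≡ stepCfg M (run M t c)
  run-suc zero    c = refl
  run-suc (suc t) c = run-suc t (stepCfg M c)

  run-correct : ∀ W i t c → Fits i c → S ^ (i + t) ≤ W →
    iter t (λ _ → stepN W) (packC W c) ≡ packC W (run M t c) × Fits (i + t) (run M t c)
  run-correct W i t c f W≥ = subst₂ (λ z j → iter t (λ _ → stepN W) (packC W c) ≡ packC W z × Fits j z)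
    (sym (as-iterate t)) (ℕP.+-comm t i)
    (iter-simulates (stepN W) (packC W) (stepCfg M) (λ j → Fits (j + i)) t
      (λ j c' j<t f' → stepN-correct W (j + i) c' f' (ℕP.≤-trans (ℕP.^-monoʳ-≤ S
        (ℕP.≤-trans (ℕP.≤-reflexive (ℕP.+-comm j i)) (ℕP.+-monoʳ-≤ i (ℕP.<⇒≤ j<t)))) W≥)) c f t ℕP.≤-refl)
    where
      as-iterate : ∀ t → run M t c ≡ iterate t (stepCfg M) c
      as-iterate zero    = refl
      as-iterate (suc t) = trans (run-suc t c) (cong (stepCfg M) (as-iterate t))

  run-done : ∀ t c b → Cfg.st c ≡ done b → Cfg.st (run M t c) ≡ done b
  run-done zero    c b eq = eq
  run-done (suc t) (cfg (done b') l h r) b eq = run-done t _ b eq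

  run-+ : ∀ s t c → run M (s + t) c ≡ run M t (run M s c)
  run-+ zero    t c = refl
  run-+ (suc s) t c = run-+ s t (stepCfg M c)

  -- Halted configurations are fixed. The halting time, which depends on the word, can thus be
  -- replaced by one time bound for all words in question.
  accepts : ∀ w t T b → t ≤ T → Cfg.st (run M t (initCfg M w)) ≡ done b → Cfg.st (run M T (initCfg M w)) ≡ done b
  accepts w t T b t≤T eq with ℕP.m≤n⇒∃[o]m+o≡n t≤T
  ... | o , refl = trans (cong Cfg.st (run-+ t o (initCfg M w))) (run-done o (run M t (initCfg M w)) b eq)

  -- The bit b is written as the symbol b + 1, since 0 is the blank; hence `suc`.
  inputTape : List Bool → ℕ
  inputTape = horner S suc

  initN : ℕ → ℕ → ℕ
  initN W R = packN W (toℕ start) (rem R S) 0 (quo R S)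

  tape-input : ∀ w → tape (L.map (inSym M) w) ≡ inputTape w
  tape-input []          = refl
  tape-input (false ∷ w) = cong suc (trans (cong (_* S) (tape-input w)) (ℕP.*-comm (inputTape w) S))
  tape-input (true ∷ w)  = cong (λ z → suc (suc z)) (trans (cong (_* S) (tape-input w)) (ℕP.*-comm (inputTape w) S))

  tape< : ∀ l → tape l < S ^ length l
  tape< []      = ℕP.≤-refl
  tape< (s ∷ l) = grow {length l} s (tape< l)

  init-correct : ∀ W w → initN W (inputTape w) ≡ packC W (initCfg M w) × Fits (length w) (initCfg M w)
  init-correct W []      = cong₂ (λ x y → packN W (toℕ start) x 0 y) (rem-small {0} {S} (s≤s z≤n)) (quo-small {0} {S} (s≤s z≤n)) ,
    ℕP.≤-refl , ℕP.≤-refl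
  init-correct W (b ∷ w) = cong₂ (λ x y → packN W (toℕ start) x 0 y)
      (trans (cong (λ z → rem z S) split) (proj₂ u)) (trans (cong (λ z → quo z S) split) (proj₁ u)) ,
    ℕP.m^n>0 S (suc (length w)) , subst (λ z → tape (L.map (inSym M) w) < S ^ suc z) (LP.length-map (inSym M) w) (up {length (L.map (inSym M) w)} (tape< (L.map (inSym M) w)))
    where
      split : inputTape (b ∷ w) ≡ toℕ (inSym M b) + tape (L.map (inSym M) w) * S
      split = sym (tape-input (b ∷ w))
      u = quo-rem-unique {toℕ (inSym M b)} {tape (L.map (inSym M) w)} {S} (FP.toℕ<n (inSym M b))

  answer : ∀ W w T t b → S ^ (length w + T) ≤ W → t ≤ T → Cfg.st (run M t (initCfg M w)) ≡ done b →
    eqn (partQ W (iter T (λ _ → stepN W) (initN W (inputTape w)))) (suc states) ≡ bit b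
  answer W w T t b W≥ t≤T halted with init-correct W w
  ... | eq₀ , f₀ with run-correct W (length w) T (initCfg M w) f₀ W≥
  ...   | eq₁ , (fl , fr) = trans (cong (λ z → eqn (partQ W z) (suc states)) (trans (cong (iter T (λ _ → stepN W)) eq₀) eq₁))
          (trans (cong (λ z → eqn z (suc states)) (trans (proj₁ (unpack {W} {stateN (Cfg.st c)} {toℕ (Cfg.here c)} {tape (Cfg.lft c)} {tape (Cfg.rgt c)}
            (stateN<K (Cfg.st c)) (sym<K (Cfg.here c)) (ℕP.<-≤-trans fl W≥))) (cong stateN (accepts w t T b t≤T halted)))) (final b))
    where
      c = run M T (initCfg M w)
      final : ∀ b → eqn (stateN (done b)) (suc states) ≡ bit b
      final false = eqn-no (ℕP.<⇒≢ ℕP.≤-refl)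
      final true  = eqn-refl (suc states)

  packN< : ∀ {W q h l r} → q < K → h < K → l < W → r < W → packN W q h l r < W * W * K * K
  packN< {W} {q} {h} {l} {r} q< h< l< r< = digit-step q< (digit-step h< (digit-step l< r<))
    where
      digit-step : ∀ {a b A B} → a < A → b < B → a + b * A < B * A
      digit-step {a} {b} {A} a< b< = ℕP.<-≤-trans (ℕP.+-monoˡ-< (b * A) a<) (ℕP.*-monoˡ-≤ A b<)

  iter-bound : ∀ W w T → S ^ (length w + T) ≤ W → ∀ i → i ≤ T →
    iter i (λ _ → stepN W) (initN W (inputTape w)) < W * W * K * K
  iter-bound W w T W≥ i i≤T with init-correct W w
  ... | eq₀ , f₀ with run-correct W (length w) i (initCfg M w) f₀ W≥'
    where
      W≥' : S ^ (length w + i) ≤ W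
      W≥' = ℕP.≤-trans (ℕP.^-monoʳ-≤ S (ℕP.+-monoʳ-≤ (length w) i≤T)) W≥
  ...   | eq₁ , (fl , fr) = ℕP.≤-<-trans (ℕP.≤-reflexive (trans (cong (iter i (λ _ → stepN W)) eq₀) eq₁))
          (packN< {W} {stateN (Cfg.st c)} {toℕ (Cfg.here c)} (stateN<K (Cfg.st c)) (sym<K (Cfg.here c)) (ℕP.<-≤-trans fl W≥') (ℕP.<-≤-trans fr W≥'))
    where
      c = run M i (initCfg M w)
      W≥' : S ^ (length w + i) ≤ W
      W≥' = ℕP.≤-trans (ℕP.^-monoʳ-≤ S (ℕP.+-monoʳ-≤ (length w) i≤T)) W≥

-- Prime numbers

choose : ℕ → ℕ → ℕ
choose n       zero    = 1
choose zero    (suc k) = 0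
choose (suc n) (suc k) = choose n k + choose n (suc k)

choose-absorb : ∀ n k → suc k * choose (suc n) (suc k) ≡ suc n * choose n k
choose-absorb zero    zero    = refl
choose-absorb zero    (suc k) = ℕP.*-zeroʳ (suc (suc k))
choose-absorb (suc n) zero    = cong suc (trans (choose-absorb n zero) refl)
choose-absorb (suc n) (suc j) = begin
  suc (suc j) * (choose (suc n) (suc j) + choose (suc n) (suc (suc j)))
    ≡⟨ ℕP.*-distribˡ-+ (suc (suc j)) (choose (suc n) (suc j)) _ ⟩
  choose (suc n) (suc j) + suc j * choose (suc n) (suc j) + suc (suc j) * choose (suc n) (suc (suc j))
    ≡⟨ cong₂ (λ x y → choose (suc n) (suc j) + x + y) (choose-absorb n j) (choose-absorb n (suc j)) ⟩
  choose (suc n) (suc j) + suc n * choose n j + suc n * choose n (suc j)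
    ≡⟨ factor (choose (suc n) (suc j)) (suc n) (choose n j) (choose n (suc j)) ⟩
  choose (suc n) (suc j) + suc n * (choose n j + choose n (suc j)) ∎
  where
    open ≡-Reasoning
    factor : ∀ c m x y → c + m * x + m * y ≡ c + m * (x + y)
    factor = ℕ-solve

choose-mono : ∀ n k → choose n k ≤ choose (suc n) k
choose-mono n zero    = ℕP.≤-refl
choose-mono n (suc k) = ℕP.m≤n+m (choose n (suc k)) (choose n k)

choose-large : ∀ n k → n < k → choose n k ≡ 0
choose-large zero    (suc k) _         = refl
choose-large (suc n) (suc k) (s≤s n<k) = cong₂ _+_ (choose-large n k n<k) (choose-large n (suc k) (ℕP.m<n⇒m<1+n n<k))

choose-diag : ∀ n → choose n n ≡ 1
choose-diag zero    = refl
choose-diag (suc n) = cong₂ _+_ (choose-diag n) (choose-large n (suc n) ℕP.≤-refl)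

choose-pos : ∀ n k → k ≤ n → 1 ≤ choose n k
choose-pos n       zero    _         = ℕP.≤-refl
choose-pos (suc n) (suc k) (s≤s k≤n) = ℕP.≤-trans (choose-pos n k k≤n) (ℕP.m≤m+n _ _)

central≥ : ∀ m → 2 ^ m ≤ choose (2 * m) m
central≥ zero    = ℕP.≤-refl
central≥ (suc m) = subst (λ z → 2 ^ suc m ≤ choose z (suc m)) (sym (ℕP.*-distribˡ-+ 2 1 m)) (begin
  2 * 2 ^ m                                              ≡⟨ cong (λ z → 2 ^ m + z) (ℕP.+-identityʳ _) ⟩
  2 ^ m + 2 ^ m                                          ≤⟨ ℕP.+-mono-≤ (central≥ m) (central≥ m) ⟩
  choose (2 * m) m + choose (2 * m) m                    ≤⟨ ℕP.+-mono-≤ (choose-mono (2 * m) m) (ℕP.m≤m+n _ _) ⟩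
  choose (suc (2 * m)) m + choose (suc (2 * m)) (suc m)  ∎)
  where open ℕP.≤-Reasoning

binomial : ∀ n a → (1 + a) ^ n ≡ ΣN (suc n) (λ k → choose n k * a ^ k)
binomial zero    a = refl
binomial (suc n) a = begin
  (1 + a) * (1 + a) ^ n
    ≡⟨ cong ((1 + a) *_) (binomial n a) ⟩
  X + a * X
    ≡⟨ ℕP.+-comm X (a * X) ⟩
  a * X + X
    ≡⟨ cong₂ _+_ (sym (ΣN-*ˡ (suc n) a _)) (trans (sym (ΣN-truncate (ℕP.n≤1+n (suc n)) (λ k lo hi → cong (_* a ^ k) (choose-large n k lo)))) (ΣN-suc (suc n) _)) ⟩
  ΣN (suc n) (λ k → a * (choose n k * a ^ k)) + (1 + ΣN (suc n) (λ k → choose n (suc k) * a ^ suc k))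
    ≡⟨ rotate (ΣN (suc n) (λ k → a * (choose n k * a ^ k))) (ΣN (suc n) (λ k → choose n (suc k) * a ^ suc k)) ⟩
  1 + (ΣN (suc n) (λ k → a * (choose n k * a ^ k)) + ΣN (suc n) (λ k → choose n (suc k) * a ^ suc k))
    ≡⟨ cong suc (sym (ΣN-+ (suc n) _ _)) ⟩
  1 + ΣN (suc n) (λ k → a * (choose n k * a ^ k) + choose n (suc k) * a ^ suc k)
    ≡⟨ cong suc (ΣN-cong (suc n) (λ k _ → collect a (choose n k) (choose n (suc k)) (a ^ k))) ⟩
  1 + ΣN (suc n) (λ k → choose (suc n) (suc k) * a ^ suc k)
    ≡⟨ ΣN-suc (suc n) _ ⟨
  ΣN (suc (suc n)) (λ k → choose (suc n) k * a ^ k) ∎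
  where
    open ≡-Reasoning
    X = ΣN (suc n) (λ k → choose n k * a ^ k)
    rotate : ∀ x y → x + (1 + y) ≡ 1 + (x + y)
    rotate = ℕ-solve
    collect : ∀ a c d p → a * (c * p) + d * (a * p) ≡ (c + d) * (a * p)
    collect = ℕ-solve

LCM : ℕ → ℕ
LCM zero    = 1
LCM (suc n) = lcm (LCM n) (suc n)

LCM-∣ : ∀ n → LCM n ∣ LCM (suc n)
LCM-∣ n = m∣lcm[m,n] (LCM n) (suc n)

lcm-pos : ∀ {a b} → 0 < a → 0 < b → 0 < lcm a b
lcm-pos {a} {b} 0<a 0<b with lcm a b in eq
... | suc _ = s≤s z≤n
... | zero  = ⊥-elim (ℕP.<⇒≢ (ℕP.*-mono-< 0<a 0<b)
  (sym (trans (sym (gcd*lcm a b)) (trans (cong (gcd a b *_) eq) (ℕP.*-zeroʳ (gcd a b))))))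

LCM-pos : ∀ n → 0 < LCM n
LCM-pos zero    = s≤s z≤n
LCM-pos (suc n) = lcm-pos (LCM-pos n) (s≤s z≤n)

-- With α = k C(n,k), β = k C(n+1,k) and e = (k+1) C(n+1,k+1) one has 1/e = 1/α - 1/β (Leibniz's harmonic triangle).
leibniz : ∀ n k → 1 ≤ k → k ≤ n → k * choose n k ∣ LCM n
leibniz (suc n) (suc zero) _ _ = subst (_∣ LCM (suc n))
  (sym (trans (choose-absorb n 0) (ℕP.*-identityʳ (suc n)))) (n∣lcm[m,n] (LCM n) (suc n))
leibniz (suc n) (suc k@(suc _)) _ (s≤s k≤n) with leibniz n k (s≤s z≤n) k≤n | leibniz (suc n) k (s≤s z≤n) (ℕP.m≤n⇒m≤1+n k≤n)
... | α∣L' | divides y Ly with ∣-trans α∣L' (LCM-∣ n)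
...   | divides x Lx = ∣m+n∣m⇒∣n (subst (e ∣_) ex≡ (m∣m*n x)) (m∣m*n y)
  where
    α = k * choose n k
    β = k * choose (suc n) k
    e = suc k * choose (suc n) (suc k)
    L = LCM (suc n)
    β>0 : 0 < β
    β>0 = ℕP.*-mono-≤ {1} {k} {1} (s≤s z≤n) (choose-pos (suc n) k (ℕP.m≤n⇒m≤1+n k≤n))
    triangle : e * β ≡ (β + e) * α
    triangle = begin
      e * β                                        ≡⟨ cong (_* β) (choose-absorb n k) ⟩
      suc n * choose n k * (k * choose (suc n) k)
        ≡⟨ shuffle (suc n) (choose n k) k (choose n (ℕ.pred k)) ⟩
      (suc n * (choose n (ℕ.pred k) + choose n k)) * (k * choose n k)
        ≡⟨ cong (_* α) (trans (ℕP.*-distribˡ-+ (suc n) (choose n (ℕ.pred k)) (choose n k))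
             (cong₂ _+_ (sym (choose-absorb n (ℕ.pred k))) (sym (choose-absorb n k)))) ⟩
      (β + e) * α ∎
      where
        open ≡-Reasoning
        shuffle : ∀ m c k d → (m * c) * (k * (d + c)) ≡ (m * (d + c)) * (k * c)
        shuffle = ℕ-solve
    -- With L = x α = y β, the identity 1/e = 1/α - 1/β becomes e x = e y + L, so that e divides L.
    ex≡ : e * x ≡ e * y + L
    ex≡ = ℕP.*-cancelʳ-≡ _ _ β {{ℕ.>-nonZero β>0}} (begin
      e * x * β              ≡⟨ rotate e x β ⟩
      (e * β) * x            ≡⟨ cong (_* x) triangle ⟩
      (β + e) * α * x        ≡⟨ rotate' (β + e) α x ⟩
      (β + e) * (x * α)      ≡⟨ cong ((β + e) *_) (sym Lx) ⟩
      (β + e) * L            ≡⟨ ℕP.*-distribʳ-+ L β e ⟩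
      β * L + e * L          ≡⟨ cong (λ z → β * L + e * z) Ly ⟩
      β * L + e * (y * β)    ≡⟨ rotate'' β L e y ⟩
      (e * y + L) * β        ∎)
      where
        open ≡-Reasoning
        rotate : ∀ e x b → e * x * b ≡ (e * b) * x
        rotate = ℕ-solve
        rotate' : ∀ s a x → s * a * x ≡ s * (x * a)
        rotate' = ℕ-solve
        rotate'' : ∀ b l e y → b * l + e * (y * b) ≡ (e * y + l) * b
        rotate'' = ℕ-solve

strip : ∀ p n → 2 ≤ p → 0 < n → ∃ λ i → ∃ λ n' → n ≡ p ^ i * n' × ¬ (p ∣ n')
strip p n 2≤p 0<n = go n n ℕP.≤-refl 0<n
  where
    go : ∀ f n → n ≤ f → 0 < n → ∃ λ i → ∃ λ n' → n ≡ p ^ i * n' × ¬ (p ∣ n')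
    go zero    n n≤f 0<n = ⊥-elim (ℕP.<⇒≱ 0<n n≤f)
    go (suc f) n n≤f 0<n with p ∣? n
    ... | no p∤n = 0 , n , sym (ℕP.*-identityˡ n) , p∤n
    ... | yes (divides zero eq) = ⊥-elim (ℕP.<⇒≢ 0<n (sym eq))
    ... | yes (divides (suc m) eq) with go f (suc m) (ℕP.≤-pred (ℕP.≤-trans smaller n≤f)) (s≤s z≤n)
      where
        smaller : suc m < n
        smaller = ℕP.<-≤-trans (ℕP.m<m*n (suc m) p {{_}} 2≤p) (ℕP.≤-reflexive (sym eq))
    ...   | i , n' , eq' , p∤n' = suc i , n' , trans eq (trans (ℕP.*-comm (suc m) p) (trans (cong (p *_) eq') (sym (ℕP.*-assoc p (p ^ i) n')))) , p∤n'

prime≥2 : ∀ {p} → Prime p → 2 ≤ p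
prime≥2 {zero} pp = ⊥-elim (¬prime[0] pp)
prime≥2 {suc zero} pp = ⊥-elim (¬prime[1] pp)
prime≥2 {suc (suc p)} pp = s≤s (s≤s z≤n)

-- If p^(k+1) divides neither number, write them as p^i a' and p^j b' with a' and b' prime to p.
-- Then i, j ≤ k, so the lcm divides p^k a' b', which p^(k+1) does not divide.
prime-power-lcm : ∀ {p} k a b → Prime p → 0 < a → 0 < b → p ^ suc k ∣ lcm a b → (p ^ suc k ∣ a) ⊎ (p ^ suc k ∣ b)
prime-power-lcm {p} k a b pp 0<a 0<b h with p ^ suc k ∣? a | p ^ suc k ∣? b
... | yes ha | _ = inj₁ ha
... | no _ | yes hb = inj₂ hb
... | no ¬ha | no ¬hb with strip p a (prime≥2 pp) 0<a | strip p b (prime≥2 pp) 0<b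
...   | i , a' , refl , p∤a' | j , b' , refl , p∤b' = ⊥-elim ([ p∤a' , p∤b' ]′ (euclidsLemma a' b' pp p∣a'b'))
  where
    instance _ = ℕ.>-nonZero (ℕP.≤-trans (ℕP.n≤1+n 1) (prime≥2 pp))
    instance _ = ℕ.>-nonZero (ℕP.m^n>0 p k)
    exponent≤ : ∀ i a' → ¬ (p ^ suc k ∣ p ^ i * a') → p ^ i ∣ p ^ k
    exponent≤ i a' ¬h with i ≤? k
    ... | yes i≤k = ^-∣ i≤k
      where
        ^-∣ : ∀ {i k} → i ≤ k → p ^ i ∣ p ^ k
        ^-∣ {i} i≤k with ℕP.m≤n⇒∃[o]m+o≡n i≤k
        ... | o , refl = subst (p ^ i ∣_) (sym (ℕP.^-distribˡ-+-* p i o)) (m∣m*n (p ^ o))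
    ... | no i≰k with ℕP.m≤n⇒∃[o]m+o≡n (ℕP.≰⇒> i≰k)
    ...   | o , refl = ⊥-elim (¬h (subst (λ z → p ^ suc k ∣ z * a') (sym (ℕP.^-distribˡ-+-* p (suc k) o))
              (∣-trans (m∣m*n (p ^ o)) (m∣m*n a'))))
    lcm∣ : lcm (p ^ i * a') (p ^ j * b') ∣ p ^ k * (a' * b')
    lcm∣ = lcm-least (*-pres-∣ (exponent≤ i a' ¬ha) (m∣m*n b')) (*-pres-∣ (exponent≤ j b' ¬hb) (n∣m*n a'))
    p∣a'b' : p ∣ a' * b'
    p∣a'b' = *-cancelˡ-∣ (p ^ k) (subst (_∣ p ^ k * (a' * b')) (ℕP.*-comm p (p ^ k)) (∣-trans h lcm∣))

LCM-prime-power : ∀ n {p} k → Prime p → p ^ suc k ∣ LCM n → p ^ suc k ≤ n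
LCM-prime-power zero    {p} k pp h = ⊥-elim (ℕP.<⇒≱ (prime≥2 pp) (ℕP.≤-trans (ℕP.m≤m*n p (p ^ k) {{ℕ.>-nonZero (ℕP.m^n>0 p {{ℕ.>-nonZero (ℕP.≤-trans (ℕP.n≤1+n 1) (prime≥2 pp))}} k)}}) (∣⇒≤ h)))
LCM-prime-power (suc n) k pp h with prime-power-lcm k (LCM n) (suc n) pp (LCM-pos n) (s≤s z≤n) h
... | inj₁ h' = ℕP.m≤n⇒m≤1+n (LCM-prime-power n k pp h')
... | inj₂ h' = ∣⇒≤ h'

-- Primality by counting the proper divisors from 2 on: a sum of comparisons, which is the form that
-- makes it an easy function.
isP : ℕ → ℕ
isP q = le 2 q * eqn (ΣN q (λ d → le 2 d * eqn (rem q d) 0)) 0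

ΣN-zero⁻¹ : ∀ n {f} → ΣN n f ≡ 0 → ∀ i → i < n → f i ≡ 0
ΣN-zero⁻¹ n h i i<n = ℕP.n≤0⇒n≡0 (ℕP.≤-trans (ΣN-member n i<n) (ℕP.≤-reflexive h))

rem≡0⇒∣ : ∀ {a b} → rem a b ≡ 0 → b ∣ a
rem≡0⇒∣ {a} {b} h = divides (quo a b) (trans (quo-rem a b) (cong (_+ quo a b * b) h))

∣⇒rem≡0 : ∀ {a b} → 0 < b → b ∣ a → rem a b ≡ 0
∣⇒rem≡0 {a} {b} 0<b (divides k refl) = proj₂ (quo-rem-unique {0} {k} {b} 0<b)

isP-prime : ∀ {q} → Prime q → isP q ≡ 1
isP-prime {q} pq = cong₂ _*_ (le-yes (prime≥2 pq)) (eqn-yes (ΣN-0 q no-divisor))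
  where
    no-divisor : ∀ d → d < q → le 2 d * eqn (rem q d) 0 ≡ 0
    no-divisor d d<q with 2 ≤? d
    ... | no ¬2≤ = cong (_* eqn (rem q d) 0) (le-no (ℕP.≰⇒> ¬2≤))
    ... | yes 2≤d = trans (cong (le 2 d *_) (eqn-no (λ h → [ (λ { refl → ℕP.<⇒≱ 2≤d ℕP.≤-refl }) , (λ { refl → ℕP.<-irrefl refl d<q }) ]′
            (prime⇒irreducible pq (rem≡0⇒∣ h))))) (ℕP.*-zeroʳ (le 2 d))

isP-1⇒prime : ∀ {q} → isP q ≢ 0 → Prime q
isP-1⇒prime {q} h with prime? q
... | yes pq = pq
... | no ¬pq = ⊥-elim (h (nonprime q ¬pq))
  where
    nonprime : ∀ q → ¬ Prime q → isP q ≡ 0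
    nonprime q ¬pq with 2 ≤? q
    ... | no ¬2≤ = cong (_* eqn (ΣN q (λ d → le 2 d * eqn (rem q d) 0)) 0) (le-no (ℕP.≰⇒> ¬2≤))
    ... | yes 2≤q with composite? q
    ...   | no ¬c = ⊥-elim (¬pq (¬composite⇒prime {{ℕ.n>1⇒nonTrivial 2≤q}} ¬c))
    ...   | yes (hasNonTrivialDivisor {d} {{nt}} d<q d∣q) = trans (cong (le 2 q *_) (eqn-no λ s → case
              trans (sym (cong₂ _*_ (le-yes (ℕ.nonTrivial⇒n>1 d)) (eqn-yes (∣⇒rem≡0 (ℕP.<-trans (s≤s z≤n) (ℕ.nonTrivial⇒n>1 d)) d∣q)))) (ΣN-zero⁻¹ q s d d<q) of λ ()))
            (ℕP.*-zeroʳ (le 2 q))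

isP-0 : ∀ {q} → ¬ Prime q → isP q ≡ 0
isP-0 {q} ¬pq with isP q ≟ 0
... | yes h = h
... | no h = ⊥-elim (¬pq (isP-1⇒prime h))

prime-factor : ∀ n → 2 ≤ n → ∃ λ p → Prime p × p ∣ n
prime-factor n 2≤n = go n n ℕP.≤-refl 2≤n
  where
    go : ∀ f n → n ≤ f → 2 ≤ n → ∃ λ p → Prime p × p ∣ n
    go zero    n n≤f 2≤n = ⊥-elim (ℕP.<⇒≱ (ℕP.<-≤-trans (s≤s z≤n) 2≤n) n≤f)
    go (suc f) n n≤f 2≤n with composite? n
    ... | no ¬c = n , ¬composite⇒prime {{ℕ.n>1⇒nonTrivial 2≤n}} ¬c , ∣-refl
    ... | yes (hasNonTrivialDivisor {d} d<n d∣n) with go f d (ℕP.≤-pred (ℕP.≤-trans d<n n≤f)) (ℕ.nonTrivial⇒n>1 d)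
    ...   | p , pp , p∣d = p , pp , ∣-trans p∣d d∣n

-- M is the product of the prime powers that exactly divide it. There is at most one for each prime
-- below t, and each is at most N. The induction on t splits off the power of the largest candidate.
prime-power-bound : ∀ N t M → 1 ≤ N → 0 < M → (∀ p → Prime p → p ∣ M → p < t) →
  (∀ p k → Prime p → p ^ suc k ∣ M → p ^ suc k ≤ N) → M ≤ N ^ ΣN t isP
prime-power-bound N zero    M 1≤N 0<M small powers with 2 ≤? M
... | no ¬2≤ = ℕP.≤-pred (ℕP.≰⇒> ¬2≤)
... | yes 2≤M with prime-factor M 2≤M
...   | p , pp , p∣M = ⊥-elim (ℕP.n≮0 (small p pp p∣M))
prime-power-bound N (suc t) M 1≤N 0<M small powers with prime? t
... | no ¬pt = subst (λ z → M ≤ N ^ z) (sym (trans (cong (λ z → ΣN t isP + z) (isP-0 ¬pt)) (ℕP.+-identityʳ _)))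
  (prime-power-bound N t M 1≤N 0<M (λ p pp p∣M → ℕP.≤∧≢⇒< (ℕP.≤-pred (small p pp p∣M)) (λ { refl → ¬pt pp })) powers)
... | yes pt with strip t M (prime≥2 pt) 0<M
...   | i , M' , refl , t∤M' = subst (λ z → t ^ i * M' ≤ N ^ z) (trans (ℕP.+-comm 1 (ΣN t isP)) (cong (λ z → ΣN t isP + z) (sym (isP-prime pt))))
  (power i (prime-power-bound N t M' 1≤N 0<M' (λ p pp p∣M' → ℕP.≤∧≢⇒< (ℕP.≤-pred (small p pp (∣-trans p∣M' (n∣m*n (t ^ i))))) (λ { refl → t∤M' p∣M' }))
    (λ p k pp h → powers p k pp (∣-trans h (n∣m*n (t ^ i))))) powers)
  where
    0<M' : 0 < M'
    0<M' = ℕP.n≢0⇒n>0 (λ eq → ℕP.<⇒≢ 0<M (sym (trans (cong (t ^ i *_) eq) (ℕP.*-zeroʳ (t ^ i)))))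
    power : ∀ i → M' ≤ N ^ ΣN t isP → (∀ p k → Prime p → p ^ suc k ∣ t ^ i * M' → p ^ suc k ≤ N) →
      t ^ i * M' ≤ N ^ suc (ΣN t isP)
    power (suc i) le powers = ℕP.*-mono-≤ (powers t i pt (m∣m*n M')) le
    power zero    le powers = ℕP.≤-trans (ℕP.≤-reflexive (ℕP.+-identityʳ M'))
      (ℕP.≤-trans le (ℕP.m≤n*m (N ^ ΣN t isP) N {{ℕ.>-nonZero 1≤N}}))

-- Chebyshev's lower bound by way of lcm(1, ..., 2m) for m = 2^r. That lcm is a multiple of m C(2m,
-- m), hence at least 2^m, and it is at most (2m)^π(2m); comparing exponents of 2 gives m ≤ (r + 1)
-- π(2m).
many-primes : ∀ r → 2 ^ r ≤ suc r * ΣN (suc (2 ^ suc r)) isP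
many-primes r = ℕP.≮⇒≥ λ few → ℕP.<⇒≱ (ℕP.^-monoʳ-< 2 ℕP.≤-refl few) (begin
  2 ^ m                          ≤⟨ central≥ m ⟩
  choose (2 * m) m               ≤⟨ ℕP.m≤n*m (choose (2 * m) m) m {{ℕ.>-nonZero m>0}} ⟩
  m * choose (2 * m) m           ≤⟨ ∣⇒≤ {{ℕ.>-nonZero (LCM-pos (2 * m))}} (leibniz (2 * m) m m>0 (ℕP.m≤n*m m 2)) ⟩
  LCM (2 * m)                    ≤⟨ prime-power-bound (2 * m) (suc (2 * m)) (LCM (2 * m)) (ℕP.m^n>0 2 (suc r)) (LCM-pos (2 * m))
                                      (λ p pp p∣ → s≤s (subst (_≤ 2 * m) (ℕP.*-identityʳ p) (LCM-prime-power (2 * m) 0 pp (subst (_∣ LCM (2 * m)) (sym (ℕP.*-identityʳ p)) p∣))))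
                                      (λ p k pp → LCM-prime-power (2 * m) k pp) ⟩
  (2 ^ suc r) ^ ΣN (suc (2 * m)) isP  ≡⟨ ℕP.^-*-assoc 2 (suc r) (ΣN (suc (2 * m)) isP) ⟩
  2 ^ (suc r * ΣN (suc (2 * m)) isP)  ∎)
  where
    open ℕP.≤-Reasoning
    m = 2 ^ r
    m>0 : 0 < m
    m>0 = ℕP.m^n>0 2 r

-- Arithmetic modulo a prime

record Mod (q : ℕ) (a b : ℤ) : Set where
  constructor congr
  field
    factor : ℤ
    equal  : a ≡ b ℤ.+ factor ℤ.* + q

mod-≡ : ∀ {q a b} → a ≡ b → Mod q a b
mod-≡ {q} {a} refl = congr ℤ.0ℤ (sym (trans (cong (ℤ._+_ a) (ℤP.*-zeroˡ (+ q))) (ℤP.+-identityʳ a)))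

mod-refl : ∀ {q a} → Mod q a a
mod-refl = mod-≡ refl

mod-sym : ∀ {q a b} → Mod q a b → Mod q b a
mod-sym {q} {a} {b} (congr k refl) = congr (ℤ.- k) (ring b k (+ q))
  where
    ring : ∀ b k q → b ≡ b ℤ.+ k ℤ.* q ℤ.+ (ℤ.- k) ℤ.* q
    ring = ℤ-solve

mod-trans : ∀ {q a b c} → Mod q a b → Mod q b c → Mod q a c
mod-trans {q} {c = c} (congr k refl) (congr l refl) = congr (l ℤ.+ k) (ring c k l (+ q))
  where
    ring : ∀ c k l q → c ℤ.+ l ℤ.* q ℤ.+ k ℤ.* q ≡ c ℤ.+ (l ℤ.+ k) ℤ.* q
    ring = ℤ-solve

mod-+ : ∀ {q a b c d} → Mod q a b → Mod q c d → Mod q (a ℤ.+ c) (b ℤ.+ d)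
mod-+ {q} {b = b} {d = d} (congr k refl) (congr l refl) = congr (k ℤ.+ l) (ring b d k l (+ q))
  where
    ring : ∀ b d k l q → (b ℤ.+ k ℤ.* q) ℤ.+ (d ℤ.+ l ℤ.* q) ≡ (b ℤ.+ d) ℤ.+ (k ℤ.+ l) ℤ.* q
    ring = ℤ-solve

mod-* : ∀ {q a b c d} → Mod q a b → Mod q c d → Mod q (a ℤ.* c) (b ℤ.* d)
mod-* {q} {b = b} {d = d} (congr k refl) (congr l refl) =
  congr (b ℤ.* l ℤ.+ k ℤ.* d ℤ.+ k ℤ.* l ℤ.* + q) (ring b d k l (+ q))
  where
    ring : ∀ b d k l q → (b ℤ.+ k ℤ.* q) ℤ.* (d ℤ.+ l ℤ.* q) ≡ b ℤ.* d ℤ.+ (b ℤ.* l ℤ.+ k ℤ.* d ℤ.+ k ℤ.* l ℤ.* q) ℤ.* q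
    ring = ℤ-solve

mod-neg : ∀ {q a b} → Mod q a b → Mod q (ℤ.- a) (ℤ.- b)
mod-neg {q} {b = b} (congr k refl) = congr (ℤ.- k) (ring b k (+ q))
  where
    ring : ∀ b k q → ℤ.- (b ℤ.+ k ℤ.* q) ≡ ℤ.- b ℤ.+ (ℤ.- k) ℤ.* q
    ring = ℤ-solve

mod-- : ∀ {q a b c d} → Mod q a b → Mod q c d → Mod q (a ℤ.- c) (b ℤ.- d)
mod-- h h' = mod-+ h (mod-neg h')

mod-^ : ∀ {q a b} k → Mod q a b → Mod q (a ℤ.^ k) (b ℤ.^ k)
mod-^ zero    h = mod-refl
mod-^ (suc k) h = mod-* h (mod-^ k h)

mod-Σ : ∀ {q} n {f g : ℕ → ℤ} → (∀ i → i < n → Mod q (f i) (g i)) → Mod q (ΣZ n f) (ΣZ n g)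
mod-Σ zero    h = mod-refl
mod-Σ (suc n) h = mod-+ (mod-Σ n (λ i i<n → h i (ℕP.m<n⇒m<1+n i<n))) (h n ℕP.≤-refl)

mod-Π : ∀ {q} n {f g : ℕ → ℤ} → (∀ i → i < n → Mod q (f i) (g i)) → Mod q (ΠZ n f) (ΠZ n g)
mod-Π zero    h = mod-refl
mod-Π (suc n) h = mod-* (mod-Π n (λ i i<n → h i (ℕP.m<n⇒m<1+n i<n))) (h n ℕP.≤-refl)

mod-multiple : ∀ {q} k → Mod q (k ℤ.* + q) ℤ.0ℤ
mod-multiple {q} k = congr k (sym (ℤP.+-identityˡ (k ℤ.* + q)))

mod-∣ : ∀ {q a} → q ∣ a → Mod q (+ a) ℤ.0ℤ
mod-∣ {q} (divides k refl) = mod-trans (mod-≡ (ℤP.pos-* k q)) (mod-multiple (+ k))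

mod-∣-abs : ∀ {q x} → q ∣ ∣ x ∣ → Mod q x ℤ.0ℤ
mod-∣-abs {q} {+ a}      h = mod-∣ h
mod-∣-abs {q} { -[1+ a ]} h = mod-neg (mod-∣ {q} {suc a} h)

∣-abs-mod : ∀ {q x} → Mod q x ℤ.0ℤ → q ∣ ∣ x ∣
∣-abs-mod {q} (congr k refl) = divides ∣ k ∣ (trans (cong ∣_∣ (ℤP.+-identityˡ (k ℤ.* + q))) (ℤP.abs-* k (+ q)))

∣-mod : ∀ {q a} → Mod q (+ a) ℤ.0ℤ → q ∣ a
∣-mod = ∣-abs-mod

mod-zero-product : ∀ {q x y} → Prime q → Mod q (x ℤ.* y) ℤ.0ℤ → Mod q x ℤ.0ℤ ⊎ Mod q y ℤ.0ℤ
mod-zero-product {q} {x} {y} pq h with euclidsLemma ∣ x ∣ ∣ y ∣ pq (subst (q ∣_) (ℤP.abs-* x y) (∣-abs-mod h))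
... | inj₁ hx = inj₁ (mod-∣-abs hx)
... | inj₂ hy = inj₂ (mod-∣-abs hy)

mod-diff : ∀ {q a b} → Mod q (a ℤ.- b) ℤ.0ℤ → Mod q a b
mod-diff {q} {a} {b} (congr k eq) = congr k (trans (ring a b) (cong (ℤ._+_ b) (trans eq (ℤP.+-identityˡ (k ℤ.* + q)))))
  where
    ring : ∀ a b → a ≡ b ℤ.+ (a ℤ.- b)
    ring = ℤ-solve

mod-diff⁻¹ : ∀ {q a b} → Mod q a b → Mod q (a ℤ.- b) ℤ.0ℤ
mod-diff⁻¹ {q} {b = b} (congr k refl) = congr k (ring b (k ℤ.* + q))
  where
    ring : ∀ b x → (b ℤ.+ x) ℤ.- b ≡ ℤ.0ℤ ℤ.+ x
    ring = ℤ-solve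

mod-cancel : ∀ {q x a b} → Prime q → ¬ Mod q x ℤ.0ℤ → Mod q (x ℤ.* a) (x ℤ.* b) → Mod q a b
mod-cancel {q} {x} {a} {b} pq x≢0 h with mod-zero-product {x = x} {a ℤ.- b} pq (mod-trans (mod-≡ (ring x a b)) (mod-diff⁻¹ h))
  where
    ring : ∀ x a b → x ℤ.* (a ℤ.- b) ≡ x ℤ.* a ℤ.- x ℤ.* b
    ring = ℤ-solve
... | inj₁ x≡0 = ⊥-elim (x≢0 x≡0)
... | inj₂ h'  = mod-diff h'

mod-rem : ∀ q a → Mod q (+ rem a q) (+ a)
mod-rem q a = mod-sym (congr (+ quo a q) (trans (cong +_ (quo-rem a q))
  (trans (ℤP.pos-+ (rem a q) _) (cong (ℤ._+_ (+ rem a q)) (ℤP.pos-* (quo a q) q)))))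

mod-unique : ∀ {q a b} → a < q → b < q → Mod q (+ a) (+ b) → a ≡ b
mod-unique {q} {a} {b} a<q b<q h with ℕP.<-cmp a b
... | tri≈ _ eq _ = eq
... | tri< a<b _ _ = ⊥-elim (distinct a<b b<q (mod-sym h))
  where
    distinct : ∀ {a b} → a < b → b < q → ¬ Mod q (+ b) (+ a)
    distinct {a} {b} a<b b<q h = ℕP.<⇒≱ (ℕP.≤-<-trans (ℕP.m∸n≤m b a) b<q)
      (∣⇒≤ {{ℕ.>-nonZero (ℕP.m<n⇒0<n∸m a<b)}} (∣-mod (mod-trans (mod-≡ (sym (trans (ℤP.m-n≡m⊖n b a) (ℤP.⊖-≥ (ℕP.<⇒≤ a<b))))) (mod-diff⁻¹ h))))
... | tri> _ _ b<a = ⊥-elim (distinct b<a a<q h)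
  where
    distinct : ∀ {a b} → a < b → b < q → ¬ Mod q (+ b) (+ a)
    distinct {a} {b} a<b b<q h = ℕP.<⇒≱ (ℕP.≤-<-trans (ℕP.m∸n≤m b a) b<q)
      (∣⇒≤ {{ℕ.>-nonZero (ℕP.m<n⇒0<n∸m a<b)}} (∣-mod (mod-trans (mod-≡ (sym (trans (ℤP.m-n≡m⊖n b a) (ℤP.⊖-≥ (ℕP.<⇒≤ a<b))))) (mod-diff⁻¹ h))))

mod⇒rem : ∀ {q a b} → 0 < q → Mod q (+ a) (+ b) → rem a q ≡ rem b q
mod⇒rem {q} {a} {b} 0<q h = mod-unique (rem< a 0<q) (rem< b 0<q) (mod-trans (mod-rem q a) (mod-trans h (mod-sym (mod-rem q b))))

rem⇒mod : ∀ {q a b} → rem a q ≡ rem b q → Mod q (+ a) (+ b)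
rem⇒mod {q} {a} {b} h = mod-trans (mod-sym (mod-rem q a)) (mod-trans (mod-≡ (cong +_ h)) (mod-rem q b))

mod? : ∀ {q} → 0 < q → ∀ a b → Dec (Mod q (+ a) (+ b))
mod? {q} 0<q a b with rem a q ≟ rem b q
... | yes h = yes (rem⇒mod h)
... | no ¬h = no (λ h → ¬h (mod⇒rem 0<q h))

pos-^ : ∀ a k → + (a ^ k) ≡ (+ a) ℤ.^ k
pos-^ a zero    = refl
pos-^ a (suc k) = trans (ℤP.pos-* a (a ^ k)) (cong (+ a ℤ.*_) (pos-^ a k))

mod-small≢0 : ∀ {q a} → 0 < a → a < q → ¬ Mod q (+ a) ℤ.0ℤ
mod-small≢0 {q} {a} 0<a a<q h = ℕP.<⇒≱ a<q (∣⇒≤ {{ℕ.>-nonZero 0<a}} (∣-mod h))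

prime>0 : ∀ {q} → Prime q → 0 < q
prime>0 pq = ℕP.<-trans (s≤s z≤n) (prime≥2 pq)

prime∣choose : ∀ {q} k → Prime q → 0 < k → k < q → q ∣ choose q k
prime∣choose {suc q} (suc k) pq _ k<q with euclidsLemma (suc k) (choose (suc q) (suc k)) pq
  (subst (suc q ∣_) (sym (choose-absorb q k)) (m∣m*n (choose q k)))
... | inj₁ q∣k = ⊥-elim (ℕP.<⇒≱ k<q (∣⇒≤ q∣k))
... | inj₂ h   = h

-- Induction on a: in the expansion of (1 + a)^q the inner binomial coefficients are divisible by q.
fermat : ∀ {q} → Prime q → ∀ a → Mod q (+ (a ^ q)) (+ a)
fermat {suc q'} pq zero = mod-refl
fermat {suc q'} pq (suc a) = mod-trans (mod-≡ (cong +_ (trans (binomial q a) (cong (_+ choose q q * a ^ q) (ΣN-suc q' (λ k → choose q k * a ^ k))))))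
  (mod-trans (mod-≡ (trans (cong +_ (shape S (choose q q * a ^ q))) (ℤP.pos-+ (suc (choose q q * a ^ q)) S)))
    (mod-trans (mod-+ {a = + suc (choose q q * a ^ q)} {b = + suc a} (mod-trans (mod-≡ (cong (λ z → + suc (z * a ^ q)) (choose-diag q)))
        (mod-trans (mod-≡ (cong (λ z → + suc z) (ℕP.+-identityʳ (a ^ q)))) (mod-+ {a = + 1} mod-refl (fermat pq a))))
        (mod-trans (mod-≡ (pos-ΣN q' _)) (mod-Σ q' {g = λ _ → ℤ.0ℤ} (λ i i<q' → mod-∣ (∣m⇒∣m*n (a ^ suc i) (prime∣choose (suc i) pq (s≤s z≤n) (s≤s i<q')))))))
      (mod-≡ (trans (cong (ℤ._+_ (+ suc a)) (ΣZ-0 q' (λ _ _ → refl))) (ℤP.+-identityʳ (+ suc a))))))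
  where
    q = suc q'
    S = ΣN q' (λ i → choose q (suc i) * a ^ suc i)
    shape : ∀ s t → 1 + s + t ≡ suc t + s
    shape = ℕ-solve

fermat' : ∀ {q} → Prime q → ∀ {a} → ¬ Mod q (+ a) ℤ.0ℤ → Mod q (+ (a ^ (q ∸ 1))) ℤ.1ℤ
fermat' {suc q'} pq {a} a≢0 = mod-cancel {x = + a} pq a≢0 (mod-trans (mod-≡ (sym (ℤP.pos-* a (a ^ q'))))
  (mod-trans (fermat pq a) (mod-≡ (sym (ℤP.*-identityʳ (+ a))))))

*-^ : ∀ k a b → (a * b) ^ k ≡ a ^ k * b ^ k
*-^ zero    a b = refl
*-^ (suc k) a b = trans (cong (a * b *_) (*-^ k a b)) (rearrange a b (a ^ k) (b ^ k))
  where
    rearrange : ∀ a b x y → a * b * (x * y) ≡ a * x * (b * y)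
    rearrange = ℕ-solve

-- The coefficients are those below the leading 1.
evalM : ∀ {d} → Vec ℤ d → ℤ → ℤ
evalM []       x = ℤ.1ℤ
evalM (c ∷ cs) x = c ℤ.+ x ℤ.* evalM cs x

addMultiple : ∀ {d} → Vec ℤ (suc d) → ℤ → Vec ℤ d → Vec ℤ (suc d)
addMultiple (c ∷ [])          a []       = (c ℤ.+ a) ∷ []
addMultiple (c ∷ cs@(_ ∷ _)) a (b ∷ bs) = (c ℤ.+ a ℤ.* b) ∷ addMultiple cs a bs

evalM-addMultiple : ∀ {d} (cs : Vec ℤ (suc d)) a bs x → evalM (addMultiple cs a bs) x ≡ evalM cs x ℤ.+ a ℤ.* evalM bs x
evalM-addMultiple (c ∷ [])          a []       x = ring c a x
  where
    ring : ∀ c a x → c ℤ.+ a ℤ.+ x ℤ.* ℤ.1ℤ ≡ c ℤ.+ x ℤ.* ℤ.1ℤ ℤ.+ a ℤ.* ℤ.1ℤ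
    ring = ℤ-solve
evalM-addMultiple (c ∷ cs@(_ ∷ _)) a (b ∷ bs) x = trans (cong (λ z → c ℤ.+ a ℤ.* b ℤ.+ x ℤ.* z) (evalM-addMultiple cs a bs x))
  (ring c a b x (evalM cs x) (evalM bs x))
  where
    ring : ∀ c a b x e f → c ℤ.+ a ℤ.* b ℤ.+ x ℤ.* (e ℤ.+ a ℤ.* f) ≡ c ℤ.+ x ℤ.* e ℤ.+ a ℤ.* (b ℤ.+ x ℤ.* f)
    ring = ℤ-solve

-- Synthetic division by x - a. Monic polynomials stay monic, so no leading coefficient has to be
-- tracked.
quotient-at : ∀ {d} → Vec ℤ (suc d) → ℤ → Vec ℤ d
quotient-at (c ∷ [])          a = []
quotient-at (c ∷ cs@(_ ∷ _)) a = addMultiple cs a (quotient-at cs a)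

evalM-quotient : ∀ {d} (cs : Vec ℤ (suc d)) a x → evalM cs x ℤ.- evalM cs a ≡ (x ℤ.- a) ℤ.* evalM (quotient-at cs a) x
evalM-quotient (c ∷ []) a x = ring c a x
  where
    ring : ∀ c a x → (c ℤ.+ x ℤ.* ℤ.1ℤ) ℤ.- (c ℤ.+ a ℤ.* ℤ.1ℤ) ≡ (x ℤ.- a) ℤ.* ℤ.1ℤ
    ring = ℤ-solve
evalM-quotient (c ∷ cs@(_ ∷ _)) a x = begin
  (c ℤ.+ x ℤ.* E x) ℤ.- (c ℤ.+ a ℤ.* E a)
    ≡⟨ ring c a x (E x) (E a) ⟩
  (x ℤ.- a) ℤ.* E x ℤ.+ a ℤ.* (E x ℤ.- E a)
    ≡⟨ cong (λ z → (x ℤ.- a) ℤ.* E x ℤ.+ a ℤ.* z) (evalM-quotient cs a x) ⟩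
  (x ℤ.- a) ℤ.* E x ℤ.+ a ℤ.* ((x ℤ.- a) ℤ.* evalM (quotient-at cs a) x)
    ≡⟨ ring' (x ℤ.- a) (E x) a (evalM (quotient-at cs a) x) ⟩
  (x ℤ.- a) ℤ.* (E x ℤ.+ a ℤ.* evalM (quotient-at cs a) x)
    ≡⟨ cong ((x ℤ.- a) ℤ.*_) (evalM-addMultiple cs a (quotient-at cs a) x) ⟨
  (x ℤ.- a) ℤ.* evalM (addMultiple cs a (quotient-at cs a)) x ∎
  where
    open ≡-Reasoning
    E = evalM cs
    ring : ∀ c a x e f → (c ℤ.+ x ℤ.* e) ℤ.- (c ℤ.+ a ℤ.* f) ≡ (x ℤ.- a) ℤ.* e ℤ.+ a ℤ.* (e ℤ.- f)
    ring = ℤ-solve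
    ring' : ∀ y e a f → y ℤ.* e ℤ.+ a ℤ.* (y ℤ.* f) ≡ y ℤ.* (e ℤ.+ a ℤ.* f)
    ring' = ℤ-solve

-- Lagrange's theorem: a monic polynomial of degree d does not have d + 1 distinct roots modulo a
-- prime. After the factor x - x 0 is divided out, the other roots remain roots of the quotient.
root-bound : ∀ {q} → Prime q → ∀ d (cs : Vec ℤ d) (x : ℕ → ℤ) →
  (∀ i j → i < j → j ≤ d → ¬ Mod q (x j) (x i)) → ¬ (∀ i → i ≤ d → Mod q (evalM cs (x i)) ℤ.0ℤ)
root-bound {q} pq zero [] x distinct roots = ℕP.<⇒≱ (prime≥2 pq) (∣⇒≤ (∣-mod (roots 0 z≤n)))
root-bound {q} pq (suc d) cs x distinct roots = root-bound pq d (quotient-at cs (x 0)) (x ∘ suc)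
  (λ i j i<j j≤d → distinct (suc i) (suc j) (s≤s i<j) (s≤s j≤d)) λ i i≤d →
    case mod-zero-product {x = x (suc i) ℤ.- x 0} {evalM (quotient-at cs (x 0)) (x (suc i))} pq
      (mod-trans (mod-≡ (sym (evalM-quotient cs (x 0) (x (suc i))))) (mod-- (roots (suc i) (s≤s i≤d)) (roots 0 z≤n))) of λ
      { (inj₁ h) → ⊥-elim (distinct 0 (suc i) (s≤s z≤n) (s≤s i≤d) (mod-diff h))
      ; (inj₂ h) → h }

power-roots : ∀ {q} → Prime q → ∀ d (x : ℕ → ℤ) → (∀ i j → i < j → j ≤ suc d → ¬ Mod q (x j) (x i)) →
  ¬ (∀ i → i ≤ suc d → Mod q (x i ℤ.^ suc d) ℤ.1ℤ)
power-roots pq d x distinct roots = root-bound pq (suc d) (ℤ.-1ℤ ∷ V.replicate d ℤ.0ℤ) x distinct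
  (λ i i≤ → mod-trans (mod-≡ (trans (cong (λ z → ℤ.-1ℤ ℤ.+ x i ℤ.* z) (evalM-zeros d (x i))) (ℤP.+-comm ℤ.-1ℤ (x i ℤ.* x i ℤ.^ d)))) (mod-diff⁻¹ (roots i i≤)))
  where
    evalM-zeros : ∀ d x → evalM (V.replicate d ℤ.0ℤ) x ≡ x ℤ.^ d
    evalM-zeros zero    x = refl
    evalM-zeros (suc d) x = trans (ℤP.+-identityˡ (x ℤ.* evalM (V.replicate d ℤ.0ℤ) x)) (cong (x ℤ.*_) (evalM-zeros d x))

-- Orders of elements, generators and discrete logarithms

Order : ℕ → ℕ → ℕ → Set
Order q a d = ∀ j → (Mod q (+ (a ^ j)) ℤ.1ℤ → d ∣ j) × (d ∣ j → Mod q (+ (a ^ j)) ℤ.1ℤ)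

mod-one-^ : ∀ {q a} i j → Mod q (+ (a ^ i)) ℤ.1ℤ → Mod q (+ (a ^ (i * j))) ℤ.1ℤ
mod-one-^ {q} {a} i j h = mod-trans (mod-≡ (trans (cong +_ (sym (ℕP.^-*-assoc a i j))) (pos-^ (a ^ i) j)))
  (mod-trans (mod-^ j h) (mod-≡ (ℤP.^-zeroˡ j)))

∤-power-cancel : ∀ {p d} k t → Prime p → ¬ (p ∣ d) → p ^ k ∣ d * t → p ^ k ∣ t
∤-power-cancel zero    t pp ndiv h = 1∣ t
∤-power-cancel {p} {d} (suc k) t pp ndiv h with euclidsLemma d t pp (∣-trans (m∣m*n (p ^ k)) h)
... | inj₁ p∣d = ⊥-elim (ndiv p∣d)
... | inj₂ (divides t' refl) = subst (p * p ^ k ∣_) (ℕP.*-comm p t') (*-monoʳ-∣ p (∤-power-cancel k t' pp ndiv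
  (*-cancelˡ-∣ p {{ℕ.>-nonZero (prime>0 pp)}} (subst (p * p ^ k ∣_) (rearrange d t' p) h))))
  where
    rearrange : ∀ d t p → d * (t * p) ≡ p * (d * t)
    rearrange = ℕ-solve

∤-cancel-power : ∀ {p d} k t → Prime p → ¬ (p ∣ d) → d ∣ p ^ k * t → d ∣ t
∤-cancel-power zero    t pp ndiv h = subst (_ ∣_) (ℕP.*-identityˡ t) h
∤-cancel-power {p} {d} (suc k) t pp ndiv h with subst (d ∣_) (ℕP.*-assoc p (p ^ k) t) h
... | divides u eq with euclidsLemma u d pp (subst (p ∣_) eq (m∣m*n (p ^ k * t)))
...   | inj₂ p∣d = ⊥-elim (ndiv p∣d)
...   | inj₁ (divides u' refl) = ∤-cancel-power k t pp ndiv (divides u' (ℕP.*-cancelˡ-≡ _ _ p {{ℕ.>-nonZero (prime>0 pp)}}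
        (trans eq (rearrange u' p d))))
  where
    rearrange : ∀ u p d → u * p * d ≡ p * (u * d)
    rearrange = ℕ-solve

module _ {q : ℕ} (pq : Prime q) where
  private
    n : ℕ
    n = q ∸ 1
    0<n : 0 < n
    0<n = ℕP.m<n⇒0<n∸m (prime≥2 pq)
    q≡1+n : suc n ≡ q
    q≡1+n = trans (ℕP.+-comm 1 n) (ℕP.m∸n+n≡m (prime>0 pq))

  unit-^ : ∀ {a} k → ¬ Mod q (+ a) ℤ.0ℤ → ¬ Mod q (+ (a ^ k)) ℤ.0ℤ
  unit-^ zero    h h' = ℕP.<⇒≱ (prime≥2 pq) (∣⇒≤ (∣-mod h'))
  unit-^ {a} (suc k) h h' with mod-zero-product {x = + a} {+ (a ^ k)} pq (mod-trans (mod-≡ (sym (ℤP.pos-* a (a ^ k)))) h')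
  ... | inj₁ z = h z
  ... | inj₂ z = unit-^ k h z

  -- Otherwise 1, ..., d + 1, which are distinct modulo q as d < q - 1, would all be roots of x^d -
  -- 1.
  nonresidue : ∀ d → d < n → 0 < d → ∃ λ x → ¬ Mod q (+ x) ℤ.0ℤ × ¬ Mod q (+ (x ^ d)) ℤ.1ℤ
  nonresidue (suc d) d<n 0<d with ℕP.anyUpTo? (λ i → notOne? i) (suc (suc d))
    where
      notOne? : ∀ i → Dec (¬ Mod q (+ (suc i ^ suc d)) ℤ.1ℤ)
      notOne? i with mod? (prime>0 pq) (suc i ^ suc d) 1
      ... | yes h = no (λ ¬h → ¬h h)
      ... | no ¬h = yes ¬h
  ... | yes (i , i< , h) = suc i , mod-small≢0 (s≤s z≤n) (ℕP.≤-trans (s≤s i<) (ℕP.≤-trans (s≤s d<n) (ℕP.≤-reflexive q≡1+n))) , h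
  ... | no none = ⊥-elim (power-roots pq d (λ i → + suc i)
        (λ i j i<j j≤ h → ℕP.<⇒≢ i<j (sym (ℕP.suc-injective (mod-unique (small j j≤) (small i (ℕP.≤-trans (ℕP.<⇒≤ i<j) j≤)) h))))
        (λ i i≤ → root i i≤))
    where
      small : ∀ i → i ≤ suc d → suc i < q
      small i i≤ = ℕP.≤-trans (s≤s (s≤s i≤)) (ℕP.≤-trans (s≤s d<n) (ℕP.≤-reflexive q≡1+n))
      root : ∀ i → i ≤ suc d → Mod q ((+ suc i) ℤ.^ suc d) ℤ.1ℤ
      root i i≤ with mod? (prime>0 pq) (suc i ^ suc d) 1
      ... | yes h = mod-trans (mod-≡ (sym (pos-^ (suc i) (suc d)))) h
      ... | no ¬h = ⊥-elim (none (i , s≤s i≤ , ¬h))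

  coprime-orders : ∀ {w l j} → Coprime l j → Mod q (+ (w ^ l)) ℤ.1ℤ → Mod q (+ (w ^ j)) ℤ.1ℤ → Mod q (+ w) ℤ.1ℤ
  coprime-orders {w} {l} {j} c hl hj with coprime-Bézout c
  ... | Bézout.+- x y eq = one-of y x j l hj hl (trans eq (ℕP.*-comm x l))
    where
      one-of : ∀ y x j l → Mod q (+ (w ^ j)) ℤ.1ℤ → Mod q (+ (w ^ l)) ℤ.1ℤ → 1 + y * j ≡ l * x → Mod q (+ w) ℤ.1ℤ
      one-of y x j l hj hl eq = mod-trans (mod-≡ (sym (ℤP.*-identityʳ (+ w)))) (mod-trans
        (mod-* {a = + w} mod-refl (mod-sym (mod-trans (mod-≡ (cong (λ z → + (w ^ z)) (ℕP.*-comm y j))) (mod-one-^ j y hj))))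
        (mod-trans (mod-≡ (trans (sym (ℤP.pos-* w (w ^ (y * j)))) (cong (λ z → + (w ^ z)) eq))) (mod-one-^ l x hl)))
  ... | Bézout.-+ x y eq = one-of x y l j hl hj (trans eq (ℕP.*-comm y j))
    where
      one-of : ∀ y x j l → Mod q (+ (w ^ j)) ℤ.1ℤ → Mod q (+ (w ^ l)) ℤ.1ℤ → 1 + y * j ≡ l * x → Mod q (+ w) ℤ.1ℤ
      one-of y x j l hj hl eq = mod-trans (mod-≡ (sym (ℤP.*-identityʳ (+ w)))) (mod-trans
        (mod-* {a = + w} mod-refl (mod-sym (mod-trans (mod-≡ (cong (λ z → + (w ^ z)) (ℕP.*-comm y j))) (mod-one-^ j y hj))))
        (mod-trans (mod-≡ (trans (sym (ℤP.pos-* w (w ^ (y * j)))) (cong (λ z → + (w ^ z)) eq))) (mod-one-^ l x hl)))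

  -- Take x with x^(n / l) ≠ 1 and y = x^m. Then y^(l^(k+1)) = x^n = 1, but y^(l^k) = x^(n / l) ≠ 1,
  -- so the order is the full prime power.
  prime-power-order : ∀ {l} k m → Prime l → n ≡ l ^ suc k * m → ∃ λ y → ¬ Mod q (+ y) ℤ.0ℤ × Order q y (l ^ suc k)
  prime-power-order {l} k m pl n≡ with nonresidue (l ^ k * m) smaller positive
    where
      positive : 0 < l ^ k * m
      positive = ℕP.n≢0⇒n>0 λ eq → ℕP.<⇒≢ 0<n (sym (trans n≡ (trans (ℕP.*-assoc l (l ^ k) m) (trans (cong (l *_) eq) (ℕP.*-zeroʳ l)))))
      smaller : l ^ k * m < n
      smaller = ℕP.<-≤-trans (ℕP.m<m*n (l ^ k * m) l {{ℕ.>-nonZero positive}} (prime≥2 pl))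
        (ℕP.≤-reflexive (trans (ℕP.*-comm (l ^ k * m) l) (trans (sym (ℕP.*-assoc l (l ^ k) m)) (sym n≡))))
  ... | x , x≢0 , x≢1 = x ^ m , unit-^ m x≢0 , λ j → to j , from j
    where
      y^ : ∀ j → (x ^ m) ^ j ≡ x ^ (m * j)
      y^ j = ℕP.^-*-assoc x m j
      full : Mod q (+ ((x ^ m) ^ (l ^ suc k))) ℤ.1ℤ
      full = mod-trans (mod-≡ (cong +_ (trans (y^ (l ^ suc k)) (cong (x ^_) (trans (ℕP.*-comm m (l ^ suc k)) (sym n≡)))))) (fermat' pq x≢0)
      from : ∀ j → l ^ suc k ∣ j → Mod q (+ ((x ^ m) ^ j)) ℤ.1ℤ
      from j (divides t refl) = mod-trans (mod-≡ (cong (λ z → + ((x ^ m) ^ z)) (ℕP.*-comm t (l ^ suc k)))) (mod-one-^ (l ^ suc k) t full)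
      to : ∀ j → Mod q (+ ((x ^ m) ^ j)) ℤ.1ℤ → l ^ suc k ∣ j
      to zero    h = (l ^ suc k) ∣0
      to j@(suc _) h with strip l j (prime≥2 pl) (s≤s z≤n)
      ... | i , j' , j≡ , l∤j' with suc k ≤? i
      ...   | yes k<i with ℕP.m≤n⇒∃[o]m+o≡n k<i
      ...     | o , refl = subst (l ^ suc k ∣_) (sym j≡) (∣m⇒∣m*n j' (subst (l ^ suc k ∣_) (sym (ℕP.^-distribˡ-+-* l (suc k) o)) (m∣m*n (l ^ o))))
      to j@(suc _) h | i , j' , j≡ , l∤j' | no k≮i with ℕP.m≤n⇒∃[o]m+o≡n (ℕP.≤-pred (ℕP.≰⇒> k≮i))
      ...     | o , refl = ⊥-elim (x≢1 (mod-trans (mod-≡ (cong (λ z → + (x ^ z)) (ℕP.*-comm (l ^ (i + o)) m))) (mod-trans (mod-≡ (cong +_ (sym (y^ (l ^ (i + o)))))) w≡1)))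
        where
          -- Here k = i + o. Both w^l and w^j' are 1, and l does not divide j', so w = 1 by Bézout,
          -- against the choice of x.
          w = (x ^ m) ^ (l ^ (i + o))
          w≡1 : Mod q (+ w) ℤ.1ℤ
          w≡1 = coprime-orders {w} {l} {j'}
            (λ {d} (d∣l , d∣j') → [ (λ h → h) , (λ { refl → ⊥-elim (l∤j' d∣j') }) ]′ (prime⇒irreducible pl d∣l))
            (mod-trans (mod-≡ (cong +_ (trans (ℕP.^-*-assoc (x ^ m) (l ^ (i + o)) l) (cong ((x ^ m) ^_) (ℕP.*-comm (l ^ (i + o)) l))))) full)
            (mod-trans (mod-≡ (cong +_ (trans (ℕP.^-*-assoc (x ^ m) (l ^ (i + o)) j') (cong ((x ^ m) ^_) exponents)))) (mod-one-^ j (l ^ o) h))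
            where
              exponents : l ^ (i + o) * j' ≡ j * l ^ o
              exponents = trans (cong (_* j') (ℕP.^-distribˡ-+-* l i o)) (trans (rearrange (l ^ i) (l ^ o) j') (cong (_* l ^ o) (sym j≡)))
                where
                  rearrange : ∀ a b c → a * b * c ≡ a * c * b
                  rearrange = ℕ-solve

  -- One prime power of d is split off at a time: the product of elements of coprime orders has the
  -- product of these orders as its order. At d = n this gives a generator.
  element-of-order : ∀ d → 0 < d → d ∣ n → ∃ λ a → ¬ Mod q (+ a) ℤ.0ℤ × Order q a d
  element-of-order d 0<d d∣n = go d d ℕP.≤-refl 0<d d∣n
    where
      go : ∀ f d → d ≤ f → 0 < d → d ∣ n → ∃ λ a → ¬ Mod q (+ a) ℤ.0ℤ × Order q a d
      go zero    d d≤f 0<d d∣n = ⊥-elim (ℕP.<⇒≱ 0<d d≤f)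
      go (suc f) d d≤f 0<d d∣n with 2 ≤? d
      ... | no ¬2≤ with ℕP.≤-antisym (ℕP.≤-pred (ℕP.≰⇒> ¬2≤)) 0<d
      ...   | refl = 1 , mod-small≢0 (s≤s z≤n) (prime≥2 pq) , λ j → (λ _ → 1∣ j) , (λ _ → mod-≡ (cong +_ (ℕP.^-zeroˡ j)))
      go (suc f) d d≤f 0<d d∣n | yes 2≤d with prime-factor d 2≤d
      ...   | l , pl , l∣d with strip l d (prime≥2 pl) 0<d
      ...     | zero , d' , refl , l∤d' = ⊥-elim (l∤d' (subst (l ∣_) (ℕP.+-identityʳ d') l∣d))
      ...     | suc k , d' , refl , l∤d' with go f d' (ℕP.≤-pred (ℕP.≤-trans smaller d≤f)) d'>0 (∣-trans (n∣m*n (l ^ suc k)) d∣n)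
        where
          d'>0 : 0 < d'
          d'>0 = ℕP.n≢0⇒n>0 λ eq → ℕP.<⇒≢ 0<d (sym (trans (cong (l ^ suc k *_) eq) (ℕP.*-zeroʳ (l ^ suc k))))
          smaller : d' < l ^ suc k * d'
          smaller = ℕP.<-≤-trans (ℕP.m<m*n d' (l ^ suc k) {{ℕ.>-nonZero d'>0}} (ℕP.<-≤-trans (prime≥2 pl)
            (ℕP.m≤m*n l (l ^ k) {{ℕ.>-nonZero (ℕP.m^n>0 l {{ℕ.>-nonZero (prime>0 pl)}} k)}}))) (ℕP.≤-reflexive (ℕP.*-comm d' (l ^ suc k)))
      ...       | a , a≢0 , ord-a with d∣n
      ...         | divides u eq with prime-power-order k (u * d') pl (trans eq (rearrange u (l ^ suc k) d'))
        where
          rearrange : ∀ u p d → u * (p * d) ≡ p * (u * d)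
          rearrange = ℕ-solve
      ...           | y , y≢0 , ord-y = a * y , (λ h → [ a≢0 , y≢0 ]′ (mod-zero-product {x = + a} {+ y} pq (mod-trans (mod-≡ (sym (ℤP.pos-* a y))) h))) ,
                      λ j → to j , from j
        where
          P = l ^ suc k
          split : ∀ j → + ((a * y) ^ j) ≡ + (a ^ j) ℤ.* + (y ^ j)
          split j = trans (cong +_ (*-^ j a y)) (ℤP.pos-* (a ^ j) (y ^ j))
          from : ∀ j → P * d' ∣ j → Mod q (+ ((a * y) ^ j)) ℤ.1ℤ
          from j h = mod-trans (mod-≡ (split j)) (mod-* (proj₂ (ord-a j) (∣-trans (n∣m*n P) h)) (proj₂ (ord-y j) (∣-trans (m∣m*n d') h)))
          to : ∀ j → Mod q (+ ((a * y) ^ j)) ℤ.1ℤ → P * d' ∣ j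
          to j h = combine (∤-cancel-power (suc k) j pl l∤d' (subst (d' ∣_) (ℕP.*-comm j P) d'∣jP)) P∣jd'
            where
              d'∣jP : d' ∣ j * P
              d'∣jP = proj₁ (ord-a (j * P)) (mod-trans (mod-≡ (sym (ℤP.*-identityʳ (+ (a ^ (j * P))))))
                (mod-trans (mod-* {a = + (a ^ (j * P))} mod-refl (mod-sym (proj₂ (ord-y (j * P)) (n∣m*n j))))
                  (mod-trans (mod-≡ (sym (split (j * P)))) (mod-one-^ j P h))))
              P∣jd' : P ∣ j * d'
              P∣jd' = proj₁ (ord-y (j * d')) (mod-trans (mod-≡ (sym (ℤP.*-identityˡ (+ (y ^ (j * d'))))))
                (mod-trans (mod-* {c = + (y ^ (j * d'))} (mod-sym (proj₂ (ord-a (j * d')) (n∣m*n j))) mod-refl)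
                  (mod-trans (mod-≡ (sym (split (j * d')))) (mod-one-^ j d' h))))
              combine : d' ∣ j → P ∣ j * d' → P * d' ∣ j
              combine (divides t refl) h = *-monoˡ-∣ d' (∤-power-cancel (suc k) t pl l∤d' (∤-power-cancel (suc k) (d' * t) pl l∤d'
                (subst (P ∣_) (rearrange t d') h)))
                where
                  rearrange : ∀ t d → t * d * d ≡ d * (d * t)
                  rearrange = ℕ-solve

  record Generator (g : ℕ) : Set where
    field
      unit  : ¬ Mod q (+ g) ℤ.0ℤ
      order : ∀ k → 0 < k → k < n → ¬ Mod q (+ (g ^ k)) ℤ.1ℤ

  generator-exists : ∃ λ g → g < q × Generator g
  generator-exists with element-of-order n 0<n ∣-refl
  ... | a , a≢0 , ord = rem a q , rem< a (prime>0 pq) , record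
    { unit  = λ h → a≢0 (mod-trans (mod-sym (mod-rem q a)) h)
    ; order = λ k 0<k k<n h → ℕP.<⇒≱ k<n (∣⇒≤ {{ℕ.>-nonZero 0<k}} (proj₁ (ord k)
        (mod-trans (mod-≡ (pos-^ a k)) (mod-trans (mod-^ k (mod-sym (mod-rem q a))) (mod-trans (mod-≡ (sym (pos-^ (rem a q) k))) h))))) }

  module _ {g : ℕ} (G : Generator g) where
    open Generator G

    powers-distinct : ∀ i j → i < j → j < n → ¬ Mod q (+ (g ^ j)) (+ (g ^ i))
    powers-distinct i j i<j j<n h with ℕP.m≤n⇒∃[o]m+o≡n (ℕP.<⇒≤ i<j)
    ... | o , refl = order o (ℕP.n≢0⇒n>0 λ { refl → ℕP.<⇒≢ i<j (sym (ℕP.+-identityʳ i)) }) (ℕP.≤-<-trans (ℕP.m≤n+m o i) j<n)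
      (mod-cancel {x = + (g ^ i)} pq (unit-^ i unit) (mod-trans (mod-≡ (trans (sym (ℤP.pos-* (g ^ i) (g ^ o))) (cong +_ (sym (ℕP.^-distribˡ-+-* g i o)))))
        (mod-trans h (mod-≡ (sym (ℤP.*-identityʳ (+ (g ^ i))))))))

    -- If a were no power of g, then the n distinct powers of g and a itself would be n + 1 roots of
    -- x^n - 1, where n = q - 1.
    discrete-log : ∀ a → ¬ Mod q (+ a) ℤ.0ℤ → ∃ λ i → i < n × Mod q (+ (g ^ i)) (+ a)
    discrete-log a a≢0 with ℕP.anyUpTo? (λ i → mod? (prime>0 pq) (g ^ i) a) n
    ... | yes h = h
    ... | no none = ⊥-elim (contradictory n refl)
      where
        contradictory : ∀ m → n ≡ m → ⊥
        contradictory zero    n≡ = ℕP.<⇒≢ 0<n (sym n≡)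
        contradictory (suc d) n≡ = power-roots pq d x distinct roots
          where
            x : ℕ → ℤ
            x i with i <? n
            ... | yes _ = + (g ^ i)
            ... | no  _ = + a
            distinct : ∀ i j → i < j → j ≤ suc d → ¬ Mod q (x j) (x i)
            distinct i j i<j j≤ h with i <? n | j <? n
            ... | yes i< | yes j< = powers-distinct i j i<j j< h
            ... | yes i< | no _   = none (i , i< , mod-sym h)
            ... | no i≮  | _      = i≮ (ℕP.<-≤-trans i<j (ℕP.≤-trans j≤ (ℕP.≤-reflexive (sym n≡))))
            power-one : ∀ b → ¬ Mod q (+ b) ℤ.0ℤ → Mod q ((+ b) ℤ.^ suc d) ℤ.1ℤ
            power-one b b≢0 = mod-trans (mod-≡ (trans (sym (pos-^ b (suc d))) (cong (λ z → + (b ^ z)) (sym n≡)))) (fermat' pq b≢0)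
            roots : ∀ i → i ≤ suc d → Mod q (x i ℤ.^ suc d) ℤ.1ℤ
            roots i i≤ with i <? n
            ... | yes _ = power-one (g ^ i) (unit-^ i unit)
            ... | no  _ = power-one a a≢0

minimal : ∀ b {P : ℕ → ℕ} → (∃ λ g → g < b × P g ≢ 0) → ∃ λ m → m < b × P m ≢ 0 × (∀ j → j < m → P j ≡ 0)
minimal (suc b) {P} (g , g< , Pg) with all-zero b
  where
    all-zero : ∀ b → (∃ λ g → g < b × P g ≢ 0) ⊎ (∀ j → j < b → P j ≡ 0)
    all-zero zero    = inj₂ λ _ ()
    all-zero (suc b) with all-zero b | P b ≟ 0
    ... | inj₁ (g , g< , h) | _ = inj₁ (g , ℕP.m<n⇒m<1+n g< , h)
    ... | inj₂ _ | no h = inj₁ (b , ℕP.≤-refl , h)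
    ... | inj₂ z | yes h = inj₂ λ j j< → case j ≟ b of λ { (yes refl) → h ; (no j≢b) → z j (ℕP.≤∧≢⇒< (ℕP.≤-pred j<) j≢b) }
... | inj₁ below = let m , m< , h , z = minimal b below in m , ℕP.m<n⇒m<1+n m< , h , z
... | inj₂ zeros with g ≟ b
...   | yes refl = g , g< , Pg , zeros
...   | no g≢b = ⊥-elim (Pg (zeros g (ℕP.≤∧≢⇒< (ℕP.≤-pred g<) g≢b)))

-- A sum with b terms, so that it stays within the class of easy functions; if P vanishes below b, the value is b.
least : ℕ → (ℕ → ℕ) → ℕ
least b P = ΣN b (λ g → eqn (ΣN (suc g) P) 0)

least-spec : ∀ b {P : ℕ → ℕ} → (∃ λ g → g < b × P g ≢ 0) → least b P < b × P (least b P) ≢ 0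
least-spec b {P} hit with minimal b {P} hit
... | m , m<b , Pm , zeros = subst (λ z → z < b × P z ≢ 0) (sym least≡m) (m<b , Pm)
  where
    least≡m : least b P ≡ m
    least≡m = trans (ΣN-truncate (ℕP.<⇒≤ m<b) (λ i m≤i _ → eqn-no (λ z → Pm (ΣN-zero⁻¹ (suc i) z m (s≤s m≤i)))))
      (trans (ΣN-cong m (λ i i<m → eqn-yes (ΣN-0 (suc i) (λ j j≤i → zeros j (ℕP.≤-<-trans (ℕP.≤-pred j≤i) i<m)))))
        (trans (ΣN-const m 1) (ℕP.*-identityʳ m)))

genTest : ℕ → ℕ → ℕ
genTest q g = le 1 g * eqn (ΣN (q ∸ 1) (λ k → le 1 k * eqn (rem (g ^ k) q) 1)) 0

-- The existence proof gives no easy function of q. The least generator can be found by search, and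
-- being canonical it is a common base for all logarithms modulo q.
genOf : ℕ → ℕ
genOf q = least q (genTest q)

module _ {q : ℕ} (pq : Prime q) where
  private
    0<q : 0 < q
    0<q = prime>0 pq

  genTest-pass : ∀ {g} → g < q → Generator pq g → genTest q g ≢ 0
  genTest-pass {g} g<q G h = case trans (sym (cong₂ _*_ (le-yes g≥1) (eqn-yes (ΣN-0 (q ∸ 1) none)))) h of λ ()
    where
      open Generator G
      g≥1 : 1 ≤ g
      g≥1 = ℕP.n≢0⇒n>0 λ { refl → unit mod-refl }
      none : ∀ k → k < q ∸ 1 → le 1 k * eqn (rem (g ^ k) q) 1 ≡ 0
      none zero    _  = cong (_* eqn (rem (g ^ 0) q) 1) (le-no {1} {0} ℕP.≤-refl)
      none (suc k) k< = trans (cong (le 1 (suc k) *_) (eqn-no λ r → order (suc k) (s≤s z≤n) k<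
        (mod-trans (mod-sym (mod-rem q (g ^ suc k))) (mod-≡ (cong +_ r))))) (ℕP.*-zeroʳ (le 1 (suc k)))

  genTest-sound : ∀ {g} → g < q → genTest q g ≢ 0 → Generator pq g
  genTest-sound {g} g<q h = record
    { unit  = mod-small≢0 g≥1 g<q
    ; order = λ k 0<k k< m → contradiction k 0<k k< (mod-unique (rem< (g ^ k) 0<q) (prime≥2 pq) (mod-trans (mod-rem q (g ^ k)) m)) }
    where
      g≥1 : 1 ≤ g
      g≥1 with 1 ≤? g
      ... | yes p = p
      ... | no ¬p = ⊥-elim (h (cong (_* eqn (ΣN (q ∸ 1) (λ k → le 1 k * eqn (rem (g ^ k) q) 1)) 0) (le-no (ℕP.≰⇒> ¬p))))
      contradiction : ∀ k → 0 < k → k < q ∸ 1 → rem (g ^ k) q ≢ 1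
      contradiction k 0<k k< r = h (trans (cong (le 1 g *_) (eqn-no λ z → case trans (sym (cong₂ _*_ (le-yes 0<k) (eqn-yes r)))
        (ΣN-zero⁻¹ (q ∸ 1) z k k<) of λ ())) (ℕP.*-zeroʳ (le 1 g)))

  genOf-spec : genOf q < q × Generator pq (genOf q)
  genOf-spec = let
      g , g< , G = generator-exists pq
      m< , h = least-spec q {genTest q} (g , g< , genTest-pass g< G)
    in m< , genTest-sound m< h

-- The powers of the generator below q - 1 are distinct, so at most one term has a nonzero test, and
-- the sum returns its exponent.
dlog : ℕ → ℕ → ℕ
dlog q a = ΣN (q ∸ 1) (λ k → k * eqn (rem (genOf q ^ k) q) (rem a q))

dlog-spec : ∀ {q} → Prime q → ∀ a → ¬ Mod q (+ a) ℤ.0ℤ → Mod q (+ (genOf q ^ dlog q a)) (+ a)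
dlog-spec {q} pq a a≢0 with discrete-log pq (proj₂ (genOf-spec pq)) a a≢0
... | i , i< , h = subst (λ z → Mod q (+ (genOf q ^ z)) (+ a)) (sym dlog≡i) h
  where
    g = genOf q
    G = proj₂ (genOf-spec pq)
    other : ∀ j → j < q ∸ 1 → j ≢ i → ¬ Mod q (+ (g ^ j)) (+ (g ^ i))
    other j j< j≢i m with ℕP.<-cmp i j
    ... | tri< i<j _ _ = powers-distinct pq G i j i<j j< m
    ... | tri≈ _ i≡j _ = j≢i (sym i≡j)
    ... | tri> _ _ j<i = powers-distinct pq G j i j<i i< (mod-sym m)
    dlog≡i : dlog q a ≡ i
    dlog≡i = trans (ΣN-single (q ∸ 1) i< (λ j j< j≢i → trans (cong (j *_) (eqn-no λ r →
        other j j< j≢i (mod-trans (rem⇒mod r) (mod-sym h)))) (ℕP.*-zeroʳ j)))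
      (trans (cong (i *_) (eqn-yes (mod⇒rem (prime>0 pq) h))) (ℕP.*-identityʳ i))

-- A product of exponentially many factors becomes a sum, of discrete logarithms.
prodMod : ℕ → ℕ → (ℕ → ℕ) → ℕ
prodMod q J a = ite (eqn (ΣN J (λ i → eqn (rem (a i) q) 0)) 0) (rem (genOf q ^ ΣN J (λ i → dlog q (a i))) q) 0

-- A factor divisible by q has no logarithm. So the number of such factors is counted before
-- anything else, and logarithms are relied on only if it is 0.
prodMod-spec : ∀ {q} → Prime q → ∀ J a → prodMod q J a ≡ rem (ΠN J a) q
prodMod-spec {q} pq J a with ΣN J (λ i → eqn (rem (a i) q) 0) ≟ 0
... | yes none = trans (ite-yes X 0 (eqn-yes none)) (mod⇒rem (prime>0 pq) (go J λ i i< h →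
        case trans (sym (eqn-yes (trans (mod⇒rem (prime>0 pq) h) (rem-small (prime>0 pq))))) (ΣN-zero⁻¹ J none i i<) of λ ()))
  where
    g = genOf q
    X = rem (g ^ ΣN J (λ i → dlog q (a i))) q
    go : ∀ J → (∀ i → i < J → ¬ Mod q (+ (a i)) ℤ.0ℤ) → Mod q (+ (g ^ ΣN J (λ i → dlog q (a i)))) (+ ΠN J a)
    go zero    units = mod-refl
    go (suc J) units = mod-trans (mod-≡ (trans (cong +_ (ℕP.^-distribˡ-+-* g (ΣN J _) (dlog q (a J)))) (ℤP.pos-* (g ^ ΣN J (λ i → dlog q (a i))) _)))
      (mod-trans (mod-* (go J (λ i i< → units i (ℕP.m<n⇒m<1+n i<))) (dlog-spec pq (a J) (units J ℕP.≤-refl))) (mod-≡ (sym (ℤP.pos-* (ΠN J a) (a J)))))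
... | no some = trans (ite-no (rem (genOf q ^ ΣN J (λ i → dlog q (a i))) q) 0 (eqn-no some)) (sym (∣⇒rem≡0 (prime>0 pq) (go J some)))
  where
    go : ∀ J → ΣN J (λ i → eqn (rem (a i) q) 0) ≢ 0 → q ∣ ΠN J a
    go zero    h = ⊥-elim (h refl)
    go (suc J) h with rem (a J) q ≟ 0
    ... | yes z = ∣n⇒∣m*n (ΠN J a) (rem≡0⇒∣ z)
    ... | no nz = ∣m⇒∣m*n (a J) (go J λ z → h (cong₂ _+_ z (eqn-no nz)))

inv : ℕ → ℕ → ℕ
inv q x = rem (x ^ (q ∸ 2)) q

inv-spec : ∀ {q} → Prime q → ∀ {x} → ¬ Mod q (+ x) ℤ.0ℤ → Mod q (+ x ℤ.* + inv q x) ℤ.1ℤ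
inv-spec {suc (suc q)} pq {x} x≢0 = mod-trans (mod-* {a = + x} mod-refl (mod-rem (suc (suc q)) (x ^ q)))
  (mod-trans (mod-≡ (sym (ℤP.pos-* x (x ^ q)))) (fermat' pq x≢0))
inv-spec {zero} pq = ⊥-elim (¬prime[0] pq)
inv-spec {suc zero} pq = ⊥-elim (¬prime[1] pq)

-- Fourier inversion over a prime field

power-sum : ℕ → ℕ → ℕ
power-sum q k = ΣN q (λ x → x ^ k)

-- Telescoping Σ_{x<q} ((x+1)^(k+1) - x^(k+1)) = q^(k+1).
power-sum-recurrence : ∀ q k → ΣN (suc k) (λ j → choose (suc k) j * power-sum q j) ≡ q ^ suc k
power-sum-recurrence q k = ℕP.+-cancelʳ-≡ (power-sum q (suc k)) _ _ (begin
  ΣN (suc k) (λ j → choose (suc k) j * power-sum q j) + power-sum q (suc k)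
    ≡⟨ cong₂ _+_ (ΣN-cong (suc k) (λ j _ → sym (ΣN-*ˡ q (choose (suc k) j) _))) (trans (sym (ℕP.*-identityˡ _)) (cong (_* power-sum q (suc k)) (sym (choose-diag (suc k))))) ⟩
  ΣN (suc k) (λ j → ΣN q (λ x → choose (suc k) j * x ^ j)) + choose (suc k) (suc k) * power-sum q (suc k)
    ≡⟨ cong₂ _+_ (ΣN-swap (suc k) q _) (sym (ΣN-*ˡ q (choose (suc k) (suc k)) _)) ⟩
  ΣN q (λ x → ΣN (suc k) (λ j → choose (suc k) j * x ^ j)) + ΣN q (λ x → choose (suc k) (suc k) * x ^ suc k)
    ≡⟨ ΣN-+ q _ _ ⟨
  ΣN q (λ x → ΣN (suc (suc k)) (λ j → choose (suc k) j * x ^ j))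
    ≡⟨ ΣN-cong q (λ x _ → sym (binomial (suc k) x)) ⟩
  ΣN q (λ x → suc x ^ suc k)
    ≡⟨ ΣN-suc q (λ x → x ^ suc k) ⟨
  power-sum q (suc k) + q ^ suc k
    ≡⟨ ℕP.+-comm (power-sum q (suc k)) _ ⟩
  q ^ suc k + power-sum q (suc k) ∎)
  where
    open ≡-Reasoning

-- Strong induction with the recurrence: modulo q only the term with coefficient C(k+1, k) = k + 1
-- remains, and k + 1 < q is a unit.
power-sum-zero : ∀ {q} → Prime q → ∀ k → k < q ∸ 1 → q ∣ power-sum q k
power-sum-zero {q} pq k k< = go (suc k) k< k ℕP.≤-refl
  where
    ∣-ΣN : ∀ n {f : ℕ → ℕ} → (∀ i → i < n → q ∣ f i) → q ∣ ΣN n f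
    ∣-ΣN zero    h = q ∣0
    ∣-ΣN (suc n) h = ∣m∣n⇒∣m+n (∣-ΣN n (λ i i< → h i (ℕP.m<n⇒m<1+n i<))) (h n ℕP.≤-refl)
    go : ∀ k → k ≤ q ∸ 1 → ∀ j → j < k → q ∣ power-sum q j
    go (suc k) k< j j<1+k with j ≟ k
    ... | no j≢k = go k (ℕP.<⇒≤ k<) j (ℕP.≤∧≢⇒< (ℕP.≤-pred j<1+k) j≢k)
    ... | yes refl with euclidsLemma (choose (suc k) k) (power-sum q k) pq
          (∣m+n∣m⇒∣n {m = ΣN k (λ j → choose (suc k) j * power-sum q j)} (subst (q ∣_) (sym (power-sum-recurrence q k)) (m∣m*n (q ^ k)))
            (∣-ΣN k (λ i i<k → ∣n⇒∣m*n (choose (suc k) i) (go k (ℕP.<⇒≤ k<) i i<k))))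
    ...   | inj₂ h = h
    ...   | inj₁ h = ⊥-elim (ℕP.<⇒≱ (ℕP.<-≤-trans (s≤s k<) (ℕP.≤-reflexive (trans (ℕP.+-comm 1 (q ∸ 1)) (ℕP.m∸n+n≡m (prime>0 pq)))))
              (∣⇒≤ (subst (q ∣_) (choose-pred k) h)))
      where
        choose-pred : ∀ k → choose (suc k) k ≡ suc k
        choose-pred zero    = refl
        choose-pred (suc k) = trans (cong₂ _+_ (choose-pred k) (choose-diag (suc k))) (ℕP.+-comm (suc k) 1)

-- The factor x^((q - 1) - e) stands for x^(-e) on the units; since e < q - 1 it vanishes at x = 0,
-- so the sum may run over the whole field.
orthogonality : ∀ {q} → Prime q → ∀ e e' → e < q ∸ 1 → e' < q ∸ 1 →
  Mod q (ΣZ q (λ x → (+ x) ℤ.^ (e' + ((q ∸ 1) ∸ e)))) (ℤ.- + eqn e e')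
orthogonality {q} pq e e' e< e'< = mod-trans (mod-≡ (trans (ΣZ-cong q (λ x _ → sym (pos-^ x (e' + ((q ∸ 1) ∸ e))))) (sym (pos-ΣN q _)))) (sum-cases (ℕP.<-cmp e' e))
  where
    n = q ∸ 1
    zero-sum : ∀ k → k < n → Mod q (+ power-sum q k) (ℤ.- + 0)
    zero-sum k k< = mod-∣ (power-sum-zero pq k k<)
    q≡ : q ≡ suc n
    q≡ = sym (trans (ℕP.+-comm 1 n) (ℕP.m∸n+n≡m (prime>0 pq)))
    0<n : 0 < n
    0<n = ℕP.m<n⇒0<n∸m (prime≥2 pq)
    sum-cases : Tri (e' < e) (e' ≡ e) (e < e') → Mod q (+ power-sum q (e' + (n ∸ e))) (ℤ.- + eqn e e')
    sum-cases (tri< e'<e _ _) = subst (λ z → Mod q (+ power-sum q (e' + (n ∸ e))) (ℤ.- + z)) (sym (eqn-no (λ h → ℕP.<⇒≢ e'<e (sym h))))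
      (zero-sum _ (ℕP.<-≤-trans (ℕP.+-monoˡ-< (n ∸ e) e'<e) (ℕP.≤-reflexive (ℕP.m+[n∸m]≡n (ℕP.<⇒≤ e<)))))
    sum-cases (tri≈ _ refl _) = subst (λ z → Mod q (+ power-sum q (e' + (n ∸ e))) (ℤ.- + z)) (sym (eqn-refl e))
      (mod-trans (mod-≡ (cong (λ z → + power-sum q z) (ℕP.m+[n∸m]≡n (ℕP.<⇒≤ e<))))
        (mod-trans (mod-≡ (trans (cong (λ z → + power-sum z n) q≡) (trans (cong +_ (ΣN-suc n (λ x → x ^ n))) (pos-sum n 0<n))))
          (mod-trans (mod-Σ n {g = λ _ → ℤ.1ℤ} (λ i i< → fermat' pq (mod-small≢0 (s≤s z≤n) (ℕP.<-≤-trans (s≤s i<) (ℕP.≤-reflexive (sym q≡))))))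
            (mod-trans (mod-≡ (trans (sym (pos-ΣN n (λ _ → 1))) (cong +_ (trans (ΣN-const n 1) (ℕP.*-identityʳ n))))) (congr ℤ.1ℤ (minus-one n q q≡))))))
      where
        pos-sum : ∀ n → 0 < n → + (0 ^ n + ΣN n (λ i → suc i ^ n)) ≡ ΣZ n (λ i → + (suc i ^ n))
        pos-sum (suc n) _ = pos-ΣN (suc n) (λ i → suc i ^ suc n)
        minus-one : ∀ n q → q ≡ suc n → + n ≡ ℤ.- + 1 ℤ.+ ℤ.1ℤ ℤ.* + q
        minus-one n _ refl = sym (cong (ℤ._+_ (ℤ.- + 1)) (ℤP.*-identityˡ (+ suc n)))
    sum-cases (tri> _ _ e<e') = subst (λ z → Mod q (+ power-sum q (e' + (n ∸ e))) (ℤ.- + z)) (sym (eqn-no (ℕP.<⇒≢ e<e')))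
      (mod-trans (mod-≡ (pos-ΣN q _)) (mod-trans (mod-Σ q (λ x x<q → reduce x x<q)) (mod-trans (mod-≡ (sym (pos-ΣN q (λ x → x ^ (e' ∸ e))))) (zero-sum (e' ∸ e) (ℕP.≤-<-trans (ℕP.m∸n≤m e' e) e'<)))))
      where
        exponent : e' + (n ∸ e) ≡ n + (e' ∸ e)
        exponent = begin
          e' + (n ∸ e)                ≡⟨ cong (_+ (n ∸ e)) (sym (ℕP.m∸n+n≡m (ℕP.<⇒≤ e<e'))) ⟩
          e' ∸ e + e + (n ∸ e)        ≡⟨ ℕP.+-assoc (e' ∸ e) e (n ∸ e) ⟩
          e' ∸ e + (e + (n ∸ e))      ≡⟨ cong (λ z → e' ∸ e + z) (ℕP.m+[n∸m]≡n (ℕP.<⇒≤ e<)) ⟩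
          e' ∸ e + n                  ≡⟨ ℕP.+-comm (e' ∸ e) n ⟩
          n + (e' ∸ e)                ∎
          where open ≡-Reasoning
        -- Fermat removes q - 1 from the exponent at units. At x = 0 it does not apply, but both
        -- powers are 0 because e' - e > 0.
        reduce : ∀ x → x < q → Mod q (+ (x ^ (e' + (n ∸ e)))) (+ (x ^ (e' ∸ e)))
        reduce zero x<q = mod-≡ (cong +_ (trans (zero-power (subst (0 <_) (sym exponent) (ℕP.<-≤-trans 0<n (ℕP.m≤m+n n (e' ∸ e))))) (sym (zero-power (ℕP.m<n⇒0<n∸m e<e')))))
          where
            zero-power : ∀ {k} → 0 < k → 0 ^ k ≡ 0
            zero-power {suc k} _ = refl
        reduce (suc x) x<q = mod-trans (mod-≡ (trans (cong (λ z → + (suc x ^ z)) exponent) (trans (cong +_ (ℕP.^-distribˡ-+-* (suc x) n (e' ∸ e))) (ℤP.pos-* (suc x ^ n) _))))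
          (mod-trans (mod-* (fermat' pq (mod-small≢0 (s≤s z≤n) x<q)) (mod-refl {a = + (suc x ^ (e' ∸ e))})) (mod-≡ (ℤP.*-identityˡ (+ (suc x ^ (e' ∸ e))))))

-- The base-q digits of X run through all points of the grid, so that distributivity turns the sum
-- over points into a product of one-variable sums.
sum-of-products : ∀ q u (h : ℕ → ℕ → ℤ) → 0 < q →
  ΣZ (q ^ u) (λ X → ΠZ u (λ i → h i (digit q X i))) ≡ ΠZ u (λ i → ΣZ q (h i))
sum-of-products q zero    h 0<q = refl
sum-of-products q (suc u) h 0<q = begin
  ΣZ (q * q ^ u) body
    ≡⟨ cong (λ z → ΣZ z body) (ℕP.*-comm q (q ^ u)) ⟩
  ΣZ (q ^ u * q) body
    ≡⟨ ΣZ-* (q ^ u) q body ⟩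
  ΣZ (q ^ u) (λ X → ΣZ q (λ x → body (X * q + x)))
    ≡⟨ ΣZ-cong (q ^ u) (λ X _ → ΣZ-cong q (λ x x<q → peel X x x<q)) ⟩
  ΣZ (q ^ u) (λ X → ΣZ q (λ x → h 0 x ℤ.* rest X))
    ≡⟨ ΣZ-cong (q ^ u) (λ X _ → ΣZ-*ʳ q (rest X) (h 0)) ⟩
  ΣZ (q ^ u) (λ X → ΣZ q (h 0) ℤ.* rest X)
    ≡⟨ ΣZ-*ˡ (q ^ u) (ΣZ q (h 0)) rest ⟩
  ΣZ q (h 0) ℤ.* ΣZ (q ^ u) rest
    ≡⟨ cong (ΣZ q (h 0) ℤ.*_) (sum-of-products q u (h ∘ suc) 0<q) ⟩
  ΣZ q (h 0) ℤ.* ΠZ u (λ i → ΣZ q (h (suc i)))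
    ≡⟨ ΠZ-suc u _ ⟨
  ΠZ (suc u) (λ i → ΣZ q (h i)) ∎
  where
    open ≡-Reasoning
    body rest : ℕ → ℤ
    body X = ΠZ (suc u) (λ i → h i (digit q X i))
    rest X = ΠZ u (λ i → h (suc i) (digit q X i))
    peel : ∀ X x → x < q → body (X * q + x) ≡ h 0 x ℤ.* rest X
    peel X x x<q = trans (ΠZ-suc u _) (cong₂ ℤ._*_ (cong (h 0) (trans (digit-0 q (X * q + x)) (trans (cong (λ z → rem z q) (ℕP.+-comm (X * q) x)) (proj₂ (quo-rem-unique {x} {X} x<q)))))
      (ΠZ-cong u (λ i _ → cong (h (suc i)) (trans (digit-suc q (X * q + x) i) (cong (λ z → digit q z i) (trans (cong (λ z → quo z q) (ℕP.+-comm (X * q) x)) (proj₁ (quo-rem-unique {x} {X} x<q))))))))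

ΠZ-0 : ∀ n {f : ℕ → ℤ} {i} → i < n → f i ≡ ℤ.0ℤ → ΠZ n f ≡ ℤ.0ℤ
ΠZ-0 (suc n) {f} {i} i<1+n h with i ≟ n
... | yes refl = trans (cong (ΠZ n f ℤ.*_) h) (ℤP.*-zeroʳ (ΠZ n f))
... | no i≢n = trans (cong (ℤ._* f n) (ΠZ-0 n (ℕP.≤∧≢⇒< (ℕP.≤-pred i<1+n) i≢n) h)) (ℤP.*-zeroˡ (f n))

digits-differ : ∀ W T h h' → h < W ^ T → h' < W ^ T → h ≢ h' → ∃ λ i → i < T × digit W h i ≢ digit W h' i
digits-differ W T h h' h< h'< h≢ with search T
  where
    search : ∀ t → (∃ λ i → i < t × digit W h i ≢ digit W h' i) ⊎ (∀ i → i < t → digit W h i ≡ digit W h' i)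
    search zero    = inj₂ λ _ ()
    search (suc t) with search t | digit W h t ≟ digit W h' t
    ... | inj₁ (i , i< , ne) | _ = inj₁ (i , ℕP.m<n⇒m<1+n i< , ne)
    ... | inj₂ _ | no ne = inj₁ (t , ℕP.≤-refl , ne)
    ... | inj₂ same | yes eq = inj₂ λ i i< → case i ≟ t of λ { (yes refl) → eq ; (no i≢t) → same i (ℕP.≤∧≢⇒< (ℕP.≤-pred i<) i≢t) }
... | inj₁ found = found
... | inj₂ same = ⊥-elim (h≢ (trans (sym (fromDigits-digit W T h h<)) (trans (fromDigits-cong W T same) (fromDigits-digit W T h' h'<))))

-- E packs the exponent vector as base-B digits; thus a sum over exponent vectors is a sum over an
-- initial segment of numbers.
monomial : ℕ → ℕ → (ℕ → ℤ) → ℕ → ℤ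
monomial B u x E = ΠZ u (λ i → x i ℤ.^ digit B E i)

-- Modulo q, Σ_x x^k over F_q is -1 if q - 1 divides k > 0, and 0 for the other k < 2 (q - 1).
fourier : ∀ {q} → Prime q → ∀ B u (c : ℕ → ℤ) → B ≤ q ∸ 1 → 0 < B → ∀ E → E < B ^ u →
  Mod q (ΣZ (q ^ u) (λ X → ΣZ (B ^ u) (λ E' → c E' ℤ.* monomial B u (λ i → + digit q X i) E')
           ℤ.* ΠZ u (λ i → (+ digit q X i) ℤ.^ ((q ∸ 1) ∸ digit B E i))))
        (ℤ.-1ℤ ℤ.^ u ℤ.* c E)
fourier {q} pq B u c B≤ 0<B E E< = mod-trans (mod-≡ rearranged) (mod-trans
    (mod-Σ (B ^ u) (λ E' _ → mod-* {a = c E'} mod-refl (mod-Π u (λ i _ →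
      orthogonality pq (digit B E i) (digit B E' i) (ℕP.<-≤-trans (digit< E i 0<B) B≤) (ℕP.<-≤-trans (digit< E' i 0<B) B≤)))))
    (mod-≡ pick))
  where
    open ≡-Reasoning
    n = q ∸ 1
    x : ℕ → ℕ → ℤ
    x X i = + digit q X i
    W : ℕ → ℤ
    W X = ΠZ u (λ i → x X i ℤ.^ (n ∸ digit B E i))
    rearranged : ΣZ (q ^ u) (λ X → ΣZ (B ^ u) (λ E' → c E' ℤ.* monomial B u (x X) E') ℤ.* W X)
      ≡ ΣZ (B ^ u) (λ E' → c E' ℤ.* ΠZ u (λ i → ΣZ q (λ y → (+ y) ℤ.^ (digit B E' i + (n ∸ digit B E i)))))
    rearranged = begin
      ΣZ (q ^ u) (λ X → ΣZ (B ^ u) (λ E' → c E' ℤ.* monomial B u (x X) E') ℤ.* W X)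
        ≡⟨ ΣZ-cong (q ^ u) (λ X _ → trans (sym (ΣZ-*ʳ (B ^ u) (W X) _)) (ΣZ-cong (B ^ u) (λ E' _ → merge X E'))) ⟩
      ΣZ (q ^ u) (λ X → ΣZ (B ^ u) (λ E' → c E' ℤ.* ΠZ u (λ i → x X i ℤ.^ (digit B E' i + (n ∸ digit B E i)))))
        ≡⟨ ΣZ-swap (q ^ u) (B ^ u) _ ⟩
      ΣZ (B ^ u) (λ E' → ΣZ (q ^ u) (λ X → c E' ℤ.* ΠZ u (λ i → x X i ℤ.^ (digit B E' i + (n ∸ digit B E i)))))
        ≡⟨ ΣZ-cong (B ^ u) (λ E' _ → trans (ΣZ-*ˡ (q ^ u) (c E') _) (cong (c E' ℤ.*_)
             (sum-of-products q u (λ i y → (+ y) ℤ.^ (digit B E' i + (n ∸ digit B E i))) (prime>0 pq)))) ⟩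
      ΣZ (B ^ u) (λ E' → c E' ℤ.* ΠZ u (λ i → ΣZ q (λ y → (+ y) ℤ.^ (digit B E' i + (n ∸ digit B E i))))) ∎
      where
        merge : ∀ X E' → (c E' ℤ.* monomial B u (x X) E') ℤ.* W X ≡ c E' ℤ.* ΠZ u (λ i → x X i ℤ.^ (digit B E' i + (n ∸ digit B E i)))
        merge X E' = trans (ℤP.*-assoc (c E') (monomial B u (x X) E') (W X)) (cong (c E' ℤ.*_)
          (trans (sym (ΠZ-* u _ _)) (ΠZ-cong u (λ i _ → sym (ℤP.^-distribˡ-+-* (x X i) (digit B E' i) (n ∸ digit B E i))))))
    sign : ∀ u {f : ℕ → ℤ} → (∀ i → i < u → f i ≡ ℤ.-1ℤ) → ΠZ u f ≡ ℤ.-1ℤ ℤ.^ u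
    sign zero    h = refl
    sign (suc u) h = trans (cong₂ ℤ._*_ (sign u (λ i i< → h i (ℕP.m<n⇒m<1+n i<))) (h u ℕP.≤-refl)) (ℤP.*-comm (ℤ.-1ℤ ℤ.^ u) ℤ.-1ℤ)
    pick : ΣZ (B ^ u) (λ E' → c E' ℤ.* ΠZ u (λ i → ℤ.- + eqn (digit B E i) (digit B E' i))) ≡ ℤ.-1ℤ ℤ.^ u ℤ.* c E
    pick = trans (ΣZ-single (B ^ u) E< (λ E' E'< E'≢E → let i , i< , ne = digits-differ B u E E' E< E'< (E'≢E ∘ sym) in
        trans (cong (c E' ℤ.*_) (ΠZ-0 u i< (cong (λ z → ℤ.- + z) (eqn-no ne)))) (ℤP.*-zeroʳ (c E'))))
      (trans (cong (c E ℤ.*_) (sign u (λ i _ → cong (λ z → ℤ.- + z) (eqn-refl (digit B E i))))) (ℤP.*-comm (c E) (ℤ.-1ℤ ℤ.^ u)))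

evalMono-ΠZ : ∀ u (a : ℕ → ℕ) (x : ℕ → ℤ) →
  evalMono (V.tabulate {n = u} (λ i → a (toℕ i))) (V.tabulate (λ i → x (toℕ i))) ≡ ΠZ u (λ i → x i ℤ.^ a i)
evalMono-ΠZ zero    a x = refl
evalMono-ΠZ (suc u) a x = trans (cong (x 0 ℤ.^ a 0 ℤ.*_) (evalMono-ΠZ u (a ∘ suc) (x ∘ suc))) (sym (ΠZ-suc u _))

exponents : ∀ u → ℕ → ℕ → Mono u
exponents u B E = V.tabulate (λ i → digit B E (toℕ i))

nth : ∀ {u} → Vec ℕ u → ℕ → ℕ
nth []      _       = 0
nth (a ∷ e) zero    = a
nth (a ∷ e) (suc i) = nth e i

tabulate-nth : ∀ {u} (e : Vec ℕ u) → V.tabulate (λ i → nth e (toℕ i)) ≡ e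
tabulate-nth []      = refl
tabulate-nth (a ∷ e) = cong (a ∷_) (tabulate-nth e)

nth≤sum : ∀ {u} (e : Vec ℕ u) i → nth e i ≤ V.sum e
nth≤sum []      i       = z≤n
nth≤sum (a ∷ e) zero    = ℕP.m≤m+n a _
nth≤sum (a ∷ e) (suc i) = ℕP.≤-trans (nth≤sum e i) (ℕP.m≤n+m _ a)

box : ∀ {u} → Poly u → ℕ → ℕ → Poly u
box         f B zero    = []
box {u} f B (suc N) = (coeff f (exponents u B N) , exponents u B N) ∷ box f B N

eval-box : ∀ {u} (f : Poly u) B N x →
  eval (box f B N) x ≡ ΣZ N (λ E → coeff f (exponents u B E) ℤ.* evalMono (exponents u B E) x)
eval-box         f B zero    x = refl
eval-box {u} f B (suc N) x = trans (cong (λ r → coeff f (exponents u B N) ℤ.* evalMono (exponents u B N) x ℤ.+ r) (eval-box f B N x))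
  (ℤP.+-comm (coeff f (exponents u B N) ℤ.* evalMono (exponents u B N) x) _)

-- Total degree below B bounds every single exponent by B, so that each exponent vector with nonzero
-- coefficient is the digit vector of exactly one E < B^u.
box-≈ : ∀ {u} (f : Poly u) B → (∀ e → coeff f e ≢ ℤ.0ℤ → totalDeg e < B) → f ≈P box f B (B ^ u)
box-≈ {u} f B deg e = sym (trans (as-sum (B ^ u)) total)
  where
    term : ℕ → ℤ
    term E with VP.≡-dec _≟_ (exponents u B E) e
    ... | yes _ = coeff f e
    ... | no  _ = ℤ.0ℤ
    as-sum : ∀ N → coeff (box f B N) e ≡ ΣZ N term
    as-sum zero    = refl
    as-sum (suc N) with VP.≡-dec _≟_ (exponents u B N) e
    ... | yes refl = trans (cong (λ r → coeff f (exponents u B N) ℤ.+ r) (as-sum N)) (ℤP.+-comm (coeff f (exponents u B N)) _)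
    ... | no  _    = trans (as-sum N) (sym (ℤP.+-identityʳ _))
    total : ΣZ (B ^ u) term ≡ coeff f e
    total with coeff f e ℤ.≟ ℤ.0ℤ
    ... | yes z = trans (ΣZ-0 (B ^ u) (λ E _ → vanish E)) (sym z)
      where
        vanish : ∀ E → term E ≡ ℤ.0ℤ
        vanish E with VP.≡-dec _≟_ (exponents u B E) e
        ... | yes _ = z
        ... | no  _ = refl
    ... | no nz = trans (ΣZ-single (B ^ u) E₀< others) here-term
      where
        small-entries : ∀ i → i < u → nth e i < B
        small-entries i _ = ℕP.≤-<-trans (nth≤sum e i) (deg e nz)
        E₀ = fromDigits B u (nth e)
        E₀< : E₀ < B ^ u
        E₀< = fromDigits< B u (nth e) small-entries
        e≡ : exponents u B E₀ ≡ e
        e≡ = trans (VP.tabulate-cong (λ i → digit-fromDigits B u (nth e) small-entries (toℕ i) (FP.toℕ<n i))) (tabulate-nth e)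
        here-term : term E₀ ≡ coeff f e
        here-term with VP.≡-dec _≟_ (exponents u B E₀) e
        ... | yes _ = refl
        ... | no ne = ⊥-elim (ne e≡)
        others : ∀ E → E < B ^ u → E ≢ E₀ → term E ≡ ℤ.0ℤ
        others E E< E≢ with VP.≡-dec _≟_ (exponents u B E) e
        ... | no _ = refl
        ... | yes eq = let i , i<u , ne = digits-differ B u E E₀ E< E₀< E≢ in
          ⊥-elim (ne (trans (sym (lookup-digit E i<u)) (trans (cong (λ v → lookup v (fromℕ< i<u)) (trans eq (sym e≡))) (lookup-digit E₀ i<u))))
          where
            lookup-digit : ∀ E {i} (i<u : i < u) → lookup (exponents u B E) (fromℕ< i<u) ≡ digit B E i
            lookup-digit E i<u = trans (VP.lookup∘tabulate _ (fromℕ< i<u)) (cong (digit B E) (FP.toℕ-fromℕ< i<u))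

eval-as-box : ∀ {u} (f : Poly u) B → (∀ e → coeff f e ≢ ℤ.0ℤ → totalDeg e < B) → ∀ (x : ℕ → ℤ) →
  eval f (V.tabulate (λ i → x (toℕ i))) ≡ ΣZ (B ^ u) (λ E → coeff f (exponents u B E) ℤ.* monomial B u x E)
eval-as-box {u} f B deg x = trans (eval-cong f (box f B (B ^ u)) (box-≈ f B deg) _) (trans (eval-box f B (B ^ u) _)
  (ΣZ-cong (B ^ u) (λ E _ → cong (coeff f (exponents u B E) ℤ.*_) (evalMono-ΠZ u (digit B E) x))))

∣ΣZ∣≤ : ∀ n {f b} → (∀ i → i < n → ∣ f i ∣ ≤ b) → ∣ ΣZ n f ∣ ≤ n * b
∣ΣZ∣≤ zero    h = z≤n
∣ΣZ∣≤ (suc n) {f} {b} h = ℕP.≤-trans (ℤP.∣i+j∣≤∣i∣+∣j∣ (ΣZ n f) (f n)) (ℕP.≤-trans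
  (ℕP.+-mono-≤ (∣ΣZ∣≤ n (λ i i< → h i (ℕP.m<n⇒m<1+n i<))) (h n ℕP.≤-refl)) (ℕP.≤-reflexive (ℕP.+-comm (n * b) b)))

∣ΠZ∣≤ : ∀ n {f b} → (∀ i → i < n → ∣ f i ∣ ≤ b) → ∣ ΠZ n f ∣ ≤ b ^ n
∣ΠZ∣≤ zero    h = ℕP.≤-refl
∣ΠZ∣≤ (suc n) {f} {b} h = ℕP.≤-trans (ℕP.≤-reflexive (ℤP.abs-* (ΠZ n f) (f n))) (ℕP.≤-trans
  (ℕP.*-mono-≤ (∣ΠZ∣≤ n (λ i i< → h i (ℕP.m<n⇒m<1+n i<))) (h n ℕP.≤-refl)) (ℕP.≤-reflexive (ℕP.*-comm (b ^ n) b)))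

abs-^ : ∀ x k → ∣ x ℤ.^ k ∣ ≡ ∣ x ∣ ^ k
abs-^ x zero    = refl
abs-^ x (suc k) = trans (ℤP.abs-* x (x ℤ.^ k)) (cong (∣ x ∣ *_) (abs-^ x k))

eval-bound : ∀ {u} (f : Poly u) B C R → (∀ e → coeff f e ≢ ℤ.0ℤ → totalDeg e < B) → (∀ e → ∣ coeff f e ∣ ≤ C) → 1 ≤ R →
  0 < B → ∀ (x : ℕ → ℤ) → (∀ i → ∣ x i ∣ ≤ R) → ∣ eval f (V.tabulate (λ i → x (toℕ i))) ∣ ≤ B ^ u * (C * (R ^ B) ^ u)
eval-bound {u} f B C R deg coeff≤ 1≤R 0<B x x≤ = ℕP.≤-trans (ℕP.≤-reflexive (cong ∣_∣ (eval-as-box f B deg x)))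
  (∣ΣZ∣≤ (B ^ u) (λ E _ → ℕP.≤-trans (ℕP.≤-reflexive (ℤP.abs-* (coeff f (exponents u B E)) (monomial B u x E)))
    (ℕP.*-mono-≤ (coeff≤ (exponents u B E)) (∣ΠZ∣≤ u (λ i _ → power E i)))))
  where
    power : ∀ E i → ∣ x i ℤ.^ digit B E i ∣ ≤ R ^ B
    power E i = ℕP.≤-trans (ℕP.≤-reflexive (abs-^ (x i) (digit B E i))) (ℕP.≤-trans (ℕP.^-monoˡ-≤ (digit B E i) (x≤ i))
      (ℕP.^-monoʳ-≤ R {{ℕ.>-nonZero 1≤R}} (ℕP.<⇒≤ (digit< E i 0<B))))

-- Encodings of integers and tuples

-- The end mark of `code` accounts for the power of two. The second half says that there is no
-- leading zero; it is what determines the length.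
bits-spec : ∀ f x → x ≤ f → code (bitsAux f x) ≡ x + 2 ^ length (bitsAux f x) × (1 ≤ x → 2 ^ length (bitsAux f x) ≤ 2 * x)
bits-spec zero    zero    _       = refl , λ ()
bits-spec (suc f) zero    _       = refl , λ ()
bits-spec (suc f) (suc k) (s≤s k≤f) with bits-spec f (suc k / 2) (half≤ k k≤f)
  where
    half≤ : ∀ k → k ≤ f → suc k / 2 ≤ f
    half≤ k k≤f = ℕP.≤-trans (ℕP.≤-pred (m/n<m (suc k) 2 ℕP.≤-refl)) k≤f
... | eq , lo = (begin
  bit (suc k % 2 ℕ.≡ᵇ 1) + 2 * code w
    ≡⟨ cong₂ (λ a b → a + 2 * b) (low-bit (suc k)) eq ⟩
  suc k % 2 + 2 * (suc k / 2 + 2 ^ length w)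
    ≡⟨ regroup (suc k % 2) (suc k / 2) (2 ^ length w) ⟩
  suc k % 2 + suc k / 2 * 2 + 2 * 2 ^ length w
    ≡⟨ cong (_+ 2 * 2 ^ length w) (m≡m%n+[m/n]*n (suc k) 2) ⟨
  suc k + 2 * 2 ^ length w ∎) , λ _ → ℕP.*-monoʳ-≤ 2 (leading (suc k / 2) refl)
  where
    open ≡-Reasoning
    w = bitsAux f (suc k / 2)
    low-bit : ∀ x → bit (x % 2 ℕ.≡ᵇ 1) ≡ x % 2
    low-bit x with x % 2 | m%n<n x 2
    ... | zero        | _ = refl
    ... | suc zero    | _ = refl
    ... | suc (suc _) | s≤s (s≤s ())
    regroup : ∀ r h p → r + 2 * (h + p) ≡ r + h * 2 + 2 * p
    regroup = ℕ-solve
    empty : ∀ f → length (bitsAux f 0) ≡ 0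
    empty zero    = refl
    empty (suc f) = refl
    leading : ∀ h → suc k / 2 ≡ h → 2 ^ length w ≤ suc k
    leading zero    h≡ = ℕP.≤-trans (ℕP.≤-reflexive (cong (2 ^_) (trans (cong (λ z → length (bitsAux f z)) h≡) (empty f)))) (s≤s z≤n)
    leading (suc h) h≡ = ℕP.≤-trans (lo (ℕP.≤-trans (s≤s z≤n) (ℕP.≤-reflexive (sym h≡))))
      (ℕP.≤-trans (ℕP.≤-reflexive (ℕP.*-comm 2 (suc k / 2))) (m/n*n≤m (suc k) 2))

length-bits : ∀ x → length (bitsℕ x) ≡ blen x
length-bits zero    = refl
length-bits (suc x) = go (bitsℕ (suc x)) (proj₁ spec) (proj₂ spec (s≤s z≤n))
  where
    spec = bits-spec (suc x) (suc x) ℕP.≤-refl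
    go : ∀ w → code w ≡ suc x + 2 ^ length w → 2 ^ length w ≤ 2 * suc x → length w ≡ blen (suc x)
    go []      eq lo with trans eq (ℕP.+-comm (suc x) 1)
    ... | ()
    go (b ∷ w) eq lo = sym (blen-unique (suc x) (length w) (ℕP.*-cancelˡ-≤ 2 lo)
      (ℕP.+-cancelʳ-< (2 ^ suc (length w)) (suc x) (2 ^ suc (length w)) (ℕP.≤-<-trans (ℕP.≤-reflexive (sym eq))
        (ℕP.<-≤-trans (code<2^ (b ∷ w)) (ℕP.≤-reflexive (cong (λ z → 2 ^ suc (length w) + z) (ℕP.+-identityʳ _)))))))

bitsN : ℕ → ℕ
bitsN x = x + 2 ^ blen x

bitsN-code : ∀ x → bitsN x ≡ code (bitsℕ x)
bitsN-code x = sym (trans (proj₁ (bits-spec x x ℕP.≤-refl)) (cong (λ l → x + 2 ^ l) (length-bits x)))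

bits< : ∀ x → x < 2 ^ length (bitsℕ x)
bits< x = ℕP.+-cancelʳ-< (2 ^ length (bitsℕ x)) x (2 ^ length (bitsℕ x)) (ℕP.≤-<-trans (ℕP.≤-reflexive (sym (proj₁ (bits-spec x x ℕP.≤-refl))))
  (ℕP.<-≤-trans (code<2^ (bitsℕ x)) (ℕP.≤-reflexive (cong (λ z → 2 ^ length (bitsℕ x) + z) (ℕP.+-identityʳ _)))))

bitsℕ-injective : ∀ {x y} → bitsℕ x ≡ bitsℕ y → x ≡ y
bitsℕ-injective {x} {y} eq = ℕP.+-cancelʳ-≡ (2 ^ length (bitsℕ x)) x y (trans (sym (proj₁ (bits-spec x x ℕP.≤-refl)))
  (trans (cong code eq) (trans (proj₁ (bits-spec y y ℕP.≤-refl)) (cong (λ w → y + 2 ^ length w) (sym eq)))))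

encℤ-injective : ∀ {x y} → encℤ x ≡ encℤ y → x ≡ y
encℤ-injective {+ m}      {+ n}      eq = cong +_ (bitsℕ-injective (LP.∷-injectiveʳ eq))
encℤ-injective { -[1+ m ]} { -[1+ n ]} eq = cong -[1+_] (ℕP.suc-injective (bitsℕ-injective (LP.∷-injectiveʳ eq)))

bitAt-suc-enc : ∀ j z → bitAt (suc j) (encℤ z) ≡ bitAt j (bitsℕ ∣ z ∣)
bitAt-suc-enc j (+ n)     = refl
bitAt-suc-enc j -[1+ n ]  = refl

bitsize-bound : ∀ z → ∣ z ∣ < 2 ^ bitsize z
bitsize-bound (+ n)    = ℕP.<-≤-trans (bits< n) (ℕP.^-monoʳ-≤ 2 (ℕP.n≤1+n (length (bitsℕ n))))
bitsize-bound -[1+ n ] = ℕP.<-≤-trans (bits< (suc n)) (ℕP.^-monoʳ-≤ 2 (ℕP.n≤1+n (length (bitsℕ (suc n)))))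

from-bits : ∀ w J → length w ≤ J → ΣN J (λ j → bit (bitAt j w) * 2 ^ j) + 2 ^ length w ≡ code w
from-bits []      J       _       = cong (_+ 1) (ΣN-0 J (λ j _ → refl))
from-bits (b ∷ w) (suc J) (s≤s l) = begin
  ΣN (suc J) (λ j → bit (bitAt j (b ∷ w)) * 2 ^ j) + 2 * 2 ^ length w
    ≡⟨ cong (_+ 2 * 2 ^ length w) (ΣN-suc J _) ⟩
  bit b * 1 + ΣN J (λ j → bit (bitAt j w) * (2 * 2 ^ j)) + 2 * 2 ^ length w
    ≡⟨ cong₂ (λ x y → x + y + 2 * 2 ^ length w) (ℕP.*-identityʳ (bit b)) (trans (ΣN-cong J (λ j _ → shuffle (bit (bitAt j w)) (2 ^ j))) (ΣN-*ˡ J 2 _)) ⟩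
  bit b + 2 * ΣN J (λ j → bit (bitAt j w) * 2 ^ j) + 2 * 2 ^ length w
    ≡⟨ factor (bit b) (ΣN J (λ j → bit (bitAt j w) * 2 ^ j)) (2 ^ length w) ⟩
  bit b + 2 * (ΣN J (λ j → bit (bitAt j w) * 2 ^ j) + 2 ^ length w)
    ≡⟨ cong (λ z → bit b + 2 * z) (from-bits w J l) ⟩
  code (b ∷ w) ∎
  where
    open ≡-Reasoning
    shuffle : ∀ b p → b * (2 * p) ≡ 2 * (b * p)
    shuffle = ℕ-solve
    factor : ∀ b s p → b + 2 * s + 2 * p ≡ b + 2 * (s + p)
    factor = ℕ-solve

value-from-bits : ∀ x J → x < 2 ^ J → ΣN J (λ j → bit (bitAt j (bitsℕ x)) * 2 ^ j) ≡ x
value-from-bits x J x< = ℕP.+-cancelʳ-≡ (2 ^ length (bitsℕ x)) _ _ (trans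
  (from-bits (bitsℕ x) J (ℕP.≤-trans (ℕP.≤-reflexive (length-bits x)) (blen≤ x J x<))) (proj₁ (bits-spec x x ℕP.≤-refl)))

-- The pairs 00 and 11 carry a letter and the pair 01 ends the word, so the first two bits always
-- decide what follows.
encWord-++-injective : ∀ u v {r r'} → encWord u L.++ r ≡ encWord v L.++ r' → u ≡ v × r ≡ r'
encWord-++-injective []      []      eq = refl , LP.∷-injectiveʳ (LP.∷-injectiveʳ eq)
encWord-++-injective []      (false ∷ v) ()
encWord-++-injective []      (true ∷ v)  ()
encWord-++-injective (false ∷ u) []  ()
encWord-++-injective (true ∷ u)  []  ()
encWord-++-injective (a ∷ u) (b ∷ v) eq with LP.∷-injectiveˡ eq | encWord-++-injective u v (LP.∷-injectiveʳ (LP.∷-injectiveʳ eq))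
... | refl | refl , eq' = refl , eq'

encTupleList-injective : ∀ us vs → encTupleList us ≡ encTupleList vs → us ≡ vs
encTupleList-injective []       []       eq = refl
encTupleList-injective []       ([] ∷ vs) ()
encTupleList-injective []       ((_ ∷ _) ∷ vs) ()
encTupleList-injective ([] ∷ us)       [] ()
encTupleList-injective ((_ ∷ _) ∷ us) [] ()
encTupleList-injective (u ∷ us) (v ∷ vs) eq with encWord-++-injective u v eq
... | refl , eq' = cong (u ∷_) (encTupleList-injective us vs eq')

-- `BitLang` only asserts that some tuple is encoded by the word; injectivity makes this a statement
-- about a given tuple.
encTuple-injective : ∀ (u : ℕ → ℕ) n n' (is : Vec ℤ (u n)) (is' : Vec ℤ (u n')) j j' b b' → encTuple n is j b ≡ encTuple n' is' j' b' →
  Σ (n ≡ n') λ eq → subst (λ n → Vec ℤ (u n)) eq is ≡ is' × j ≡ j' × b ≡ b'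
encTuple-injective u n n' is is' j j' b b' eq with encTupleList-injective (unary n ∷ (V.toList (V.map encℤ is) L.++ (bitsℕ j ∷ (b ∷ []) ∷ [])))
  (unary n' ∷ (V.toList (V.map encℤ is') L.++ (bitsℕ j' ∷ (b' ∷ []) ∷ []))) eq
... | eq' with unary-injective (LP.∷-injectiveˡ eq')
  where
    unary-injective : unary n ≡ unary n' → n ≡ n'
    unary-injective h = trans (sym (LP.length-replicate n)) (trans (cong length h) (LP.length-replicate n'))
...   | refl with coordinates is is' (LP.∷-injectiveʳ eq')
  where
    coordinates : ∀ {k} (v w : Vec ℤ k) → V.toList (V.map encℤ v) L.++ (bitsℕ j ∷ (b ∷ []) ∷ []) ≡ V.toList (V.map encℤ w) L.++ (bitsℕ j' ∷ (b' ∷ []) ∷ []) →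
      v ≡ w × j ≡ j' × b ≡ b'
    coordinates []      []      h = refl , bitsℕ-injective (LP.∷-injectiveˡ h) , LP.∷-injectiveˡ (LP.∷-injectiveˡ (LP.∷-injectiveʳ h))
    coordinates (x ∷ v) (y ∷ w) h with coordinates v w (LP.∷-injectiveʳ h) | encℤ-injective {x} {y} (LP.∷-injectiveˡ h)
    ... | refl , r | refl = refl , r
...     | is≡ , j≡ , b≡ = refl , is≡ , j≡ , b≡

-- The codes are assembled from the right, the last coordinate being prepended before the others.
-- The code of n ones is 2^(n+1) - 1; doubling prefixes the sign bit 0 of a nonnegative integer; 3
-- is the code of the one-letter word `true`.
tupleN : ℕ → ℕ → (ℕ → ℕ) → ℕ → ℕ
tupleN n u x j = catN (encN (2 ^ suc n ∸ 1))
  (iter u (λ t acc → catN (encN (2 * bitsN (x (u ∸ suc t)))) acc) (catN (encN (bitsN j)) (encN 3)))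

tupleN-code : ∀ n u x j → tupleN n u x j ≡ code (encTuple n (V.tabulate {n = u} (λ i → + x (toℕ i))) j true)
tupleN-code n u x j = trans (cong₂ catN (trans (cong encN (unary-code n)) (encN-code (unary n))) (trans (all-coordinates u) (cong code (coordinates u x))))
  (catN-code (encWord (unary n)) _)
  where
    unary-code : ∀ n → 2 ^ suc n ∸ 1 ≡ code (unary n)
    unary-code n = cong (_∸ 1) (go n)
      where
        go : ∀ n → 2 ^ suc n ≡ suc (code (unary n))
        go zero    = refl
        go (suc n) = trans (cong (2 *_) (go n)) (arith (code (unary n)))
          where
            arith : ∀ c → 2 * suc c ≡ suc (1 + 2 * c)
            arith = ℕ-solve
    tail : List Bool
    tail = encTupleList (bitsℕ j ∷ (true ∷ []) ∷ [])
    words : ℕ → (ℕ → ℕ) → ℕ → List Bool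
    words u x zero    = tail
    words u x (suc t) = encWord (encℤ (+ x (u ∸ suc t))) L.++ words u x t
    tail-code : catN (encN (bitsN j)) (encN 3) ≡ code tail
    tail-code = trans (cong₂ catN (trans (cong encN (bitsN-code j)) (encN-code (bitsℕ j))) (encN-code (true ∷ []))) (catN-code (encWord (bitsℕ j)) (encWord (true ∷ [])))
    all-coordinates : ∀ t → iter t (λ t acc → catN (encN (2 * bitsN (x (u ∸ suc t)))) acc) (catN (encN (bitsN j)) (encN 3)) ≡ code (words u x t)
    all-coordinates zero    = tail-code
    all-coordinates (suc t) = trans (cong₂ catN (trans (cong (λ z → encN (2 * z)) (bitsN-code (x (u ∸ suc t)))) (encN-code (encℤ (+ x (u ∸ suc t))))) (all-coordinates t))
      (catN-code (encWord (encℤ (+ x (u ∸ suc t)))) (words u x t))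
    words-shift : ∀ u x t → t ≤ u → words (suc u) x t ≡ words u (x ∘ suc) t
    words-shift u x zero    _   = refl
    words-shift u x (suc t) t<u = cong₂ (λ z r → encWord (encℤ (+ x z)) L.++ r) (ℕP.+-∸-assoc 1 t<u) (words-shift u x t (ℕP.<⇒≤ t<u))
    coordinates : ∀ u x → words u x u ≡ concatMap encWord (V.toList (V.map encℤ (V.tabulate {n = u} (λ i → + x (toℕ i)))) L.++ (bitsℕ j ∷ (true ∷ []) ∷ []))
    coordinates zero    x = refl
    coordinates (suc u) x = cong₂ (λ z r → encWord (encℤ (+ x z)) L.++ r) (ℕP.n∸n≡0 u) (trans (words-shift u x u ℕP.≤-refl) (coordinates u (x ∘ suc)))

-- Chinese remaindering

quo-between : ∀ {a b n} → a * b ≤ n → n < suc a * b → quo n b ≡ a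
quo-between {a} {zero}  {n} lo hi = ⊥-elim (ℕP.n≮0 (subst (n <_) (ℕP.*-zeroʳ (suc a)) hi))
quo-between {a} {b@(suc _)} {n} lo hi = trans (cong (λ z → quo z b) (sym (ℕP.m∸n+n≡m lo)))
  (proj₁ (quo-rem-unique {n ∸ a * b} {a} {b} (ℕP.+-cancelʳ-< (a * b) (n ∸ a * b) b (ℕP.≤-<-trans (ℕP.≤-reflexive (ℕP.m∸n+n≡m lo)) hi))))

quo-*≤ : ∀ a b → quo a b * b ≤ a
quo-*≤ a b = ℕP.≤-trans (ℕP.m≤n+m _ (rem a b)) (ℕP.≤-reflexive (sym (quo-rem a b)))

<suc-quo-* : ∀ a {b} → 0 < b → a < suc (quo a b) * b
<suc-quo-* a {b} 0<b = ℕP.≤-<-trans (ℕP.≤-reflexive (quo-rem a b)) (ℕP.+-monoˡ-< (quo a b * b) (rem< a 0<b))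

quo-+* : ∀ a k {b} → 0 < b → quo (a + k * b) b ≡ quo a b + k
quo-+* a k {b} 0<b = trans (cong (λ z → quo (z + k * b) b) (quo-rem a b)) (trans (cong (λ z → quo z b) (arith (rem a b) (quo a b) k b))
  (proj₁ (quo-rem-unique {rem a b} {quo a b + k} {b} (rem< a 0<b))))
  where
    arith : ∀ r q k b → r + q * b + k * b ≡ r + (q + k) * b
    arith = ℕ-solve

quo-double : ∀ a {b} → 0 < b → quo (2 * a) b ≡ 2 * quo a b + quo (2 * rem a b) b
quo-double a {b} 0<b = trans (cong (λ z → quo (2 * z) b) (quo-rem a b)) (trans (cong (λ z → quo z b) (arith (rem a b) (quo a b) b))
  (trans (quo-+* (2 * rem a b) (2 * quo a b) 0<b) (ℕP.+-comm (quo (2 * rem a b) b) _)))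
  where
    arith : ∀ r q b → 2 * (r + q * b) ≡ 2 * r + 2 * q * b
    arith = ℕ-solve

-- Long division of y by p in binary: doubling a remainder produces the next bit. The remainders of
-- y 2^t can be found by modular powers even when 2^t is too large to be written down.
quo-digits : ∀ y {p} s → y < p → quo (y * 2 ^ s) p ≡ ΣN s (λ k → 2 ^ k * quo (2 * rem (y * 2 ^ (s ∸ suc k)) p) p)
quo-digits y {p} zero    y<p = quo-small (subst (_< p) (sym (ℕP.*-identityʳ y)) y<p)
quo-digits y {p} (suc s) y<p = begin
  quo (y * (2 * 2 ^ s)) p
    ≡⟨ cong (λ z → quo z p) (arith y (2 ^ s)) ⟩
  quo (2 * (y * 2 ^ s)) p
    ≡⟨ quo-double (y * 2 ^ s) 0<p ⟩
  2 * quo (y * 2 ^ s) p + d s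
    ≡⟨ cong₂ _+_ (trans (cong (2 *_) (quo-digits y s y<p)) (sym (ΣN-*ˡ s 2 _))) (sym (ℕP.*-identityˡ (d s))) ⟩
  ΣN s (λ k → 2 * (2 ^ k * d (s ∸ suc k))) + 1 * d s
    ≡⟨ ℕP.+-comm _ (1 * d s) ⟩
  1 * d s + ΣN s (λ k → 2 * (2 ^ k * d (s ∸ suc k)))
    ≡⟨ cong (λ z → 1 * d s + z) (ΣN-cong s (λ k _ → sym (ℕP.*-assoc 2 (2 ^ k) (d (s ∸ suc k))))) ⟩
  1 * d s + ΣN s (λ k → 2 ^ suc k * d (s ∸ suc k))
    ≡⟨ ΣN-suc s _ ⟨
  ΣN (suc s) (λ k → 2 ^ k * d (suc s ∸ suc k)) ∎
  where
    open ≡-Reasoning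
    d : ℕ → ℕ
    d t = quo (2 * rem (y * 2 ^ t) p) p
    0<p : 0 < p
    0<p = ℕP.≤-<-trans z≤n y<p
    arith : ∀ y w → y * (2 * w) ≡ 2 * (y * w)
    arith = ℕ-solve

ΠN-mono : ∀ n {f g} → (∀ i → i < n → f i ≤ g i) → ΠN n f ≤ ΠN n g
ΠN-mono zero    h = ℕP.≤-refl
ΠN-mono (suc n) h = ℕP.*-mono-≤ (ΠN-mono n (λ i i<n → h i (ℕP.m<n⇒m<1+n i<n))) (h n ℕP.≤-refl)

ΠN-pos : ∀ n {f} → (∀ i → i < n → 0 < f i) → 0 < ΠN n f
ΠN-pos n h = ℕP.≤-trans (ℕP.≤-reflexive (sym (ΠN-1 n (λ _ _ → refl)))) (ΠN-mono n h)

ΠN-member-∣ : ∀ n {f i} → i < n → f i ∣ ΠN n f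
ΠN-member-∣ (suc n) {f} {i} i<1+n with i ≟ n
... | yes refl = n∣m*n (ΠN n f)
... | no i≢n = ∣m⇒∣m*n (f n) (ΠN-member-∣ n (ℕP.≤∧≢⇒< (ℕP.≤-pred i<1+n) i≢n))

prime∣ΠN : ∀ {q} → Prime q → ∀ n {f} → q ∣ ΠN n f → ∃ λ i → i < n × q ∣ f i
prime∣ΠN pq zero    h = ⊥-elim (ℕP.<⇒≱ (prime≥2 pq) (∣⇒≤ h))
prime∣ΠN pq (suc n) {f} h with euclidsLemma (ΠN n f) (f n) pq h
... | inj₂ h' = n , ℕP.≤-refl , h'
... | inj₁ h' = let i , i< , d = prime∣ΠN pq n h' in i , ℕP.m<n⇒m<1+n i< , d

prime∣prime : ∀ {p q} → Prime p → Prime q → p ∣ q → p ≡ q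
prime∣prime pp pq h with prime⇒irreducible pq h
... | inj₁ refl = ⊥-elim (¬prime[1] pp)
... | inj₂ eq   = eq

ΠN-remove : ∀ n p j → j < n → ΠN n p ≡ p j * ΠN n (λ l → ite (eqn l j) 1 (p l))
ΠN-remove (suc n) p j j<1+n with j ≟ n
... | yes refl = trans (ℕP.*-comm (ΠN n p) (p n)) (cong (p n *_) (trans (sym (ℕP.*-identityʳ _))
  (cong₂ _*_ (ΠN-cong n (λ l l<n → sym (ite-no 1 (p l) (eqn-no (ℕP.<⇒≢ l<n))))) (sym (ite-yes 1 (p n) (eqn-refl n))))))
... | no j≢n = trans (cong (_* p n) (ΠN-remove n p j (ℕP.≤∧≢⇒< (ℕP.≤-pred j<1+n) j≢n)))
  (trans (ℕP.*-assoc (p j) _ (p n)) (cong (λ z → p j * (ΠN n (λ l → ite (eqn l j) 1 (p l)) * z)) (sym (ite-no 1 (p n) (eqn-no (λ n≡j → j≢n (sym n≡j)))))))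

primes-product-∣ : ∀ n {p : ℕ → ℕ} {M} → (∀ i → i < n → Prime (p i)) → (∀ i j → i < n → j < n → p i ≡ p j → i ≡ j) →
  (∀ i → i < n → p i ∣ M) → ΠN n p ∣ M
primes-product-∣ zero    pp inj h = 1∣ _
primes-product-∣ (suc n) {p} pp inj h with primes-product-∣ n {p} (λ i i< → pp i (ℕP.m<n⇒m<1+n i<))
    (λ i j i< j< → inj i j (ℕP.m<n⇒m<1+n i<) (ℕP.m<n⇒m<1+n j<)) (λ i i< → h i (ℕP.m<n⇒m<1+n i<))
... | divides t refl with euclidsLemma t (ΠN n p) (pp n ℕP.≤-refl) (h n ℕP.≤-refl)
...   | inj₁ d = subst (_∣ t * ΠN n p) (ℕP.*-comm (p n) (ΠN n p)) (*-pres-∣ d ∣-refl)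
...   | inj₂ d with prime∣ΠN (pp n ℕP.≤-refl) n d
...     | i , i< , d' = ⊥-elim (ℕP.<⇒≢ i< (inj i n (ℕP.m<n⇒m<1+n i<) ℕP.≤-refl
            (sym (prime∣prime (pp n ℕP.≤-refl) (pp i (ℕP.m<n⇒m<1+n i<)) d'))))

-- The inequality Π (1 - 1 / f i) ≥ 1 - s / w for f i ≥ w, with denominators cleared.
deficit : ∀ s w (f : ℕ → ℕ) → (∀ i → i < s → w ≤ f i) → (∀ i → i < s → 1 ≤ f i) →
  w * ΠN s f ≤ w * ΠN s (λ i → f i ∸ 1) + s * ΠN s f
deficit zero    w f h pos = ℕP.m≤m+n _ 0
deficit (suc s) w f h pos = begin
  w * (P * f s)                                ≡⟨ ℕP.*-assoc w P (f s) ⟨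
  w * P * f s                                  ≤⟨ ℕP.*-monoˡ-≤ (f s) (deficit s w f (λ i i< → h i (ℕP.m<n⇒m<1+n i<)) (λ i i< → pos i (ℕP.m<n⇒m<1+n i<))) ⟩
  (w * P' + s * P) * f s                       ≡⟨ cong ((w * P' + s * P) *_) (sym fs) ⟩
  (w * P' + s * P) * (g + 1)                   ≡⟨ arith w P' s P g ⟩
  w * (P' * g) + w * P' + s * (P * (g + 1))    ≤⟨ ℕP.+-monoˡ-≤ (s * (P * (g + 1))) (ℕP.+-monoʳ-≤ (w * (P' * g)) (ℕP.*-mono-≤ (h s ℕP.≤-refl) (ΠN-mono s (λ i _ → ℕP.m∸n≤m (f i) 1)))) ⟩
  w * (P' * g) + f s * P + s * (P * (g + 1))   ≡⟨ cong (λ z → w * (P' * g) + f s * P + s * (P * z)) fs ⟩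
  w * (P' * g) + f s * P + s * (P * f s)       ≡⟨ arith' (w * (P' * g)) (f s) P s ⟩
  w * (P' * g) + suc s * (P * f s)             ∎
  where
    open ℕP.≤-Reasoning
    P = ΠN s f
    P' = ΠN s (λ i → f i ∸ 1)
    g = f s ∸ 1
    fs : g + 1 ≡ f s
    fs = ℕP.m∸n+n≡m (pos s ℕP.≤-refl)
    arith : ∀ w p' s p g → (w * p' + s * p) * (g + 1) ≡ w * (p' * g) + w * p' + s * (p * (g + 1))
    arith = ℕ-solve
    arith' : ∀ a f p s → a + f * p + s * (p * f) ≡ a + (p * f + s * (p * f))
    arith' = ℕ-solve

-- Chinese remaindering to binary. The primes are split into s groups with products G i; then
-- Z / Q = Π (1 - 1 / G i) / 2 is extremely close to 2^-s, so that c Z / Q modulo 1, which is a sum of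
-- fractions with small denominators, is c / 2^s up to a tiny error.
module Reconstruct (s D m : ℕ) (p : ℕ → ℕ) where
  J : ℕ
  J = s * D

  G : ℕ → ℕ
  G i = ΠN D (λ l → p (i * D + l))

  Q Z : ℕ
  Q = ΠN J p
  Z = ΠN s (λ i → quo (G i ∸ 1) 2)

  -- Q / p j, written as a product so that its residues are products of residues.
  R : ℕ → ℕ
  R j = ΠN J (λ l → ite (eqn l j) 1 (p l))

  -- The integer part of Σ y j / p j, from fractions rounded down to m bits; the summand J makes up
  -- for the J roundings.
  wraps : (ℕ → ℕ) → ℕ
  wraps y = quo (ΣN J (λ j → quo (y j * 2 ^ m) (p j)) + J) (2 ^ m)

  -- What the fractional parts of y j 2^s / p j add up to. In `suc J`, J compensates the roundings
  -- and 1 compensates the gap between 2^s Z and Q.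
  tail : (ℕ → ℕ) → ℕ
  tail y = quo (ΣN J (λ j → quo (rem (y j * 2 ^ s) (p j) * 2 ^ m) (p j)) + suc J) (2 ^ m)

  -- The number of quotients y j 2^s / p j whose binary digit of weight 2^k is 1, when y j < p j;
  -- these column sums are left without carries.
  column : (ℕ → ℕ) → ℕ → ℕ
  column y k = ΣN J (λ j → quo (2 * rem (y j * 2 ^ (s ∸ suc k)) (p j)) (p j))

  module _ (prime : ∀ j → j < J → Prime (p j)) (distinct : ∀ i j → i < J → j < J → p i ≡ p j → i ≡ j)
           (odd : ∀ j → j < J → ¬ (2 ∣ p j)) where

    index< : ∀ {i l} → i < s → l < D → i * D + l < J
    index< {i} {l} i<s l<D = ℕP.<-≤-trans (ℕP.+-monoʳ-< (i * D) l<D) (ℕP.≤-trans (ℕP.≤-reflexive (ℕP.+-comm (i * D) D)) (ℕP.*-monoˡ-≤ D i<s))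

    Q-groups : Q ≡ ΠN s G
    Q-groups = Big.big-* ℕP.*-1-commutativeMonoid s D p

    Q>0 : 0 < Q
    Q>0 = ΠN-pos J (λ j j< → prime>0 (prime j j<))

    G≥ : ∀ i → i < s → 2 ^ D ≤ G i
    G≥ i i<s = ℕP.≤-trans (ℕP.≤-reflexive (sym (ΠN-const D 2))) (ΠN-mono D (λ l l< → prime≥2 (prime _ (index< i<s l<))))

    G-odd : ∀ i → i < s → 2 * quo (G i ∸ 1) 2 ≡ G i ∸ 1
    G-odd i i<s with rem (G i ∸ 1) 2 | quo-rem (G i ∸ 1) 2 | rem< (G i ∸ 1) {2} (s≤s z≤n)
    ... | zero | eq | _ = trans (ℕP.*-comm 2 (quo (G i ∸ 1) 2)) (sym eq)
    ... | suc (suc _) | eq | s≤s (s≤s ())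
    ... | suc zero | eq | _ = ⊥-elim (let l , l<D , d = prime∣ΠN prime[2] D even in odd (i * D + l) (index< i<s l<D) d)
      where
        even : 2 ∣ G i
        even = divides (suc (quo (G i ∸ 1) 2)) (trans (sym (ℕP.m∸n+n≡m (ℕP.≤-trans (ℕP.m^n>0 2 D) (G≥ i i<s)))) (trans (cong (_+ 1) eq) (arith (quo (G i ∸ 1) 2))))
          where
            arith : ∀ x → 1 + x * 2 + 1 ≡ suc x * 2
            arith = ℕ-solve

    2^sZ : 2 ^ s * Z ≡ ΠN s (λ i → G i ∸ 1)
    2^sZ = trans (cong (_* Z) (sym (ΠN-const s 2))) (trans (sym (ΠN-* s (λ _ → 2) _)) (ΠN-cong s (λ i i<s → G-odd i i<s)))

    2^sZ≤Q : 2 ^ s * Z ≤ Q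
    2^sZ≤Q = ℕP.≤-trans (ℕP.≤-reflexive 2^sZ) (ℕP.≤-trans (ΠN-mono s (λ i _ → ℕP.m∸n≤m (G i) 1)) (ℕP.≤-reflexive (sym Q-groups)))

    nearly : 2 ^ D * Q ≤ 2 ^ D * (2 ^ s * Z) + s * Q
    nearly = subst₂ (λ a b → 2 ^ D * a ≤ 2 ^ D * b + s * a) (sym Q-groups) (sym 2^sZ)
      (deficit s (2 ^ D) G (λ i i<s → G≥ i i<s) (λ i i<s → ℕP.≤-trans (ℕP.m^n>0 2 D) (G≥ i i<s)))

    pR≡Q : ∀ j → j < J → p j * R j ≡ Q
    pR≡Q j j< = sym (ΠN-remove J p j j<)

    -- `c-small` keeps c Z / Q at or below one half, and `m-large` keeps all roundings within the
    -- other half. `D-large` makes the error of 2^s Z against Q, enlarged by c 2^m, at most one Q.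
    module _ (c : ℕ) (y : ℕ → ℕ)
             (y< : ∀ j → j < J → y j < p j) (residue : ∀ j → j < J → Mod (p j) (+ (y j * R j)) (+ (c * Z)))
             (c-small : 2 * c ≤ 2 ^ s) (D-large : c * 2 ^ m * s ≤ 2 ^ D) (m-large : 2 * suc J ≤ 2 ^ m) where

      T : ℕ
      T = ΣN J (λ j → y j * R j)

      T-residue : ∀ l → l < J → Mod (p l) (+ T) (+ (c * Z))
      T-residue l l< = mod-trans (mod-≡ (pos-ΣN J _)) (mod-trans (mod-Σ J {g = λ j → + (eqn j l) ℤ.* + (y j * R j)} only)
        (mod-trans (mod-≡ (trans (ΣZ-single J l< (λ j _ j≢l → trans (cong (λ z → + z ℤ.* + (y j * R j)) (eqn-no j≢l)) (ℤP.*-zeroˡ (+ (y j * R j)))))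
          (trans (cong (λ z → + z ℤ.* + (y l * R l)) (eqn-refl l)) (ℤP.*-identityˡ (+ (y l * R l)))))) (residue l l<)))
        where
          only : ∀ j → j < J → Mod (p l) (+ (y j * R j)) (+ (eqn j l) ℤ.* + (y j * R j))
          only j j< with j ≟ l
          ... | yes refl = mod-≡ (sym (trans (cong (λ z → + z ℤ.* + (y l * R l)) (eqn-refl l)) (ℤP.*-identityˡ (+ (y l * R l)))))
          ... | no j≢l = mod-trans (mod-∣ (∣n⇒∣m*n (y j) (subst (_∣ R j) (ite-no 1 (p l) (eqn-no (λ l≡j → j≢l (sym l≡j)))) (ΠN-member-∣ J {λ l → ite (eqn l j) 1 (p l)} l<))))
            (mod-≡ (sym (trans (cong (λ z → + z ℤ.* + (y j * R j)) (eqn-no j≢l)) (ℤP.*-zeroˡ (+ (y j * R j))))))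

      2cZ≤Q : 2 * (c * Z) ≤ Q
      2cZ≤Q = ℕP.≤-trans (ℕP.≤-reflexive (sym (ℕP.*-assoc 2 c Z))) (ℕP.≤-trans (ℕP.*-monoˡ-≤ Z c-small) 2^sZ≤Q)

      -- T and c Z agree modulo every prime, hence modulo Q. T cannot be the smaller one, because
      -- their difference would then be a positive multiple of Q, while c Z ≤ Q / 2.
      T≡ : ∃ λ K → T ≡ c * Z + K * Q
      T≡ with c * Z ≤? T
      ... | yes cZ≤T with primes-product-∣ J {p} {T ∸ c * Z} prime distinct
              (λ l l< → ∣-mod (mod-trans (mod-≡ (sym (trans (ℤP.m-n≡m⊖n T (c * Z)) (ℤP.⊖-≥ cZ≤T)))) (mod-diff⁻¹ (T-residue l l<))))
      ...   | divides K eq = K , trans (sym (ℕP.m+[n∸m]≡n cZ≤T)) (cong (λ z → c * Z + z) eq)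
      T≡ | no cZ≰T with primes-product-∣ J {p} {c * Z ∸ T} prime distinct
              (λ l l< → ∣-mod (mod-trans (mod-≡ (sym (trans (ℤP.m-n≡m⊖n (c * Z) T) (ℤP.⊖-≥ (ℕP.<⇒≤ (ℕP.≰⇒> cZ≰T)))))) (mod-diff⁻¹ (mod-sym (T-residue l l<)))))
      ...   | Q∣ = ⊥-elim (ℕP.<⇒≱ (ℕP.<-≤-trans (ℕP.m<m*n Q 2 {{ℕ.>-nonZero Q>0}} ℕP.≤-refl) (ℕP.≤-reflexive (ℕP.*-comm Q 2)))
              (ℕP.≤-trans (ℕP.*-monoʳ-≤ 2 (ℕP.≤-trans (∣⇒≤ {{ℕ.>-nonZero (ℕP.m<n⇒0<n∸m (ℕP.≰⇒> cZ≰T))}} Q∣) (ℕP.m∸n≤m (c * Z) T))) 2cZ≤Q))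

      floors : ∀ t → ΣN J (λ j → quo (y j * 2 ^ t) (p j)) * Q ≤ T * 2 ^ t × T * 2 ^ t ≤ (ΣN J (λ j → quo (y j * 2 ^ t) (p j)) + J) * Q
      floors t = (begin
        ΣN J F * Q                                 ≡⟨ ΣN-*ʳ J Q F ⟨
        ΣN J (λ j → F j * Q)                       ≤⟨ ΣN-mono J lower ⟩
        ΣN J (λ j → y j * R j * 2 ^ t)             ≡⟨ ΣN-*ʳ J (2 ^ t) _ ⟩
        T * 2 ^ t                                  ∎) , (begin
        T * 2 ^ t                                  ≡⟨ ΣN-*ʳ J (2 ^ t) _ ⟨
        ΣN J (λ j → y j * R j * 2 ^ t)             ≤⟨ ΣN-mono J upper ⟩
        ΣN J (λ j → (F j + 1) * Q)                 ≡⟨ ΣN-*ʳ J Q _ ⟩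
        ΣN J (λ j → F j + 1) * Q                   ≡⟨ cong (_* Q) (trans (ΣN-+ J F (λ _ → 1)) (cong (λ z → ΣN J F + z) (trans (ΣN-const J 1) (ℕP.*-identityʳ J)))) ⟩
        (ΣN J F + J) * Q                           ∎)
        where
          open ℕP.≤-Reasoning
          F : ℕ → ℕ
          F j = quo (y j * 2 ^ t) (p j)
          swap : ∀ f p r → f * (p * r) ≡ f * p * r
          swap = ℕ-solve
          swap' : ∀ y r w → y * r * w ≡ y * w * r
          swap' = ℕ-solve
          lower : ∀ j → j < J → F j * Q ≤ y j * R j * 2 ^ t
          lower j j< = begin
            F j * Q                ≡⟨ cong (F j *_) (sym (pR≡Q j j<)) ⟩
            F j * (p j * R j)      ≡⟨ swap (F j) (p j) (R j) ⟩
            F j * p j * R j        ≤⟨ ℕP.*-monoˡ-≤ (R j) (quo-*≤ (y j * 2 ^ t) (p j)) ⟩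
            y j * 2 ^ t * R j      ≡⟨ swap' (y j) (2 ^ t) (R j) ⟩
            y j * R j * 2 ^ t      ∎
          upper : ∀ j → j < J → y j * R j * 2 ^ t ≤ (F j + 1) * Q
          upper j j< = begin
            y j * R j * 2 ^ t          ≡⟨ swap' (y j) (R j) (2 ^ t) ⟩
            y j * 2 ^ t * R j          ≤⟨ ℕP.*-monoˡ-≤ (R j) (ℕP.<⇒≤ (<suc-quo-* (y j * 2 ^ t) (prime>0 (prime j j<)))) ⟩
            suc (F j) * p j * R j      ≡⟨ swap (suc (F j)) (p j) (R j) ⟨
            suc (F j) * (p j * R j)    ≡⟨ cong₂ _*_ (ℕP.+-comm 1 (F j)) (pR≡Q j j<) ⟩
            (F j + 1) * Q              ∎

      cancelQ : ∀ {a b} → a * Q ≤ b * Q → a ≤ b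
      cancelQ {a} {b} = ℕP.*-cancelʳ-≤ a b Q {{ℕ.>-nonZero Q>0}}

      -- T / Q lies in the lower half of the interval from K to K + 1, so errors below one half do
      -- not reach the next integer. The upper bound is doubled to avoid the fraction 1/2.
      wraps-correct : wraps y ≡ proj₁ T≡
      wraps-correct = quo-between lo (ℕP.*-cancelˡ-≤ 2 hi)
        where
          open ℕP.≤-Reasoning
          K = proj₁ T≡
          N = ΣN J (λ j → quo (y j * 2 ^ m) (p j))
          swap : ∀ k q w → k * q * w ≡ k * w * q
          swap = ℕ-solve
          lo : K * 2 ^ m ≤ N + J
          lo = cancelQ (begin
            K * 2 ^ m * Q             ≡⟨ swap K (2 ^ m) Q ⟩
            K * Q * 2 ^ m             ≤⟨ ℕP.*-monoˡ-≤ (2 ^ m) (ℕP.m≤n+m (K * Q) (c * Z)) ⟩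
            (c * Z + K * Q) * 2 ^ m   ≡⟨ cong (_* 2 ^ m) (proj₂ T≡) ⟨
            T * 2 ^ m                 ≤⟨ proj₂ (floors m) ⟩
            (N + J) * Q               ∎)
          2N≤ : 2 * N ≤ 2 ^ m + 2 * (K * 2 ^ m)
          2N≤ = cancelQ (begin
            2 * N * Q                              ≡⟨ ℕP.*-assoc 2 N Q ⟩
            2 * (N * Q)                            ≤⟨ ℕP.*-monoʳ-≤ 2 (proj₁ (floors m)) ⟩
            2 * (T * 2 ^ m)                        ≡⟨ cong (λ z → 2 * (z * 2 ^ m)) (proj₂ T≡) ⟩
            2 * ((c * Z + K * Q) * 2 ^ m)          ≡⟨ expand (c * Z) K Q (2 ^ m) ⟩
            2 * (c * Z) * 2 ^ m + 2 * (K * 2 ^ m) * Q  ≤⟨ ℕP.+-monoˡ-≤ _ (ℕP.*-monoˡ-≤ (2 ^ m) 2cZ≤Q) ⟩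
            Q * 2 ^ m + 2 * (K * 2 ^ m) * Q        ≡⟨ collect Q (2 ^ m) (2 * (K * 2 ^ m)) ⟩
            (2 ^ m + 2 * (K * 2 ^ m)) * Q          ∎)
            where
              expand : ∀ x k q w → 2 * ((x + k * q) * w) ≡ 2 * x * w + 2 * (k * w) * q
              expand = ℕ-solve
              collect : ∀ q w v → q * w + v * q ≡ (w + v) * q
              collect = ℕ-solve
          hi : 2 * suc (N + J) ≤ 2 * (suc K * 2 ^ m)
          hi = begin
            2 * suc (N + J)                         ≡⟨ arith₁ N J ⟩
            2 * N + 2 * suc J                       ≤⟨ ℕP.+-mono-≤ 2N≤ m-large ⟩
            2 ^ m + 2 * (K * 2 ^ m) + 2 ^ m         ≡⟨ arith₂ (2 ^ m) K ⟩
            2 * (suc K * 2 ^ m)                     ∎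
            where
              arith₁ : ∀ n j → 2 * suc (n + j) ≡ 2 * n + 2 * suc j
              arith₁ = ℕ-solve
              arith₂ : ∀ w k → w + 2 * (k * w) + w ≡ 2 * (suc k * w)
              arith₂ = ℕ-solve

      rounded : quo (ΣN J (λ j → quo (y j * 2 ^ (s + m)) (p j)) + suc J) (2 ^ m) ≡ c + wraps y * 2 ^ s
      rounded = trans (quo-between lo hi) (cong (λ k → c + k * 2 ^ s) (sym wraps-correct))
        where
          open ℕP.≤-Reasoning
          K = proj₁ T≡
          N = ΣN J (λ j → quo (y j * 2 ^ (s + m)) (p j))
          t = s + m
          T2^t : T * 2 ^ t ≡ c * 2 ^ m * (2 ^ s * Z) + K * 2 ^ s * 2 ^ m * Q
          T2^t = trans (cong₂ _*_ (proj₂ T≡) (ℕP.^-distribˡ-+-* 2 s m)) (arith c Z K Q (2 ^ s) (2 ^ m))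
            where
              arith : ∀ c z k q v w → (c * z + k * q) * (v * w) ≡ c * w * (v * z) + k * v * w * q
              arith = ℕ-solve
          split : ∀ c k v w → (c + k * v) * w ≡ c * w + k * v * w
          split = ℕ-solve
          N≤ : N ≤ (c + K * 2 ^ s) * 2 ^ m
          N≤ = cancelQ (begin
            N * Q                                              ≤⟨ proj₁ (floors t) ⟩
            T * 2 ^ t                                          ≡⟨ T2^t ⟩
            c * 2 ^ m * (2 ^ s * Z) + K * 2 ^ s * 2 ^ m * Q    ≤⟨ ℕP.+-monoˡ-≤ _ (ℕP.*-monoʳ-≤ (c * 2 ^ m) 2^sZ≤Q) ⟩
            c * 2 ^ m * Q + K * 2 ^ s * 2 ^ m * Q              ≡⟨ trans (cong (_* Q) (split c K (2 ^ s) (2 ^ m))) (ℕP.*-distribʳ-+ Q (c * 2 ^ m) _) ⟨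
            (c + K * 2 ^ s) * 2 ^ m * Q                        ∎)
          hi : N + suc J < suc (c + K * 2 ^ s) * 2 ^ m
          hi = begin-strict
            N + suc J                              <⟨ ℕP.+-mono-≤-< N≤ (ℕP.<-≤-trans (ℕP.m<m*n (suc J) 2 ℕP.≤-refl) (ℕP.≤-trans (ℕP.≤-reflexive (ℕP.*-comm (suc J) 2)) m-large)) ⟩
            (c + K * 2 ^ s) * 2 ^ m + 2 ^ m        ≡⟨ ℕP.+-comm _ (2 ^ m) ⟩
            suc (c + K * 2 ^ s) * 2 ^ m            ∎
          -- Here the group length D enters: Q exceeds 2^s Z by at most s Q / 2^D, and c 2^m times
          -- this is at most Q.
          close : c * 2 ^ m * Q ≤ c * 2 ^ m * (2 ^ s * Z) + Q
          close = ℕP.*-cancelˡ-≤ (2 ^ D) {{ℕ.>-nonZero (ℕP.m^n>0 2 D)}} (begin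
            2 ^ D * (c * 2 ^ m * Q)                                      ≡⟨ rot (2 ^ D) (c * 2 ^ m) Q ⟩
            c * 2 ^ m * (2 ^ D * Q)                                      ≤⟨ ℕP.*-monoʳ-≤ (c * 2 ^ m) nearly ⟩
            c * 2 ^ m * (2 ^ D * (2 ^ s * Z) + s * Q)                    ≡⟨ expand (c * 2 ^ m) (2 ^ D) (2 ^ s * Z) s Q ⟩
            2 ^ D * (c * 2 ^ m * (2 ^ s * Z)) + c * 2 ^ m * s * Q        ≤⟨ ℕP.+-monoʳ-≤ _ (ℕP.*-monoˡ-≤ Q D-large) ⟩
            2 ^ D * (c * 2 ^ m * (2 ^ s * Z)) + 2 ^ D * Q                ≡⟨ ℕP.*-distribˡ-+ (2 ^ D) _ Q ⟨
            2 ^ D * (c * 2 ^ m * (2 ^ s * Z) + Q)                        ∎)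
            where
              rot : ∀ w x q → w * (x * q) ≡ x * (w * q)
              rot = ℕ-solve
              expand : ∀ x w z s q → x * (w * z + s * q) ≡ w * (x * z) + x * s * q
              expand = ℕ-solve
          lo : (c + K * 2 ^ s) * 2 ^ m ≤ N + suc J
          lo = cancelQ (begin
            (c + K * 2 ^ s) * 2 ^ m * Q                            ≡⟨ trans (cong (_* Q) (split c K (2 ^ s) (2 ^ m))) (ℕP.*-distribʳ-+ Q (c * 2 ^ m) _) ⟩
            c * 2 ^ m * Q + K * 2 ^ s * 2 ^ m * Q                  ≤⟨ ℕP.+-monoˡ-≤ _ close ⟩
            c * 2 ^ m * (2 ^ s * Z) + Q + K * 2 ^ s * 2 ^ m * Q    ≡⟨ swap (c * 2 ^ m * (2 ^ s * Z)) Q (K * 2 ^ s * 2 ^ m * Q) ⟩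
            c * 2 ^ m * (2 ^ s * Z) + K * 2 ^ s * 2 ^ m * Q + Q    ≡⟨ cong (_+ Q) (sym T2^t) ⟩
            T * 2 ^ t + Q                                          ≤⟨ ℕP.+-monoˡ-≤ Q (proj₂ (floors t)) ⟩
            (N + J) * Q + Q                                        ≡⟨ collect N J Q ⟩
            (N + suc J) * Q                                        ∎)
            where
              swap : ∀ a b c → a + b + c ≡ a + c + b
              swap = ℕ-solve
              collect : ∀ n j q → (n + j) * q + q ≡ (n + suc j) * q
              collect = ℕ-solve

      -- The quotients in `rounded` are too long to be handled whole. Each is split into the whole
      -- quotient of y j 2^s, expanded into its binary digits, and m further bits that come from the
      -- remainder.
      reconstruct : ΣN s (λ k → 2 ^ k * column y k) + tail y ≡ c + wraps y * 2 ^ s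
      reconstruct = trans (sym (trans (cong (λ z → quo z (2 ^ m)) shape) (trans (quo-+* (N' + suc J) H (ℕP.m^n>0 2 m)) (trans (ℕP.+-comm (tail y) H) (cong (_+ tail y) H≡))))) rounded
        where
          open ≡-Reasoning
          H = ΣN J (λ j → quo (y j * 2 ^ s) (p j))
          N' = ΣN J (λ j → quo (rem (y j * 2 ^ s) (p j) * 2 ^ m) (p j))
          H≡ : H ≡ ΣN s (λ k → 2 ^ k * column y k)
          H≡ = trans (ΣN-cong J (λ j j< → quo-digits (y j) s (y< j j<))) (trans (ΣN-swap J s _) (ΣN-cong s (λ k _ → ΣN-*ˡ J (2 ^ k) _)))
          each : ∀ j → j < J → quo (y j * 2 ^ (s + m)) (p j) ≡ quo (rem (y j * 2 ^ s) (p j) * 2 ^ m) (p j) + quo (y j * 2 ^ s) (p j) * 2 ^ m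
          each j j< = begin
            quo (y j * 2 ^ (s + m)) (p j)
              ≡⟨ cong (λ z → quo z (p j)) (trans (cong (y j *_) (ℕP.^-distribˡ-+-* 2 s m)) (sym (ℕP.*-assoc (y j) (2 ^ s) (2 ^ m)))) ⟩
            quo (y j * 2 ^ s * 2 ^ m) (p j)
              ≡⟨ cong (λ z → quo (z * 2 ^ m) (p j)) (quo-rem (y j * 2 ^ s) (p j)) ⟩
            quo ((r + h * p j) * 2 ^ m) (p j)
              ≡⟨ cong (λ z → quo z (p j)) (arith r h (p j) (2 ^ m)) ⟩
            quo (r * 2 ^ m + h * 2 ^ m * p j) (p j)
              ≡⟨ quo-+* (r * 2 ^ m) (h * 2 ^ m) (prime>0 (prime j j<)) ⟩
            quo (r * 2 ^ m) (p j) + h * 2 ^ m ∎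
            where
              r = rem (y j * 2 ^ s) (p j)
              h = quo (y j * 2 ^ s) (p j)
              arith : ∀ r h p w → (r + h * p) * w ≡ r * w + h * w * p
              arith = ℕ-solve
          shape : ΣN J (λ j → quo (y j * 2 ^ (s + m)) (p j)) + suc J ≡ N' + suc J + H * 2 ^ m
          shape = trans (cong (_+ suc J) (trans (ΣN-cong J each) (trans (ΣN-+ J _ _) (cong (λ z → N' + z) (ΣN-*ʳ J (2 ^ m) _))))) (arith N' (H * 2 ^ m) (suc J))
            where
              arith : ∀ a b c → a + b + c ≡ a + c + b
              arith = ℕ-solve

module UnderCollapse (collapse : ∀ (G : Family) → VP0 G ⇔ VNP0 G) where

  -- Easy functions

  -- This is where the collapse is applied. It concerns families, so the circuits for all n are
  -- summed together, over a number of Boolean variables given by one polynomial p.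
  h-sum : ∀ {u} → PolyBounded u → ∀ p q →
    (R : ∀ n → Σ ℕ λ s → Σ (Circuit (u n + ⟦ p ⟧ n) s) λ C → s ≤ ⟦ q ⟧ n × formalDegree C ≤ ⟦ q ⟧ n) →
    Σ NatPoly λ q' → ∀ n → Realised {X = Vec ℤ (u n)} (λ x → x)
      (λ x → ΣB (⟦ p ⟧ n) (λ ε → evalC (proj₁ (proj₂ (R n))) (x V.++ V.map boolℤ ε))) (⟦ q' ⟧ n)
  h-sum {u} pb p q R with Equivalence.from (collapse (family u (λ n → sumBool (⟦ p ⟧ n) (computed (proj₁ (proj₂ (R n)))))))
    (pb , p , (λ n → computed (proj₁ (proj₂ (R n)))) ,
     (pb-+ pb (pb-poly p) , q , λ n → proj₁ (R n) , proj₁ (proj₂ (R n)) , proj₁ (proj₂ (proj₂ (R n))) ,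
       proj₂ (proj₂ (proj₂ (R n))) , λ e → refl) , λ n e → refl)
  ... | _ , q' , C' = q' , λ n → let s , C , s≤ , d≤ , eq = C' n in
    realised C s≤ d≤ (λ x → trans (evalC-correct C x) (trans (eval-cong (computed C) (sumBool (⟦ p ⟧ n) (computed (proj₁ (proj₂ (R n))))) eq x)
      (trans (eval-sumBool (⟦ p ⟧ n) (computed (proj₁ (proj₂ (R n)))) x)
        (ΣB-cong (⟦ p ⟧ n) (λ ε → sym (evalC-correct (proj₁ (proj₂ (R n))) _))))))

  -- Families of functions of k natural numbers. A family is easy if, for every polynomial p, its restriction
  -- to p(n)-bit arguments is computed by VP0 circuits on the bits of the arguments.
  Env : ℕ → Set
  Env zero    = ⊤
  Env (suc k) = ℕ × Env k

  Asg : ℕ → ℕ → Set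
  Asg P zero    = ⊤
  Asg P (suc k) = Vec Bool P × Asg P k

  env : ∀ {P} k → Asg P k → Env k
  env zero    _        = tt
  env (suc k) (b , bs) = val b , env k bs

  get : ∀ {k} → Fin k → Env k → ℕ
  get zero    (a , _) = a
  get (suc i) (_ , γ) = get i γ

  getA : ∀ {P k} → Fin k → Asg P k → Vec Bool P
  getA zero    (b , _)  = b
  getA (suc i) (_ , bs) = getA i bs

  val-getA : ∀ {P k} (i : Fin k) (a : Asg P k) → val (getA i a) ≡ get i (env k a)
  val-getA zero    _        = refl
  val-getA (suc i) (_ , bs) = val-getA i bs

  nv : ℕ → ℕ → ℕ
  nv P zero    = 0
  nv P (suc k) = nv P k + P

  flatB : ∀ {P} k → Asg P k → Vec Bool (nv P k)
  flatB zero    _        = []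
  flatB (suc k) (b , bs) = flatB k bs V.++ b

  flat : ∀ {P} k → Asg P k → Vec ℤ (nv P k)
  flat k a = V.map boolℤ (flatB k a)

  pb-nv : ∀ p k → PolyBounded (λ n → nv (⟦ p ⟧ n) k)
  pb-nv p zero    = pb-const 0
  pb-nv p (suc k) = pb-+ (pb-nv p k) (pb-poly p)

  module BitWires {X : Set} {m : ℕ} (ι : X → Vec ℤ m) {s} {C : SLP m s} where
    open Wires ι

    record Bits {n} (w : X → Vec Bool n) : Set where
      constructor bits
      field
        wireOf : ∀ i → Has C (λ x → boolℤ (lookup (w x) i)) 1
    open Bits public

    bits-++ : ∀ {n n'} {v : X → Vec Bool n} {w : X → Vec Bool n'} → Bits v → Bits w → Bits (λ x → v x V.++ w x)
    bits-++ {n} {v = v} {w} hv hw = bits λ i →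
      has-cong (λ x → cong boolℤ (sym (VP.lookup-splitAt n (v x) (w x) i))) (pick (F.splitAt n i))
      where
        pick : ∀ z → Has C (λ x → boolℤ ([ lookup (v x) , lookup (w x) ]′ z)) 1
        pick (inj₁ j) = wireOf hv j
        pick (inj₂ j) = wireOf hw j

    bits-cong : ∀ {n} {v w : X → Vec Bool n} → (∀ x → v x ≡ w x) → Bits v → Bits w
    bits-cong eq h = bits λ i → has-cong (λ x → cong (λ u → boolℤ (lookup u i)) (eq x)) (wireOf h i)

    bits-map : ∀ {n} {w : X → Vec Bool n} → Bits w → ∀ i → Has C (λ x → lookup (V.map boolℤ (w x)) i) 1
    bits-map {w = w} h i = has-cong (λ x → sym (VP.lookup-map i boolℤ (w x))) (wireOf h i)

    bits-const : ∀ {n} → Has C (λ _ → ℤ.0ℤ) 1 → (v : Vec Bool n) → Bits (λ _ → v)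
    bits-const hz v = bits λ i → go (lookup v i)
      where
        go : ∀ b → Has C (λ _ → boolℤ b) 1
        go false = hz
        go true  = has-one C

    bits-flat : ∀ {P} k {a : X → Asg P k} → (∀ i → Bits (λ x → getA i (a x))) → Bits (λ x → flatB k (a x))
    bits-flat zero    h = bits λ ()
    bits-flat (suc k) {a} h = bits-++ (bits-flat k {λ x → proj₂ (a x)} (λ i → h (suc i))) (h zero)

    gen-val : ∀ {n} {w : X → Vec Bool n} → Bits w → Gen C (λ x → + val (w x)) 1 (n * 2 + 1)
    gen-val {zero} {w} h = gen-cong (λ x → nil (w x)) gen-zero
      where
        nil : (v : Vec Bool 0) → ℤ.0ℤ ≡ + val v
        nil [] = refl
    gen-val {suc n} {w} h = gen-cong (λ x → cons (w x)) (gen-≤ (ℕP.⊔-lub ℕP.≤-refl (ℕP.⊔-lub ℕP.≤-refl ℕP.≤-refl)) (ℕP.≤-reflexive (arith n))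
      (gen-let (gen-val {n} {λ x → V.tail (w x)} (bits λ i → has-cong (λ x → cong boolℤ (tail≡ (w x))) (wireOf h (suc i))))
        (λ p hv → gen-op plus (gen-has (has-⊑ p (wireOf h zero))) (gen-op plus (gen-has hv) (gen-has hv)))))
      where
        tail≡ : ∀ (v : Vec Bool (suc n)) {i} → lookup v (suc i) ≡ lookup (V.tail v) i
        tail≡ (_ ∷ _) = refl
        arith : ∀ n → (n * 2 + 1) + (0 + ((0 + (0 + 1)) + 1)) ≡ suc n * 2 + 1
        arith = ℕ-solve
        cons : ∀ (v : Vec Bool (suc n)) →
          boolℤ (lookup v zero) ℤ.+ (+ val (V.tail v) ℤ.+ + val (V.tail v)) ≡ + val v
        cons (b ∷ bs) = begin
          boolℤ b ℤ.+ (+ val bs ℤ.+ + val bs) ≡⟨ cong (ℤ._+ (+ val bs ℤ.+ + val bs)) (pos-bit b) ⟩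
          + (bit b + (val bs + val bs))       ≡⟨ cong +_ (cong (λ z → bit b + (val bs + z)) (sym (ℕP.+-identityʳ _))) ⟩
          + (bit b + 2 * val bs)              ≡⟨ cong +_ (val-∷ b bs) ⟨
          + val (b ∷ bs)                      ∎
          where open ≡-Reasoning

  -- All arguments of an easy function have the same number of bits, so shorter ones receive high
  -- zeros before they are passed on.
  padTo : ∀ Q {P} → Vec Bool P → Vec Bool Q
  padTo zero    _        = []
  padTo (suc Q) []       = false ∷ padTo Q []
  padTo (suc Q) (b ∷ bs) = b ∷ padTo Q bs

  val-padTo : ∀ Q {P} (w : Vec Bool P) → P ≤ Q → val (padTo Q w) ≡ val w
  val-padTo zero    []       _       = refl
  val-padTo (suc Q) []       _       = cong (2 *_) (val-padTo Q [] z≤n)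
  val-padTo (suc Q) (b ∷ bs) (s≤s l) =
    trans (val-∷ b _) (trans (cong (λ z → bit b + 2 * z) (val-padTo Q bs l)) (sym (val-∷ b bs)))

  padAll : ∀ Q {P} k → Asg P k → Asg Q k
  padAll Q zero    _        = tt
  padAll Q (suc k) (b , bs) = padTo Q b , padAll Q k bs

  env-padAll : ∀ Q {P} k (a : Asg P k) → P ≤ Q → env k (padAll Q k a) ≡ env k a
  env-padAll Q zero    _        _ = refl
  env-padAll Q (suc k) (b , bs) l = cong₂ _,_ (val-padTo Q b l) (env-padAll Q k bs l)

  getA-padAll : ∀ Q {P k} (i : Fin k) (a : Asg P k) → getA i (padAll Q k a) ≡ padTo Q (getA i a)
  getA-padAll Q zero    _        = refl
  getA-padAll Q (suc i) (_ , bs) = getA-padAll Q i bs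

  binary : ∀ P c → c < 2 ^ P → ∃ λ (v : Vec Bool P) → val v ≡ c
  binary zero    zero    _ = [] , refl
  binary zero    (suc c) (s≤s ())
  binary (suc P) c c< with halve c
    where
      halve : ∀ c → ∃ λ b → ∃ λ d → c ≡ bit b + 2 * d
      halve zero    = false , 0 , refl
      halve (suc c) with halve c
      ... | false , d , refl = true , d , refl
      ... | true  , d , refl = false , suc d , sym (ℕP.*-distribˡ-+ 2 1 d)
  ... | b , d , refl with binary P d (ℕP.*-cancelˡ-< 2 d (2 ^ P) (ℕP.≤-<-trans (ℕP.m≤n+m (2 * d) (bit b)) c<))
  ...   | v , refl = b ∷ v , val-∷ b v

  module Inputs {P k : ℕ} {s} {C : SLP (nv P k) s} where
    open Wires (flat {P} k)
    open BitWires (flat {P} k) {C = C}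

    input-bits : ∀ (i : Fin k) → Bits (λ a → getA i a)
    input-bits i = bits λ t → has-cong (λ a → position k i a t) (has-input C (index k i t))
      where
        index : ∀ k → Fin k → Fin P → Fin (nv P k)
        index (suc k) zero    t = nv P k ↑ʳ t
        index (suc k) (suc i) t = index k i t ↑ˡ P
        position-B : ∀ k i (a : Asg P k) t → lookup (flatB k a) (index k i t) ≡ lookup (getA i a) t
        position-B (suc k) zero    (b , bs) t = VP.lookup-++ʳ (flatB k bs) b t
        position-B (suc k) (suc i) (b , bs) t = trans (VP.lookup-++ˡ (flatB k bs) b (index k i t)) (position-B k i bs t)
        position : ∀ k i (a : Asg P k) t → lookup (flat k a) (index k i t) ≡ boolℤ (lookup (getA i a) t)
        position k i a t = trans (VP.lookup-map (index k i t) boolℤ (flatB k a)) (cong boolℤ (position-B k i a t))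

  module Pad {X : Set} {m : ℕ} (ι : X → Vec ℤ m) {s} {C : SLP m s} where
    open Wires ι
    open BitWires ι {C = C}

    bits-padTo : ∀ Q {P} {w : X → Vec Bool P} → Has C (λ _ → ℤ.0ℤ) 1 → Bits w → Bits (λ x → padTo Q (w x))
    bits-padTo Q {w = w} hz h = bits (go Q (λ x → w x) h)
      where
        go : ∀ Q {P} (w : X → Vec Bool P) → Bits w → ∀ i → Has C (λ x → boolℤ (lookup (padTo Q (w x)) i)) 1
        go (suc Q) {zero} w h zero    = has-cong (λ x → nil (w x)) hz
          where
            nil : (v : Vec Bool 0) → ℤ.0ℤ ≡ boolℤ (lookup (padTo (suc Q) v) zero)
            nil [] = refl
        go (suc Q) {zero} w h (suc i) = has-cong (λ x → nil (w x)) (go Q w h i)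
          where
            nil : (v : Vec Bool 0) → boolℤ (lookup (padTo Q v) i) ≡ boolℤ (lookup (padTo (suc Q) v) (suc i))
            nil [] = refl
        go (suc Q) {suc P} w h zero = has-cong (λ x → cons (w x)) (wireOf h zero)
          where
            cons : (v : Vec Bool (suc P)) → boolℤ (lookup v zero) ≡ boolℤ (lookup (padTo (suc Q) v) zero)
            cons (_ ∷ _) = refl
        go (suc Q) {suc P} w h (suc i) = has-cong (λ x → cons (w x))
          (go Q (λ x → V.tail (w x)) (bits λ j → has-cong (λ x → tail≡ (w x)) (wireOf h (suc j))) i)
          where
            cons : (v : Vec Bool (suc P)) → boolℤ (lookup (padTo Q (V.tail v)) i) ≡ boolℤ (lookup (padTo (suc Q) v) (suc i))
            cons (_ ∷ _) = refl
            tail≡ : (v : Vec Bool (suc P)) {j : Fin P} → boolℤ (lookup v (suc j)) ≡ boolℤ (lookup (V.tail v) j)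
            tail≡ (_ ∷ _) = refl

  record EasyAt (p : NatPoly) {k} (φ : ℕ → Env k → ℤ) : Set where
    constructor easyAt
    field
      bound : NatPoly
      real  : ∀ n → Realised (flat {⟦ p ⟧ n} k) (λ a → φ n (env k a)) (⟦ bound ⟧ n)

  record Easy {k} (φ : ℕ → Env k → ℤ) : Set where
    constructor easy
    field
      at : ∀ p → EasyAt p φ
  open Easy public using (at)

  easyAt-pb : ∀ {p k} {φ : ℕ → Env k → ℤ} {b} → PolyBounded b →
    (∀ n → Realised (flat {⟦ p ⟧ n} k) (λ a → φ n (env k a)) (b n)) → EasyAt p φ
  easyAt-pb (q , h) R = easyAt q (λ n → realised-≤ (h n) (R n))

  easyAt-cong : ∀ {p k} {φ ψ : ℕ → Env k → ℤ} → (∀ n (a : Asg (⟦ p ⟧ n) k) → φ n (env k a) ≡ ψ n (env k a)) →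
    EasyAt p φ → EasyAt p ψ
  easyAt-cong h (easyAt q R) = easyAt q λ n → let realised C s d e = R n in
    realised C s d (λ a → trans (e a) (h n a))

  easy-cong : ∀ {k} {φ ψ : ℕ → Env k → ℤ} → (∀ n γ → φ n γ ≡ ψ n γ) → Easy φ → Easy ψ
  easy-cong h E = easy λ p → easyAt-cong (λ n a → h n _) (at E p)

  gen-same : ∀ {P k f b} → Realised (flat {P} k) f b → Wires.Gen (flat {P} k) [] f b b
  gen-same {k = k} R = gen-realised (flat k) R (λ a → a) (Wires.has-input (flat k) [])

  easy-op : ∀ o {k} {φ ψ : ℕ → Env k → ℤ} → Easy φ → Easy ψ → Easy (λ n γ → opZ o (φ n γ) (ψ n γ))
  easy-op o {k} E E' = easy λ p → let open EasyAt in
    easyAt-pb (pb-+ (pb-poly (bound (at E p))) (pb-+ (pb-poly (bound (at E' p))) (pb-const 1))) λ n →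
      realise (flat k) (Wires.gen-op (flat k) o (gen-same (real (at E p) n)) (gen-same (real (at E' p) n)))
        (deg o (⟦ bound (at E p) ⟧ n) (⟦ bound (at E' p) ⟧ n)) ℕP.≤-refl
    where
      deg : ∀ o a b → degOp o a b ≤ a + (b + 1)
      deg plus  a b = ℕP.⊔-lub (ℕP.m≤m+n a _) (ℕP.≤-trans (ℕP.m≤m+n b 1) (ℕP.m≤n+m _ a))
      deg minus a b = ℕP.⊔-lub (ℕP.m≤m+n a _) (ℕP.≤-trans (ℕP.m≤m+n b 1) (ℕP.m≤n+m _ a))
      deg times a b = ℕP.+-monoʳ-≤ a (ℕP.m≤m+n b 1)

  easy-var : ∀ {k} (i : Fin k) → Easy (λ n γ → + get i γ)
  easy-var {k} i = easy λ p → easyAt-pb (pb-+ (pb-* (pb-poly p) (pb-const 2)) (pb-const 1)) λ n →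
    realise (flat k) (Wires.gen-cong (flat k) (λ a → cong +_ (val-getA i a))
        (BitWires.gen-val (flat k) (Inputs.input-bits {⟦ p ⟧ n} {k} i)))
      (ℕP.m≤n+m 1 _) ℕP.≤-refl

  -- Easiness is non-uniform: circuits are chosen separately for each n, so any sequence of
  -- constants with polynomially many bits is allowed. This is the door through which advice enters.
  easy-const : ∀ {k} (c : ℕ → ℕ) p → (∀ n → c n < 2 ^ ⟦ p ⟧ n) → Easy {k} (λ n γ → + c n)
  easy-const {k} c p h = easy λ r → easyAt-pb (pb-+ (pb-const 1) (pb-+ (pb-* (pb-poly p) (pb-const 2)) (pb-const 1))) λ n →
    let v , eq = binary (⟦ p ⟧ n) (c n) (h n) in
    realise (flat k) (Wires.gen-let (flat k) (Wires.gen-zero (flat k)) (λ _ hz →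
        Wires.gen-cong (flat k) (λ _ → cong +_ eq) (BitWires.gen-val (flat k) (BitWires.bits-const (flat k) hz v))))
      (s≤s z≤n) ℕP.≤-refl

  ΣB-val : ∀ k F → ΣB k (λ ε → F (val ε)) ≡ ΣZ (2 ^ k) F
  ΣB-val zero    F = sym (ℤP.+-identityˡ _)
  ΣB-val (suc k) F = begin
    ΣB k (λ ε → F (2 * val ε)) ℤ.+ ΣB k (λ ε → F (suc (2 * val ε)))
      ≡⟨ cong₂ ℤ._+_ (ΣB-val k (λ i → F (2 * i))) (ΣB-val k (λ i → F (suc (2 * i)))) ⟩
    ΣZ w (λ i → F (2 * i)) ℤ.+ ΣZ w (λ i → F (suc (2 * i)))
      ≡⟨ ΣZ-+ w _ _ ⟨
    ΣZ w (λ i → F (2 * i) ℤ.+ F (suc (2 * i)))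
      ≡⟨ ΣZ-cong w (λ i _ → cong₂ ℤ._+_ (trans (cong F (trans (ℕP.*-comm 2 i) (sym (ℕP.+-identityʳ _)))) (sym (ℤP.+-identityˡ _)))
                                         (cong F (trans (cong suc (ℕP.*-comm 2 i)) (ℕP.+-comm 1 _)))) ⟩
    ΣZ w (λ i → ΣZ 2 (λ j → F (i * 2 + j)))
      ≡⟨ ΣZ-* w 2 F ⟨
    ΣZ (w * 2) F
      ≡⟨ cong (λ z → ΣZ z F) (ℕP.*-comm w 2) ⟩
    ΣZ (2 * w) F ∎
    where
      open ≡-Reasoning
      w = 2 ^ k

  ⟦addN⟧-≤ˡ : ∀ p q n → ⟦ p ⟧ n ≤ ⟦ addN p q ⟧ n
  ⟦addN⟧-≤ˡ p q n = ℕP.≤-trans (ℕP.m≤m+n _ _) (ℕP.≤-reflexive (sym (⟦addN⟧ p q n)))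

  ⟦addN⟧-≤ʳ : ∀ p q n → ⟦ q ⟧ n ≤ ⟦ addN p q ⟧ n
  ⟦addN⟧-≤ʳ p q n = ℕP.≤-trans (ℕP.m≤n+m _ _) (ℕP.≤-reflexive (sym (⟦addN⟧ p q n)))

  map-++ : ∀ {m n} (v : Vec Bool m) (w : Vec Bool n) → V.map boolℤ (v V.++ w) ≡ V.map boolℤ v V.++ V.map boolℤ w
  map-++ = VP.map-++ boolℤ

  -- The bound variable may need more bits than the parameters. All are padded to p + p' bits, the
  -- length for which circuits for φ are supplied.
  easyAt-Σ : ∀ {p p' k} {φ : ℕ → Env (suc k) → ℤ} → EasyAt (addN p p') φ →
    EasyAt p (λ n γ → ΣZ (2 ^ ⟦ p' ⟧ n) (λ y → φ n (y , γ)))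
  easyAt-Σ {p} {p'} {k} {φ} (easyAt q R) = easyAt (proj₁ summed) λ n →
    let realised C s d e = proj₂ summed n in
    realised C s d (λ a → trans (e (flat k a)) (trans
      (ΣB-cong (⟦ p' ⟧ n) (λ ε → trans (cong (evalC (Realised.circ (inner n))) (sym (map-++ (flatB k a) ε)))
        (trans (Realised.sem (inner n) (a , ε))
          (cong (φ n) (cong₂ _,_ (val-padTo (Q n) ε (⟦addN⟧-≤ʳ p p' n)) (env-padAll (Q n) k a (⟦addN⟧-≤ˡ p p' n)))))))
      (ΣB-val (⟦ p' ⟧ n) (λ y → φ n (y , env k a)))))
    where
      Q : ℕ → ℕ
      Q n = ⟦ addN p p' ⟧ n
      X : ℕ → Set
      X n = Asg (⟦ p ⟧ n) k × Vec Bool (⟦ p' ⟧ n)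
      ι : ∀ n → X n → Vec ℤ (nv (⟦ p ⟧ n) k + ⟦ p' ⟧ n)
      ι n (a , y) = V.map boolℤ (flatB k a V.++ y)
      h : ∀ n → X n → Asg (Q n) (suc k)
      h n (a , y) = padTo (Q n) y , padAll (Q n) k a
      inputs : ∀ n {s} {C : SLP _ s} → BitWires.Bits (ι n) {C = C} (λ (a , y) → flatB k a V.++ y)
      inputs n {C = C} = BitWires.bits λ i → Wires.has-cong (ι n) (λ (a , y) → VP.lookup-map i boolℤ (flatB k a V.++ y))
        (Wires.has-input (ι n) C i)
      first : ∀ n {s} {C : SLP _ s} → BitWires.Bits (ι n) {C = C} (λ (a , y) → flatB k a)
      first n = BitWires.bits λ i → Wires.has-cong (ι n) (λ (a , y) → cong boolℤ (VP.lookup-++ˡ (flatB k a) y i))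
        (BitWires.wireOf (inputs n) (i ↑ˡ _))
      second : ∀ n {s} {C : SLP _ s} → BitWires.Bits (ι n) {C = C} (λ (a , y) → y)
      second n = BitWires.bits λ i → Wires.has-cong (ι n) (λ (a , y) → cong boolℤ (VP.lookup-++ʳ (flatB k a) y i))
        (BitWires.wireOf (inputs n) (nv (⟦ p ⟧ n) k ↑ʳ i))
      block : ∀ n {s} {C : SLP _ s} (i : Fin k) → BitWires.Bits (ι n) {C = C} (λ (a , y) → getA i a)
      block n i = go k (λ (a , y) → a) (first n) i
        where
          go : ∀ k {s} {C : SLP _ s} (a : X n → Asg (⟦ p ⟧ n) k) → BitWires.Bits (ι n) {C = C} (λ x → flatB k (a x)) →
            ∀ i → BitWires.Bits (ι n) {C = C} (λ x → getA i (a x))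
          go (suc k) a H zero = BitWires.bits λ t → Wires.has-cong (ι n)
            (λ x → cong boolℤ (VP.lookup-++ʳ (flatB k (proj₂ (a x))) (proj₁ (a x)) t)) (BitWires.wireOf H (_ ↑ʳ t))
          go (suc k) a H (suc i) = go k (λ x → proj₂ (a x)) (BitWires.bits λ t → Wires.has-cong (ι n)
            (λ x → cong boolℤ (VP.lookup-++ˡ (flatB k (proj₂ (a x))) (proj₁ (a x)) t)) (BitWires.wireOf H (t ↑ˡ _))) i
      inner : ∀ n → Realised (ι n) (λ x → φ n (env (suc k) (h n x))) (1 + ⟦ q ⟧ n)
      inner n = realise (ι n) (Wires.gen-let (ι n) (Wires.gen-zero (ι n)) (λ {s'} {C'} _ hz →
        gen-realised (ι n) (R n) (h n) (BitWires.bits-map (ι n) (BitWires.bits-flat (ι n) (suc k) (λ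
          { zero    → Pad.bits-padTo (ι n) (Q n) hz (second n)
          ; (suc i) → BitWires.bits-cong (ι n) (λ (a , y) → sym (getA-padAll (Q n) i a))
              (Pad.bits-padTo (ι n) (Q n) hz (block n i)) })))))
        (ℕP.n≤1+n _) ℕP.≤-refl
      summed = h-sum (pb-nv p k) p' (addN (1 ∷ []) q) (λ n → _ , Realised.circ (inner n) ,
        ℕP.≤-trans (Realised.size≤ (inner n)) (bnd n) , ℕP.≤-trans (Realised.degree≤ (inner n)) (bnd n))
        where
          bnd : ∀ n → 1 + ⟦ q ⟧ n ≤ ⟦ addN (1 ∷ []) q ⟧ n
          bnd n = ℕP.≤-reflexive (sym (trans (⟦addN⟧ (1 ∷ []) q n) (cong (λ z → suc z + ⟦ q ⟧ n) (ℕP.*-zeroʳ n))))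

  -- In contrast to sums, only polynomially many factors are possible: the formal degrees of the
  -- factors add up.
  easyAt-Π : ∀ {p r k} {φ : ℕ → Env (suc k) → ℤ} → EasyAt (addN p r) φ →
    EasyAt p (λ n γ → ΠZ (⟦ r ⟧ n) (λ i → φ n (i , γ)))
  easyAt-Π {p} {r} {k} {φ} (easyAt q R) = easyAt-pb
    (pb-+ (pb-const 1) (pb-* (pb-poly r) (pb-+ (pb-poly q) (pb-const 1)))) λ n →
    realise (flat k) (Wires.gen-let (flat k) (Wires.gen-zero (flat k)) (λ {s'} {C'} _ hz →
      Wires.gen-product (flat k) (⟦ r ⟧ n) (λ i a → φ n (i , env k a)) (λ i i<r → factor n hz i i<r)))
      (ℕP.≤-trans (ℕP.+-monoˡ-≤ 1 (ℕP.*-monoʳ-≤ (⟦ r ⟧ n) (ℕP.m≤m+n _ 1))) (ℕP.≤-reflexive (ℕP.+-comm _ 1)))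
      ℕP.≤-refl
    where
      factor : ∀ n {s'} {C' : SLP _ s'} → Wires.Has (flat k) C' (λ _ → ℤ.0ℤ) 1 → ∀ i → i < ⟦ r ⟧ n →
        Wires.Gen (flat {⟦ p ⟧ n} k) C' (λ a → φ n (i , env k a)) (⟦ q ⟧ n) (⟦ q ⟧ n)
      factor n hz i i<r = let
          Q = ⟦ addN p r ⟧ n
          i<2^Q = ℕP.<-≤-trans (ℕP.<-trans i<r (n<2^n (⟦ r ⟧ n))) (ℕP.^-monoʳ-≤ 2 (⟦addN⟧-≤ʳ p r n))
          v , eq = binary Q i i<2^Q
        in Wires.gen-cong (flat k) (λ a → cong (φ n) (cong₂ _,_ eq (env-padAll Q k a (⟦addN⟧-≤ˡ p r n))))
          (gen-realised (flat k) (R n) (λ a → v , padAll Q k a)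
            (BitWires.bits-map (flat k) (BitWires.bits-flat (flat k) (suc k) (λ
              { zero    → BitWires.bits-const (flat k) hz v
              ; (suc j) → BitWires.bits-cong (flat k) (λ a → sym (getA-padAll Q j a))
                  (Pad.bits-padTo (flat k) Q hz (Inputs.input-bits {⟦ p ⟧ n} {k} j)) }))))

  -- The number of variables summed in `VNP0` is exactly the value of a polynomial, so programs are
  -- filled up with dummy gates to that number.
  pad-BP : ∀ {m k K} (B : BP m k) → k ℕ.≤′ K → Σ (BP m K) λ B' → B ⊑𝔹 B'
  pad-BP B ℕ.≤′-refl     = B , here
  pad-BP B (ℕ.≤′-step l) with pad-BP B l
  ... | B' , p = let i = HasB.index (hasB-true B') in (B' ▷ ((λ _ _ _ → false) , i , i , i)) , next p

  pb-signCost : ∀ {b c} → PolyBounded b → PolyBounded c → PolyBounded (λ n → signCost (b n) (c n))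
  pb-signCost hb hc = pb-+ (pb-const 1) (pb-+ (pb-* hb (opc (pb-+ (pb-const 1) hc))) (pb-const 1))
    where
      opc : ∀ {d} → PolyBounded d → PolyBounded (λ n → opCost (d n))
      opc hd = pb-+ (pb-+ hd (pb-* hd (pb-const 2))) (pb-* hd (pb-+ hd (pb-* hd (pb-const 2))))

  circuit-bound : ∀ {m s} (C : Circuit m s) b → s ≤ b → formalDegree C ≤ b → ∀ x →
    ∣ evalC C (V.map boolℤ x) ∣ < 2 ^ (b * b + 1)
  circuit-bound (circuit C o) b s≤ d≤ x = ℕP.≤-<-trans (proj₁ (evalS-bound C x o))
    (ℕP.≤-<-trans (ℕP.^-monoʳ-≤ 2 (ℕP.*-mono-≤ s≤ d≤)) (ℕP.^-monoʳ-< 2 ℕP.≤-refl (ℕP.≤-reflexive (ℕP.+-comm 1 (b * b)))))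

  -- The passage from arithmetic to logic. With size and degree at most b, the value has at most b²
  -- + 1 bits at Boolean points; a Boolean program for its top bit exists, and summing over its
  -- guessed gate values makes it a low-degree circuit.
  easyAt-sign : ∀ {p k} {φ : ℕ → Env k → ℤ} → EasyAt p φ → EasyAt p (λ n γ → boolℤ (nonneg (φ n γ)))
  easyAt-sign {p} {k} {φ} (easyAt q R) = easyAt (proj₁ summed) λ n →
    let realised C s d e = proj₂ summed n in
    realised C s d (λ a → trans (e (flat k a)) (trans
      (ΣB-cong (K n) (λ z → Realised.sem (inner n) (flatB k a , z)))
      (trans (ΣB-check (prog n) (flatB k a) (λ ν → boolℤ (lookup ν (out n))))
        (cong boolℤ (trans (HasB.sem (wire-out n) (flatB k a)) (cong nonneg (Realised.sem (R n) a)))))))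
    where
      M : ℕ → ℕ
      M n = nv (⟦ p ⟧ n) k
      b : ℕ → ℕ
      b n = ⟦ q ⟧ n
      cost-pb : PolyBounded (λ n → signCost (b n) (b n * b n + 1))
      cost-pb = pb-signCost (pb-poly q) (pb-+ (pb-* (pb-poly q) (pb-poly q)) (pb-const 1))
      r = proj₁ cost-pb
      K : ℕ → ℕ
      K n = ⟦ r ⟧ n
      D : ∀ n → Circuit (M n) (Realised.size (R n))
      D n = Realised.circ (R n)
      base : ∀ n → Σ ℕ λ k' → Σ (BP (M n) k') λ B → k' ≤ signCost (Realised.size (R n)) (b n * b n + 1) ×
        HasB B (λ x → nonneg (evalC (D n) (V.map boolℤ x)))
      base n = sign-BP (D n) (b n * b n + 1) (circuit-bound (D n) (b n) (Realised.size≤ (R n)) (Realised.degree≤ (R n)))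
      base≤ : ∀ n → proj₁ (base n) ≤ K n
      base≤ n = ℕP.≤-trans (proj₁ (proj₂ (proj₂ (base n)))) (ℕP.≤-trans
        (s≤s (ℕP.+-monoˡ-≤ 1 (ℕP.*-monoˡ-≤ (opCost (suc (b n * b n + 1))) (Realised.size≤ (R n))))) (proj₂ cost-pb n))
      padded : ∀ n → Σ (BP (M n) (K n)) λ B' → proj₁ (proj₂ (base n)) ⊑𝔹 B'
      padded n = pad-BP (proj₁ (proj₂ (base n))) (ℕP.≤⇒≤′ (base≤ n))
      prog : ∀ n → BP (M n) (K n)
      prog n = proj₁ (padded n)
      wire-out : ∀ n → HasB (prog n) (λ x → nonneg (evalC (D n) (V.map boolℤ x)))
      wire-out n = hasB-⊑ (proj₂ (padded n)) (proj₂ (proj₂ (proj₂ (base n))))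
      out : ∀ n → Fin (K n + suc (M n))
      out n = HasB.index (wire-out n)
      X : ℕ → Set
      X n = Vec Bool (M n) × Vec Bool (K n)
      ι : ∀ n → X n → Vec ℤ (M n + K n)
      ι n (x , z) = V.map boolℤ x V.++ V.map boolℤ z
      ν : ∀ n → X n → Vec Bool (K n + suc (M n))
      ν n (x , z) = z V.++ (true ∷ x)
      wires : ∀ n → BitWires.Bits (ι n) {C = []} (ν n)
      wires n = BitWires.bits-++ (ι n) {v = λ (x , z) → z} {w = λ (x , z) → true ∷ x}
        (BitWires.bits λ i → Wires.has-cong (ι n) (λ (x , z) → trans (VP.lookup-++ʳ (V.map boolℤ x) (V.map boolℤ z) i) (VP.lookup-map i boolℤ z))
          (Wires.has-input (ι n) [] (M n ↑ʳ i)))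
        (BitWires.bits λ
          { zero    → Wires.has-one (ι n) []
          ; (suc i) → Wires.has-cong (ι n) (λ (x , z) → trans (VP.lookup-++ˡ (V.map boolℤ x) (V.map boolℤ z) i) (VP.lookup-map i boolℤ x))
              (Wires.has-input (ι n) [] (i ↑ˡ K n)) })
      inner : ∀ n → Realised (ι n) (λ xz → check (prog n) (ν n xz) ℤ.* boolℤ (lookup (ν n xz) (out n)))
        (K n * 5 + 1 + 1 + K n * (muxCost 4 + 1))
      inner n = realise (ι n) (Wires.gen-op (ι n) times
          (GenBool.gen-check (ι n) (prog n) (ν n) (BitWires.wireOf (wires n)))
          (Wires.gen-has (ι n) (BitWires.wireOf (wires n) (out n))))
        (ℕP.m≤m+n _ _) (ℕP.≤-trans (ℕP.≤-reflexive (ℕP.+-comm _ 1)) (ℕP.+-monoˡ-≤ _ (ℕP.m≤n+m 1 (K n * 5 + 1))))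
      cost : PolyBounded (λ n → K n * 5 + 1 + 1 + K n * (muxCost 4 + 1))
      cost = pb-+ (pb-+ (pb-+ (pb-* (pb-poly r) (pb-const 5)) (pb-const 1)) (pb-const 1)) (pb-* (pb-poly r) (pb-const (muxCost 4 + 1)))
      summed = h-sum (pb-nv p k) r (proj₁ cost) (λ n → _ , Realised.circ (inner n) ,
        ℕP.≤-trans (Realised.size≤ (inner n)) (proj₂ cost n) , ℕP.≤-trans (Realised.degree≤ (inner n)) (proj₂ cost n))

  easy-sign : ∀ {k} {φ : ℕ → Env k → ℤ} → Easy φ → Easy (λ n γ → boolℤ (nonneg (φ n γ)))
  easy-sign E = easy λ p → easyAt-sign (at E p)

  -- Supplies the number of bits over which a guess for the value has to range.
  easyAt-bound : ∀ {p k} {φ : ℕ → Env k → ℤ} → EasyAt p φ →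
    Σ NatPoly λ w → ∀ n (a : Asg (⟦ p ⟧ n) k) → ∣ φ n (env k a) ∣ < 2 ^ ⟦ w ⟧ n
  easyAt-bound {p} {k} {φ} (easyAt q R) = addN (mulN q q) (1 ∷ []) , λ n a → let realised C s≤ d≤ e = R n in
    subst₂ (λ z w → ∣ z ∣ < 2 ^ w) (e a) (sym (bnd n)) (circuit-bound C (⟦ q ⟧ n) s≤ d≤ (flatB k a))
    where
      bnd : ∀ n → ⟦ addN (mulN q q) (1 ∷ []) ⟧ n ≡ ⟦ q ⟧ n * ⟦ q ⟧ n + 1
      bnd n = trans (⟦addN⟧ (mulN q q) (1 ∷ []) n) (cong₂ _+_ (⟦mulN⟧ q q n) (cong suc (ℕP.*-zeroʳ n)))

  mkEnv : ∀ j → (Fin j → ℕ) → Env j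
  mkEnv zero    f = tt
  mkEnv (suc j) f = f zero , mkEnv j (λ i → f (suc i))

  mkEnv-get : ∀ k (γ : Env k) → mkEnv k (λ i → get i γ) ≡ γ
  mkEnv-get zero    _       = refl
  mkEnv-get (suc k) (a , γ) = cong (a ,_) (mkEnv-get k γ)

  easy-rename : ∀ {j k} {φ : ℕ → Env j → ℤ} (ρ : Fin j → Fin k) → Easy φ →
    Easy {k} (λ n γ → φ n (mkEnv j (λ i → get (ρ i) γ)))
  easy-rename {j} {k} {φ} ρ E = easy λ p → let open EasyAt in
    easyAt-pb (pb-poly (bound (at E p))) λ n →
      realise (flat k) (Wires.gen-cong (flat k) (λ a → cong (φ n) (env-mk j (λ i → getA (ρ i) a) (λ i → val-getA (ρ i) a)))
        (gen-realised (flat k) (real (at E p) n) (λ a → mkAsg j (λ i → getA (ρ i) a))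
          (BitWires.bits-map (flat k) (BitWires.bits-flat (flat k) j (λ i →
            BitWires.bits-cong (flat k) (λ a → sym (getA-mk j (λ i → getA (ρ i) a) i)) (Inputs.input-bits (ρ i)))))))
        ℕP.≤-refl ℕP.≤-refl
    where
      mkAsg : ∀ {P} j → (Fin j → Vec Bool P) → Asg P j
      mkAsg zero    f = tt
      mkAsg (suc j) f = f zero , mkAsg j (λ i → f (suc i))
      getA-mk : ∀ {P} j (f : Fin j → Vec Bool P) i → getA i (mkAsg j f) ≡ f i
      getA-mk (suc j) f zero    = refl
      getA-mk (suc j) f (suc i) = getA-mk j (λ i → f (suc i)) i
      env-mk : ∀ {P} j (f : Fin j → Vec Bool P) {g : Fin j → ℕ} → (∀ i → val (f i) ≡ g i) → env j (mkAsg j f) ≡ mkEnv j g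
      env-mk zero    f h = refl
      env-mk (suc j) f h = cong₂ _,_ (h zero) (env-mk j (λ i → f (suc i)) (λ i → h (suc i)))

  easy-weaken : ∀ {k} {φ : ℕ → Env k → ℤ} → Easy φ → Easy {suc k} (λ n γ → φ n (proj₂ γ))
  easy-weaken {k} {φ} E = easy-cong (λ n γ → cong (φ n) (mkEnv-get k (proj₂ γ))) (easy-rename suc E)

  -- Closure of easy functions under arithmetic operations

  EasyN : ∀ {k} → (ℕ → Env k → ℕ) → Set
  EasyN f = Easy (λ n γ → + f n γ)

  n-cong : ∀ {k} {f g : ℕ → Env k → ℕ} → (∀ n γ → f n γ ≡ g n γ) → EasyN f → EasyN g
  n-cong h = easy-cong (λ n γ → cong +_ (h n γ))

  n-weaken : ∀ {k} {f : ℕ → Env k → ℕ} → EasyN f → EasyN {suc k} (λ n γ → f n (proj₂ γ))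
  n-weaken = easy-weaken

  n-num : ∀ {k} c → EasyN {k} (λ _ _ → c)
  n-num c = easy-const (λ _ → c) (c ∷ []) (λ n → ℕP.<-≤-trans (n<2^n c) (ℕP.^-monoʳ-≤ 2 (ℕP.m≤m+n c _)))

  n-poly : ∀ {k} p → EasyN {k} (λ n _ → ⟦ p ⟧ n)
  n-poly p = easy-const ⟦ p ⟧ p (λ n → n<2^n (⟦ p ⟧ n))

  n-2^poly : ∀ {k} p → EasyN {k} (λ n _ → 2 ^ ⟦ p ⟧ n)
  n-2^poly p = easy-const (λ n → 2 ^ ⟦ p ⟧ n) (addN p (1 ∷ [])) (λ n → ℕP.^-monoʳ-< 2 ℕP.≤-refl (ℕP.≤-reflexive
    (trans (ℕP.+-comm 1 (⟦ p ⟧ n)) (sym (trans (⟦addN⟧ p (1 ∷ []) n) (cong (λ z → ⟦ p ⟧ n + suc z) (ℕP.*-zeroʳ n)))))))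

  n-+ : ∀ {k} {f g : ℕ → Env k → ℕ} → EasyN f → EasyN g → EasyN (λ n γ → f n γ + g n γ)
  n-+ {f = f} {g} E E' = easy-cong (λ n γ → sym (ℤP.pos-+ (f n γ) (g n γ))) (easy-op plus E E')

  n-* : ∀ {k} {f g : ℕ → Env k → ℕ} → EasyN f → EasyN g → EasyN (λ n γ → f n γ * g n γ)
  n-* {f = f} {g} E E' = easy-cong (λ n γ → sym (ℤP.pos-* (f n γ) (g n γ))) (easy-op times E E')

  n-le : ∀ {k} {f g : ℕ → Env k → ℕ} → EasyN f → EasyN g → EasyN (λ n γ → le (f n γ) (g n γ))
  n-le {f = f} {g} E E' = easy-cong (λ n γ → le-sign (f n γ) (g n γ)) (easy-sign (easy-op minus E' E))

  n-lt : ∀ {k} {f g : ℕ → Env k → ℕ} → EasyN f → EasyN g → EasyN (λ n γ → lt (f n γ) (g n γ))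
  n-lt E E' = n-le (n-+ (n-num 1) E) E'

  n-eqn : ∀ {k} {f g : ℕ → Env k → ℕ} → EasyN f → EasyN g → EasyN (λ n γ → eqn (f n γ) (g n γ))
  n-eqn {f = f} {g} E E' = n-cong (λ n γ → sym (eqn-def (f n γ) (g n γ))) (n-* (n-le E E') (n-le E' E))

  n-∸ : ∀ {k} {f g : ℕ → Env k → ℕ} → EasyN f → EasyN g → EasyN (λ n γ → f n γ ∸ g n γ)
  n-∸ {f = f} {g} E E' = easy-cong (λ n γ → monus (f n γ) (g n γ)) (easy-op times (n-le E' E) (easy-op minus E E'))
    where
      monus : ∀ a b → + le b a ℤ.* (+ a ℤ.- + b) ≡ + (a ∸ b)
      monus a b with b ≤? a
      ... | yes b≤a = trans (cong (λ z → + z ℤ.* (+ a ℤ.- + b)) (le-yes b≤a))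
                            (trans (ℤP.*-identityˡ _) (trans (ℤP.m-n≡m⊖n a b) (ℤP.⊖-≥ b≤a)))
      ... | no b≰a = trans (cong (λ z → + z ℤ.* (+ a ℤ.- + b)) (le-no (ℕP.≰⇒> b≰a)))
                           (trans (ℤP.*-zeroˡ (+ a ℤ.- + b)) (cong +_ (sym (ℕP.m≤n⇒m∸n≡0 (ℕP.<⇒≤ (ℕP.≰⇒> b≰a))))))

  n-ite : ∀ {k} {c f g : ℕ → Env k → ℕ} → EasyN c → EasyN f → EasyN g → EasyN (λ n γ → ite (c n γ) (f n γ) (g n γ))
  n-ite {c = c} {f} {g} C E E' = n-cong (λ n γ → sym (ite-def (c n γ) (f n γ) (g n γ)))
    (n-+ (n-* C E) (n-* (n-∸ (n-num 1) C) E'))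

  v0 : ∀ {k} → EasyN {suc k} (λ n γ → proj₁ γ)
  v0 = easy-var zero

  v1 : ∀ {k} → EasyN {2 + k} (λ n γ → proj₁ (proj₂ γ))
  v1 = easy-var (suc zero)

  v2 : ∀ {k} → EasyN {3 + k} (λ n γ → proj₁ (proj₂ (proj₂ γ)))
  v2 = easy-var (suc (suc zero))

  v3 : ∀ {k} → EasyN {4 + k} (λ n γ → proj₁ (proj₂ (proj₂ (proj₂ γ))))
  v3 = easy-var (suc (suc (suc zero)))

  -- The range depends on the arguments, whereas the Boolean cube does not; so the sum is taken over
  -- all values of w bits and cut off by a comparison.
  n-Σ : ∀ {k} {b : ℕ → Env k → ℕ} {f : ℕ → Env (suc k) → ℕ} → EasyN b → EasyN f →
    EasyN (λ n γ → ΣN (b n γ) (λ y → f n (y , γ)))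
  n-Σ {k} {b} {f} B E = easy λ p → let w , h = easyAt-bound (at B p) in
    easyAt-cong (λ n a → let γ = env k a in begin
      ΣZ (2 ^ ⟦ w ⟧ n) (λ y → + (lt y (b n γ) * f n (y , γ)))
        ≡⟨ pos-ΣN (2 ^ ⟦ w ⟧ n) _ ⟨
      + ΣN (2 ^ ⟦ w ⟧ n) (λ y → lt y (b n γ) * f n (y , γ))
        ≡⟨ cong +_ (ΣN-truncate (ℕP.<⇒≤ (h n a)) (λ y b≤y _ → cong (_* f n (y , γ)) (le-no (s≤s b≤y)))) ⟩
      + ΣN (b n γ) (λ y → lt y (b n γ) * f n (y , γ))
        ≡⟨ cong +_ (ΣN-cong (b n γ) (λ y y<b → trans (cong (_* f n (y , γ)) (le-yes y<b)) (ℕP.*-identityˡ _))) ⟩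
      + ΣN (b n γ) (λ y → f n (y , γ)) ∎)
      (easyAt-Σ (at (n-* (n-lt v0 (n-weaken B)) E) (addN p w)))
    where open ≡-Reasoning

  -- Circuits for φ expect the bits of their argument, while a circuit for g gives only its value.
  -- Summing over all y the products of φ at y with the test y = g closes this gap; composition thus
  -- costs one application of the collapse.
  easy-let : ∀ {k} {g : ℕ → Env k → ℕ} {φ : ℕ → Env (suc k) → ℤ} → EasyN g → Easy φ → Easy (λ n γ → φ n (g n γ , γ))
  easy-let {k} {g} {φ} G E = easy λ p → let w , h = easyAt-bound (at G p) in
    easyAt-cong (λ n a → let γ = env k a in begin
      ΣZ (2 ^ ⟦ w ⟧ n) (λ y → + eqn y (g n γ) ℤ.* φ n (y , γ))
        ≡⟨ ΣZ-single (2 ^ ⟦ w ⟧ n) (h n a) (λ y _ y≢ → trans (cong (λ z → + z ℤ.* φ n (y , γ)) (eqn-no y≢)) (ℤP.*-zeroˡ (φ n (y , γ)))) ⟩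
      + eqn (g n γ) (g n γ) ℤ.* φ n (g n γ , γ)
        ≡⟨ trans (cong (λ z → + z ℤ.* φ n (g n γ , γ)) (eqn-refl (g n γ))) (ℤP.*-identityˡ _) ⟩
      φ n (g n γ , γ) ∎)
      (easyAt-Σ (at (easy-op times (n-eqn v0 (n-weaken G)) E) (addN p w)))
    where open ≡-Reasoning

  lift1 : ∀ {k} {φ : ℕ → Env 1 → ℤ} {a : ℕ → Env k → ℕ} → Easy φ → EasyN a → Easy (λ n γ → φ n (a n γ , tt))
  lift1 E A = easy-let A (easy-rename (λ _ → zero) E)

  lift3 : ∀ {k} {φ : ℕ → Env 3 → ℤ} {a b c : ℕ → Env k → ℕ} → Easy φ → EasyN a → EasyN b → EasyN c →
    Easy (λ n γ → φ n (a n γ , b n γ , c n γ , tt))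
  lift3 {φ = φ} E A B C = easy-let C (easy-let (n-weaken B) (easy-let (n-weaken (n-weaken A))
    (easy-rename {φ = φ} (λ { zero → zero ; (suc zero) → suc zero ; (suc (suc zero)) → suc (suc zero) }) E)))

  n-quo : ∀ {k} {f g : ℕ → Env k → ℕ} → EasyN f → EasyN g → EasyN (λ n γ → quo (f n γ) (g n γ))
  n-quo {f = f} {g} E E' = n-cong (λ n γ → sym (quo-formula (f n γ) (g n γ)))
    (n-* (n-le (n-num 1) E') (n-Σ E (n-le (n-* (n-+ (n-num 1) v0) (n-weaken E')) (n-weaken E))))

  n-rem : ∀ {k} {f g : ℕ → Env k → ℕ} → EasyN f → EasyN g → EasyN (λ n γ → rem (f n γ) (g n γ))
  n-rem {f = f} {g} E E' = n-cong (λ n γ → sym (rem-def (f n γ) (g n γ))) (n-∸ E (n-* (n-quo E E') E'))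

  -- Small families have polynomially bounded values, not merely values with polynomially many bits.
  record Small {k} (f : ℕ → Env k → ℕ) : Set where
    constructor small
    field
      smallAt : ∀ p → Σ NatPoly λ r → ∀ n (a : Asg (⟦ p ⟧ n) k) → f n (env k a) ≤ ⟦ r ⟧ n
  open Small public

  small-≤ : ∀ {k} {f g : ℕ → Env k → ℕ} → (∀ n γ → f n γ ≤ g n γ) → Small g → Small f
  small-≤ h (small S) = small λ p → let r , b = S p in r , λ n a → ℕP.≤-trans (h n _) (b n a)

  small-poly : ∀ {k} p → Small {k} (λ n _ → ⟦ p ⟧ n)
  small-poly p = small λ _ → p , λ _ _ → ℕP.≤-refl

  small-num : ∀ {k} c → Small {k} (λ _ _ → c)
  small-num c = small λ _ → c ∷ [] , λ n _ → ℕP.m≤m+n c _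

  small-+ : ∀ {k} {f g : ℕ → Env k → ℕ} → Small f → Small g → Small (λ n γ → f n γ + g n γ)
  small-+ (small S) (small T) = small λ p → let r , b = S p ; r' , b' = T p in
    addN r r' , λ n a → ℕP.≤-trans (ℕP.+-mono-≤ (b n a) (b' n a)) (ℕP.≤-reflexive (sym (⟦addN⟧ r r' n)))

  small-* : ∀ {k} {f g : ℕ → Env k → ℕ} → Small f → Small g → Small (λ n γ → f n γ * g n γ)
  small-* (small S) (small T) = small λ p → let r , b = S p ; r' , b' = T p in
    mulN r r' , λ n a → ℕP.≤-trans (ℕP.*-mono-≤ (b n a) (b' n a)) (ℕP.≤-reflexive (sym (⟦mulN⟧ r r' n)))

  small-weaken : ∀ {k} {f : ℕ → Env k → ℕ} → Small f → Small {suc k} (λ n γ → f n (proj₂ γ))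
  small-weaken (small S) = small λ p → let r , b = S p in r , λ n (_ , a) → b n a

  n-Π : ∀ {k} {t : ℕ → Env k → ℕ} {f : ℕ → Env (suc k) → ℕ} → Small t → EasyN t → EasyN f →
    EasyN (λ n γ → ΠN (t n γ) (λ i → f n (i , γ)))
  n-Π {k} {t} {f} (small S) T E = easy λ p → let r , h = S p in
    easyAt-cong (λ n a → let γ = env k a in begin
      ΠZ (⟦ r ⟧ n) (λ i → + ite (lt i (t n γ)) (f n (i , γ)) 1)
        ≡⟨ pos-ΠN (⟦ r ⟧ n) _ ⟨
      + ΠN (⟦ r ⟧ n) (λ i → ite (lt i (t n γ)) (f n (i , γ)) 1)
        ≡⟨ cong +_ (ΠN-truncate (h n a) (λ i t≤i _ → ite-no (f n (i , γ)) 1 (le-no (s≤s t≤i)))) ⟩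
      + ΠN (t n γ) (λ i → ite (lt i (t n γ)) (f n (i , γ)) 1)
        ≡⟨ cong +_ (ΠN-cong (t n γ) (λ i i<t → ite-yes (f n (i , γ)) 1 (le-yes i<t))) ⟩
      + ΠN (t n γ) (λ i → f n (i , γ)) ∎)
      (easyAt-Π (at (n-ite (n-lt v0 (n-weaken T)) E (n-num 1)) (addN p r)))
    where open ≡-Reasoning

  -- One factor per unit of the exponent, hence the restriction to small exponents; `n-powmod` is
  -- the version for large ones.
  n-^ : ∀ {k} {b e : ℕ → Env k → ℕ} → EasyN b → Small e → EasyN e → EasyN (λ n γ → b n γ ^ e n γ)
  n-^ {b = b} {e} B S E = n-cong (λ n γ → ΠN-const (e n γ) (b n γ)) (n-Π S E (n-weaken B))

  n-digit : ∀ {k} {W h i : ℕ → Env k → ℕ} → EasyN W → EasyN h → Small i → EasyN i →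
    EasyN (λ n γ → digit (W n γ) (h n γ) (i n γ))
  n-digit {W = W} {h} {i} EW Eh S Ei = n-cong (λ n γ → sym (digit-def (W n γ) (h n γ) (i n γ)))
    (n-rem (n-quo Eh (n-^ EW S Ei)) EW)

  -- Exponents are capped so that they are small for all values of the bound variable i.
  n-iter : ∀ {k} r {F : ℕ → Env (2 + k) → ℕ} {x : ℕ → Env k → ℕ} → EasyN F → EasyN x →
    (∀ p → Σ NatPoly λ w → ∀ n (a : Asg (⟦ p ⟧ n) k) i → i ≤ ⟦ r ⟧ n →
      iter i (λ i s → F n (i , s , env k a)) (x n (env k a)) < 2 ^ ⟦ w ⟧ n) →
    EasyN (λ n γ → iter (⟦ r ⟧ n) (λ i s → F n (i , s , γ)) (x n γ))
  n-iter {k} r {F} {x} EF Ex bounded = easy λ p → let w , h = bounded p in main p w h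
    where
      main : ∀ p w → (∀ n (a : Asg (⟦ p ⟧ n) k) i → i ≤ ⟦ r ⟧ n →
        iter i (λ i s → F n (i , s , env k a)) (x n (env k a)) < 2 ^ ⟦ w ⟧ n) →
        EasyAt p (λ n γ → + iter (⟦ r ⟧ n) (λ i s → F n (i , s , γ)) (x n γ))
      main p w h = easyAt-cong (λ n a → begin
          ΣZ (2 ^ ⟦ mulN w (addN (1 ∷ []) r) ⟧ n) (λ H → + G n (H , env k a))
            ≡⟨ pos-ΣN (2 ^ ⟦ mulN w (addN (1 ∷ []) r) ⟧ n) _ ⟨
          + ΣN (2 ^ ⟦ mulN w (addN (1 ∷ []) r) ⟧ n) (λ H → G n (H , env k a))
            ≡⟨ cong (λ z → + ΣN z (λ H → G n (H , env k a))) (size n) ⟩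
          + ΣN (W n ^ suc (⟦ r ⟧ n)) (λ H → G n (H , env k a))
            ≡⟨ cong +_ (ΣN-cong (W n ^ suc (⟦ r ⟧ n)) (λ H _ → uncap n H (env k a))) ⟩
          + ΣN (W n ^ suc (⟦ r ⟧ n)) _
            ≡⟨ cong +_ (iter-as-sum (W n) (⟦ r ⟧ n) (λ i s → F n (i , s , env k a)) (x n (env k a)) (h n a)) ⟩
          + iter (⟦ r ⟧ n) (λ i s → F n (i , s , env k a)) (x n (env k a)) ∎)
        (easyAt-Σ (at EG (addN p (mulN w (addN (1 ∷ []) r)))))
        where
          open ≡-Reasoning
          W : ℕ → ℕ
          W n = 2 ^ ⟦ w ⟧ n
          dig : ∀ {j} → (ℕ → Env j → ℕ) → (ℕ → Env j → ℕ) → ℕ → Env j → ℕ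
          dig H i n γ = digit (W n) (H n γ) (i n γ)
          cap : ℕ → ℕ → ℕ
          cap n i = ite (le i (⟦ r ⟧ n)) i 0
          cap≡ : ∀ n {i} → i ≤ ⟦ r ⟧ n → cap n i ≡ i
          cap≡ n {i} i≤ = ite-yes i 0 (le-yes i≤)
          cap≤ : ∀ n i → cap n i ≤ ⟦ r ⟧ n
          cap≤ n i with i ≤? ⟦ r ⟧ n
          ... | yes i≤ = ℕP.≤-trans (ℕP.≤-reflexive (cap≡ n i≤)) i≤
          ... | no i≰ = ℕP.≤-trans (ℕP.≤-reflexive (ite-no i 0 (le-no (ℕP.≰⇒> i≰)))) z≤n
          G : ℕ → Env (suc k) → ℕ
          G n (H , γ) = eqn (digit (W n) H 0) (x n γ)
            * ΠN (⟦ r ⟧ n) (λ i → eqn (digit (W n) H (cap n (suc i))) (F n (i , digit (W n) H (cap n i) , γ)))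
            * digit (W n) H (⟦ r ⟧ n)
          E-cap : ∀ {j} {i : ℕ → Env j → ℕ} → EasyN i → EasyN (λ n γ → cap n (i n γ))
          E-cap Ei = n-ite (n-le Ei (n-poly r)) Ei (n-num 0)
          S-cap : ∀ {j} {i : ℕ → Env j → ℕ} → Small (λ n γ → cap n (i n γ))
          S-cap {i = i} = small-≤ (λ n γ → cap≤ n (i n γ)) (small-poly r)
          EG : EasyN G
          EG = n-* (n-* (n-eqn (n-digit (n-2^poly w) v0 (small-num 0) (n-num 0)) (n-weaken Ex))
              (n-Π (small-poly r) (n-poly r) (n-eqn (n-digit (n-2^poly w) v1 S-cap (E-cap (n-+ (n-num 1) v0)))
                (easy-let (n-digit (n-2^poly w) v1 S-cap (E-cap v0))
                  (easy-cong (λ n γ → cong (λ δ → + F n (proj₁ (proj₂ γ) , proj₁ γ , δ)) (mkEnv-get k (proj₂ (proj₂ (proj₂ γ)))))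
                    (easy-rename {φ = λ n γ → + F n γ} (λ { zero → suc zero ; (suc zero) → zero ; (suc (suc i)) → suc (suc (suc i)) }) EF))))))
            (n-digit (n-2^poly w) v0 (small-poly r) (n-poly r))
          size : ∀ n → 2 ^ ⟦ mulN w (addN (1 ∷ []) r) ⟧ n ≡ W n ^ suc (⟦ r ⟧ n)
          size n = trans (cong (2 ^_) (trans (⟦mulN⟧ w (addN (1 ∷ []) r) n) (cong (⟦ w ⟧ n *_)
              (trans (⟦addN⟧ (1 ∷ []) r n) (cong (λ z → suc z + ⟦ r ⟧ n) (ℕP.*-zeroʳ n))))))
            (sym (ℕP.^-*-assoc 2 (⟦ w ⟧ n) (suc (⟦ r ⟧ n))))
          uncap : ∀ n H γ → G n (H , γ) ≡ eqn (digit (W n) H 0) (x n γ)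
            * ΠN (⟦ r ⟧ n) (λ i → eqn (digit (W n) H (suc i)) (F n (i , digit (W n) H i , γ))) * digit (W n) H (⟦ r ⟧ n)
          uncap n H γ = cong (λ z → eqn (digit (W n) H 0) (x n γ) * z * digit (W n) H (⟦ r ⟧ n))
            (ΠN-cong (⟦ r ⟧ n) (λ i i<r → cong₂ (λ a b → eqn (digit (W n) H a) (F n (i , digit (W n) H b , γ)))
              (cap≡ n i<r) (cap≡ n (ℕP.<⇒≤ i<r))))

  n-⊓ : ∀ {k} {f g : ℕ → Env k → ℕ} → EasyN f → EasyN g → EasyN (λ n γ → f n γ ℕ.⊓ g n γ)
  n-⊓ {f = f} {g} E E' = n-cong (λ n γ → minimum (f n γ) (g n γ)) (n-ite (n-le E E') E E')
    where
      minimum : ∀ a b → ite (le a b) a b ≡ a ℕ.⊓ b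
      minimum a b with a ≤? b
      ... | yes a≤b = trans (ite-yes a b (le-yes a≤b)) (sym (ℕP.m≤n⇒m⊓n≡m a≤b))
      ... | no a≰b = trans (ite-no a b (le-no (ℕP.≰⇒> a≰b))) (sym (ℕP.m≥n⇒m⊓n≡n (ℕP.<⇒≤ (ℕP.≰⇒> a≰b))))

  small-⊓ʳ : ∀ {k} {f g : ℕ → Env k → ℕ} → Small g → Small (λ n γ → f n γ ℕ.⊓ g n γ)
  small-⊓ʳ {f = f} {g} = small-≤ (λ n γ → ℕP.m⊓n≤n (f n γ) (g n γ))

  small-∸ : ∀ {k} {f g : ℕ → Env k → ℕ} → Small f → Small (λ n γ → f n γ ∸ g n γ)
  small-∸ {f = f} {g} = small-≤ (λ n γ → ℕP.m∸n≤m (f n γ) (g n γ))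

  n-poly-of : ∀ {k} p {x : ℕ → Env k → ℕ} → EasyN x → EasyN (λ n γ → ⟦ p ⟧ (x n γ))
  n-poly-of []      E = n-num 0
  n-poly-of (c ∷ p) E = n-+ (n-num c) (n-* E (n-poly-of p E))

  small-poly-of : ∀ {k} p {x : ℕ → Env k → ℕ} → Small x → Small (λ n γ → ⟦ p ⟧ (x n γ))
  small-poly-of []      S = small-num 0
  small-poly-of (c ∷ p) S = small-+ (small-num c) (small-* S (small-poly-of p S))

  nat-bound : ∀ {p k} {f : ℕ → Env k → ℕ} → EasyAt p (λ n γ → + f n γ) →
    Σ NatPoly λ w → ∀ n (a : Asg (⟦ p ⟧ n) k) → f n (env k a) < 2 ^ ⟦ w ⟧ n
  nat-bound = easyAt-bound

  -- Easy operations on word codes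

  n-blen : ∀ {k} {g : ℕ → Env k → ℕ} → EasyN g → EasyN (λ n γ → blen (g n γ))
  n-blen {k} {g} G = easy λ p → let w , h = nat-bound (at G p) in
    easyAt-cong (λ n a → cong +_ (trans
        (ΣN-cong (⟦ w ⟧ n) (λ j j< → cong (λ z → le (2 ^ z) (g n (env k a))) (ℕP.m≤n⇒m⊓n≡m (ℕP.<⇒≤ j<))))
        (blen-cut (g n (env k a)) (⟦ w ⟧ n) (h n a))))
      (at (n-Σ (n-poly w) (n-le (n-^ (n-num 2) (small-⊓ʳ {f = λ n γ → proj₁ γ} (small-poly w)) (n-⊓ v0 (n-poly w))) (n-weaken G))) p)

  small-blen : ∀ {k} {g : ℕ → Env k → ℕ} → EasyN g → Small (λ n γ → blen (g n γ))
  small-blen {k} {g} G = small λ p → let w , h = nat-bound (at G p) in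
    w , λ n a → blen≤ (g n (env k a)) (⟦ w ⟧ n) (h n a)

  n-lenN : ∀ {k} {g : ℕ → Env k → ℕ} → EasyN g → EasyN (λ n γ → lenN (g n γ))
  n-lenN G = n-∸ (n-blen G) (n-num 1)

  small-lenN : ∀ {k} {g : ℕ → Env k → ℕ} → EasyN g → Small (λ n γ → lenN (g n γ))
  small-lenN G = small-∸ {g = λ _ _ → 1} (small-blen G)

  n-horner : ∀ {k} c {g : ℕ → ℕ} {f : ℕ → Env k → ℕ} →
    (∀ {j} {x : ℕ → Env j → ℕ} → EasyN x → EasyN (λ n γ → g (x n γ))) → EasyN f →
    EasyN (λ n γ → hornerN c g (f n γ))
  n-horner {k} c {g} {f} Eg Ef = n-cong
    (λ n γ → ΣN-cong (lenN (f n γ)) (λ j j< → cong (λ z → g (digit 2 (f n γ) z) * c ^ z) (ℕP.m≤n⇒m⊓n≡m (ℕP.<⇒≤ j<))))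
    (n-Σ (n-lenN Ef) (n-* (Eg (n-digit (n-num 2) (n-weaken Ef) S E)) (n-^ (n-num c) S E)))
    where
      S : Small {suc k} (λ n γ → proj₁ γ ℕ.⊓ lenN (f n (proj₂ γ)))
      S = small-⊓ʳ {f = λ n γ → proj₁ γ} (small-weaken (small-lenN Ef))
      E : EasyN {suc k} (λ n γ → proj₁ γ ℕ.⊓ lenN (f n (proj₂ γ)))
      E = n-⊓ v0 (n-weaken (n-lenN Ef))

  n-encN : ∀ {k} {f : ℕ → Env k → ℕ} → EasyN f → EasyN (λ n γ → encN (f n γ))
  n-encN E = n-+ (n-horner 4 {g = 3 *_} (n-* (n-num 3)) E) (n-* (n-^ (n-num 4) (small-lenN E) (n-lenN E)) (n-num 6))

  n-catN : ∀ {k} {f g : ℕ → Env k → ℕ} → EasyN f → EasyN g → EasyN (λ n γ → catN (f n γ) (g n γ))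
  n-catN E E' = n-+ (n-∸ E P) (n-* P E')
    where P = n-^ (n-num 2) (small-lenN E) (n-lenN E)

  n-pairN : ∀ {k} {f g : ℕ → Env k → ℕ} → EasyN f → EasyN g → EasyN (λ n γ → pairN (f n γ) (g n γ))
  n-pairN E E' = n-catN (n-encN E) (n-encN E')

  n-Σfin : ∀ {k} A {f : ℕ → ℕ → Env k → ℕ} → (∀ i → EasyN (f i)) → EasyN (λ n γ → ΣN A (λ i → f i n γ))
  n-Σfin zero    E = n-num 0
  n-Σfin (suc A) E = n-+ (n-Σfin A E) (E A)

  -- A table whose dimensions do not depend on n, such as a transition function, is a finite sum of
  -- tests for its entries. Outside the table the default takes over.
  n-table : ∀ {k} (g : ℕ → ℕ → ℕ) A B {d x y : ℕ → Env k → ℕ} → EasyN d → EasyN x → EasyN y →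
    (∀ n γ → A ≤ x n γ ⊎ B ≤ y n γ → g (x n γ) (y n γ) ≡ d n γ) → EasyN (λ n γ → g (x n γ) (y n γ))
  n-table g A B {d} {x} {y} D X Y default = n-cong (λ n γ → eq (x n γ) (y n γ) (default n γ))
    (n-+ (n-Σfin A (λ i → n-Σfin B (λ j → n-* (n-* (n-eqn X (n-num i)) (n-eqn Y (n-num j))) (n-num (g i j)))))
         (n-ite (n-* (n-lt X (n-num A)) (n-lt Y (n-num B))) (n-num 0) D))
    where
      entry : ℕ → ℕ → ℕ → ℕ → ℕ
      entry x y i j = eqn x i * eqn y j * g i j
      miss-x : ∀ x y i j → x ≢ i → entry x y i j ≡ 0
      miss-x x y i j ne = cong (λ z → z * eqn y j * g i j) (eqn-no ne)
      miss-y : ∀ x y i j → y ≢ j → entry x y i j ≡ 0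
      miss-y x y i j ne = cong (_* g i j) (trans (cong (eqn x i *_) (eqn-no ne)) (ℕP.*-zeroʳ (eqn x i)))
      eq : ∀ x y {dv} → (A ≤ x ⊎ B ≤ y → g x y ≡ dv) →
        ΣN A (λ i → ΣN B (entry x y i)) + ite (lt x A * lt y B) 0 dv ≡ g x y
      eq x y {dv} default with x <? A | y <? B
      ... | no x≮ | _ = trans (cong₂ _+_
              (ΣN-0 A (λ i i< → ΣN-0 B (λ j _ → miss-x x y i j (λ { refl → x≮ i< }))))
              (ite-no 0 dv (cong (_* lt y B) (le-no (s≤s (ℕP.≮⇒≥ x≮))))))
            (sym (default (inj₁ (ℕP.≮⇒≥ x≮))))
      ... | yes x< | no y≮ = trans (cong₂ _+_
              (ΣN-0 A (λ i _ → ΣN-0 B (λ j j< → miss-y x y i j (λ { refl → y≮ j< }))))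
              (ite-no 0 dv (trans (cong (lt x A *_) (le-no (s≤s (ℕP.≮⇒≥ y≮)))) (ℕP.*-zeroʳ (lt x A)))))
            (sym (default (inj₂ (ℕP.≮⇒≥ y≮))))
      ... | yes x< | yes y< = trans (cong₂ _+_
              (trans (ΣN-single A x< (λ i _ i≢x → ΣN-0 B (λ j _ → miss-x x y i j (i≢x ∘ sym))))
                (trans (ΣN-single B y< (λ j _ j≢y → miss-y x y x j (j≢y ∘ sym)))
                  (trans (cong₂ (λ a b → a * b * g x y) (eqn-refl x) (eqn-refl y)) (ℕP.+-identityʳ (g x y)))))
              (ite-yes 0 dv (cong₂ _*_ (le-yes x<) (le-yes y<))))
            (ℕP.+-identityʳ _)

  -- Languages of the counting hierarchy, with advice

  EasyLang : Lang → Set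
  EasyLang A = EasyN {1} (λ n (N , _) → bit (A (decode N)))

  n-lang : ∀ {A k} {f : ℕ → Env k → ℕ} → EasyLang A → EasyN f → EasyN (λ n γ → bit (A (decode (f n γ))))
  n-lang {B} E F = lift1 E F

  -- Arguments outside [1, 2^P) are replaced by the code of the empty word.
  clip : ℕ → ℕ → ℕ
  clip P N = ite (le 1 N * lt N (2 ^ P)) N 1

  clip-word : ∀ P N → ∃ λ w → clip P N ≡ code w × length w ≤ P
  clip-word P N with 1 ≤? N | N <? 2 ^ P
  ... | yes 1≤N | yes N< = decode N , trans (ite-yes N 1 (cong₂ _*_ (le-yes 1≤N) (le-yes N<))) (sym (code-decode N 1≤N)) ,
    length≤ (decode N) P (subst (_< 2 ^ P) (sym (code-decode N 1≤N)) N<)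
  ... | no 1≰N | _ = [] , ite-no N 1 (cong (_* lt N (2 ^ P)) (le-no (ℕP.≰⇒> 1≰N))) , z≤n
  ... | yes _ | no N≮ = [] , ite-no N 1 (trans (cong (le 1 N *_) (le-no (s≤s (ℕP.≮⇒≥ N≮)))) (ℕP.*-zeroʳ (le 1 N))) , z≤n

  clip-decode : ∀ P N → N < 2 ^ P → decode (clip P N) ≡ decode N
  clip-decode P zero    N< = cong decode (ite-no 0 1 (cong (_* lt 0 (2 ^ P)) (le-no {1} {0} ℕP.≤-refl)))
  clip-decode P (suc N) N< = cong decode (ite-yes (suc N) 1 (cong₂ _*_ (le-yes {1} {suc N} (s≤s z≤n)) (le-yes N<)))

  n-clip : ∀ {k} p {f : ℕ → Env k → ℕ} → EasyN f → EasyN (λ n γ → clip (⟦ p ⟧ n) (f n γ))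
  n-clip p E = n-ite (n-* (n-le (n-num 1) E) (n-lt E (n-2^poly p))) E (n-num 1)

  val-bound : ∀ {P} (a : Asg P 1) → proj₁ (env 1 a) < 2 ^ P
  val-bound (b , _) = val<2^ b

  module _ {A : Lang} (M : TM) (q : NatPoly)
    (decides : ∀ w → Σ ℕ λ t → t ≤ ⟦ q ⟧ (length w) × Cfg.st (run M t (initCfg M w)) ≡ done (A w)) where
    open TM M
    open Simulation M

    n-stepN : ∀ {k} {W c : ℕ → Env k → ℕ} → EasyN W → EasyN c → EasyN (λ n γ → stepN (W n γ) (c n γ))
    n-stepN {k} {W} {c} EW Ec = n-pack (n-nextState Q H)
        (n-ite (n-eqn Mv (n-num 0)) (n-rem L' (n-num S)) (n-ite (n-eqn Mv (n-num 1)) (n-rem R (n-num S)) Sy))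
        (n-ite (n-eqn Mv (n-num 0)) (n-quo L' (n-num S)) (n-ite (n-eqn Mv (n-num 1)) (n-+ Sy (n-* L' (n-num S))) L'))
        (n-ite (n-eqn Mv (n-num 0)) (n-+ Sy (n-* R (n-num S))) (n-ite (n-eqn Mv (n-num 1)) (n-quo R (n-num S)) R))
      where
        out-of-range : ∀ {g : ℕ → ℕ → ℕ} {d : ℕ → ℕ → ℕ} → (∀ q h → ¬ (q < states) → g q h ≡ d q h) →
          (∀ q h → ¬ (h < S) → g q h ≡ d q h) → ∀ q h → states ≤ q ⊎ S ≤ h → g q h ≡ d q h
        out-of-range f g q h (inj₁ le) = f q h (ℕP.≤⇒≯ le)
        out-of-range f g q h (inj₂ le) = g q h (ℕP.≤⇒≯ le)
        n-nextState : ∀ {x y : ℕ → Env k → ℕ} → EasyN x → EasyN y → EasyN (λ n γ → nextState (x n γ) (y n γ))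
        n-nextState X Y = n-table nextState states S X X Y (λ n γ → out-of-range {nextState} {λ q h → q} noQ noH _ _)
          where
            noQ : ∀ q h → ¬ (q < states) → nextState q h ≡ q
            noQ q h ¬q with q <? states | h <? S
            ... | yes q< | _ = ⊥-elim (¬q q<)
            ... | no _ | yes _ = refl
            ... | no _ | no _ = refl
            noH : ∀ q h → ¬ (h < S) → nextState q h ≡ q
            noH q h ¬h with q <? states | h <? S
            ... | _ | yes h< = ⊥-elim (¬h h<)
            ... | yes _ | no _ = refl
            ... | no _ | no _ = refl
        n-nextMove : ∀ {x y : ℕ → Env k → ℕ} → EasyN x → EasyN y → EasyN (λ n γ → nextMove (x n γ) (y n γ))
        n-nextMove X Y = n-table nextMove states S (n-num 2) X Y (λ n γ → out-of-range {nextMove} {λ q h → 2} noQ noH _ _)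
          where
            noQ : ∀ q h → ¬ (q < states) → nextMove q h ≡ 2
            noQ q h ¬q with q <? states | h <? S
            ... | yes q< | _ = ⊥-elim (¬q q<)
            ... | no _ | yes _ = refl
            ... | no _ | no _ = refl
            noH : ∀ q h → ¬ (h < S) → nextMove q h ≡ 2
            noH q h ¬h with q <? states | h <? S
            ... | _ | yes h< = ⊥-elim (¬h h<)
            ... | yes _ | no _ = refl
            ... | no _ | no _ = refl
        n-nextSym : ∀ {x y : ℕ → Env k → ℕ} → EasyN x → EasyN y → EasyN (λ n γ → nextSym (x n γ) (y n γ))
        n-nextSym X Y = n-table nextSym states S Y X Y (λ n γ → out-of-range {nextSym} {λ q h → h} noQ noH _ _)
          where
            noQ : ∀ q h → ¬ (q < states) → nextSym q h ≡ h
            noQ q h ¬q with q <? states | h <? S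
            ... | yes q< | _ = ⊥-elim (¬q q<)
            ... | no _ | yes _ = refl
            ... | no _ | no _ = refl
            noH : ∀ q h → ¬ (h < S) → nextSym q h ≡ h
            noH q h ¬h with q <? states | h <? S
            ... | _ | yes h< = ⊥-elim (¬h h<)
            ... | yes _ | no _ = refl
            ... | no _ | no _ = refl
        n-pack : ∀ {x h l r : ℕ → Env k → ℕ} → EasyN x → EasyN h → EasyN l → EasyN r →
          EasyN (λ n γ → packN (W n γ) (x n γ) (h n γ) (l n γ) (r n γ))
        n-pack X H L' R = n-+ X (n-* (n-+ H (n-* (n-+ L' (n-* R EW)) (n-num K))) (n-num K))
        Q = n-rem Ec (n-num K)
        H = n-rem (n-quo Ec (n-num K)) (n-num K)
        L' = n-rem (n-quo (n-quo Ec (n-num K)) (n-num K)) EW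
        R = n-quo (n-quo (n-quo Ec (n-num K)) (n-num K)) EW
        Mv = n-nextMove Q H
        Sy = n-nextSym Q H

    P-easy-at : ∀ p → EasyAt p {1} (λ n (N , _) → + bit (A (decode N)))
    P-easy-at p = easyAt-cong (λ n a → cong +_ (correct n (proj₁ (env 1 a)) (val-bound a))) (at easy-run p)
      where
        -- A clipped code has at most p(n) letters, so q(p(n)) steps suffice; p(n) + T(n) then
        -- bounds the number of cells, and S to this power bounds the tape codes.
        T = compN q p
        m = addN p T
        W : ℕ → ℕ
        W n = S ^ ⟦ m ⟧ n
        input : ℕ → ℕ → ℕ
        input n N = hornerN S suc (clip (⟦ p ⟧ n) N)
        result : ℕ → Env 1 → ℕ
        result n (N , _) = eqn (partQ (W n) (iter (⟦ T ⟧ n) (λ _ → stepN (W n)) (initN (W n) (input n N)))) (suc states)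
        EW : ∀ {k} → EasyN {k} (λ n _ → W n)
        EW = n-^ (n-num S) (small-poly m) (n-poly m)
        E-input : EasyN {1} (λ n (N , _) → input n N)
        E-input = n-horner S {g = suc} (n-+ (n-num 1)) (n-clip p v0)
        E-init : EasyN {1} (λ n (N , _) → initN (W n) (input n N))
        E-init = n-+ (n-num (toℕ start)) (n-* (n-+ (n-rem E-input (n-num S))
          (n-* (n-+ (n-num 0) (n-* (n-quo E-input (n-num S)) EW)) (n-num K))) (n-num K))
        fits : ∀ n N → ∃ λ w → hornerN S suc (clip (⟦ p ⟧ n) N) ≡ inputTape w × length w ≤ ⟦ p ⟧ n × S ^ (length w + ⟦ T ⟧ n) ≤ W n × clip (⟦ p ⟧ n) N ≡ code w
        fits n N = let w , eq , l = clip-word (⟦ p ⟧ n) N in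
          w , trans (cong (hornerN S suc) eq) (hornerN-code S suc w) , l ,
          ℕP.^-monoʳ-≤ S (ℕP.≤-trans (ℕP.+-monoˡ-≤ (⟦ T ⟧ n) l) (ℕP.≤-reflexive (sym (⟦addN⟧ p T n)))) , eq
        big : PolyBounded (λ n → S * ⟦ m ⟧ n + S * ⟦ m ⟧ n + K + K)
        big = pb-+ (pb-+ (pb-+ (pb-* (pb-const S) (pb-poly m)) (pb-* (pb-const S) (pb-poly m))) (pb-const K)) (pb-const K)
        W≤ : ∀ n → W n ≤ 2 ^ (S * ⟦ m ⟧ n)
        W≤ n = ℕP.≤-trans (ℕP.^-monoˡ-≤ (⟦ m ⟧ n) (ℕP.<⇒≤ (n<2^n S))) (ℕP.≤-reflexive (ℕP.^-*-assoc 2 S (⟦ m ⟧ n)))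
        space : ∀ n → W n * W n * K * K ≤ 2 ^ ⟦ proj₁ big ⟧ n
        space n = begin
          W n * W n * K * K
            ≤⟨ ℕP.*-mono-≤ (ℕP.*-mono-≤ (ℕP.*-mono-≤ (W≤ n) (W≤ n)) (ℕP.<⇒≤ (n<2^n K))) (ℕP.<⇒≤ (n<2^n K)) ⟩
          2 ^ e * 2 ^ e * 2 ^ K * 2 ^ K
            ≡⟨ cong (λ z → z * 2 ^ K * 2 ^ K) (sym (ℕP.^-distribˡ-+-* 2 e e)) ⟩
          2 ^ (e + e) * 2 ^ K * 2 ^ K
            ≡⟨ cong (_* 2 ^ K) (sym (ℕP.^-distribˡ-+-* 2 (e + e) K)) ⟩
          2 ^ (e + e + K) * 2 ^ K
            ≡⟨ ℕP.^-distribˡ-+-* 2 (e + e + K) K ⟨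
          2 ^ (e + e + K + K)
            ≤⟨ ℕP.^-monoʳ-≤ 2 (proj₂ big n) ⟩
          2 ^ ⟦ proj₁ big ⟧ n ∎
          where
            open ℕP.≤-Reasoning
            e = S * ⟦ m ⟧ n
        easy-run : EasyN result
        easy-run = n-eqn (n-rem (n-iter T {F = λ n (i , s , γ) → stepN (W n) s} (n-stepN EW v1) E-init
            (λ p' → proj₁ big , λ n a i i≤ → let w , eq , _ , W≥ , _ = fits n (proj₁ (env 1 a)) in
              subst (λ z → iter i (λ _ → stepN (W n)) (initN (W n) z) < 2 ^ ⟦ proj₁ big ⟧ n) (sym eq)
                (ℕP.<-≤-trans (iter-bound (W n) w (⟦ T ⟧ n) W≥ i i≤) (space n)))) (n-num K)) (n-num (suc states))
        correct : ∀ n N → N < 2 ^ ⟦ p ⟧ n → result n (N , tt) ≡ bit (A (decode N))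
        correct n N N< = let
            w , eq , l , W≥ , eqc = fits n N
            t , t≤ , halted = decides w
          in trans (cong (λ z → eqn (partQ (W n) (iter (⟦ T ⟧ n) (λ _ → stepN (W n)) (initN (W n) z))) (suc states)) eq)
            (trans (answer (W n) w (⟦ T ⟧ n) t (A w) W≥
                (ℕP.≤-trans t≤ (ℕP.≤-trans (⟦⟧-mono q l) (ℕP.≤-reflexive (sym (⟦compN⟧ q p n))))) halted)
              (cong (λ z → bit (A z)) (trans (sym (decode-code w)) (trans (cong decode (sym eqc)) (clip-decode (⟦ p ⟧ n) N N<)))))

  P-easy : ∀ {A} → InP A → EasyLang A
  P-easy {A} (M , q , decides) = easy (P-easy-at {A} M q decides)

  -- The witnesses are counted by one Boolean sum, and a comparison tests the threshold. The number
  -- 0, which codes no word, is decoded as the empty word and is therefore replaced by its code 1.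
  counting-easy : ∀ {A B} p → EasyLang B →
    (∀ x → (A x ≡ true) ⇔ (2 ^ (⟦ p ⟧ (length x) ∸ 1) ≤ Defs.count B x (⟦ p ⟧ (length x)))) → EasyLang A
  counting-easy {A} {B} p E spec = n-cong (λ n (N , _) → correct N)
    (n-le (n-^ (n-num 2) (small-∸ {g = λ _ _ → 1} SK) (n-∸ EK (n-num 1)))
      (n-Σ (n-^ (n-num 2) SK EK) (n-lang {B} E (n-pairN (n-weaken EN) (n-+ (n-weaken (n-^ (n-num 2) SK EK)) v0)))))
    where
      N' : ℕ → ℕ
      N' N = ite (le 1 N) N 1
      EN : EasyN {1} (λ n (N , _) → N' N)
      EN = n-ite (n-le (n-num 1) v0) v0 (n-num 1)
      EK : EasyN {1} (λ n (N , _) → ⟦ p ⟧ (lenN (N' N)))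
      EK = n-poly-of p (n-lenN EN)
      SK : Small {1} (λ n (N , _) → ⟦ p ⟧ (lenN (N' N)))
      SK = small-poly-of p (small-lenN EN)
      word : ∀ N → N' N ≡ code (decode N)
      word zero    = ite-no 0 1 (le-no {1} {0} ℕP.≤-refl)
      word (suc N) = trans (ite-yes (suc N) 1 (le-yes {1} {suc N} (s≤s z≤n))) (sym (code-decode (suc N) (s≤s z≤n)))
      correct : ∀ N → le (2 ^ (⟦ p ⟧ (lenN (N' N)) ∸ 1)) (ΣN (2 ^ ⟦ p ⟧ (lenN (N' N)))
        (λ y → bit (B (decode (pairN (N' N) (2 ^ ⟦ p ⟧ (lenN (N' N)) + y)))))) ≡ bit (A (decode N))
      correct N = trans (cong (λ z → le (2 ^ (⟦ p ⟧ (lenN z) ∸ 1)) (ΣN (2 ^ ⟦ p ⟧ (lenN z))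
          (λ y → bit (B (decode (pairN z (2 ^ ⟦ p ⟧ (lenN z) + y))))))) (word N))
        (trans (cong (λ l → le (2 ^ (⟦ p ⟧ l ∸ 1)) (ΣN (2 ^ ⟦ p ⟧ l)
          (λ y → bit (B (decode (pairN (code w) (2 ^ ⟦ p ⟧ l + y))))))) (lenN-code w))
        (trans (cong (le (2 ^ (⟦ p ⟧ (length w) ∸ 1))) (sym (count-code B w (⟦ p ⟧ (length w))))) decide))
        where
          w = decode N
          decide : le (2 ^ (⟦ p ⟧ (length w) ∸ 1)) (Defs.count B w (⟦ p ⟧ (length w))) ≡ bit (A w)
          decide with A w in eq
          ... | true  = le-yes (Equivalence.to (spec w) eq)
          ... | false with 2 ^ (⟦ p ⟧ (length w) ∸ 1) ≤? Defs.count B w (⟦ p ⟧ (length w))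
          ...   | no ¬h = le-no (ℕP.≰⇒> ¬h)
          ...   | yes h with trans (sym eq) (Equivalence.from (spec w) h)
          ...     | ()

  CP-easy : ∀ i {A} → CP i A → EasyLang A
  CP-easy zero {A} h = P-easy {A} h
  CP-easy (suc i) {A} (B , hB , p , spec) = counting-easy {A} {B} p (CP-easy i {B} hB) spec

  -- The length of the input is not fixed by n. The advice words for all lengths up to p(n) are
  -- packed as digits of a single constant, and the right one is selected by the length.
  advice-easy : ∀ {B} → EasyLang B → ∀ p (a : ℕ → List Bool) → (∀ n → length (a n) ≤ ⟦ p ⟧ n) →
    EasyLang (λ w → B (pair w (a (length w))))
  advice-easy {B} E pa a short = easy λ p → main p
    where
      main : ∀ p → EasyAt p {1} (λ n (N , _) → + bit (B (pair (decode N) (a (length (decode N))))))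
      main p = easyAt-cong (λ n A → cong +_ (correct n (proj₁ (env 1 A)) (val-bound A)))
          (at (n-lang {B} E (n-pairN EN (n-digit (n-2^poly Z) (easy-const table Tsize table<)
            (small-⊓ʳ {f = λ n γ → lenN (clip (⟦ p ⟧ n) (proj₁ γ))} (small-poly p)) (n-⊓ (n-lenN EN) (n-poly p))))) p)
        where
          EN : EasyN {1} (λ n (N , _) → clip (⟦ p ⟧ n) N)
          EN = n-clip p v0
          Z = addN (1 ∷ []) (compN pa p)
          ⟦Z⟧ : ∀ n → ⟦ Z ⟧ n ≡ suc (⟦ pa ⟧ (⟦ p ⟧ n))
          ⟦Z⟧ n = trans (⟦addN⟧ (1 ∷ []) (compN pa p) n) (cong₂ (λ x y → suc x + y) (ℕP.*-zeroʳ n) (⟦compN⟧ pa p n))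
          table : ℕ → ℕ
          table n = fromDigits (2 ^ ⟦ Z ⟧ n) (suc (⟦ p ⟧ n)) (λ l → code (a l))
          entry< : ∀ n l → l < suc (⟦ p ⟧ n) → code (a l) < 2 ^ ⟦ Z ⟧ n
          entry< n l (s≤s l≤) = ℕP.<-≤-trans (code<2^ (a l)) (ℕP.^-monoʳ-≤ 2
            (ℕP.≤-trans (s≤s (ℕP.≤-trans (short l) (⟦⟧-mono pa l≤))) (ℕP.≤-reflexive (sym (⟦Z⟧ n)))))
          Tsize = mulN Z (addN (1 ∷ []) p)
          table< : ∀ n → table n < 2 ^ ⟦ Tsize ⟧ n
          table< n = ℕP.<-≤-trans (fromDigits< (2 ^ ⟦ Z ⟧ n) (suc (⟦ p ⟧ n)) (λ l → code (a l)) (entry< n))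
            (ℕP.≤-reflexive (trans (ℕP.^-*-assoc 2 (⟦ Z ⟧ n) (suc (⟦ p ⟧ n))) (cong (2 ^_) (sym (trans (⟦mulN⟧ Z (addN (1 ∷ []) p) n)
              (cong (⟦ Z ⟧ n *_) (trans (⟦addN⟧ (1 ∷ []) p n) (cong (λ z → suc z + ⟦ p ⟧ n) (ℕP.*-zeroʳ n)))))))))
          correct : ∀ n N → N < 2 ^ ⟦ p ⟧ n →
            bit (B (decode (pairN (clip (⟦ p ⟧ n) N) (digit (2 ^ ⟦ Z ⟧ n) (table n) (lenN (clip (⟦ p ⟧ n) N) ℕ.⊓ ⟦ p ⟧ n)))))
            ≡ bit (B (pair (decode N) (a (length (decode N)))))
          correct n N N< = let
              w , eq , l = clip-word (⟦ p ⟧ n) N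
              w≡ : w ≡ decode N
              w≡ = trans (sym (decode-code w)) (trans (cong decode (sym eq)) (clip-decode (⟦ p ⟧ n) N N<))
              len≡ : lenN (clip (⟦ p ⟧ n) N) ℕ.⊓ ⟦ p ⟧ n ≡ length w
              len≡ = trans (cong (ℕ._⊓ ⟦ p ⟧ n) (trans (cong lenN eq) (lenN-code w))) (ℕP.m≤n⇒m⊓n≡m l)
            in trans (cong₂ (λ x y → bit (B (decode (pairN x y)))) eq
                 (trans (cong (digit (2 ^ ⟦ Z ⟧ n) (table n)) len≡)
                   (digit-fromDigits (2 ^ ⟦ Z ⟧ n) (suc (⟦ p ⟧ n)) (λ l → code (a l)) (entry< n) (length w) (s≤s l))))
               (trans (cong (λ z → bit (B z)) (trans (cong decode (pairN-code w (a (length w)))) (decode-code (pair w (a (length w))))))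
                 (cong (λ z → bit (B (pair z (a (length z))))) w≡))

  n-skip : ∀ {k} {f : ℕ → Env (suc k) → ℕ} → EasyN f → EasyN {2 + k} (λ n γ → f n (proj₁ γ , proj₂ (proj₂ γ)))
  n-skip {k} {f} E = easy-cong (λ n γ → cong (λ δ → + f n (proj₁ γ , δ)) (mkEnv-get k (proj₂ (proj₂ γ))))
    (easy-rename {φ = λ n γ → + f n γ} (λ { zero → zero ; (suc i) → suc (suc i) }) E)

  -- Easy modular arithmetic

  rem-*-rem : ∀ q a b → 0 < q → rem (a * rem b q) q ≡ rem (a * b) q
  rem-*-rem q a b 0<q = mod⇒rem 0<q (mod-trans (mod-≡ (ℤP.pos-* a (rem b q)))
    (mod-trans (mod-* {a = + a} mod-refl (mod-rem q b)) (mod-≡ (sym (ℤP.pos-* a b)))))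

  -- Repeated squaring, reading the exponent from its most significant bit.
  power-step : ℕ → ℕ → ℕ → ℕ → ℕ → ℕ → ℕ
  power-step P a e q i s = rem (s * s * ite (digit 2 e (P ∸ suc i)) a 1) q

  power-iter : ∀ P a e q → 0 < q → e < 2 ^ P → ∀ i → i ≤ P → iter i (power-step P a e q) (rem 1 q) ≡ rem (a ^ quo e (2 ^ (P ∸ i))) q
  power-iter P a e q 0<q e< zero    _   = cong (λ z → rem (a ^ z) q) (sym (quo-small e<))
  power-iter P a e q 0<q e< (suc i) i<P = trans (cong (power-step P a e q i) (power-iter P a e q 0<q e< i (ℕP.<⇒≤ i<P)))
    (trans (mod⇒rem 0<q (mod-trans (mod-≡ (trans (ℤP.pos-* (r * r) t) (cong (ℤ._* + t) (ℤP.pos-* r r))))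
        (mod-trans (mod-* (mod-* (mod-rem q (a ^ h)) (mod-rem q (a ^ h))) (mod-refl {a = + t}))
          (mod-≡ (sym (trans (ℤP.pos-* (a ^ h * a ^ h) t) (cong (ℤ._* + t) (ℤP.pos-* (a ^ h) (a ^ h)))))))))
      (cong (λ z → rem z q) (trans (cong (a ^ h * a ^ h *_) (select d d<2)) (trans (cong (_* a ^ d) (sym (ℕP.^-distribˡ-+-* a h h)))
        (trans (sym (ℕP.^-distribˡ-+-* a (h + h) d)) (cong (a ^_) exponent))))))
    where
      h = quo e (2 ^ (P ∸ i))
      r = rem (a ^ h) q
      d = digit 2 e (P ∸ suc i)
      t = ite d a 1
      d<2 : d < 2
      d<2 = digit< e (P ∸ suc i) (s≤s z≤n)
      select : ∀ d → d < 2 → ite d a 1 ≡ a ^ d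
      select zero _ = ite-no a 1 refl
      select (suc zero) _ = trans (ite-yes a 1 refl) (sym (ℕP.*-identityʳ a))
      select (suc (suc d)) (s≤s (s≤s ()))
      exponent : h + h + d ≡ quo e (2 ^ (P ∸ suc i))
      exponent = sym (trans (quo-rem E 2) (trans (ℕP.+-comm (rem E 2) _) (cong₂ _+_ double (sym (digit-def 2 e (P ∸ suc i))))))
        where
          E = quo e (2 ^ (P ∸ suc i))
          double : quo E 2 * 2 ≡ h + h
          double = trans (cong (_* 2) (trans (quo-quo e (2 ^ (P ∸ suc i)) 2) (cong (quo e) (trans (ℕP.*-comm (2 ^ (P ∸ suc i)) 2)
            (cong (2 ^_) (sym (ℕP.+-∸-assoc 1 i<P))))))) (trans (ℕP.*-comm h 2) (cong (λ z → h + z) (ℕP.+-identityʳ h)))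

  n-powmod : ∀ {k} {a e q : ℕ → Env k → ℕ} → EasyN a → EasyN e → EasyN q → (∀ n γ → 1 ≤ q n γ) →
    EasyN (λ n γ → rem (a n γ ^ e n γ) (q n γ))
  n-powmod {k} {a} {e} {q} EA EE EQ q≥1 = n-cong (λ n γ → cong (rem (a n γ ^ e n γ)) (ite-yes (q n γ) 1 (le-yes (q≥1 n γ)))) (lift3 core EA EE EQ)
    where
      -- The iteration must stay bounded for arbitrary arguments of `core`. With modulus 0 nothing
      -- would be reduced, as `rem a 0` is `a`.
      clamp : ℕ → ℕ
      clamp q = ite (le 1 q) q 1
      clamp≥1 : ∀ q → 1 ≤ clamp q
      clamp≥1 zero    = ℕP.≤-reflexive (sym (ite-no 0 1 (le-no {1} {0} ℕP.≤-refl)))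
      clamp≥1 (suc q) = ℕP.≤-trans (s≤s z≤n) (ℕP.≤-reflexive (sym (ite-yes (suc q) 1 (le-yes {1} {suc q} (s≤s z≤n)))))
      E-clamp : EasyN {3} (λ n (a , e , q , _) → clamp q)
      E-clamp = n-ite (n-le (n-num 1) v2) v2 (n-num 1)
      core : EasyN {3} (λ n (a , e , q , _) → rem (a ^ e) (clamp q))
      core = easy λ p → let w , bnd = nat-bound (at E-clamp p) in
        easyAt-cong (λ n (va , ve , vq , _) → cong +_ (trans
            (power-iter (⟦ p ⟧ n) (val va) (val ve) (clamp (val vq)) (clamp≥1 (val vq)) (val<2^ ve) (⟦ p ⟧ n) ℕP.≤-refl)
            (cong (λ z → rem (val va ^ z) (clamp (val vq))) (trans (cong (λ z → quo (val ve) (2 ^ z)) (ℕP.n∸n≡0 (⟦ p ⟧ n))) (quo-1 (val ve))))))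
          (at (n-iter p {F = λ n (i , s , a , e , q , _) → power-step (⟦ p ⟧ n) a e (clamp q) i s}
            (n-rem (n-* (n-* v1 v1) (n-ite (n-digit (n-num 2) v3 (small-∸ {g = λ n γ → suc (proj₁ γ)} (small-poly p)) (n-∸ (n-poly p) (n-+ (n-num 1) v0))) v2 (n-num 1)))
              (n-weaken (n-weaken E-clamp)))
            (n-rem (n-num 1) E-clamp)
            (bounded p)) p)
        where
          bounded : ∀ p p' → Σ NatPoly λ w → ∀ n (a : Asg (⟦ p' ⟧ n) 3) i → i ≤ ⟦ p ⟧ n →
            iter i (λ i s → power-step (⟦ p ⟧ n) (proj₁ (env 3 a)) (proj₁ (proj₂ (env 3 a))) (clamp (proj₁ (proj₂ (proj₂ (env 3 a))))) i s)
              (rem 1 (clamp (proj₁ (proj₂ (proj₂ (env 3 a)))))) < 2 ^ ⟦ w ⟧ n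
          bounded p p' = let w , bnd = nat-bound (at E-clamp p') in w , λ n a i _ → ℕP.<-trans (below n a i) (bnd n a)
            where
              below : ∀ n (a : Asg (⟦ p' ⟧ n) 3) i →
                iter i (λ i s → power-step (⟦ p ⟧ n) (proj₁ (env 3 a)) (proj₁ (proj₂ (env 3 a))) (clamp (proj₁ (proj₂ (proj₂ (env 3 a))))) i s)
                  (rem 1 (clamp (proj₁ (proj₂ (proj₂ (env 3 a)))))) < clamp (proj₁ (proj₂ (proj₂ (env 3 a))))
              below n a zero    = rem< 1 (clamp≥1 (proj₁ (proj₂ (proj₂ (env 3 a)))))
              below n a (suc i) = rem< _ (clamp≥1 (proj₁ (proj₂ (proj₂ (env 3 a)))))

  n-least : ∀ {k} {b : ℕ → Env k → ℕ} {P : ℕ → Env (suc k) → ℕ} → EasyN b → EasyN P → EasyN (λ n γ → least (b n γ) (λ g → P n (g , γ)))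
  n-least B E = n-Σ B (n-eqn (n-Σ (n-+ (n-num 1) v0) (n-skip E)) (n-num 0))

  n-isP : ∀ {k} {q : ℕ → Env k → ℕ} → EasyN q → EasyN (λ n γ → isP (q n γ))
  n-isP Q = n-* (n-le (n-num 2) Q) (n-eqn (n-Σ Q (n-* (n-le (n-num 2) v0) (n-eqn (n-rem (n-weaken Q) v0) (n-num 0)))) (n-num 0))

  module _ {k} {q : ℕ → Env k → ℕ} (Q : EasyN q) (q≥1 : ∀ n γ → 1 ≤ q n γ) where

    n-genOf : EasyN (λ n γ → genOf (q n γ))
    n-genOf = n-least Q (n-* (n-le (n-num 1) v0) (n-eqn (n-Σ (n-∸ (n-weaken Q) (n-num 1))
      (n-* (n-le (n-num 1) v0) (n-eqn (n-powmod v1 v0 (n-weaken (n-weaken Q)) (λ n γ → q≥1 n (proj₂ (proj₂ γ)))) (n-num 1)))) (n-num 0)))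

    n-inv : ∀ {x : ℕ → Env k → ℕ} → EasyN x → EasyN (λ n γ → inv (q n γ) (x n γ))
    n-inv X = n-powmod X (n-∸ Q (n-num 2)) Q q≥1

    n-dlog : ∀ {a : ℕ → Env k → ℕ} → EasyN a → EasyN (λ n γ → dlog (q n γ) (a n γ))
    n-dlog A = n-Σ (n-∸ Q (n-num 1)) (n-* v0 (n-eqn
      (n-powmod (n-weaken n-genOf) v0 (n-weaken Q) (λ n γ → q≥1 n (proj₂ γ))) (n-rem (n-weaken A) (n-weaken Q))))

  n-prodMod : ∀ {k} {q J : ℕ → Env k → ℕ} {a : ℕ → Env (suc k) → ℕ} → EasyN q → (∀ n γ → 1 ≤ q n γ) → EasyN J → EasyN a →
    EasyN (λ n γ → prodMod (q n γ) (J n γ) (λ i → a n (i , γ)))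
  n-prodMod Q q≥1 J A = n-ite (n-eqn (n-Σ J (n-eqn (n-rem A (n-weaken Q)) (n-num 0))) (n-num 0))
    (n-powmod (n-genOf Q q≥1) (n-Σ J (n-dlog (n-weaken Q) (λ n γ → q≥1 n (proj₂ γ)) A)) Q q≥1) (n-num 0)

  n-bitsN : ∀ {k} {x : ℕ → Env k → ℕ} → EasyN x → EasyN (λ n γ → bitsN (x n γ))
  n-bitsN X = n-+ X (n-^ (n-num 2) (small-blen X) (n-blen X))

  -- `n-iter` runs for a number of steps given by a polynomial, while only u(n) coordinates have to
  -- be processed; the surplus steps are idle.
  iter-extend : ∀ {F : ℕ → ℕ → ℕ} {x} t T → t ≤ T → (∀ i s → t ≤ i → i < T → F i s ≡ s) → iter T F x ≡ iter t F x
  iter-extend {F} {x} t T t≤T stable with ℕP.m≤n⇒∃[o]m+o≡n t≤T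
  ... | o , refl = go o stable
    where
      go : ∀ o → (∀ i s → t ≤ i → i < t + o → F i s ≡ s) → iter (t + o) F x ≡ iter t F x
      go zero    h = cong (λ z → iter z F x) (ℕP.+-identityʳ t)
      go (suc o) h = trans (cong (λ z → iter z F x) (ℕP.+-suc t o)) (trans (h (t + o) (iter (t + o) F x) (ℕP.m≤m+n t o) (ℕP.≤-reflexive (sym (ℕP.+-suc t o))))
        (go o (λ i s lo hi → h i s lo (ℕP.<-trans hi (ℕP.+-monoʳ-< t ℕP.≤-refl)))))

  iter-cong : ∀ {F G : ℕ → ℕ → ℕ} {x} t → (∀ i s → i < t → F i s ≡ G i s) → iter t F x ≡ iter t G x
  iter-cong zero    h = refl
  iter-cong {F} (suc t) h = trans (cong (F t) (iter-cong t (λ i s i< → h i s (ℕP.m<n⇒m<1+n i<)))) (h t _ ℕP.≤-refl)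

  length-encWord : ∀ w → length (encWord w) ≡ 2 * length w + 2
  length-encWord []      = refl
  length-encWord (b ∷ w) = trans (cong (λ z → suc (suc z)) (length-encWord w)) (arith (length w))
    where
      arith : ∀ l → suc (suc (2 * l + 2)) ≡ 2 * suc l + 2
      arith = ℕ-solve

  digit≤ : ∀ W h i → digit W h i ≤ h
  digit≤ W h i = ℕP.≤-trans (ℕP.≤-reflexive (digit-def W h i)) (ℕP.≤-trans (ℕP.≤-trans (ℕP.m≤m+n _ _) (ℕP.≤-reflexive (sym (quo-rem (quo h (W ^ i)) W)))) (quo≤ h (W ^ i)))
    where
      quo≤ : ∀ a b → quo a b ≤ a
      quo≤ a zero    = ℕP.≤-trans (ℕP.≤-reflexive (trans (quo-formula a 0) (cong (_* ΣN a (λ k → le (suc k * 0) a)) (le-no {1} {0} ℕP.≤-refl)))) z≤n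
      quo≤ a (suc b) = ℕP.≤-trans (ℕP.m≤m*n (quo a (suc b)) (suc b)) (quo-*≤ a (suc b))

  module _ (u : ℕ → ℕ) (uq : NatPoly) (u≤ : ∀ n → u n ≤ ⟦ uq ⟧ n) where

    n-u : ∀ {k} → EasyN {k} (λ n _ → u n)
    n-u = easy-const u uq (λ n → ℕP.≤-<-trans (u≤ n) (n<2^n (⟦ uq ⟧ n)))

    small-u : ∀ {k} → Small {k} (λ n _ → u n)
    small-u = small-≤ (λ n _ → u≤ n) (small-poly uq)

    n-tuple : ∀ {k} {q X j : ℕ → Env k → ℕ} → EasyN q → EasyN X → EasyN j →
      EasyN (λ n γ → tupleN n (u n) (digit (q n γ) (X n γ)) (j n γ))
    n-tuple EQ EX EJ = lift3 core EQ EX EJ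
      where
        step' : ℕ → Env 5 → ℕ
        step' n (t , acc , q , X , j , _) = ite (lt t (u n)) (catN (encN (2 * bitsN (digit q X (u n ∸ suc t)))) acc) acc
        start : ℕ → Env 3 → ℕ
        start n (q , X , j , _) = catN (encN (bitsN j)) (encN 3)
        E-step : EasyN step'
        E-step = n-ite (n-lt v0 n-u) (n-catN (n-encN (n-* (n-num 2) (n-bitsN (n-digit v2 v3 (small-∸ {g = λ n γ → suc (proj₁ γ)} small-u)
          (n-∸ n-u (n-+ (n-num 1) v0)))))) v1) v1
        E-start : EasyN start
        E-start = n-catN (n-encN (n-bitsN v2)) (n-encN (n-num 3))
        unary-const : EasyN {3} (λ n _ → 2 ^ suc n ∸ 1)
        unary-const = easy-const (λ n → 2 ^ suc n ∸ 1) (1 ∷ 1 ∷ []) (λ n → ℕP.<-≤-trans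
          (ℕP.≤-reflexive (trans (ℕP.+-comm 1 _) (ℕP.m∸n+n≡m (ℕP.m^n>0 2 (suc n)))))
          (ℕP.^-monoʳ-≤ 2 (ℕP.≤-reflexive (sym (cong suc (trans (cong (n *_) (cong suc (ℕP.*-zeroʳ n))) (ℕP.*-identityʳ n)))))))
        -- A coordinate of at most P bits, with its sign, is encoded by at most 2 (P + 1) + 2
        -- letters; the bit index and the final one-letter word take at most (2 P + 2) + 4.
        word-of : ∀ P n q X j → X < 2 ^ P → j < 2 ^ P → ∀ i →
          ∃ λ w → iter i (λ t acc → step' n (t , acc , q , X , j , tt)) (start n (q , X , j , tt)) ≡ code w × length w ≤ (2 * P + 6) + i * (2 * P + 4)
        word-of P n q X j X< j< zero = encWord (bitsℕ j) L.++ encWord (true ∷ []) ,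
          trans (cong₂ catN (trans (cong encN (bitsN-code j)) (encN-code (bitsℕ j))) (encN-code (true ∷ []))) (catN-code (encWord (bitsℕ j)) (encWord (true ∷ []))) ,
          ℕP.≤-trans (ℕP.≤-reflexive (trans (LP.length-++ (encWord (bitsℕ j))) (cong (_+ 4) (length-encWord (bitsℕ j)))))
            (ℕP.≤-trans (ℕP.+-monoˡ-≤ 4 (ℕP.+-monoˡ-≤ 2 (ℕP.*-monoʳ-≤ 2 (ℕP.≤-trans (ℕP.≤-reflexive (length-bits j)) (blen≤ j P j<)))))
              (ℕP.≤-reflexive (arith P)))
          where
            arith : ∀ P → 2 * P + 2 + 4 ≡ 2 * P + 6 + 0
            arith = ℕ-solve
        word-of P n q X j X< j< (suc i) with word-of P n q X j X< j< i | i <? u n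
        ... | w , eq , l | no i≮ = w , trans (ite-no (catN (encN (2 * bitsN (digit q X (u n ∸ suc i)))) s) s (le-no (s≤s (ℕP.≮⇒≥ i≮)))) eq ,
              ℕP.≤-trans l (ℕP.+-monoʳ-≤ (2 * P + 6) (ℕP.m≤n+m (i * (2 * P + 4)) (2 * P + 4)))
          where s = iter i (λ t acc → step' n (t , acc , q , X , j , tt)) (start n (q , X , j , tt))
        ... | w , eq , l | yes i<u = encWord (encℤ (+ x)) L.++ w ,
              trans (ite-yes (catN (encN (2 * bitsN x)) s) s (le-yes i<u))
                (trans (cong₂ catN (trans (cong (λ z → encN (2 * z)) (bitsN-code x)) (encN-code (encℤ (+ x)))) eq) (catN-code (encWord (encℤ (+ x))) w)) ,
              ℕP.≤-trans (ℕP.≤-reflexive (trans (LP.length-++ (encWord (encℤ (+ x)))) (cong (_+ length w) (length-encWord (encℤ (+ x))))))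
                (ℕP.≤-trans (ℕP.+-mono-≤ (ℕP.+-monoˡ-≤ 2 (ℕP.*-monoʳ-≤ 2 (s≤s (ℕP.≤-trans (ℕP.≤-reflexive (length-bits x)) (blen≤ x P (ℕP.≤-<-trans (digit≤ q X (u n ∸ suc i)) X<)))))) l)
                  (ℕP.≤-reflexive (arith P i)))
          where
            s = iter i (λ t acc → step' n (t , acc , q , X , j , tt)) (start n (q , X , j , tt))
            x = digit q X (u n ∸ suc i)
            arith : ∀ P i → 2 * suc P + 2 + (2 * P + 6 + i * (2 * P + 4)) ≡ 2 * P + 6 + (2 * P + 4 + i * (2 * P + 4))
            arith = ℕ-solve
        core : EasyN {3} (λ n (q , X , j , _) → tupleN n (u n) (digit q X) j)
        core = n-cong (λ n (q , X , j , _) → cong (catN (encN (2 ^ suc n ∸ 1)))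
            (trans (iter-extend (u n) (⟦ uq ⟧ n) (u≤ n) (λ i s lo _ → ite-no (catN (encN (2 * bitsN (digit q X (u n ∸ suc i)))) s) s (le-no (s≤s lo))))
              (iter-cong (u n) (λ i s i<u → ite-yes (catN (encN (2 * bitsN (digit q X (u n ∸ suc i)))) s) s (le-yes i<u)))))
          (n-catN (n-encN unary-const) (n-iter uq {F = step'} E-step E-start bounded))
          where
            bounded : ∀ p → Σ NatPoly λ w → ∀ n (a : Asg (⟦ p ⟧ n) 3) i → i ≤ ⟦ uq ⟧ n →
              iter i (λ t s → step' n (t , s , env 3 a)) (start n (env 3 a)) < 2 ^ ⟦ w ⟧ n
            bounded p = proj₁ size , λ n (vq , vX , vj , _) i i≤ → let w , eq , l = word-of (⟦ p ⟧ n) n (val vq) (val vX) (val vj) (val<2^ vX) (val<2^ vj) i in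
                ℕP.≤-<-trans (ℕP.≤-reflexive eq) (ℕP.<-≤-trans (code<2^ w) (ℕP.^-monoʳ-≤ 2 (ℕP.≤-trans (s≤s (ℕP.≤-trans l
                  (ℕP.+-monoʳ-≤ (2 * ⟦ p ⟧ n + 6) (ℕP.*-monoˡ-≤ (2 * ⟦ p ⟧ n + 4) i≤)))) (proj₂ size n))))
              where
                size : PolyBounded (λ n → suc ((2 * ⟦ p ⟧ n + 6) + ⟦ uq ⟧ n * (2 * ⟦ p ⟧ n + 4)))
                size = pb-+ (pb-const 1) (pb-+ (pb-+ (pb-* (pb-const 2) (pb-poly p)) (pb-const 6)) (pb-* (pb-poly uq) (pb-+ (pb-* (pb-const 2) (pb-poly p)) (pb-const 4))))

  -- Repeated squaring

  -- The product of the w_i with b_i = 1, each power w^b being written as 1 - b + b w; this form is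
  -- a polynomial in the exponent bits too.
  bitProduct : ∀ {P} → Vec Bool P → Vec ℤ P → ℤ
  bitProduct []       []       = ℤ.1ℤ
  bitProduct (b ∷ bs) (w ∷ ws) = ((ℤ.1ℤ ℤ.- boolℤ b) ℤ.+ boolℤ b ℤ.* w) ℤ.* bitProduct bs ws

  bitProduct-monomial : ∀ {P} (bs : Vec Bool P) (Y : ℕ → ℤ) → bitProduct bs (V.tabulate (λ i → Y (toℕ i))) ≡ monomial 2 P Y (val bs)
  bitProduct-monomial []               Y = refl
  bitProduct-monomial {suc P} (b ∷ bs) Y = begin
    ((ℤ.1ℤ ℤ.- boolℤ b) ℤ.+ boolℤ b ℤ.* Y 0) ℤ.* bitProduct bs (V.tabulate (λ i → Y (suc (toℕ i))))
      ≡⟨ cong₂ ℤ._*_ (select b (Y 0)) (bitProduct-monomial bs (Y ∘ suc)) ⟩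
    Y 0 ℤ.^ bit b ℤ.* ΠZ P (λ i → Y (suc i) ℤ.^ digit 2 (val bs) i)
      ≡⟨ cong₂ ℤ._*_ (cong (Y 0 ℤ.^_) (sym (trans (digit-0 2 (val (b ∷ bs))) (trans (cong (λ z → rem z 2) (val-∷ b bs)) (rem-bit b (val bs))))))
           (ΠZ-cong P (λ i _ → cong (Y (suc i) ℤ.^_) (sym (trans (digit-suc 2 (val (b ∷ bs)) i)
             (cong (λ z → digit 2 z i) (trans (cong (λ z → quo z 2) (val-∷ b bs)) (quo-bit b (val bs)))))))) ⟩
    Y 0 ℤ.^ digit 2 (val (b ∷ bs)) 0 ℤ.* ΠZ P (λ i → Y (suc i) ℤ.^ digit 2 (val (b ∷ bs)) (suc i))
      ≡⟨ ΠZ-suc P _ ⟨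
    monomial 2 (suc P) Y (val (b ∷ bs)) ∎
    where
      open ≡-Reasoning
      select : ∀ b w → (ℤ.1ℤ ℤ.- boolℤ b) ℤ.+ boolℤ b ℤ.* w ≡ w ℤ.^ bit b
      select false w = cong (ℤ._+_ ℤ.1ℤ) (ℤP.*-zeroˡ w)
      select true  w = trans (ℤP.+-identityˡ _) (trans (ℤP.*-identityˡ w) (sym (ℤP.*-identityʳ w)))

  power-binary : ∀ P (x : ℤ) e → e < 2 ^ P → ΠZ P (λ r → (x ℤ.^ (2 ^ r)) ℤ.^ digit 2 e r) ≡ x ℤ.^ e
  power-binary zero    x zero    _ = refl
  power-binary zero    x (suc e) (s≤s ())
  power-binary (suc P) x e e< = begin
    ΠZ (suc P) (λ r → (x ℤ.^ (2 ^ r)) ℤ.^ digit 2 e r)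
      ≡⟨ ΠZ-suc P _ ⟩
    (x ℤ.^ 1) ℤ.^ digit 2 e 0 ℤ.* ΠZ P (λ r → (x ℤ.^ (2 * 2 ^ r)) ℤ.^ digit 2 e (suc r))
      ≡⟨ cong₂ ℤ._*_ (cong₂ ℤ._^_ (ℤP.^-identityʳ x) (digit-0 2 e))
           (ΠZ-cong P (λ r _ → cong₂ ℤ._^_ (sym (ℤP.^-*-assoc x 2 (2 ^ r))) (digit-suc 2 e r))) ⟩
    x ℤ.^ rem e 2 ℤ.* ΠZ P (λ r → ((x ℤ.^ 2) ℤ.^ (2 ^ r)) ℤ.^ digit 2 (quo e 2) r)
      ≡⟨ cong (x ℤ.^ rem e 2 ℤ.*_) (power-binary P (x ℤ.^ 2) (quo e 2) (quo< (ℕP.<-≤-trans e< (ℕP.≤-reflexive (ℕP.*-comm 2 (2 ^ P)))))) ⟩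
    x ℤ.^ rem e 2 ℤ.* (x ℤ.^ 2) ℤ.^ quo e 2
      ≡⟨ cong (x ℤ.^ rem e 2 ℤ.*_) (ℤP.^-*-assoc x 2 (quo e 2)) ⟩
    x ℤ.^ rem e 2 ℤ.* x ℤ.^ (2 * quo e 2)
      ≡⟨ ℤP.^-distribˡ-+-* x (rem e 2) (2 * quo e 2) ⟨
    x ℤ.^ (rem e 2 + 2 * quo e 2)
      ≡⟨ cong (x ℤ.^_) (trans (cong (λ z → rem e 2 + z) (ℕP.*-comm 2 (quo e 2))) (sym (quo-rem e 2))) ⟩
    x ℤ.^ e ∎
    where open ≡-Reasoning

  digit-of-digit : ∀ b E i r → r < b → digit 2 E (i * b + r) ≡ digit 2 (digit (2 ^ b) E i) r
  digit-of-digit b E i r r<b with ℕP.m≤n⇒∃[o]m+o≡n r<b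
  ... | o , refl = begin
    digit 2 E (i * b + r)
      ≡⟨ digit-def 2 E (i * b + r) ⟩
    rem (quo E (2 ^ (i * b + r))) 2
      ≡⟨ cong (λ z → rem z 2) (trans (cong (quo E) (trans (ℕP.^-distribˡ-+-* 2 (i * b) r) (cong (_* 2 ^ r) (trans (cong (2 ^_) (ℕP.*-comm i b)) (sym (ℕP.^-*-assoc 2 b i)))))) (sym (quo-quo E ((2 ^ b) ^ i) (2 ^ r)))) ⟩
    rem (quo X (2 ^ r)) 2
      ≡⟨ cong (λ z → rem (quo z (2 ^ r)) 2) (quo-rem X (2 ^ b)) ⟩
    rem (quo (Y + H * 2 ^ b) (2 ^ r)) 2
      ≡⟨ cong (λ z → rem (quo (Y + z) (2 ^ r)) 2) (trans (cong (λ z → H * (2 * z)) (ℕP.^-distribˡ-+-* 2 r o)) (arith H (2 ^ r) (2 ^ o))) ⟩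
    rem (quo (Y + H * 2 ^ o * 2 * 2 ^ r) (2 ^ r)) 2
      ≡⟨ cong (λ z → rem z 2) (quo-+* Y (H * 2 ^ o * 2) (ℕP.m^n>0 2 r)) ⟩
    rem (quo Y (2 ^ r) + H * 2 ^ o * 2) 2
      ≡⟨ trans (rem-% _ 1) (trans ([m+kn]%n≡m%n (quo Y (2 ^ r)) (H * 2 ^ o) 2) (sym (rem-% _ 1))) ⟩
    rem (quo Y (2 ^ r)) 2
      ≡⟨ trans (digit-def 2 _ r) (cong (λ z → rem (quo z (2 ^ r)) 2) (digit-def (2 ^ b) E i)) ⟨
    digit 2 (digit (2 ^ b) E i) r ∎
    where
      open ≡-Reasoning
      X = quo E ((2 ^ b) ^ i)
      Y = rem X (2 ^ b)
      H = quo X (2 ^ b)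
      arith : ∀ h p q → h * (2 * (p * q)) ≡ h * q * 2 * p
      arith = ℕ-solve

  nthZ : ∀ {u} → Vec ℤ u → ℕ → ℤ
  nthZ []      _       = ℤ.1ℤ
  nthZ (x ∷ v) zero    = x
  nthZ (x ∷ v) (suc i) = nthZ v i

  tabulate-nthZ : ∀ {u} (v : Vec ℤ u) → V.tabulate (λ i → nthZ v (toℕ i)) ≡ v
  tabulate-nthZ []      = refl
  tabulate-nthZ (x ∷ v) = cong (x ∷_) (tabulate-nthZ v)

  nthZ-lookup : ∀ {u} (v : Vec ℤ u) {i} (i<u : i < u) → nthZ v i ≡ lookup v (fromℕ< i<u)
  nthZ-lookup (x ∷ v) {zero}  (s≤s i<u) = refl
  nthZ-lookup (x ∷ v) {suc i} (s≤s i<u) = nthZ-lookup v i<u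

  -- The powers x_i^(2^r), i < u, r < b, in the order of the bits of an exponent tuple in base 2^b.
  squares : ℕ → ℕ → (ℕ → ℤ) → ℕ → ℤ
  squares u b x t with t <? u * b
  ... | yes _ = x (quo t b) ℤ.^ (2 ^ rem t b)
  ... | no  _ = ℤ.1ℤ

  -- The bit of E at place i b + r is bit r of the exponent of x_i, so a monomial of exponential
  -- degree in x becomes multilinear in the powers x_i^(2^r). Places beyond u b hold the value 1.
  squares-monomial : ∀ u b x E P → E < (2 ^ b) ^ u → u * b ≤ P → monomial 2 P (squares u b x) E ≡ monomial (2 ^ b) u x E
  squares-monomial u b x E P E< ub≤P = begin
    ΠZ P (λ t → squares u b x t ℤ.^ digit 2 E t)
      ≡⟨ ΠZ-truncate ub≤P (λ t lo _ → trans (cong (ℤ._^ digit 2 E t) (beyond t lo)) (ℤP.^-zeroˡ (digit 2 E t))) ⟩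
    ΠZ (u * b) (λ t → squares u b x t ℤ.^ digit 2 E t)
      ≡⟨ Big.big-* ℤP.*-1-commutativeMonoid u b _ ⟩
    ΠZ u (λ i → ΠZ b (λ r → squares u b x (i * b + r) ℤ.^ digit 2 E (i * b + r)))
      ≡⟨ ΠZ-cong u (λ i i<u → trans (ΠZ-cong b (λ r r<b → cong₂ ℤ._^_ (within i r i<u r<b) (digit-of-digit b E i r r<b)))
           (power-binary b (x i) (digit (2 ^ b) E i) (digit< E i (ℕP.m^n>0 2 b)))) ⟩
    ΠZ u (λ i → x i ℤ.^ digit (2 ^ b) E i) ∎
    where
      open ≡-Reasoning
      beyond : ∀ t → u * b ≤ t → squares u b x t ≡ ℤ.1ℤ
      beyond t lo with t <? u * b
      ... | yes t< = ⊥-elim (ℕP.<⇒≱ t< lo)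
      ... | no _ = refl
      within : ∀ i r → i < u → r < b → squares u b x (i * b + r) ≡ x i ℤ.^ (2 ^ r)
      within i r i<u r<b with (i * b + r) <? u * b
      ... | no ¬t< = ⊥-elim (¬t< (ℕP.<-≤-trans (ℕP.+-monoʳ-< (i * b) r<b) (ℕP.≤-trans (ℕP.≤-reflexive (ℕP.+-comm (i * b) b)) (ℕP.*-monoˡ-≤ b i<u))))
      ... | yes _ = let u₁ = quo-rem-unique {r} {i} {b} r<b in
        cong₂ (λ q t → x q ℤ.^ (2 ^ t)) (trans (cong (λ z → quo z b) (ℕP.+-comm (i * b) r)) (proj₁ u₁)) (trans (cong (λ z → rem z b) (ℕP.+-comm (i * b) r)) (proj₂ u₁))

  -- Substitution asks for one degree bound common to all wires. An exponential bound is enough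
  -- here, because `VP0nb` limits the size only.
  fdegs-bound : ∀ {m s} (C : SLP m s) i → lookup (fdegs C) i ≤ 2 ^ s
  fdegs-bound []                zero    = ℕP.≤-refl
  fdegs-bound []                (suc i) = ℕP.≤-reflexive (VP.lookup-replicate i 1)
  fdegs-bound {s = suc s} (C ▷ (o , i , j)) zero = op o
    where
      hi = fdegs-bound C i
      hj = fdegs-bound C j
      double : 2 ^ s + 2 ^ s ≤ 2 ^ suc s
      double = ℕP.≤-reflexive (cong (λ z → 2 ^ s + z) (sym (ℕP.+-identityʳ _)))
      op : ∀ o → lookup (fdegs (C ▷ (o , i , j))) zero ≤ 2 ^ suc s
      op plus  = ℕP.≤-trans (ℕP.⊔-lub hi hj) (ℕP.m≤n*m (2 ^ s) 2)
      op minus = ℕP.≤-trans (ℕP.⊔-lub hi hj) (ℕP.m≤n*m (2 ^ s) 2)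
      op times = ℕP.≤-trans (ℕP.+-mono-≤ hi hj) double
  fdegs-bound {s = suc s} (C ▷ g) (suc i) = ℕP.≤-trans (fdegs-bound C i) (ℕP.m≤n*m (2 ^ s) 2)

  module Sequences {X : Set} {m : ℕ} (ι : X → Vec ℤ m) where
    open Wires ι hiding (has; extension)

    HasAny : ∀ {s} → SLP m s → (X → ℤ) → Set
    HasAny C f = ∃ λ d → Has C f d

    -- Each entry costs one gate once the earlier ones are present; a chain of T squarings therefore
    -- has T gates, whatever its degree.
    sequence : ∀ (g : ℕ → X → ℤ) T →
      (∀ t → t < T → ∀ {s} (C : SLP m s) → (∀ t' → t' < t → HasAny C (g t')) → Extension C 1 (λ C' → HasAny C' (g t))) →
      ∀ {s} (C : SLP m s) → Extension C T (λ C' → ∀ t → t < T → HasAny C' (g t))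
    sequence g zero    extend C = extension C here (ℕP.≤-reflexive (sym (ℕP.+-identityʳ _))) (λ _ ())
    sequence g (suc T) extend {s} C with sequence g T (λ t t<T → extend t (ℕP.m<n⇒m<1+n t<T)) C
    ... | extension C₁ p₁ c₁ h₁ with extend T ℕP.≤-refl C₁ h₁
    ...   | extension C₂ p₂ c₂ (e , h₂) = extension C₂ (⊑-trans p₁ p₂)
            (ℕP.≤-trans c₂ (ℕP.≤-trans (ℕP.+-monoˡ-≤ 1 c₁) (ℕP.≤-reflexive (trans (ℕP.+-assoc s T 1) (cong (λ z → s + z) (ℕP.+-comm T 1))))))
            (λ t t< → case t ≟ T of λ
              { (yes refl) → e , h₂
              ; (no t≢T) → let d , h = h₁ t (ℕP.≤∧≢⇒< (ℕP.≤-pred t<) t≢T) in d , has-⊑ p₂ h })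

    one-gate : ∀ o {s} {C : SLP m s} {f g} → HasAny C f → HasAny C g → Extension C 1 (λ C' → HasAny C' (λ x → opZ o (f x) (g x)))
    one-gate o (d , hf) (e , hg) = extension _ (next here) (ℕP.≤-reflexive (ℕP.+-comm 1 _)) (degOp o d e , has-op o hf hg)

    no-gate : ∀ {s} {C : SLP m s} {f} → HasAny C f → Extension C 1 (λ C' → HasAny C' f)
    no-gate {s} h = extension _ here (ℕP.m≤m+n s 1) h

    any-cong : ∀ {s} {C : SLP m s} {f g} → (∀ x → f x ≡ g x) → Extension C 1 (λ C' → HasAny C' f) → Extension C 1 (λ C' → HasAny C' g)
    any-cong eq (extension C p c (d , h)) = extension C p c (d , has-cong eq h)

  x^2^suc : ∀ x r → (x ℤ.^ (2 ^ r)) ℤ.* (x ℤ.^ (2 ^ r)) ≡ x ℤ.^ (2 ^ suc r)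
  x^2^suc x r = trans (sym (ℤP.^-distribˡ-+-* x (2 ^ r) (2 ^ r))) (cong (λ z → x ℤ.^ (2 ^ r + z)) (sym (ℕP.+-identityʳ (2 ^ r))))

  module _ {X : Set} {m : ℕ} (ι : X → Vec ℤ m) where
    open Wires ι hiding (has; extension)
    open Sequences ι

    towers : ∀ T {s} (C : SLP m s) → Extension C T (λ C' → ∀ t → t < T → HasAny C' (λ _ → (+ 2) ℤ.^ (2 ^ t)))
    towers T = sequence (λ t _ → (+ 2) ℤ.^ (2 ^ t)) T λ
      { zero    _ C _ → one-gate plus (1 , has-one C) (1 , has-one C)
      ; (suc t) _ C h → any-cong (λ _ → x^2^suc (+ 2) t) (one-gate times (h t ℕP.≤-refl) (h t ℕP.≤-refl)) }

  module _ {u : ℕ} (b : ℕ) where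
    open Wires {Vec ℤ u} (λ x → x) hiding (has; extension)
    open Sequences {Vec ℤ u} (λ x → x)

    all-squares : ∀ {s} (C : SLP u s) → Extension C (u * b) (λ C' → ∀ t → t < u * b → HasAny C' (λ x → squares u b (nthZ x) t))
    all-squares = sequence (λ t x → squares u b (nthZ x) t) (u * b) square-step
      where
        inside : ∀ x t → t < u * b → squares u b x t ≡ x (quo t b) ℤ.^ (2 ^ rem t b)
        inside x t t< with t <? u * b
        ... | yes _ = refl
        ... | no ¬t< = ⊥-elim (¬t< t<)
        square-step : ∀ t → t < u * b → ∀ {s} (C : SLP u s) → (∀ t' → t' < t → HasAny C (λ x → squares u b (nthZ x) t')) →
          Extension C 1 (λ C' → HasAny C' (λ x → squares u b (nthZ x) t))
        square-step t t< C h with rem t b in eq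
        ... | zero = any-cong (λ x → sym (trans (inside (nthZ x) t t<) (trans (cong (λ z → nthZ x (quo t b) ℤ.^ (2 ^ z)) eq)
                (trans (ℤP.^-identityʳ _) (nthZ-lookup x (quo< t<))))))
              (no-gate (1 , has-input C (fromℕ< (quo< t<))))
        ... | suc r = any-cong (λ x → trans (cong (λ z → z ℤ.* z) (previous (nthZ x))) (trans (x^2^suc (nthZ x (quo t b)) r)
                (sym (trans (inside (nthZ x) t t<) (cong (λ z → nthZ x (quo t b) ℤ.^ (2 ^ z)) eq)))))
              (one-gate times (h t' t'<t) (h t' t'<t))
          where
            t' = r + quo t b * b
            t≡ : t ≡ suc t'
            t≡ = trans (quo-rem t b) (cong (_+ quo t b * b) eq)
            t'<t : t' < t
            t'<t = ℕP.≤-reflexive (sym t≡)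
            b>0 : 0 < b
            b>0 = ℕP.n≢0⇒n>0 λ b≡0 → ℕP.n≮0 (subst (t <_) (trans (cong (u *_) b≡0) (ℕP.*-zeroʳ u)) t<)
            r<b : r < b
            r<b = ℕP.<-trans (ℕP.≤-reflexive (sym eq)) (rem< t b>0)
            previous : ∀ x → squares u b x t' ≡ x (quo t b) ℤ.^ (2 ^ r)
            previous x = let q , m = quo-rem-unique {r} {quo t b} {b} r<b in
              trans (inside x t' (ℕP.<-trans t'<t t<)) (cong₂ (λ i j → x i ℤ.^ (2 ^ j)) q m)

  gen-bitProduct : ∀ {X : Set} {m} (ι : X → Vec ℤ m) {s} {C : SLP m s} P (e : X → Vec Bool P) (w : X → Vec ℤ P) →
    (∀ i → Wires.Has ι C (λ x → boolℤ (lookup (e x) i)) 1) → (∀ i → Wires.Has ι C (λ x → lookup (w x) i) 1) →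
    Wires.Gen ι C (λ x → bitProduct (e x) (w x)) (P * 2 + 1) (P * 4)
  gen-bitProduct ι zero e w he hw = Wires.gen-cong ι (λ x → nil (e x) (w x)) (Wires.gen-one ι)
    where
      nil : ∀ (e : Vec Bool 0) (w : Vec ℤ 0) → ℤ.1ℤ ≡ bitProduct e w
      nil [] [] = refl
  gen-bitProduct ι (suc P) e w he hw = Wires.gen-cong ι (λ x → cons (e x) (w x))
    (Wires.gen-≤ ι (ℕP.≤-reflexive refl) (ℕP.≤-reflexive (arith P))
      (Wires.gen-op ι times (Wires.gen-op ι plus (Wires.gen-op ι minus (Wires.gen-one ι) (Wires.gen-has ι (he zero)))
          (Wires.gen-op ι times (Wires.gen-has ι (he zero)) (Wires.gen-has ι (hw zero))))
        (gen-bitProduct ι P (λ x → V.tail (e x)) (λ x → V.tail (w x))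
          (λ i → Wires.has-cong ι (λ x → cong boolℤ (tail≡ (e x))) (he (suc i))) (λ i → Wires.has-cong ι (λ x → tail≡ (w x)) (hw (suc i))))))
    where
      tail≡ : ∀ {A : Set} {n} (v : Vec A (suc n)) {i} → lookup v (suc i) ≡ lookup (V.tail v) i
      tail≡ (_ ∷ _) = refl
      arith : ∀ P → ((0 + (0 + 1)) + ((0 + (0 + 1)) + 1)) + (P * 4 + 1) ≡ 4 + P * 4
      arith = ℕ-solve
      cons : ∀ (e : Vec Bool (suc P)) (w : Vec ℤ (suc P)) →
        ((ℤ.1ℤ ℤ.- boolℤ (lookup e zero)) ℤ.+ boolℤ (lookup e zero) ℤ.* lookup w zero) ℤ.* bitProduct (V.tail e) (V.tail w) ≡ bitProduct e w
      cons (_ ∷ _) (_ ∷ _) = refl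

  -- The monomials z^k y^E are multilinear, with one variable per bit of k and of E.
  easy-generating : ∀ {φ : ℕ → Env 2 → ℤ} → Easy φ → ∀ p → Σ NatPoly λ q → ∀ n → let P = ⟦ p ⟧ n in
    Σ ℕ λ s → Σ (Circuit (P + P) s) λ D → s ≤ ⟦ q ⟧ n × (∀ (Z Y : ℕ → ℤ) →
      evalC D (V.tabulate {n = P} (λ i → Z (toℕ i)) V.++ V.tabulate {n = P} (λ i → Y (toℕ i)))
      ≡ ΣZ (2 ^ P) (λ E → ΣZ (2 ^ P) (λ k → φ n (k , E , tt) ℤ.* monomial 2 P Z k ℤ.* monomial 2 P Y E)))
  easy-generating {φ} Eφ p = proj₁ second , λ n → Realised.size (proj₂ second n) , Realised.circ (proj₂ second n) , Realised.size≤ (proj₂ second n) ,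
    λ Z Y → let
        P = ⟦ p ⟧ n
        z = V.tabulate {n = P} (λ i → Z (toℕ i))
        y = V.tabulate {n = P} (λ i → Y (toℕ i))
      in trans (Realised.sem (proj₂ second n) (z V.++ y)) (trans
        (ΣB-cong P (λ ε → trans (Realised.sem (proj₂ first n) ((z V.++ y) V.++ V.map boolℤ ε)) (trans
          (ΣB-cong P (λ κ → trans (Realised.sem (inner n) (z , y , ε , κ))
            (cong₂ (λ a c → φ n (val κ , val ε , tt) ℤ.* a ℤ.* c) (bitProduct-monomial κ Z) (bitProduct-monomial ε Y))))
          (ΣB-val P (λ k → φ n (k , val ε , tt) ℤ.* monomial 2 P Z k ℤ.* monomial 2 P Y (val ε))))))
        (ΣB-val P (λ E → ΣZ (2 ^ P) (λ k → φ n (k , E , tt) ℤ.* monomial 2 P Z k ℤ.* monomial 2 P Y E))))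
    where
      P₀ : ℕ → ℕ
      P₀ n = ⟦ p ⟧ n
      b₀ : ℕ → ℕ
      b₀ n = ⟦ EasyAt.bound (at Eφ p) ⟧ n
      X : ℕ → Set
      X n = Vec ℤ (P₀ n) × Vec ℤ (P₀ n) × Vec Bool (P₀ n) × Vec Bool (P₀ n)
      ι : ∀ n → X n → Vec ℤ (((P₀ n + P₀ n) + P₀ n) + P₀ n)
      ι n (z , y , ε , κ) = ((z V.++ y) V.++ V.map boolℤ ε) V.++ V.map boolℤ κ
      cost : ℕ → ℕ
      cost n = (b₀ n + (P₀ n * 4 + 1)) + (P₀ n * 4 + 1)
      inner : ∀ n → Realised (ι n) (λ (z , y , ε , κ) → φ n (val κ , val ε , tt) ℤ.* bitProduct κ z ℤ.* bitProduct ε y) (cost n)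
      inner n = realise (ι n) (Wires.gen-op (ι n) times (Wires.gen-op (ι n) times
          (gen-realised (ι n) (EasyAt.real (at Eφ p) n) (λ (z , y , ε , κ) → κ , ε , tt)
            (BitWires.bits-map (ι n) (BitWires.bits-flat (ι n) 2 {λ (z , y , ε , κ) → κ , ε , tt} (λ
              { zero → BitWires.bits hκ ; (suc zero) → BitWires.bits hε }))))
          (gen-bitProduct (ι n) (P₀ n) (λ (z , y , ε , κ) → κ) (λ (z , y , ε , κ) → z) hκ hz))
          (gen-bitProduct (ι n) (P₀ n) (λ (z , y , ε , κ) → ε) (λ (z , y , ε , κ) → y) hε hy))
        (ℕP.+-mono-≤ (ℕP.+-monoʳ-≤ (b₀ n) degree≤) degree≤) ℕP.≤-refl
        where
          N = P₀ n
          degree≤ : N * 2 + 1 ≤ N * 4 + 1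
          degree≤ = ℕP.+-monoˡ-≤ 1 (ℕP.*-monoʳ-≤ N (ℕP.m≤m+n 2 2))
          hκ : ∀ i → Wires.Has (ι n) [] (λ (z , y , ε , κ) → boolℤ (lookup κ i)) 1
          hκ i = Wires.has-cong (ι n) (λ (z , y , ε , κ) → trans (VP.lookup-++ʳ ((z V.++ y) V.++ V.map boolℤ ε) (V.map boolℤ κ) i) (VP.lookup-map i boolℤ κ))
            (Wires.has-input (ι n) [] (((N + N) + N) ↑ʳ i))
          hε : ∀ i → Wires.Has (ι n) [] (λ (z , y , ε , κ) → boolℤ (lookup ε i)) 1
          hε i = Wires.has-cong (ι n) (λ (z , y , ε , κ) → trans (VP.lookup-++ˡ ((z V.++ y) V.++ V.map boolℤ ε) (V.map boolℤ κ) ((N + N) ↑ʳ i))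
              (trans (VP.lookup-++ʳ (z V.++ y) (V.map boolℤ ε) i) (VP.lookup-map i boolℤ ε)))
            (Wires.has-input (ι n) [] (((N + N) ↑ʳ i) ↑ˡ N))
          hy : ∀ i → Wires.Has (ι n) [] (λ (z , y , ε , κ) → lookup y i) 1
          hy i = Wires.has-cong (ι n) (λ (z , y , ε , κ) → trans (VP.lookup-++ˡ ((z V.++ y) V.++ V.map boolℤ ε) (V.map boolℤ κ) ((N ↑ʳ i) ↑ˡ N))
              (trans (VP.lookup-++ˡ (z V.++ y) (V.map boolℤ ε) (N ↑ʳ i)) (VP.lookup-++ʳ z y i)))
            (Wires.has-input (ι n) [] (((N ↑ʳ i) ↑ˡ N) ↑ˡ N))
          hz : ∀ i → Wires.Has (ι n) [] (λ (z , y , ε , κ) → lookup z i) 1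
          hz i = Wires.has-cong (ι n) (λ (z , y , ε , κ) → trans (VP.lookup-++ˡ ((z V.++ y) V.++ V.map boolℤ ε) (V.map boolℤ κ) ((i ↑ˡ N) ↑ˡ N))
              (trans (VP.lookup-++ˡ (z V.++ y) (V.map boolℤ ε) (i ↑ˡ N)) (VP.lookup-++ˡ z y i)))
            (Wires.has-input (ι n) [] (((i ↑ˡ N) ↑ˡ N) ↑ˡ N))
      cost-pb : PolyBounded cost
      cost-pb = pb-+ (pb-+ (pb-poly (EasyAt.bound (at Eφ p))) product-cost) product-cost
        where
          product-cost : PolyBounded (λ n → P₀ n * 4 + 1)
          product-cost = pb-+ (pb-* (pb-poly p) (pb-const 4)) (pb-const 1)
      -- The bits of k are summed out while the bits of E are still ordinary variables; the second
      -- application sums out those of E.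
      first = h-sum (pb-+ (pb-+ (pb-poly p) (pb-poly p)) (pb-poly p)) p (proj₁ cost-pb) (λ n → Realised.size (inner n) , Realised.circ (inner n) ,
        ℕP.≤-trans (Realised.size≤ (inner n)) (proj₂ cost-pb n) , ℕP.≤-trans (Realised.degree≤ (inner n)) (proj₂ cost-pb n))
      second = h-sum (pb-+ (pb-poly p) (pb-poly p)) p (proj₁ first) (λ n → Realised.size (proj₂ first n) , Realised.circ (proj₂ first n) ,
        Realised.size≤ (proj₂ first n) , Realised.degree≤ (proj₂ first n))

  -- Here the polynomial degree is given up: D has one input for each power, and the chains of
  -- squarings feeding them add only P + u b gates. Agreement with F is verified at integer points.
  substitute-powers : ∀ {u s} b P (D : Circuit (P + P) s) (F : Poly u) →
    (∀ x → evalC D (V.tabulate {n = P} (λ i → (+ 2) ℤ.^ (2 ^ toℕ i)) V.++ V.tabulate {n = P} (λ i → squares u b (nthZ x) (toℕ i))) ≡ eval F x) →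
    Σ ℕ λ S → Σ (Circuit u S) λ C → S ≤ P + u * b + s × computed C ≈P F
  substitute-powers {u} {s} b P D F sem = from-towers (towers (λ x → x) P [])
    where
      open Wires {Vec ℤ u} (λ x → x) hiding (has; extension)
      open Sequences {Vec ℤ u} (λ x → x)
      zs : Vec ℤ P
      zs = V.tabulate (λ i → (+ 2) ℤ.^ (2 ^ toℕ i))
      ys : Vec ℤ u → Vec ℤ P
      ys x = V.tabulate (λ i → squares u b (nthZ x) (toℕ i))
      weaken : ∀ {t} {C : SLP u t} {g} → HasAny C g → Has C g (2 ^ t)
      weaken {C = C} (_ , has i e _) = has i e (fdegs-bound C i)
      module _ {t} {C : SLP u t} (tower : ∀ r → r < P → HasAny C (λ _ → (+ 2) ℤ.^ (2 ^ r)))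
               (square : ∀ r → r < u * b → HasAny C (λ x → squares u b (nthZ x) r)) where
        square-wire : ∀ r → Has C (λ x → squares u b (nthZ x) r) (2 ^ t)
        square-wire r = by-cases (r <? u * b)
          where
            beyond : ¬ r < u * b → ∀ x → squares u b x r ≡ ℤ.1ℤ
            beyond ¬r< x with r <? u * b
            ... | yes r< = ⊥-elim (¬r< r<)
            ... | no _ = refl
            by-cases : Dec (r < u * b) → Has C (λ x → squares u b (nthZ x) r) (2 ^ t)
            by-cases (yes r<) = weaken (square r r<)
            by-cases (no ¬r<) = weaken (1 , has-cong (λ x → sym (beyond ¬r< (nthZ x))) (has-one C))
        input-wire : ∀ i → Has C (λ x → [ lookup zs , lookup (ys x) ]′ (F.splitAt P i)) (2 ^ t)
        input-wire i = pick (F.splitAt P i)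
          where
            pick : ∀ z → Has C (λ x → [ lookup zs , lookup (ys x) ]′ z) (2 ^ t)
            pick (inj₁ j) = has-cong (λ x → sym (VP.lookup∘tabulate (λ i → (+ 2) ℤ.^ (2 ^ toℕ i)) j)) (weaken (tower (toℕ j) (FP.toℕ<n j)))
            pick (inj₂ j) = has-cong (λ x → sym (VP.lookup∘tabulate (λ i → squares u b (nthZ x) (toℕ i)) j)) (square-wire (toℕ j))
      finish : ∀ {t} {C : SLP u t} → t ≤ P + u * b → Extension C s (λ C' → Has C' (λ x → evalC D (zs V.++ ys x)) (formalDegree D * 2 ^ t)) →
        Σ ℕ λ S → Σ (Circuit u S) λ C → S ≤ P + u * b + s × computed C ≈P F
      finish t≤ (extension C₃ p₃ c₃ (has i e _)) = _ , circuit C₃ i , ℕP.≤-trans c₃ (ℕP.+-monoˡ-≤ s t≤) ,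
        eval-injective (computed (circuit C₃ i)) F (λ x → trans (sym (evalC-correct (circuit C₃ i) x)) (trans (e x) (sem x)))
      from-squares : ∀ {t} {C : SLP u t} → t ≤ P → (∀ r → r < P → HasAny C (λ _ → (+ 2) ℤ.^ (2 ^ r))) →
        Extension C (u * b) (λ C' → ∀ r → r < u * b → HasAny C' (λ x → squares u b (nthZ x) r)) →
        Σ ℕ λ S → Σ (Circuit u S) λ C → S ≤ P + u * b + s × computed C ≈P F
      from-squares t≤ tower (extension {t} C₂ p₂ c₂ square) = finish (ℕP.≤-trans c₂ (ℕP.+-monoˡ-≤ (u * b) t≤))
        (gen-embed D (λ x → zs V.++ ys x) (2 ^ t) (ℕP.m^n>0 2 t)
          (λ i → has-cong (λ x → sym (VP.lookup-splitAt P zs (ys x) i)) (input-wire (λ r r< → let d , h = tower r r< in d , has-⊑ p₂ h) square i)) here)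
      from-towers : Extension {0} [] P (λ C' → ∀ r → r < P → HasAny C' (λ _ → (+ 2) ℤ.^ (2 ^ r))) →
        Σ ℕ λ S → Σ (Circuit u S) λ C → S ≤ P + u * b + s × computed C ≈P F
      from-towers (extension C₁ p₁ c₁ tower) = from-squares c₁ tower (all-squares b C₁)

  signed-pos : ∀ z B → ∣ z ∣ ≤ B → + ∣ z ℤ.+ + B ∣ ≡ z ℤ.+ + B
  signed-pos (+ z)     B h = refl
  signed-pos -[1+ z ]  B h = cong (λ w → + ∣ w ∣) (ℤP.⊖-≥ h) ⟨≡⟩ sym (ℤP.⊖-≥ h)
    where
      infixl 1 _⟨≡⟩_
      _⟨≡⟩_ : ∀ {a b c : ℤ} → a ≡ b → b ≡ c → a ≡ c
      _⟨≡⟩_ = trans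

  minus-one-square : ∀ k → ℤ.-1ℤ ℤ.^ k ℤ.* ℤ.-1ℤ ℤ.^ k ≡ ℤ.1ℤ
  minus-one-square zero    = refl
  minus-one-square (suc k) = trans (ring (ℤ.-1ℤ ℤ.^ k)) (minus-one-square k)
    where
      ring : ∀ x → ℤ.-1ℤ ℤ.* x ℤ.* (ℤ.-1ℤ ℤ.* x) ≡ x ℤ.* x
      ring = ℤ-solve

  -- The partial sums start at 0 and grow by at most 1, so each value j below the total is attained
  -- just before some increase.
  rank-hit : ∀ N j {G : ℕ → ℕ} → (∀ q → G q ≤ 1) → j < ΣN N G → ∃ λ q → q < N × G q ≢ 0 × ΣN q G ≡ j
  rank-hit (suc N) j {G} G≤1 j< with j <? ΣN N G
  ... | yes j<' = let q , q< , h = rank-hit N j G≤1 j<' in q , ℕP.m<n⇒m<1+n q< , h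
  ... | no j≮ = N , ℕP.≤-refl , (λ z → j≮ (ℕP.<-≤-trans j< (ℕP.≤-reflexive (trans (cong (λ w → ΣN N G + w) z) (ℕP.+-identityʳ _))))) ,
    ℕP.≤-antisym (ℕP.≮⇒≥ j≮) (ℕP.≤-pred (ℕP.<-≤-trans j< (ℕP.≤-trans (ℕP.+-monoʳ-≤ (ΣN N G) (G≤1 N)) (ℕP.≤-reflexive (ℕP.+-comm (ΣN N G) 1)))))

  le≤1 : ∀ a b → le a b ≤ 1
  le≤1 a b with a ≤? b
  ... | yes h = ℕP.≤-reflexive (le-yes h)
  ... | no ¬h = ℕP.≤-trans (ℕP.≤-reflexive (le-no (ℕP.≰⇒> ¬h))) z≤n

  isP≤1 : ∀ q → isP q ≤ 1
  isP≤1 q = ℕP.*-mono-≤ (le≤1 2 q) (ℕP.≤-trans (ℕP.≤-reflexive (eqn-def _ 0)) (ℕP.*-mono-≤ (le≤1 _ 0) (le≤1 0 _)))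

  count-below : ∀ N B → ΣN N (λ q → le q B) ≤ suc B
  count-below N B with ℕP.≤-total N (suc B)
  ... | inj₁ N≤ = ℕP.≤-trans (ΣN-≤ N (λ q _ → le≤1 q B)) (ℕP.≤-trans (ℕP.≤-reflexive (ℕP.*-identityʳ N)) N≤)
  ... | inj₂ B< = ℕP.≤-trans (ℕP.≤-reflexive (ΣN-truncate B< (λ q lo _ → le-no lo)))
    (ℕP.≤-trans (ΣN-≤ (suc B) (λ q _ → le≤1 q B)) (ℕP.≤-reflexive (ℕP.*-identityʳ (suc B))))

  -- The encoding has its sign in bit 0; for negative z the residue of -∣z∣ is written as q - r,
  -- which is a natural number.
  signed-residue : ∀ z {q c r} → c ≡ bit (bitAt 0 (encℤ z)) → r ≤ q → Mod q (+ r) (+ ∣ z ∣) → Mod q (+ ite c (q ∸ r) r) z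
  signed-residue (+ a)     {q} {c} {r} c≡ r≤q h = mod-trans (mod-≡ (cong +_ (ite-no (q ∸ r) r c≡))) h
  signed-residue -[1+ a ]  {q} {c} {r} c≡ r≤q h = mod-trans
    (mod-≡ (trans (cong +_ (ite-yes (q ∸ r) r c≡)) (sym (trans (ℤP.m-n≡m⊖n q r) (ℤP.⊖-≥ r≤q)))))
    (mod-trans (mod-- {a = + q} {b = ℤ.0ℤ} (congr ℤ.1ℤ (trans (sym (ℤP.*-identityˡ (+ q))) (sym (ℤP.+-identityˡ _)))) h)
      (mod-≡ (ℤP.+-identityˡ _)))

  -- The coefficients of f_n from its bits at integer points

  module Coefficients
    (u : ℕ → ℕ) (uq : NatPoly) (u≤ : ∀ n → u n ≤ ⟦ uq ⟧ n) (f : ∀ n → Poly (u n)) (pD : NatPoly)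
    (degree : ∀ n e → coeff (f n) e ≢ ℤ.0ℤ → totalDeg e ≤ 2 ^ ⟦ pD ⟧ n)
    (height : ∀ n e → bitsize (coeff (f n) e) ≤ 2 ^ ⟦ pD ⟧ n)
    (C : Lang) (EC : EasyLang C) (C-spec : ∀ n is j → C (encTuple n is j true) ≡ bitAt j (encℤ (evalP (f n) is))) where

    -- B exceeds all exponents and Bc bounds the bit sizes. The 2 in s covers the shift that makes
    -- coefficients nonnegative and the demand 2 c ≤ 2^s. D is 2 s + m so that c 2^m s ≤ 2^D. J is
    -- at most 54 Bc², which m and v leave room for: 2 (J + 1) ≤ 2^m and J + B + 1 ≤ 2^v. At least
    -- 2^v primes lie up to bnd = 2^(2v + 1).
    d b B Bc s m D J v bnd : ℕ → ℕ
    d n = ⟦ pD ⟧ n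
    b n = suc (d n)
    B n = 2 ^ b n
    Bc n = 2 ^ d n
    s n = Bc n + 2
    m n = 2 * d n + 10
    D n = s n + m n + s n
    J n = s n * D n
    v n = 2 * d n + 8
    bnd n = 2 ^ suc (2 * v n)

    Bc≥1 : ∀ n → 1 ≤ Bc n
    Bc≥1 n = ℕP.m^n>0 2 (d n)

    square : ∀ n k → Bc n * Bc n * 2 ^ k ≡ 2 ^ (2 * d n + k)
    square n k = trans (cong (_* 2 ^ k) (trans (sym (ℕP.^-distribˡ-+-* 2 (d n) (d n))) (cong (λ z → 2 ^ (d n + z)) (sym (ℕP.+-identityʳ (d n))))))
      (sym (ℕP.^-distribˡ-+-* 2 (2 * d n) k))

    y≤y² : ∀ n → Bc n ≤ Bc n * Bc n
    y≤y² n = ℕP.m≤m*n (Bc n) (Bc n) {{ℕ.>-nonZero (Bc≥1 n)}}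

    1≤y² : ∀ n → 1 ≤ Bc n * Bc n
    1≤y² n = ℕP.≤-trans (Bc≥1 n) (y≤y² n)

    J≤ : ∀ n → J n ≤ 54 * (Bc n * Bc n)
    J≤ n = ℕP.≤-trans (ℕP.*-mono-≤ s≤ (ℕP.+-mono-≤ (ℕP.+-mono-≤ s≤ m≤) s≤)) (ℕP.≤-reflexive (arith y))
      where
        y = Bc n
        s≤ : s n ≤ 3 * y
        s≤ = ℕP.≤-trans (ℕP.+-monoʳ-≤ y (ℕP.*-monoʳ-≤ 2 (Bc≥1 n))) (ℕP.≤-reflexive refl)
        m≤ : m n ≤ 12 * y
        m≤ = ℕP.≤-trans (ℕP.+-mono-≤ (ℕP.*-monoʳ-≤ 2 (ℕP.<⇒≤ (n<2^n (d n)))) (ℕP.*-monoʳ-≤ 10 (Bc≥1 n))) (ℕP.≤-reflexive (arith₁ y))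
          where
            arith₁ : ∀ y → 2 * y + 10 * y ≡ 12 * y
            arith₁ = ℕ-solve
        arith : ∀ y → 3 * y * (3 * y + 12 * y + 3 * y) ≡ 54 * (y * y)
        arith = ℕ-solve

    m-large : ∀ n → 2 * suc (J n) ≤ 2 ^ m n
    m-large n = begin
      2 * suc (J n)             ≤⟨ ℕP.*-monoʳ-≤ 2 (ℕP.+-mono-≤ (1≤y² n) (J≤ n)) ⟩
      2 * (Y + 54 * Y)          ≡⟨ arith Y ⟩
      Y * 110                   ≤⟨ ℕP.*-monoʳ-≤ Y (ℕP.m≤m+n 110 914) ⟩
      Y * 2 ^ 10                ≡⟨ square n 10 ⟩
      2 ^ m n                   ∎
      where
        open ℕP.≤-Reasoning
        Y = Bc n * Bc n
        arith : ∀ y → 2 * (y + 54 * y) ≡ y * 110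
        arith = ℕ-solve

    -- Fourier inversion needs exponents below q - 1, hence primes above B. As at most B + 1 numbers
    -- are discarded, J + B + 1 primes are asked for.
    primes-needed : ∀ n → J n + suc (B n) ≤ 2 ^ v n
    primes-needed n = begin
      J n + suc (B n)           ≤⟨ ℕP.+-mono-≤ (J≤ n) (ℕP.+-mono-≤ (1≤y² n) (ℕP.*-monoʳ-≤ 2 (y≤y² n))) ⟩
      54 * Y + (Y + 2 * Y)      ≡⟨ arith Y ⟩
      Y * 57                    ≤⟨ ℕP.*-monoʳ-≤ Y (ℕP.m≤m+n 57 199) ⟩
      Y * 2 ^ 8                 ≡⟨ square n 8 ⟩
      2 ^ v n                   ∎
      where
        open ℕP.≤-Reasoning
        Y = Bc n * Bc n
        arith : ∀ y → 54 * y + (y + 2 * y) ≡ y * 57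
        arith = ℕ-solve

    -- Applied to `many-primes` at r = 2 v: the factor 2 v + 1 lost there is at most 2^v, so at
    -- least 2^v primes remain.
    log-small : ∀ n → suc (2 * v n) ≤ 2 ^ v n
    log-small n = begin
      suc (2 * v n)             ≡⟨ arith₁ (d n) ⟩
      4 * d n + 17              ≤⟨ ℕP.+-monoˡ-≤ 17 (ℕP.*-monoʳ-≤ 4 (ℕP.≤-trans (ℕP.<⇒≤ (n<2^n (d n))) (y≤y² n))) ⟩
      4 * Y + 17                ≤⟨ ℕP.+-monoʳ-≤ (4 * Y) (ℕP.*-monoʳ-≤ 17 (1≤y² n)) ⟩
      4 * Y + 17 * Y            ≡⟨ arith₂ Y ⟩
      Y * 21                    ≤⟨ ℕP.*-monoʳ-≤ Y (ℕP.m≤m+n 21 235) ⟩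
      Y * 2 ^ 8                 ≡⟨ square n 8 ⟩
      2 ^ v n                   ∎
      where
        open ℕP.≤-Reasoning
        Y = Bc n * Bc n
        arith₁ : ∀ d → suc (2 * (2 * d + 8)) ≡ 4 * d + 17
        arith₁ = ℕ-solve
        arith₂ : ∀ y → 4 * y + 17 * y ≡ y * 21
        arith₂ = ℕ-solve

    opaque
      large : ℕ → ℕ → ℕ
      large n q = isP q * lt (B n) q

      rank : ℕ → ℕ → ℕ
      rank n q = ΣN q (large n)

      large≤1 : ∀ n q → large n q ≤ 1
      large≤1 n q = ℕP.*-mono-≤ (isP≤1 q) (le≤1 (suc (B n)) q)

      enough : ∀ n → J n ≤ rank n (suc (bnd n))
      enough n = ℕP.+-cancelʳ-≤ (suc (B n)) (J n) (rank n (suc (bnd n))) (ℕP.≤-trans J+B≤π (ℕP.≤-trans (ΣN-mono (suc (bnd n)) (λ q _ → split q))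
        (ℕP.≤-trans (ℕP.≤-reflexive (ΣN-+ (suc (bnd n)) (large n) (λ q → le q (B n)))) (ℕP.+-monoʳ-≤ (rank n (suc (bnd n))) (count-below (suc (bnd n)) (B n))))))
        where
          π : ℕ
          π = ΣN (suc (bnd n)) isP
          split : ∀ q → isP q ≤ large n q + le q (B n)
          split q with q ≤? B n
          ... | yes h = ℕP.≤-trans (isP≤1 q) (ℕP.≤-trans (ℕP.≤-reflexive (sym (le-yes h))) (ℕP.m≤n+m _ (large n q)))
          ... | no ¬h = ℕP.≤-trans (ℕP.≤-reflexive (trans (sym (ℕP.*-identityʳ (isP q))) (cong (isP q *_) (sym (le-yes (ℕP.≰⇒> ¬h)))))) (ℕP.m≤m+n (large n q) _)
          J+B≤π : J n + suc (B n) ≤ π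
          J+B≤π = ℕP.≮⇒≥ λ few → ℕP.<-irrefl refl (begin-strict
            2 ^ (2 * v n)              ≤⟨ many-primes (2 * v n) ⟩
            suc (2 * v n) * π          ≤⟨ ℕP.*-monoˡ-≤ π (log-small n) ⟩
            2 ^ v n * π                <⟨ ℕP.*-monoʳ-< (2 ^ v n) {{ℕ.>-nonZero (ℕP.m^n>0 2 (v n))}} (ℕP.<-≤-trans few (primes-needed n)) ⟩
            2 ^ v n * 2 ^ v n          ≡⟨ ℕP.^-distribˡ-+-* 2 (v n) (v n) ⟨
            2 ^ (v n + v n)            ≡⟨ cong (λ z → 2 ^ (v n + z)) (ℕP.+-identityʳ (v n)) ⟨
            2 ^ (2 * v n)              ∎)
            where open ℕP.≤-Reasoning

      -- The j-th prime above B n.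
      pr : ℕ → ℕ → ℕ
      pr n j = suc (least (bnd n) (λ q → large n (suc q) * eqn (rank n (suc q)) j))

      pr-spec : ∀ n j → j < J n → Prime (pr n j) × B n < pr n j × pr n j ≤ bnd n × rank n (pr n j) ≡ j
      pr-spec n j j< = isP-1⇒prime (λ z → hit (cong (λ w → w * lt (B n) q * eqn (rank n q) j) z)) ,
          below (λ z → hit (trans (cong (λ w → isP q * w * eqn (rank n q) j) z) (cong (_* eqn (rank n q) j) (ℕP.*-zeroʳ (isP q))))) ,
          proj₁ spec ,
          equal (λ z → hit (trans (cong (large n q *_) z) (ℕP.*-zeroʳ (large n q))))
        where
          q : ℕ
          q = pr n j
          positive : (∃ λ q → q < suc (bnd n) × large n q ≢ 0 × rank n q ≡ j) → ∃ λ q → q < bnd n × large n (suc q) * eqn (rank n (suc q)) j ≢ 0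
          positive (zero , _ , h , _) = ⊥-elim (h (cong (_* lt (B n) 0) (cong (_* eqn (ΣN 0 (λ d → le 2 d * eqn (rem 0 d) 0)) 0) (le-no {2} {0} (s≤s z≤n)))))
          positive (suc q , s≤s q< , h , eq) = q , q< , λ z → h (trans (sym (ℕP.*-identityʳ (large n (suc q)))) (trans (cong (large n (suc q) *_) (sym (eqn-yes eq))) z))
          exists : ∃ λ q → q < bnd n × large n (suc q) * eqn (rank n (suc q)) j ≢ 0
          exists = positive (rank-hit (suc (bnd n)) j (large≤1 n) (ℕP.<-≤-trans j< (enough n)))
          spec : q ≤ bnd n × large n q * eqn (rank n q) j ≢ 0
          spec = least-spec (bnd n) exists
          hit : large n q * eqn (rank n q) j ≢ 0
          hit = proj₂ spec
          below : lt (B n) q ≢ 0 → B n < q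
          below h with B n <? q
          ... | yes p = p
          ... | no ¬p = ⊥-elim (h (le-no (s≤s (ℕP.≮⇒≥ ¬p))))
          equal : eqn (rank n q) j ≢ 0 → rank n q ≡ j
          equal h with rank n q ≟ j
          ... | yes p = p
          ... | no ¬p = ⊥-elim (h (eqn-no ¬p))

      -- `pr` is a successor by definition, also for j ≥ J, where the search need not succeed.
      -- Positive moduli for all arguments are what the easiness of modular powers requires.
      pr>0 : ∀ n j → 0 < pr n j
      pr>0 n j = s≤s z≤n

    point : ∀ n → ℕ → ℕ → Vec ℤ (u n)
    point n q X = V.tabulate (λ i → + digit q X (toℕ i))

    opaque
      β : ℕ → ℕ → ℕ → ℕ → ℕ
      β n q X j = bit (C (decode (tupleN n (u n) (digit q X) j)))

      β-spec : ∀ n q X j → β n q X j ≡ bit (bitAt j (encℤ (eval (f n) (point n q X))))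
      β-spec n q X j = cong bit (trans (cong C (trans (cong decode (tupleN-code n (u n) (digit q X) j)) (decode-code _)))
        (trans (C-spec n (point n q X) j) (cong (λ z → bitAt j (encℤ z)) (evalP≡eval (f n) (point n q X)))))

    -- Enough bits for B^u monomials, each with a coefficient up to 2^Bc and u powers up to bnd^B.
    -- The number is exponential, so the value itself is never formed.
    Jf : ℕ → ℕ
    Jf n = suc (b n * ⟦ uq ⟧ n + (Bc n + suc (2 * v n) * B n * ⟦ uq ⟧ n))

    B≥1 : ∀ n → 0 < B n
    B≥1 n = ℕP.m^n>0 2 (b n)

    degree< : ∀ n e → coeff (f n) e ≢ ℤ.0ℤ → totalDeg e < B n
    degree< n e nz = ℕP.≤-<-trans (degree n e nz) (ℕP.^-monoʳ-< 2 ℕP.≤-refl (ℕP.n<1+n (d n)))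

    coeff≤ : ∀ n e → ∣ coeff (f n) e ∣ ≤ 2 ^ Bc n
    coeff≤ n e = ℕP.≤-trans (ℕP.<⇒≤ (bitsize-bound (coeff (f n) e))) (ℕP.^-monoʳ-≤ 2 (height n e))

    value< : ∀ n q X → 0 < q → q ≤ bnd n → ∣ eval (f n) (point n q X) ∣ < 2 ^ Jf n
    value< n q X 0<q q≤ = ℕP.≤-<-trans (eval-bound (f n) (B n) (2 ^ Bc n) (bnd n) (degree< n) (coeff≤ n) (ℕP.m^n>0 2 (suc (2 * v n))) (B≥1 n)
        (λ i → + digit q X i) (λ i → ℕP.≤-trans (ℕP.<⇒≤ (digit< X i 0<q)) q≤))
      (ℕP.≤-<-trans (ℕP.≤-reflexive (trans (cong₂ _*_ (ℕP.^-*-assoc 2 (b n) (u n)) (cong (2 ^ Bc n *_)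
          (trans (cong (_^ u n) (ℕP.^-*-assoc 2 (suc (2 * v n)) (B n))) (ℕP.^-*-assoc 2 (suc (2 * v n) * B n) (u n)))))
          (trans (cong (2 ^ (b n * u n) *_) (sym (ℕP.^-distribˡ-+-* 2 (Bc n) _))) (sym (ℕP.^-distribˡ-+-* 2 (b n * u n) _)))))
        (ℕP.^-monoʳ-< 2 ℕP.≤-refl (s≤s (ℕP.+-mono-≤ (ℕP.*-monoʳ-≤ (b n) (u≤ n)) (ℕP.+-monoʳ-≤ (Bc n) (ℕP.*-monoʳ-≤ (suc (2 * v n) * B n) (u≤ n)))))))

    opaque
      -- Only the residue of the long value is easy: a sum over its bits, read from the language,
      -- with the powers of two reduced modulo q.
      mag fm : ℕ → ℕ → ℕ → ℕ
      mag n q X = rem (ΣN (Jf n) (λ j → β n q X (suc j) * rem (2 ^ j) q)) q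
      fm n q X = ite (β n q X 0) (q ∸ mag n q X) (mag n q X)

      mag-spec : ∀ n q X → 0 < q → q ≤ bnd n → Mod q (+ mag n q X) (+ ∣ eval (f n) (point n q X) ∣)
      mag-spec n q X 0<q q≤ = mod-trans (mod-rem q _) (mod-trans (mod-≡ (pos-ΣN (Jf n) _))
        (mod-trans (mod-Σ (Jf n) {g = λ j → + (bit (bitAt j (bitsℕ A)) * 2 ^ j)} (λ j _ → term j))
          (mod-≡ (trans (sym (pos-ΣN (Jf n) _)) (cong +_ (value-from-bits A (Jf n) (value< n q X 0<q q≤)))))))
        where
          A : ℕ
          A = ∣ eval (f n) (point n q X) ∣
          term : ∀ j → Mod q (+ (β n q X (suc j) * rem (2 ^ j) q)) (+ (bit (bitAt j (bitsℕ A)) * 2 ^ j))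
          term j = mod-trans (mod-≡ (trans (cong (λ z → + (z * rem (2 ^ j) q)) (trans (β-spec n q X (suc j)) (cong bit (bitAt-suc-enc j (eval (f n) (point n q X))))))
              (ℤP.pos-* (bit (bitAt j (bitsℕ A))) _)))
            (mod-trans (mod-* {a = + bit (bitAt j (bitsℕ A))} mod-refl (mod-rem q (2 ^ j))) (mod-≡ (sym (ℤP.pos-* (bit (bitAt j (bitsℕ A))) (2 ^ j)))))

      fm-spec : ∀ n q X → 0 < q → q ≤ bnd n → Mod q (+ fm n q X) (eval (f n) (point n q X))
      fm-spec n q X 0<q q≤ = signed-residue (eval (f n) (point n q X)) (β-spec n q X 0) (ℕP.<⇒≤ (rem< _ 0<q)) (mag-spec n q X 0<q q≤)

    cE : ∀ n → ℕ → ℤ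
    cE n E = coeff (f n) (exponents (u n) (B n) E)

    -- Reconstruction works with natural numbers; adding 2^Bc makes the coefficient nonnegative, and
    -- `ψ` takes the shift out again.
    shifted : ℕ → ℕ → ℕ
    shifted n E = ∣ cE n E ℤ.+ + (2 ^ Bc n) ∣

    shifted≡ : ∀ n E → + shifted n E ≡ cE n E ℤ.+ + (2 ^ Bc n)
    shifted≡ n E = signed-pos (cE n E) (2 ^ Bc n) (coeff≤ n (exponents (u n) (B n) E))

    opaque
      wt : ℕ → ℕ → ℕ → ℕ → ℕ
      wt n q X E = ΠN (u n) (λ i → rem (digit q X i ^ ((q ∸ 1) ∸ digit (B n) E i)) q)

      -- The Fourier sum yields the coefficient times (-1)^u; the factor (q - 1)^u is congruent to
      -- (-1)^u and cancels the sign.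
      cm : ℕ → ℕ → ℕ → ℕ
      cm n q E = ΣN (q ^ u n) (λ X → fm n q X * wt n q X E) * (q ∸ 1) ^ u n + rem (2 ^ Bc n) q

      cm-spec : ∀ n {q} E → Prime q → B n < q → q ≤ bnd n → E < B n ^ u n → Mod q (+ cm n q E) (+ shifted n E)
      cm-spec n {q} E pq B<q q≤ E< = mod-trans (mod-≡ (trans (ℤP.pos-+ (S * (q ∸ 1) ^ u n) _) (cong (ℤ._+ + rem (2 ^ Bc n) q) (ℤP.pos-* S _))))
        (mod-trans (mod-+ (mod-trans (mod-* S-spec sign) (mod-≡ (trans (ring (ℤ.-1ℤ ℤ.^ u n) (cE n E)) (trans (cong (ℤ._* cE n E) (minus-one-square (u n))) (ℤP.*-identityˡ (cE n E))))))
            (mod-rem q (2 ^ Bc n)))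
          (mod-≡ (sym (shifted≡ n E))))
        where
          S : ℕ
          S = ΣN (q ^ u n) (λ X → fm n q X * wt n q X E)
          ring : ∀ x c → x ℤ.* c ℤ.* x ≡ x ℤ.* x ℤ.* c
          ring = ℤ-solve
          sign : Mod q (+ ((q ∸ 1) ^ u n)) (ℤ.-1ℤ ℤ.^ u n)
          sign = mod-trans (mod-≡ (pos-^ (q ∸ 1) (u n))) (mod-^ (u n) (congr ℤ.1ℤ (trans (sym (trans (ℤP.m-n≡m⊖n q 1) (ℤP.⊖-≥ (prime>0 pq))))
            (trans (ℤP.+-comm (+ q) ℤ.-1ℤ) (cong (ℤ._+_ ℤ.-1ℤ) (sym (ℤP.*-identityˡ (+ q))))))))
          weight : ∀ X → Mod q (+ wt n q X E) (ΠZ (u n) (λ i → (+ digit q X i) ℤ.^ ((q ∸ 1) ∸ digit (B n) E i)))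
          weight X = mod-trans (mod-≡ (pos-ΠN (u n) _)) (mod-Π (u n) (λ i _ → mod-trans (mod-rem q _) (mod-≡ (pos-^ (digit q X i) ((q ∸ 1) ∸ digit (B n) E i)))))
          S-spec : Mod q (+ S) (ℤ.-1ℤ ℤ.^ u n ℤ.* cE n E)
          S-spec = mod-trans (mod-≡ (pos-ΣN (q ^ u n) _)) (mod-trans (mod-Σ (q ^ u n) (λ X _ → mod-trans (mod-≡ (ℤP.pos-* (fm n q X) (wt n q X E)))
              (mod-* (mod-trans (fm-spec n q X (prime>0 pq) q≤) (mod-≡ (eval-as-box (f n) (B n) (degree< n) (λ i → + digit q X i)))) (weight X))))
            (fourier pq (B n) (u n) (cE n) (ℕP.≤-pred (ℕP.<-≤-trans B<q (ℕP.≤-reflexive (sym (trans (ℕP.+-comm 1 (q ∸ 1)) (ℕP.m∸n+n≡m (prime>0 pq))))))) (B≥1 n) E E<))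

    module Rec n = Reconstruct (s n) (D n) (m n) (pr n)

    pr-prime : ∀ n j → j < J n → Prime (pr n j)
    pr-prime n j j< = proj₁ (pr-spec n j j<)

    pr-distinct : ∀ n i j → i < J n → j < J n → pr n i ≡ pr n j → i ≡ j
    pr-distinct n i j i< j< eq = trans (sym (proj₂ (proj₂ (proj₂ (pr-spec n i i<))))) (trans (cong (rank n) eq) (proj₂ (proj₂ (proj₂ (pr-spec n j j<)))))

    2≤B : ∀ n → 2 ≤ B n
    2≤B n = ℕP.*-monoʳ-≤ 2 (Bc≥1 n)

    pr>2 : ∀ n j → j < J n → 2 < pr n j
    pr>2 n j j< = ℕP.≤-<-trans (2≤B n) (proj₁ (proj₂ (pr-spec n j j<)))

    pr-odd : ∀ n j → j < J n → ¬ (2 ∣ pr n j)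
    pr-odd n j j< h = ℕP.<⇒≢ (pr>2 n j j<) (prime∣prime prime[2] (pr-prime n j j<) h)

    two-unit : ∀ n j → j < J n → ¬ Mod (pr n j) (+ 2) ℤ.0ℤ
    two-unit n j j< = mod-small≢0 (s≤s z≤n) (pr>2 n j j<)

    opaque
      -- The halving in Z is exact because the primes are odd, so modulo an odd q it is
      -- multiplication by the inverse of 2. Adding q - 1 stands for subtracting 1. Both levels of
      -- products are turned into sums of logarithms.
      Zm : ℕ → ℕ → ℕ
      Zm n q = prodMod q (s n) (λ i → (prodMod q (D n) (λ l → pr n (i * D n + l)) + (q ∸ 1)) * inv q 2)

      Zm-spec : ∀ n {q} → Prime q → ¬ Mod q (+ 2) ℤ.0ℤ → Mod q (+ Zm n q) (+ Rec.Z n)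
      Zm-spec n {q} pq two-unit = mod-trans (mod-≡ (cong +_ (prodMod-spec pq (s n) _))) (mod-trans (mod-rem q _) (mod-trans (mod-≡ (pos-ΠN (s n) _))
          (mod-trans (mod-Π (s n) factor) (mod-≡ (sym (pos-ΠN (s n) _))))))
        where
          minus-one : Mod q (+ (q ∸ 1)) (ℤ.- ℤ.1ℤ)
          minus-one = congr ℤ.1ℤ (trans (sym (trans (ℤP.m-n≡m⊖n q 1) (ℤP.⊖-≥ (prime>0 pq))))
            (trans (ℤP.+-comm (+ q) ℤ.-1ℤ) (cong (ℤ._+_ ℤ.-1ℤ) (sym (ℤP.*-identityˡ (+ q))))))
          factor : ∀ i → i < s n → Mod q (+ ((prodMod q (D n) (λ l → pr n (i * D n + l)) + (q ∸ 1)) * inv q 2)) (+ quo (Rec.G n i ∸ 1) 2)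
          factor i i<s = mod-cancel {x = + 2} pq two-unit (mod-trans (mod-≡ (trans (cong (+ 2 ℤ.*_) (trans (ℤP.pos-* (g' + (q ∸ 1)) (inv q 2))
                (cong (ℤ._* + inv q 2) (ℤP.pos-+ g' (q ∸ 1))))) (ring₂ (+ g' ℤ.+ + (q ∸ 1)) (+ inv q 2))))
              (mod-trans (mod-* (mod-+ (mod-trans (mod-≡ (cong +_ (prodMod-spec pq (D n) _))) (mod-rem q g)) minus-one) (inv-spec pq two-unit))
                (mod-≡ (trans (ℤP.*-identityʳ _) (trans (trans (ℤP.m-n≡m⊖n g 1) (ℤP.⊖-≥ g≥1)) (trans (cong +_ (sym (Rec.G-odd n (pr-prime n) (pr-distinct n) (pr-odd n) i i<s))) (ℤP.pos-* 2 (quo (g ∸ 1) 2))))))))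
            where
              g g' : ℕ
              g = Rec.G n i
              g' = prodMod q (D n) (λ l → pr n (i * D n + l))
              ring₂ : ∀ a i → + 2 ℤ.* (a ℤ.* i) ≡ a ℤ.* (+ 2 ℤ.* i)
              ring₂ = ℤ-solve
              g≥1 : 1 ≤ g
              g≥1 = ℕP.≤-trans (ℕP.m^n>0 2 (D n)) (Rec.G≥ n (pr-prime n) (pr-distinct n) (pr-odd n) i i<s)

      Rm : ℕ → ℕ → ℕ → ℕ
      Rm n j q = prodMod q (J n) (λ l → ite (eqn l j) 1 (pr n l))

      Rm-spec : ∀ n j {q} → Prime q → Mod q (+ Rm n j q) (+ Rec.R n j)
      Rm-spec n j {q} pq = mod-trans (mod-≡ (cong +_ (prodMod-spec pq (J n) _))) (mod-rem q (Rec.R n j))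

    R-unit : ∀ n j → j < J n → ¬ Mod (pr n j) (+ Rec.R n j) ℤ.0ℤ
    R-unit n j j< h = absurd (prime∣ΠN pq (J n) (∣-mod h))
      where
        q = pr n j
        pq = pr-prime n j j<
        divides-other : ∀ l → l < J n → q ∣ ite (eqn l j) 1 (pr n l) → Dec (l ≡ j) → ⊥
        divides-other l l< q∣ (yes l≡j) = ℕP.<⇒≱ (prime≥2 pq) (∣⇒≤ (subst (q ∣_) (ite-yes 1 (pr n l) (eqn-yes l≡j)) q∣))
        divides-other l l< q∣ (no l≢j) = l≢j (sym (pr-distinct n j l j< l< (prime∣prime pq (pr-prime n l l<) (subst (q ∣_) (ite-no 1 (pr n l) (eqn-no l≢j)) q∣))))
        absurd : (∃ λ l → l < J n × q ∣ ite (eqn l j) 1 (pr n l)) → ⊥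
        absurd (l , l< , q∣) = divides-other l l< q∣ (l ≟ j)

    cancel-R : ∀ n j → j < J n → Mod (pr n j) (+ Rec.R n j ℤ.* + inv (pr n j) (Rm n j (pr n j))) ℤ.1ℤ
    cancel-R n j j< = mod-trans (mod-* (mod-sym R≡) mod-refl) (inv-spec pq (λ h → R-unit n j j< (mod-trans (mod-sym R≡) h)))
      where
        pq = pr-prime n j j<
        R≡ = Rm-spec n j pq

    opaque
      -- The solution of y R ≡ c Z modulo the j-th prime, c being the shifted coefficient; R, the
      -- product of the other primes, is a unit there.
      y : ℕ → ℕ → ℕ → ℕ
      y n E j = rem (cm n (pr n j) E * (Zm n (pr n j) * inv (pr n j) (Rm n j (pr n j)))) (pr n j)

      y< : ∀ n E j → y n E j < pr n j
      y< n E j = rem< _ (pr>0 n j)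

      y-spec : ∀ n E → E < B n ^ u n → ∀ j → j < J n →
        Mod (pr n j) (+ y n E j) (+ shifted n E ℤ.* (+ Rec.Z n ℤ.* + inv (pr n j) (Rm n j (pr n j))))
      y-spec n E E< j j< = mod-trans (mod-rem (pr n j) _) (mod-trans (mod-≡ (trans (ℤP.pos-* c (z * i)) (cong (+ c ℤ.*_) (ℤP.pos-* z i))))
          (mod-* (cm-spec n E pq (proj₁ (proj₂ spec)) (proj₁ (proj₂ (proj₂ spec))) E<) (mod-* (Zm-spec n pq (two-unit n j j<)) (mod-refl {a = + i}))))
        where
          spec : Prime (pr n j) × B n < pr n j × pr n j ≤ bnd n × rank n (pr n j) ≡ j
          spec = pr-spec n j j<
          pq : Prime (pr n j)
          pq = pr-prime n j j<
          c z i : ℕ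
          c = cm n (pr n j) E
          z = Zm n (pr n j)
          i = inv (pr n j) (Rm n j (pr n j))

    residue : ∀ n E → E < B n ^ u n → ∀ j → j < J n → Mod (pr n j) (+ (y n E j * Rec.R n j)) (+ (shifted n E * Rec.Z n))
    residue n E E< j j< = mod-trans (mod-≡ (ℤP.pos-* (y n E j) R)) (mod-trans (mod-* (y-spec n E E< j j<) (mod-refl {a = + R}))
      (mod-trans (mod-≡ (ring (+ shifted n E) (+ Z) (+ i) (+ R))) (mod-trans (mod-* (mod-refl {a = + shifted n E ℤ.* + Z}) (cancel-R n j j<))
        (mod-≡ (trans (ℤP.*-identityʳ (+ shifted n E ℤ.* + Z)) (sym (ℤP.pos-* (shifted n E) Z)))))))
      where
        R = Rec.R n j
        Z = Rec.Z n
        i = inv (pr n j) (Rm n j (pr n j))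
        ring : ∀ c z i r → c ℤ.* (z ℤ.* i) ℤ.* r ≡ c ℤ.* z ℤ.* (r ℤ.* i)
        ring = ℤ-solve

    shifted≤ : ∀ n E → 2 * shifted n E ≤ 2 ^ s n
    shifted≤ n E = begin
      2 * shifted n E                       ≤⟨ ℕP.*-monoʳ-≤ 2 (ℕP.≤-trans (ℤP.∣i+j∣≤∣i∣+∣j∣ (cE n E) _) (ℕP.+-monoˡ-≤ (2 ^ Bc n) (coeff≤ n (exponents (u n) (B n) E)))) ⟩
      2 * (2 ^ Bc n + 2 ^ Bc n)             ≡⟨ arith (2 ^ Bc n) ⟩
      2 ^ Bc n * 2 ^ 2                      ≡⟨ ℕP.^-distribˡ-+-* 2 (Bc n) 2 ⟨
      2 ^ s n                               ∎
      where
        open ℕP.≤-Reasoning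
        arith : ∀ x → 2 * (x + x) ≡ x * 4
        arith = ℕ-solve

    D-large : ∀ n E → shifted n E * 2 ^ m n * s n ≤ 2 ^ D n
    D-large n E = begin
      shifted n E * 2 ^ m n * s n     ≤⟨ ℕP.*-mono-≤ (ℕP.*-monoˡ-≤ (2 ^ m n) (ℕP.≤-trans (ℕP.m≤n*m (shifted n E) 2) (shifted≤ n E))) (ℕP.<⇒≤ (n<2^n (s n))) ⟩
      2 ^ s n * 2 ^ m n * 2 ^ s n     ≡⟨ cong (_* 2 ^ s n) (ℕP.^-distribˡ-+-* 2 (s n) (m n)) ⟨
      2 ^ (s n + m n) * 2 ^ s n       ≡⟨ ℕP.^-distribˡ-+-* 2 (s n + m n) (s n) ⟨
      2 ^ D n                         ∎
      where open ℕP.≤-Reasoning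

    -- The column sums with the powers of two reduced modulo the prime before multiplication: s is
    -- exponential, so 2^s itself is not an easy number.
    col : ℕ → ℕ → ℕ → ℕ
    col n k E = ΣN (J n) (λ j → quo (2 * rem (y n E j * rem (2 ^ (s n ∸ suc k)) (pr n j)) (pr n j)) (pr n j))

    tl wr : ℕ → ℕ → ℕ
    tl n E = quo (ΣN (J n) (λ j → quo (rem (y n E j * rem (2 ^ s n) (pr n j)) (pr n j) * 2 ^ m n) (pr n j)) + suc (J n)) (2 ^ m n)
    wr n E = quo (ΣN (J n) (λ j → quo (y n E j * 2 ^ m n) (pr n j)) + J n) (2 ^ m n)

    expansion : ∀ n E → E < B n ^ u n → ΣN (s n) (λ k → 2 ^ k * col n k E) + tl n E ≡ shifted n E + wr n E * 2 ^ s n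
    expansion n E E< = trans (cong₂ _+_
        (ΣN-cong (s n) (λ k _ → cong (2 ^ k *_) (ΣN-cong (J n) (λ j _ → cong (λ z → quo (2 * z) (pr n j)) (rem-*-rem (pr n j) (y n E j) _ (pr>0 n j))))))
        (cong (λ z → quo (z + suc (J n)) (2 ^ m n)) (ΣN-cong (J n) (λ j _ → cong (λ z → quo (z * 2 ^ m n) (pr n j)) (rem-*-rem (pr n j) (y n E j) _ (pr>0 n j))))))
      (Rec.reconstruct n (pr-prime n) (pr-distinct n) (pr-odd n) (shifted n E) (y n E) (λ j _ → y< n E j) (residue n E E<) (shifted≤ n E) (D-large n E) (m-large n))

    -- The weights of the binary places, carries unresolved: the columns at k < s, the tail at k =
    -- 0. The whole turns are subtracted at k = s, where they count as multiples of 2^s, and the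
    -- shift is subtracted at k = Bc.
    ψ : ℕ → Env 2 → ℤ
    ψ n (k , E , _) = + (lt k (s n) * col n k E + eqn k 0 * tl n E) ℤ.- + (eqn k (s n) * wr n E + eqn k (Bc n))

    ψ-spec : ∀ n E → E < B n ^ u n → ∀ N → s n < N → ΣZ N (λ k → ψ n (k , E , tt) ℤ.* + (2 ^ k)) ≡ cE n E
    ψ-spec n E E< N s<N = begin
      ΣZ N (λ k → ψ n (k , E , tt) ℤ.* + (2 ^ k))
        ≡⟨ ΣZ-cong N (λ k _ → separate k) ⟩
      ΣZ N (λ k → + Pos k ℤ.- + Neg k)
        ≡⟨ trans (ΣZ-+ N (λ k → + Pos k) (λ k → ℤ.- + Neg k)) (cong (λ z → ΣZ N (λ k → + Pos k) ℤ.+ z) (ΣZ-neg N (λ k → + Neg k))) ⟩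
      ΣZ N (λ k → + Pos k) ℤ.- ΣZ N (λ k → + Neg k)
        ≡⟨ cong₂ ℤ._-_ (trans (sym (pos-ΣN N Pos)) (cong +_ ΣPos)) (trans (sym (pos-ΣN N Neg)) (cong +_ ΣNeg)) ⟩
      + (ΣN (s n) (λ k → 2 ^ k * col n k E) + tl n E) ℤ.- + (wr n E * 2 ^ s n + 2 ^ Bc n)
        ≡⟨ cong (λ z → + z ℤ.- + (wr n E * 2 ^ s n + 2 ^ Bc n)) (expansion n E E<) ⟩
      + (shifted n E + wr n E * 2 ^ s n) ℤ.- + (wr n E * 2 ^ s n + 2 ^ Bc n)
        ≡⟨ cong₂ ℤ._-_ (ℤP.pos-+ (shifted n E) _) (ℤP.pos-+ (wr n E * 2 ^ s n) _) ⟩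
      (+ shifted n E ℤ.+ + (wr n E * 2 ^ s n)) ℤ.- (+ (wr n E * 2 ^ s n) ℤ.+ + (2 ^ Bc n))
        ≡⟨ cong (λ z → (z ℤ.+ + (wr n E * 2 ^ s n)) ℤ.- (+ (wr n E * 2 ^ s n) ℤ.+ + (2 ^ Bc n))) (shifted≡ n E) ⟩
      (cE n E ℤ.+ + (2 ^ Bc n) ℤ.+ + (wr n E * 2 ^ s n)) ℤ.- (+ (wr n E * 2 ^ s n) ℤ.+ + (2 ^ Bc n))
        ≡⟨ ring (cE n E) (+ (2 ^ Bc n)) (+ (wr n E * 2 ^ s n)) ⟩
      cE n E ∎
      where
        open ≡-Reasoning
        ring : ∀ c b w → (c ℤ.+ b ℤ.+ w) ℤ.- (w ℤ.+ b) ≡ c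
        ring = ℤ-solve
        Pos Neg : ℕ → ℕ
        Pos k = lt k (s n) * (2 ^ k * col n k E) + eqn k 0 * (tl n E * 2 ^ k)
        Neg k = eqn k (s n) * (wr n E * 2 ^ k) + eqn k (Bc n) * 2 ^ k
        separate : ∀ k → ψ n (k , E , tt) ℤ.* + (2 ^ k) ≡ + Pos k ℤ.- + Neg k
        separate k = trans (ℤP.*-distribʳ-+ (+ (2 ^ k)) (+ (lt k (s n) * col n k E + eqn k 0 * tl n E)) (ℤ.- + (eqn k (s n) * wr n E + eqn k (Bc n))))
          (cong₂ ℤ._+_ (trans (sym (ℤP.pos-* (lt k (s n) * col n k E + eqn k 0 * tl n E) (2 ^ k))) (cong +_ (arith₁ (lt k (s n)) (col n k E) (eqn k 0) (tl n E) (2 ^ k))))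
            (trans (sym (ℤP.neg-distribˡ-* (+ (eqn k (s n) * wr n E + eqn k (Bc n))) (+ (2 ^ k)))) (cong (λ z → ℤ.- z)
              (trans (sym (ℤP.pos-* (eqn k (s n) * wr n E + eqn k (Bc n)) (2 ^ k))) (cong +_ (arith₂ (eqn k (s n)) (wr n E) (eqn k (Bc n)) (2 ^ k)))))))
          where
            arith₁ : ∀ l c e t w → (l * c + e * t) * w ≡ l * (w * c) + e * (t * w)
            arith₁ = ℕ-solve
            arith₂ : ∀ e r g w → (e * r + g) * w ≡ e * (r * w) + g * w
            arith₂ = ℕ-solve
        pick : ∀ i → i < N → (h : ℕ → ℕ) → ΣN N (λ k → eqn k i * h k) ≡ h i
        pick i i<N h = trans (ΣN-single N i<N (λ k _ k≢i → cong (_* h k) (eqn-no k≢i))) (trans (cong (_* h i) (eqn-refl i)) (ℕP.*-identityˡ (h i)))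
        ΣPos : ΣN N Pos ≡ ΣN (s n) (λ k → 2 ^ k * col n k E) + tl n E
        ΣPos = trans (ΣN-+ N _ _) (cong₂ _+_
          (trans (ΣN-truncate (ℕP.<⇒≤ s<N) (λ k s≤k _ → cong (_* (2 ^ k * col n k E)) (le-no (s≤s s≤k))))
            (ΣN-cong (s n) (λ k k<s → trans (cong (_* (2 ^ k * col n k E)) (le-yes k<s)) (ℕP.*-identityˡ _))))
          (trans (pick 0 (ℕP.≤-<-trans z≤n s<N) (λ k → tl n E * 2 ^ k)) (ℕP.*-identityʳ (tl n E))))
        ΣNeg : ΣN N Neg ≡ wr n E * 2 ^ s n + 2 ^ Bc n
        ΣNeg = trans (ΣN-+ N _ _) (cong₂ _+_ (pick (s n) s<N (λ k → wr n E * 2 ^ k))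
          (pick (Bc n) (ℕP.≤-<-trans (ℕP.m≤m+n (Bc n) 2) s<N) (λ k → 2 ^ k)))

    -- Easiness of the coefficient functions

    n-d : ∀ {k} → EasyN {k} (λ n _ → d n)
    n-d = n-poly pD

    n-b : ∀ {k} → EasyN {k} (λ n _ → b n)
    n-b = n-+ (n-num 1) n-d

    small-b : ∀ {k} → Small {k} (λ n _ → b n)
    small-b = small-+ (small-num 1) (small-poly pD)

    n-B : ∀ {k} → EasyN {k} (λ n _ → B n)
    n-B = n-^ (n-num 2) small-b n-b

    n-Bc : ∀ {k} → EasyN {k} (λ n _ → Bc n)
    n-Bc = n-2^poly pD

    n-s : ∀ {k} → EasyN {k} (λ n _ → s n)
    n-s = n-+ n-Bc (n-num 2)

    n-m : ∀ {k} → EasyN {k} (λ n _ → m n)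
    n-m = n-+ (n-* (n-num 2) n-d) (n-num 10)

    n-2^m : ∀ {k} → EasyN {k} (λ n _ → 2 ^ m n)
    n-2^m = n-^ (n-num 2) (small-+ (small-* (small-num 2) (small-poly pD)) (small-num 10)) n-m

    n-D : ∀ {k} → EasyN {k} (λ n _ → D n)
    n-D = n-+ (n-+ n-s n-m) n-s

    n-J : ∀ {k} → EasyN {k} (λ n _ → J n)
    n-J = n-* n-s n-D

    n-v : ∀ {k} → EasyN {k} (λ n _ → v n)
    n-v = n-+ (n-* (n-num 2) n-d) (n-num 8)

    n-bnd : ∀ {k} → EasyN {k} (λ n _ → bnd n)
    n-bnd = n-^ (n-num 2) (small-+ (small-num 1) (small-* (small-num 2) (small-+ (small-* (small-num 2) (small-poly pD)) (small-num 8))))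
      (n-+ (n-num 1) (n-* (n-num 2) n-v))

    opaque
      unfolding pr

      n-large : ∀ {k} {q : ℕ → Env k → ℕ} → EasyN q → EasyN (λ n γ → large n (q n γ))
      n-large Q = n-* (n-isP Q) (n-lt n-B Q)

      n-rank : ∀ {k} {q : ℕ → Env k → ℕ} → EasyN q → EasyN (λ n γ → rank n (q n γ))
      n-rank Q = n-Σ Q (n-large v0)

      n-pr : ∀ {k} {j : ℕ → Env k → ℕ} → EasyN j → EasyN (λ n γ → pr n (j n γ))
      n-pr Ej = n-+ (n-num 1) (n-least n-bnd (n-* (n-large (n-+ (n-num 1) v0)) (n-eqn (n-rank (n-+ (n-num 1) v0)) (n-weaken Ej))))

    opaque
      unfolding β

      n-β : ∀ {k} {q X j : ℕ → Env k → ℕ} → EasyN q → EasyN X → EasyN j → EasyN (λ n γ → β n (q n γ) (X n γ) (j n γ))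
      n-β Q EX Ej = n-lang {C} EC (n-tuple u uq u≤ Q EX Ej)

    n-Jf : ∀ {k} → EasyN {k} (λ n _ → Jf n)
    n-Jf = n-+ (n-num 1) (n-+ (n-* n-b (n-poly uq)) (n-+ n-Bc (n-* (n-* (n-+ (n-num 1) (n-* (n-num 2) n-v)) n-B) (n-poly uq))))

    opaque
      unfolding fm

      n-mag : ∀ {k} {q X : ℕ → Env k → ℕ} → EasyN q → (∀ n γ → 1 ≤ q n γ) → EasyN X → EasyN (λ n γ → mag n (q n γ) (X n γ))
      n-mag Q q≥1 EX = n-rem (n-Σ n-Jf (n-* (n-β (n-weaken Q) (n-weaken EX) (n-+ (n-num 1) v0))
        (n-powmod (n-num 2) v0 (n-weaken Q) (λ n γ → q≥1 n (proj₂ γ))))) Q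

      n-fm : ∀ {k} {q X : ℕ → Env k → ℕ} → EasyN q → (∀ n γ → 1 ≤ q n γ) → EasyN X → EasyN (λ n γ → fm n (q n γ) (X n γ))
      n-fm Q q≥1 EX = n-ite (n-β Q EX (n-num 0)) (n-∸ Q (n-mag Q q≥1 EX)) (n-mag Q q≥1 EX)

    opaque
      unfolding cm

      n-wt : ∀ {k} {q X E : ℕ → Env k → ℕ} → EasyN q → (∀ n γ → 1 ≤ q n γ) → EasyN X → EasyN E → EasyN (λ n γ → wt n (q n γ) (X n γ) (E n γ))
      n-wt {k} {q} {X} {E} Q q≥1 EX EE = n-cong
        (λ n γ → ΠN-cong (u n) (λ i i<u → cong (λ z → rem (digit (q n γ) (X n γ) z ^ ((q n γ ∸ 1) ∸ digit (B n) (E n γ) z)) (q n γ)) (ℕP.m≤n⇒m⊓n≡m (ℕP.<⇒≤ i<u))))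
        (n-Π (small-u u uq u≤) (n-u u uq u≤) (n-powmod (n-digit (n-weaken Q) (n-weaken EX) S-i E-i)
          (n-∸ (n-∸ (n-weaken Q) (n-num 1)) (n-digit n-B (n-weaken EE) S-i E-i)) (n-weaken Q) (λ n γ → q≥1 n (proj₂ γ))))
        where
          S-i : Small {suc k} (λ n γ → proj₁ γ ℕ.⊓ u n)
          S-i = small-⊓ʳ {f = λ n γ → proj₁ γ} (small-u u uq u≤)
          E-i : EasyN {suc k} (λ n γ → proj₁ γ ℕ.⊓ u n)
          E-i = n-⊓ v0 (n-u u uq u≤)

      n-cm : ∀ {k} {q E : ℕ → Env k → ℕ} → EasyN q → (∀ n γ → 1 ≤ q n γ) → EasyN E → EasyN (λ n γ → cm n (q n γ) (E n γ))
      n-cm Q q≥1 EE = n-+ (n-* (n-Σ (n-^ Q (small-u u uq u≤) (n-u u uq u≤)) (n-* (n-fm (n-weaken Q) (λ n γ → q≥1 n (proj₂ γ)) v0) (n-wt (n-weaken Q) (λ n γ → q≥1 n (proj₂ γ)) v0 (n-weaken EE))))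
          (n-^ (n-∸ Q (n-num 1)) (small-u u uq u≤) (n-u u uq u≤)))
        (n-powmod (n-num 2) n-Bc Q q≥1)

    opaque
      unfolding Zm Rm

      n-Zm : ∀ {k} {q : ℕ → Env k → ℕ} → EasyN q → (∀ n γ → 1 ≤ q n γ) → EasyN (λ n γ → Zm n (q n γ))
      n-Zm Q q≥1 = n-prodMod Q q≥1 n-s (n-* (n-+ (n-prodMod (n-weaken Q) (λ n γ → q≥1 n (proj₂ γ)) n-D (n-pr (n-+ (n-* v1 n-D) v0)))
        (n-∸ (n-weaken Q) (n-num 1))) (n-inv (n-weaken Q) (λ n γ → q≥1 n (proj₂ γ)) (n-num 2)))

      n-Rm : ∀ {k} {q j : ℕ → Env k → ℕ} → EasyN j → EasyN q → (∀ n γ → 1 ≤ q n γ) → EasyN (λ n γ → Rm n (j n γ) (q n γ))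
      n-Rm Ej Q q≥1 = n-prodMod Q q≥1 n-J (n-ite (n-eqn v0 (n-weaken Ej)) (n-num 1) (n-pr v0))

    opaque
      unfolding y

      n-y : ∀ {k} {E j : ℕ → Env k → ℕ} → EasyN E → EasyN j → EasyN (λ n γ → y n (E n γ) (j n γ))
      n-y {j = j} EE Ej = n-rem (n-* (n-cm P P≥1 EE) (n-* (n-Zm P P≥1) (n-inv P P≥1 (n-Rm Ej P P≥1)))) P
        where
          P : EasyN (λ n γ → pr n (j n γ))
          P = n-pr Ej
          P≥1 : ∀ n γ → 1 ≤ pr n (j n γ)
          P≥1 n γ = pr>0 n (j n γ)

    n-col : ∀ {k} {i E : ℕ → Env k → ℕ} → EasyN i → EasyN E → EasyN (λ n γ → col n (i n γ) (E n γ))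
    n-col Ei EE = n-Σ n-J (n-quo (n-* (n-num 2) (n-rem (n-* (n-y (n-weaken EE) v0)
      (n-powmod (n-num 2) (n-∸ n-s (n-+ (n-num 1) (n-weaken Ei))) P (λ n γ → pr>0 n (proj₁ γ)))) P)) P)
      where P = n-pr v0

    n-tl : ∀ {k} {E : ℕ → Env k → ℕ} → EasyN E → EasyN (λ n γ → tl n (E n γ))
    n-tl EE = n-quo (n-+ (n-Σ n-J (n-quo (n-* (n-rem (n-* (n-y (n-weaken EE) v0) (n-powmod (n-num 2) n-s P (λ n γ → pr>0 n (proj₁ γ)))) P) n-2^m) P)) (n-+ (n-num 1) n-J)) n-2^m
      where P = n-pr v0

    n-wr : ∀ {k} {E : ℕ → Env k → ℕ} → EasyN E → EasyN (λ n γ → wr n (E n γ))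
    n-wr EE = n-quo (n-+ (n-Σ n-J (n-quo (n-* (n-y (n-weaken EE) v0) n-2^m) P)) n-J) n-2^m
      where P = n-pr v0

    -- Assembly of the circuit for f_n

    -- E will range over all P-bit numbers, but `ψ` is known to give coefficients only for E < B^u;
    -- the factor cuts off the rest.
    guarded : ℕ → Env 2 → ℤ
    guarded n (i , E , _) = + lt E (B n ^ u n) ℤ.* ψ n (i , E , tt)

    easy-ψ : Easy guarded
    easy-ψ = easy-op times (n-lt v1 (n-^ n-B (small-u u uq u≤) (n-u u uq u≤)))
      (easy-op minus (n-+ (n-* (n-lt v0 n-s) (n-col v0 v1)) (n-* (n-eqn v0 (n-num 0)) (n-tl v1)))
                     (n-+ (n-* (n-eqn v0 n-s) (n-wr v1)) (n-eqn v0 n-Bc)))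

    -- One length for k and E: d + 3 bits hold every k up to s, and b times the bound on u holds the
    -- packed exponents. The sum is above both.
    pp : NatPoly
    pp = addN (addN pD (3 ∷ [])) (mulN (addN (1 ∷ []) pD) uq)

    P : ℕ → ℕ
    P n = ⟦ pp ⟧ n

    P≡ : ∀ n → P n ≡ d n + 3 + b n * ⟦ uq ⟧ n
    P≡ n = trans (⟦addN⟧ (addN pD (3 ∷ [])) _ n) (cong₂ _+_
      (trans (⟦addN⟧ pD (3 ∷ []) n) (cong (λ z → d n + (3 + z)) (ℕP.*-zeroʳ n)))
      (trans (⟦mulN⟧ (addN (1 ∷ []) pD) uq n) (cong (_* ⟦ uq ⟧ n) (trans (⟦addN⟧ (1 ∷ []) pD n) (cong (λ z → suc z + d n) (ℕP.*-zeroʳ n))))))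

    s<2^P : ∀ n → s n < 2 ^ P n
    s<2^P n = ℕP.<-≤-trans (begin-strict
      Bc n + 2              ≤⟨ ℕP.+-monoʳ-≤ (Bc n) (ℕP.*-monoʳ-≤ 2 (Bc≥1 n)) ⟩
      Bc n + 2 * Bc n       <⟨ ℕP.m<m+n _ (Bc≥1 n) ⟩
      Bc n + 2 * Bc n + Bc n  ≤⟨ ℕP.≤-trans (ℕP.≤-reflexive (arith (Bc n))) (ℕP.*-monoʳ-≤ (Bc n) (ℕP.m≤m+n 4 4)) ⟩
      Bc n * 2 ^ 3          ≡⟨ ℕP.^-distribˡ-+-* 2 (d n) 3 ⟨
      2 ^ (d n + 3)         ∎) (ℕP.^-monoʳ-≤ 2 (ℕP.≤-trans (ℕP.m≤m+n (d n + 3) _) (ℕP.≤-reflexive (sym (P≡ n)))))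
      where
        open ℕP.≤-Reasoning
        arith : ∀ y → y + 2 * y + y ≡ y * 4
        arith = ℕ-solve

    ub≤P : ∀ n → u n * b n ≤ P n
    ub≤P n = ℕP.≤-trans (ℕP.≤-reflexive (ℕP.*-comm (u n) (b n))) (ℕP.≤-trans (ℕP.*-monoʳ-≤ (b n) (u≤ n))
      (ℕP.≤-trans (ℕP.m≤n+m _ (d n + 3)) (ℕP.≤-reflexive (sym (P≡ n)))))

    B^u≤ : ∀ n → B n ^ u n ≤ 2 ^ P n
    B^u≤ n = ℕP.≤-trans (ℕP.≤-reflexive (ℕP.^-*-assoc 2 (b n) (u n))) (ℕP.^-monoʳ-≤ 2 (ℕP.≤-trans (ℕP.≤-reflexive (ℕP.*-comm (b n) (u n))) (ub≤P n)))

    tower : ℕ → ℤ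
    tower t = (+ 2) ℤ.^ (2 ^ t)

    Y : ∀ n → Vec ℤ (u n) → ℕ → ℤ
    Y n x = squares (u n) (b n) (nthZ x)

    value : ∀ n x → ΣZ (2 ^ P n) (λ E → ΣZ (2 ^ P n) (λ k → guarded n (k , E , tt) ℤ.* monomial 2 (P n) tower k ℤ.* monomial 2 (P n) (Y n x) E))
      ≡ eval (f n) x
    value n x = begin
      ΣZ (2 ^ P n) (λ E → ΣZ (2 ^ P n) (λ k → guarded n (k , E , tt) ℤ.* monomial 2 (P n) tower k ℤ.* monomial 2 (P n) (Y n x) E))
        ≡⟨ ΣZ-cong (2 ^ P n) (λ E _ → trans (ΣZ-cong (2 ^ P n) (λ k k< → term E k k<)) (ΣZ-*ʳ (2 ^ P n) (M E) (λ k → g E ℤ.* (ψ n (k , E , tt) ℤ.* + (2 ^ k))))) ⟩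
      ΣZ (2 ^ P n) (λ E → ΣZ (2 ^ P n) (λ k → g E ℤ.* (ψ n (k , E , tt) ℤ.* + (2 ^ k))) ℤ.* M E)
        ≡⟨ ΣZ-cong (2 ^ P n) (λ E _ → cong (ℤ._* M E) (ΣZ-*ˡ (2 ^ P n) (g E) _)) ⟩
      ΣZ (2 ^ P n) (λ E → g E ℤ.* S E ℤ.* M E)
        ≡⟨ ΣZ-truncate (B^u≤ n) (λ E lo _ → trans (cong (λ z → + z ℤ.* S E ℤ.* M E) (le-no (s≤s lo))) (trans (cong (ℤ._* M E) (ℤP.*-zeroˡ (S E))) (ℤP.*-zeroˡ (M E)))) ⟩
      ΣZ (B n ^ u n) (λ E → g E ℤ.* S E ℤ.* M E)
        ≡⟨ ΣZ-cong (B n ^ u n) (λ E E< → cong₂ ℤ._*_ (trans (cong (λ z → + z ℤ.* S E) (le-yes E<)) (trans (ℤP.*-identityˡ (S E)) (ψ-spec n E E< (2 ^ P n) (s<2^P n))))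
             (squares-monomial (u n) (b n) (nthZ x) E (P n) E< (ub≤P n))) ⟩
      ΣZ (B n ^ u n) (λ E → cE n E ℤ.* monomial (B n) (u n) (nthZ x) E)
        ≡⟨ eval-as-box (f n) (B n) (degree< n) (nthZ x) ⟨
      eval (f n) (V.tabulate (λ i → nthZ x (toℕ i)))
        ≡⟨ cong (eval (f n)) (tabulate-nthZ x) ⟩
      eval (f n) x ∎
      where
        open ≡-Reasoning
        g : ℕ → ℤ
        g E = + lt E (B n ^ u n)
        M : ℕ → ℤ
        M E = monomial 2 (P n) (Y n x) E
        S : ℕ → ℤ
        S E = ΣZ (2 ^ P n) (λ k → ψ n (k , E , tt) ℤ.* + (2 ^ k))
        term : ∀ E k → k < 2 ^ P n → guarded n (k , E , tt) ℤ.* monomial 2 (P n) tower k ℤ.* M E ≡ g E ℤ.* (ψ n (k , E , tt) ℤ.* + (2 ^ k)) ℤ.* M E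
        term E k k< = cong (ℤ._* M E) (trans (cong (g E ℤ.* ψ n (k , E , tt) ℤ.*_) (trans (power-binary (P n) (+ 2) k k<) (sym (pos-^ 2 k))))
          (ℤP.*-assoc (g E) (ψ n (k , E , tt)) (+ (2 ^ k))))

    generating = easy-generating easy-ψ pp

    circuits : ∀ n → Σ ℕ λ S → Σ (Circuit (u n) S) λ C → S ≤ P n + u n * b n + ⟦ proj₁ generating ⟧ n × computed C ≈P f n
    circuits n = let
        s , D , s≤ , sem = proj₂ generating n
        S , C , S≤ , C≈ = substitute-powers (b n) (P n) D (f n) (λ x → trans (sem tower (Y n x)) (value n x))
      in S , C , ℕP.≤-trans S≤ (ℕP.+-monoʳ-≤ (P n + u n * b n) s≤) , C≈

    size-pb : PolyBounded (λ n → P n + u n * b n + ⟦ proj₁ generating ⟧ n)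
    size-pb = pb-+ (pb-+ (pb-poly pp) (pb-* (uq , u≤) (pb-+ (pb-const 1) (pb-poly pD)))) (pb-poly (proj₁ generating))

    result : VP0nb (family u f)
    result = (uq , u≤) , proj₁ size-pb , λ n → let S , C , S≤ , eq = circuits n in S , C , ℕP.≤-trans S≤ (proj₂ size-pb n) , eq

  -- From the evaluation hypothesis to the circuits

  evaluable⇒VP0nb : ∀ F → EvalCHpoly F → VP0nb F
  evaluable⇒VP0nb (family u f) ((uq , u≤) , (pD , bounds) , B , (i , hB) , pa , a , a≤ , spec) =
    Coefficients.result u uq u≤ f pD (λ n e → proj₁ (bounds n e)) (λ n e → proj₂ (bounds n e))
      (λ w → B (pair w (a (length w)))) (advice-easy {B} (CP-easy i hB) pa a a≤) decides
    where
      -- Queries that ask for the bit 1 are enough: when the bit is 0, the queried word lies outside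
      -- the language, since no other tuple has the same encoding.
      decides : ∀ n is j → B (pair (encTuple n is j true) (a (length (encTuple n is j true)))) ≡ bitAt j (encℤ (evalP (f n) is))
      decides n is j with bitAt j (encℤ (evalP (f n) is)) in eq | B (pair (encTuple n is j true) (a (length (encTuple n is j true)))) in eqB
      ... | true  | true  = refl
      ... | false | false = refl
      ... | true  | false with trans (sym eqB) (Equivalence.to (spec (encTuple n is j true)) (n , is , j , true , refl , eq))
      ...   | ()
      decides n is j | false | true with Equivalence.from (spec (encTuple n is j true)) eqB
      ...   | n' , is' , j' , b' , enc≡ , bit≡ with encTuple-injective u n n' is is' j j' true b' enc≡
      ...     | refl , refl , refl , refl with trans (sym eq) bit≡
      ...       | ()

theorem3 : (F : Family) → EvalCHpoly F →
    (∀ (G : Family) → VP0 G ⇔ VNP0 G) →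
    VP0nb F
theorem3 F evaluable collapse = UnderCollapse.evaluable⇒VP0nb collapse F evaluable
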